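{- Let $f\in\mathbb{Z}[t_1,t_2,t_3]$ be a nondegenerate ternary quadratic form that is anisotropic (over $\mathbb{Q}$). Then $\delta(f)<1$.
   Context: $D_f\coloneqq f(\mathbb{Z}^3)\setminus\{0\}$. For $S\subset\mathbb{Z}$: $S$ is positive if it contains no negative integers, negative if it contains no positive integers, indefinite otherwise. The density of $S$ is $\lim_{N\to\infty}\#(S\cap[1,N])/N$ if $S$ is positive, $\lim_{N\to\infty}\#(S\cap[-N,-1])/N$ if $S$ is negative, and $\lim_{N\to\infty}\#(S\cap[-N,N])/(2N)$ if $S$ is indefinite (the limit being required to exist). $\delta(f)$ denotes the density of $D_f$. -}

module Defs where

open import Data.Nat as ℕ using (ℕ; suc)
open import Data.Integer as ℤ using (ℤ; +_; -_)
open import Data.Rational as ℚ using (ℚ; 0ℚ; 1ℚ; ∣_∣)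
open import Data.List using (List; length)
open import Data.List.Membership.Propositional using (_∈_)
open import Data.List.Relation.Unary.Unique.Propositional using (Unique)
open import Data.Product using (Σ; ∃; ∃-syntax; _×_)
open import Data.Sum using (_⊎_)
open import Relation.Binary.PropositionalEquality using (_≡_; _≢_)
open import Relation.Nullary using (¬_)

-- A ternary quadratic form with integer coefficients
--   f(t1,t2,t3) = a t1² + b t2² + c t3² + d t1 t2 + e t1 t3 + g t2 t3
record TernaryForm : Set where
  constructor form
  field
    a b c d e g : ℤ
open TernaryForm public

evalℤ : TernaryForm → ℤ → ℤ → ℤ → ℤ
evalℤ f x y z =
  a f ℤ.* x ℤ.* x ℤ.+ b f ℤ.* y ℤ.* y ℤ.+ c f ℤ.* z ℤ.* z
  ℤ.+ d f ℤ.* x ℤ.* y ℤ.+ e f ℤ.* x ℤ.* z ℤ.+ g f ℤ.* y ℤ.* z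

evalℚ : TernaryForm → ℚ → ℚ → ℚ → ℚ
evalℚ f x y z =
  q (a f) ℚ.* x ℚ.* x ℚ.+ q (b f) ℚ.* y ℚ.* y ℚ.+ q (c f) ℚ.* z ℚ.* z
  ℚ.+ q (d f) ℚ.* x ℚ.* y ℚ.+ q (e f) ℚ.* x ℚ.* z ℚ.+ q (g f) ℚ.* y ℚ.* z
  where
  q : ℤ → ℚ
  q n = n ℚ./ 1

-- determinant of the (Hessian) Gram matrix
--   [[2a, d, e], [d, 2b, g], [e, g, 2c]]
gramDet : TernaryForm → ℤ
gramDet f =
  (+ 2 ℤ.* a f) ℤ.* ((+ 2 ℤ.* b f) ℤ.* (+ 2 ℤ.* c f) ℤ.- g f ℤ.* g f)
  ℤ.- d f ℤ.* (d f ℤ.* (+ 2 ℤ.* c f) ℤ.- g f ℤ.* e f)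
  ℤ.+ e f ℤ.* (d f ℤ.* g f ℤ.- (+ 2 ℤ.* b f) ℤ.* e f)

Nondegenerate : TernaryForm → Set
Nondegenerate f = gramDet f ≢ + 0

Anisotropic : TernaryForm → Set
Anisotropic f = ∀ (x y z : ℚ) → evalℚ f x y z ≡ 0ℚ → (x ≡ 0ℚ × y ≡ 0ℚ × z ≡ 0ℚ)

D : TernaryForm → ℤ → Set
D f n = (n ≢ + 0) × ∃[ x ] ∃[ y ] ∃[ z ] evalℤ f x y z ≡ n

Positive : (ℤ → Set) → Set
Positive S = ∀ n → S n → + 0 ℤ.≤ n

Negative : (ℤ → Set) → Set
Negative S = ∀ n → S n → n ℤ.≤ + 0

Indefinite : (ℤ → Set) → Set
Indefinite S = ¬ Positive S × ¬ Negative S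

CountIs : (ℤ → Set) → ℤ → ℤ → ℕ → Set
CountIs S lo hi k = Σ (List ℤ) λ xs →
  Unique xs × length xs ≡ k
  × (∀ x → x ∈ xs → (lo ℤ.≤ x × x ℤ.≤ hi) × S x)
  × (∀ x → lo ℤ.≤ x → x ℤ.≤ hi → S x → x ∈ xs)

-- DensityRatio S N r : r is the N-th term of the sequence whose limit defines
-- the density of S (N ≥ 1, written suc m), according to whether S is
-- positive, negative or indefinite.
DensityRatio : (ℤ → Set) → (m : ℕ) → ℚ → Set
DensityRatio S m r =
    (Positive S × ∃[ k ] (CountIs S (+ 1) (+ N) k × r ≡ (+ k) ℚ./ N))
  ⊎ (Negative S × ∃[ k ] (CountIs S (- (+ N)) (- (+ 1)) k × r ≡ (+ k) ℚ./ N))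
  ⊎ (Indefinite S × ∃[ k ] (CountIs S (- (+ N)) (+ N) k × r ≡ (+ k) ℚ./ (2 ℕ.* N)))
  where
  N : ℕ
  N = suc m

DensityExists : (ℤ → Set) → Set
DensityExists S = ∀ (ε : ℚ) → 0ℚ ℚ.< ε → ∃[ M ] ∀ (m m' : ℕ) → M ℕ.≤ m → M ℕ.≤ m' →
  ∀ (r r' : ℚ) → DensityRatio S m r → DensityRatio S m' r' → ∣ r ℚ.- r' ∣ ℚ.< ε

-- the limit is < 1: the sequence is eventually bounded by some rational c < 1
-- (given that the limit exists, this is equivalent to "limit < 1")
DensityBelowOne : (ℤ → Set) → Set
DensityBelowOne S = ∃[ c ] (c ℚ.< 1ℚ × ∃[ M ] ∀ (m : ℕ) → M ℕ.≤ m →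
  ∀ (r : ℚ) → DensityRatio S m r → r ℚ.≤ c)

{-# OPTIONS --safe #-}
-- The integers represented by f are compared with the image of f in ℤ/Q for a highly divisible Q.
--
-- Density below one. After diagonalising, Legendre's descent for z² = ax² + by² produces, unless
-- there is a rational zero, a prime p at which f is anisotropic; such a form omits the square class
-- of -det f at p, hence a whole residue class.
--
-- Existence of the density. It suffices that f represents almost all integers, of a sign it takes, in
-- almost every residue class mod Q that meets its image. Along an orthogonal frame consider the values
--   n(i,t,u) = f(x₀ + q(i e₁ + t e₂ + u e₃)),   i < KT,  t, u < T,
-- each weighted by i so that they are equidistributed in size. Two of them agree iff
--   d(α₀ + qa(2i' + d)) = g(t',u') - g(t,u),   d = i - i',
-- a congruence mod 2qad for the four variables t, u, t', u'. As K is large, d is small compared with T,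
-- so (t,u,t',u') runs through complete residue systems, and in the coordinates t + t', u + u' the
-- congruence is linear. It has the expected number of solutions up to a factor ∑ 1/e over the divisors
-- e of d prime to Q, which is 1 + O(1/P) on average if all primes up to P divide Q. So the second moment
-- of the weighted number of representations is asymptotically the square of the first, and
-- Cauchy–Schwarz shows that few integers of the class are missed.
module Submission where

-- No reciprocity law is invoked to find a finite prime: the descent ends in a rational zero, in a
-- prime at which it is blocked, or at `z² + x² + y² = 0`, which fails at 2 although it is definite
-- as well. The limit is never identified. Each `m` has its own modulus, for which the proportion of
-- represented integers is within a constant over `m` of the proportion of residues taken;
-- eliminating the latter between two lengths leaves a Cauchy estimate. The numbers 24, 28, 32, 34,
-- 68 are errors accumulated in units of `1/m`. One sign is counted at a time, the other through
-- `-f`. As `e₁` may be any vector with `f(e₁) > 0`, a long range of `i` makes the values positive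
-- and lets `i` govern their size, whatever the signs along `e₂` and `e₃`. The delicate point is the
-- primes of `F`: if both linear coefficients along `e₂` and `e₃` are highly divisible by one of
-- them, the congruence degenerates. Classes where `f(x₀)` is itself highly divisible are given up;
-- elsewhere a rational rotation in the plane of `e₁`, `e₂` brings the base point into general
-- position.

module Arithmetic where

  open import Data.Nat as ℕ using (ℕ; zero; suc; z≤n; s≤s)
  import Data.Nat.Properties as ℕP
  import Data.Nat.Divisibility as ℕD
  import Data.Nat.Coprimality as Cop
  open import Data.Nat.GCD using (module Bézout)
  open import Data.Nat.Induction using (<-rec)
  open import Data.Nat.ListAction using (product)
  open import Data.Nat.Primality using (Prime; prime[2]; prime⇒nonZero; prime⇒nonTrivial; prime⇒irreducible; euclidsLemma)
  open import Data.Nat.Primality.Factorisation using (factorise)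
  import Data.Nat.Tactic.RingSolver as ℕRing
  open import Data.Integer hiding (suc)
  open import Data.Integer.Properties
  open import Data.Integer.DivMod using (_%ℕ_; _/ℕ_; n%ℕd<d; a≡a%ℕn+[a/ℕn]*n)
  open import Data.Integer.Divisibility.Signed
  open import Data.Integer.Tactic.RingSolver using (solve-∀)
  open import Data.List using ([]; _∷_)
  open import Data.List.Relation.Unary.All using (_∷_)
  open import Data.Product using (∃-syntax; _×_; _,_; proj₁; proj₂)
  open import Data.Sum using (_⊎_; inj₁; inj₂; [_,_]′)
  open import Data.Empty using (⊥; ⊥-elim)
  open import Function using (_∘_)
  open import Relation.Nullary using (¬_; Dec; yes; no)
  open import Relation.Nullary.Decidable using (map′)
  open import Relation.Binary.PropositionalEquality

  -- Divisibility and congruences of integers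

  prime⇒≥2 : ∀ {p} → Prime p → 2 ℕ.≤ p
  prime⇒≥2 {p} pp = ℕ.nonTrivial⇒n>1 p {{prime⇒nonTrivial pp}}

  ∣*ˡ : ∀ {m x} y → m ∣ x → m ∣ y * x
  ∣*ˡ y = ∣n⇒∣m*n y

  ∣-eq : ∀ {m x y} → m ∣ x → x ≡ y → m ∣ y
  ∣-eq d refl = d

  ^-∣ : ∀ p {j k} → j ℕ.≤ k → + (p ℕ.^ j) ∣ + (p ℕ.^ k)
  ^-∣ p {j} {k} j≤k = divides (+ (p ℕ.^ (k ℕ.∸ j)))
    (trans (cong +_ (trans (cong (p ℕ.^_) (sym (ℕP.m∸n+n≡m j≤k))) (ℕP.^-distribˡ-+-* p (k ℕ.∸ j) j)))
           (pos-* (p ℕ.^ (k ℕ.∸ j)) (p ℕ.^ j)))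

  p∣pos^ : ∀ p k → + p ∣ + (p ℕ.^ suc k)
  p∣pos^ p k = divides (+ (p ℕ.^ k)) (trans (cong +_ (ℕP.*-comm p (p ℕ.^ k))) (pos-* (p ℕ.^ k) p))

  euclidℤ : ∀ {p} → Prime p → ∀ x y → + p ∣ x * y → (+ p ∣ x) ⊎ (+ p ∣ y)
  euclidℤ {p} pp x y d with euclidsLemma ∣ x ∣ ∣ y ∣ pp (subst (p ℕD.∣_) (abs-* x y) (∣⇒∣ᵤ d))
  ... | inj₁ e = inj₁ (∣ᵤ⇒∣ e)
  ... | inj₂ e = inj₂ (∣ᵤ⇒∣ e)

  prime-∣-sq : ∀ {p} → Prime p → ∀ x → + p ∣ x * x → + p ∣ x
  prime-∣-sq pp x d with euclidℤ pp x x d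
  ... | inj₁ e = e
  ... | inj₂ e = e

  prime⇒coprime-∤ : ∀ {p} → Prime p → ∀ {m} → ¬ (p ℕD.∣ m) → Cop.Coprime p m
  prime⇒coprime-∤ pp ndiv {d} (d∣p , d∣m) with prime⇒irreducible pp d∣p
  ... | inj₁ d≡1 = d≡1
  ... | inj₂ refl = ⊥-elim (ndiv d∣m)

  bézoutℤ : ∀ {m n} → Cop.Coprime m n → ∃[ u ] ∃[ v ] u * + m + v * + n ≡ + 1
  bézoutℤ {m} {n} cop with Cop.coprime-Bézout cop
  ... | Bézout.+- x y eq = + x , - + y ,
    trans (cong (_+ (- + y) * + n) (trans (sym (pos-* x m)) (trans (cong +_ (sym eq)) (trans (pos-+ 1 (y ℕ.* n)) (cong (_+_ (+ 1)) (pos-* y n))))))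
          (lem (+ y) (+ n))
    where lem : ∀ a b → + 1 + a * b + (- a) * b ≡ + 1
          lem = solve-∀
  ... | Bézout.-+ x y eq = - + x , + y ,
    trans (cong (_+_ ((- + x) * + m)) (trans (sym (pos-* y n)) (trans (cong +_ (sym eq)) (trans (pos-+ 1 (x ℕ.* m)) (cong (_+_ (+ 1)) (pos-* x m))))))
          (lem (+ x) (+ m))
    where lem : ∀ a b → (- a) * b + (+ 1 + a * b) ≡ + 1
          lem = solve-∀

  coprime-∣-* : ∀ {m n} → Cop.Coprime m n → ∀ {x} → + m ∣ x → + n ∣ x → + m * + n ∣ x
  coprime-∣-* {m} {n} cop {x} (divides k eq) (divides l eq') with bézoutℤ cop
  ... | u , v , e = divides (u * l + v * k)
    (trans (sym (*-identityʳ x)) (trans (cong (x *_) (sym e)) (trans (dist x u v (+ m) (+ n))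
    (trans (cong₂ (λ a b → a * (u * + m) + b * (v * + n)) eq' eq) (lem u v k l (+ m) (+ n))))))
    where
    dist : ∀ x u v m n → x * (u * m + v * n) ≡ x * (u * m) + x * (v * n)
    dist = solve-∀
    lem : ∀ u v k l m n → (l * n) * (u * m) + (k * m) * (v * n) ≡ (u * l + v * k) * (m * n)
    lem = solve-∀

  coprime-∣-cancel : ∀ {m n} → Cop.Coprime m n → ∀ {x} → + m ∣ + n * x → + m ∣ x
  coprime-∣-cancel {m} {n} cop {x} d with bézoutℤ cop
  ... | u , v , e = ∣-eq (∣m∣n⇒∣m+n (∣*ˡ (u * x) (∣-refl {+ m})) (∣*ˡ v d))
    (trans (lem u v x (+ m) (+ n)) (trans (cong (_* x) e) (*-identityˡ x)))
    where
    lem : ∀ u v x m n → u * x * m + v * (n * x) ≡ (u * m + v * n) * x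
    lem = solve-∀

  prime-pow-cancel : ∀ {p} → Prime p → ∀ {c} → ¬ (+ p ∣ c) → ∀ n {x} → + (p ℕ.^ n) ∣ c * x → + (p ℕ.^ n) ∣ x
  prime-pow-cancel pp nd zero {x} d = divides x (sym (*-identityʳ x))
  prime-pow-cancel {p} pp {c} nd (suc n) {x} d
    with euclidℤ pp c x (∣-trans (p∣pos^ p n) d)
  ... | inj₁ e = ⊥-elim (nd e)
  ... | inj₂ (divides y refl) = subst (_∣ y * + p) (trans (*-comm (+ (p ℕ.^ n)) (+ p)) (sym (pos-* p (p ℕ.^ n)))) (*-monoˡ-∣ (+ p) ih)
    where
    instance _ = prime⇒nonZero pp
    e1 : c * (y * + p) ≡ + p * (c * y)
    e1 = lem c y (+ p) where lem : ∀ c y p → c * (y * p) ≡ p * (c * y)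
                             lem = solve-∀
    d' : + p * + (p ℕ.^ n) ∣ + p * (c * y)
    d' = ∣-eq (subst (_∣ c * (y * + p)) (pos-* p (p ℕ.^ n)) d) e1
    ih : + (p ℕ.^ n) ∣ y
    ih = prime-pow-cancel pp nd n (*-cancelˡ-∣ (+ p) d')

  -- The valuation of `m` at `p` is bounded crudely by `m` itself. This is enough, since the
  -- applications only need a loss of exponent that does not depend on `x`.
  prime-pow-divide-out : ∀ {p} → Prime p → ∀ m → m ≢ 0 → ∀ {x} j → + (p ℕ.^ (j ℕ.+ m)) ∣ + m * x → + (p ℕ.^ j) ∣ x
  prime-pow-divide-out {p} pp = <-rec (λ m → m ≢ 0 → ∀ {x} j → + (p ℕ.^ (j ℕ.+ m)) ∣ + m * x → + (p ℕ.^ j) ∣ x) step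
    where
    instance _ = prime⇒nonZero pp
    step : ∀ m → (∀ {m'} → m' ℕ.< m → m' ≢ 0 → ∀ {x} j → + (p ℕ.^ (j ℕ.+ m')) ∣ + m' * x → + (p ℕ.^ j) ∣ x) →
           m ≢ 0 → ∀ {x} j → + (p ℕ.^ (j ℕ.+ m)) ∣ + m * x → + (p ℕ.^ j) ∣ x
    step m rec m≢0 {x} j d with (+ p) ∣? (+ m)
    ... | no nd = prime-pow-cancel pp nd j (∣-trans (^-∣ p (ℕP.m≤m+n j m)) d)
    ... | yes e with ∣⇒∣ᵤ e
    ... | ℕD.divides m' refl = rec lt m'≢0 j (∣-trans (^-∣ p (ℕP.+-monoʳ-≤ j ℕP.≤-refl)) d2)
      where
      m'≢0 : m' ≢ 0
      m'≢0 refl = m≢0 refl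
      lt : m' ℕ.< m' ℕ.* p
      lt = ℕP.m<m*n m' p {{ℕ.≢-nonZero m'≢0}} (prime⇒≥2 pp)
      d0 : + (p ℕ.^ suc (j ℕ.+ m')) ∣ + (m' ℕ.* p) * x
      d0 = ∣-trans (^-∣ p (ℕP.≤-trans (ℕP.≤-reflexive (sym (ℕP.+-suc j m'))) (ℕP.+-monoʳ-≤ j lt))) d
      d1 : + p * + (p ℕ.^ (j ℕ.+ m')) ∣ + p * (+ m' * x)
      d1 = ∣-eq (subst (_∣ + (m' ℕ.* p) * x) (pos-* p _) d0) (trans (cong (_* x) (pos-* m' p)) (lem (+ m') (+ p) x))
        where lem : ∀ m p x → m * p * x ≡ p * (m * x)
              lem = solve-∀
      d2 : + (p ℕ.^ (j ℕ.+ m')) ∣ + m' * x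
      d2 = *-cancelˡ-∣ (+ p) d1

  +∣∣* : ∀ {m} c x → m ∣ c * x → m ∣ + ∣ c ∣ * x
  +∣∣* {m} c x d = ∣ᵤ⇒∣ (subst (∣ m ∣ ℕD.∣_) (trans (abs-* c x) (sym (abs-* (+ ∣ c ∣) x))) (∣⇒∣ᵤ d))

  prime-pow-divide-outℤ : ∀ {p} → Prime p → ∀ c → c ≢ + 0 → ∀ {x} j → + (p ℕ.^ (j ℕ.+ ∣ c ∣)) ∣ c * x → + (p ℕ.^ j) ∣ x
  prime-pow-divide-outℤ pp c c≢0 {x} j d = prime-pow-divide-out pp ∣ c ∣ (c≢0 ∘ ∣i∣≡0⇒i≡0) j (+∣∣* c x d)

  exists-prime-divisor : ∀ n → 2 ℕ.≤ n → ∃[ p ] Prime p × p ℕD.∣ n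
  exists-prime-divisor n 2≤n with factorise n {{ℕ.>-nonZero (ℕP.≤-trans (s≤s z≤n) 2≤n)}}
  ... | record { factors = [] ; isFactorisation = eq } = ⊥-elim (ℕP.<-irrefl (sym eq) 2≤n)
  ... | record { factors = p ∷ ps ; isFactorisation = eq ; factorsPrime = pp ∷ _ } =
    p , pp , subst (p ℕD.∣_) (sym eq) (ℕD.m∣m*n (product ps))

  abs-square : ∀ x → + ∣ x ∣ * + ∣ x ∣ ≡ x * x
  abs-square (+ n) = refl
  abs-square -[1+ n ] = refl

  -- A Hasse principle for z² = a x² + b y²

  -- Anisotropy over the p-adic numbers in finite form: by compactness, a zero to high order must be
  -- close to the origin. Stated through congruences, it can be carried along the substitutions of
  -- the descent at the price of enlarging `j`.
  LocallyAnisotropic : ℤ → ℤ → Set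
  LocallyAnisotropic a b = ∃[ p ] Prime p × (∀ j → ∃[ k ] ∀ z x y →
    + (p ℕ.^ k) ∣ z * z - a * (x * x) - b * (y * y) →
    (+ (p ℕ.^ j) ∣ z) × (+ (p ℕ.^ j) ∣ x) × (+ (p ℕ.^ j) ∣ y))

  Isotropic : ℤ → ℤ → Set
  Isotropic a b = ∃[ z ] ∃[ x ] ∃[ y ] ¬ (z ≡ + 0 × x ≡ + 0 × y ≡ + 0) × z * z ≡ a * (x * x) + b * (y * y)

  HasseAlternative : ℤ → ℤ → Set
  HasseAlternative a b = Isotropic a b ⊎ LocallyAnisotropic a b

  hasse-swap : ∀ a b → HasseAlternative a b → HasseAlternative b a
  hasse-swap a b (inj₁ (z , x , y , nt , e)) =
    inj₁ (z , y , x , (λ (h1 , h2 , h3) → nt (h1 , h3 , h2)) , trans e (+-comm (a * (x * x)) _))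
  hasse-swap a b (inj₂ (p , pp , h)) = inj₂ (p , pp , λ j → proj₁ (h j) , λ z x y d →
    let (u , v , w) = proj₂ (h j) z y x (∣-eq d (lem a b z x y)) in u , w , v)
    where lem : ∀ a b z x y → z * z - b * (x * x) - a * (y * y) ≡ z * z - a * (y * y) - b * (x * x)
          lem = solve-∀

  -- The form is homogeneous of degree two, so a factor `p` common to all variables cancels at the
  -- cost of two powers of `p`; repeating this reaches every `j`.
  locallyAnisotropic-iterate : ∀ a b p k → Prime p →
    (∀ z x y → + (p ℕ.^ k) ∣ z * z - a * (x * x) - b * (y * y) → (+ p ∣ z) × (+ p ∣ x) × (+ p ∣ y)) →
    LocallyAnisotropic a b
  locallyAnisotropic-iterate a b p k pp base = p , pp , λ j → K j , go j
    where
    instance _ = prime⇒nonZero pp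
    K : ℕ → ℕ
    K zero = k
    K (suc j) = suc (suc (K j))
    k≤K : ∀ j → k ℕ.≤ K j
    k≤K zero = ℕP.≤-refl
    k≤K (suc j) = ℕP.m≤n⇒m≤1+n (ℕP.m≤n⇒m≤1+n (k≤K j))
    up : ∀ j {z} → + (p ℕ.^ j) ∣ z → + (p ℕ.^ suc j) ∣ z * + p
    up j {z} d = subst (_∣ z * + p) (trans (sym (pos-* (p ℕ.^ j) p)) (cong +_ (ℕP.*-comm (p ℕ.^ j) p))) (*-monoˡ-∣ (+ p) d)
    go : ∀ j z x y → + (p ℕ.^ K j) ∣ z * z - a * (x * x) - b * (y * y) →
         (+ (p ℕ.^ j) ∣ z) × (+ (p ℕ.^ j) ∣ x) × (+ (p ℕ.^ j) ∣ y)
    go zero z x y d = one z , one x , one y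
      where one : ∀ z → + 1 ∣ z
            one z = divides z (sym (*-identityʳ z))
    go (suc j) z x y d with base z x y (∣-trans (^-∣ p (k≤K (suc j))) d)
    ... | divides z' refl , divides x' refl , divides y' refl =
      let (u , v , w) = go j z' x' y' (*-cancelˡ-∣ (+ p) (*-cancelˡ-∣ (+ p) d'))
      in up j u , up j v , up j w
      where
      lem : ∀ a b p z x y → z * p * (z * p) - a * (x * p * (x * p)) - b * (y * p * (y * p)) ≡ p * (p * (z * z - a * (x * x) - b * (y * y)))
      lem = solve-∀
      d' : + p * (+ p * + (p ℕ.^ K j)) ∣ + p * (+ p * (z' * z' - a * (x' * x') - b * (y' * y')))
      d' = ∣-eq (subst (_∣ _) (trans (pos-* p (p ℕ.* p ℕ.^ K j)) (cong (_*_ (+ p)) (pos-* p (p ℕ.^ K j)))) d) (lem a b (+ p) z' x' y')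

  hasse-square-factor : ∀ a b p → p ≢ + 0 → HasseAlternative a b → HasseAlternative a (b * (p * p))
  hasse-square-factor a b p p≢0 (inj₁ (z , x , y , nt , e)) =
    inj₁ (z * p , x * p , y , nt' , trans (lem1 z p) (trans (cong (_* (p * p)) e) (lem2 a b p x y)))
    where
    canc : ∀ u → u * p ≡ + 0 → u ≡ + 0
    canc u h with i*j≡0⇒i≡0∨j≡0 u h
    ... | inj₁ e = e
    ... | inj₂ e = ⊥-elim (p≢0 e)
    nt' : ¬ (z * p ≡ + 0 × x * p ≡ + 0 × y ≡ + 0)
    nt' (h1 , h2 , h3) = nt (canc z h1 , canc x h2 , h3)
    lem1 : ∀ z p → z * p * (z * p) ≡ z * z * (p * p)
    lem1 = solve-∀
    lem2 : ∀ a b p x y → (a * (x * x) + b * (y * y)) * (p * p) ≡ a * (x * p * (x * p)) + b * (p * p) * (y * y)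
    lem2 = solve-∀
  hasse-square-factor a b p p≢0 (inj₂ (l , pl , h)) = inj₂ (l , pl , λ j →
    let (k , f) = h (j ℕ.+ ∣ p ∣) in k , λ z x y d →
    let (u , v , w) = f z x (p * y) (∣-eq d (lem a b p z x y)) in
    ∣-trans (^-∣ l (ℕP.m≤m+n j _)) u , ∣-trans (^-∣ l (ℕP.m≤m+n j _)) v , prime-pow-divide-outℤ pl p p≢0 j w)
    where
    lem : ∀ a b p z x y → z * z - a * (x * x) - b * (p * p) * (y * y) ≡ z * z - a * (x * x) - b * (p * y * (p * y))
    lem = solve-∀

  -- `t² - a` is the norm of `t + √a`, and multiplying `z + x√a` by `t + √a` multiplies the norm
  -- `z² - a x²` by `b c`. So `b` and `c` agree up to norms and squares, and the two conics have the
  -- same solubility, rationally and at each prime.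
  hasse-descend : ∀ a b c t → b ≢ + 0 → c ≢ + 0 → t * t - a ≡ b * c → HasseAlternative a c → HasseAlternative a b
  hasse-descend a b c t b≢0 c≢0 eq (inj₁ (z , x , y , nt , e)) =
    inj₁ (z * t + a * x , z + t * x , c * y , nt' , e')
    where
    norm : ∀ z t a x → (z * t + a * x) * (z * t + a * x) ≡ a * ((z + t * x) * (z + t * x)) + (z * z - a * (x * x)) * (t * t - a)
    norm = solve-∀
    e0 : z * z - a * (x * x) ≡ c * (y * y)
    e0 = trans (cong (_- a * (x * x)) e) (lem (a * (x * x)) (c * (y * y)))
      where lem : ∀ u v → u + v - u ≡ v
            lem = solve-∀
    e' : (z * t + a * x) * (z * t + a * x) ≡ a * ((z + t * x) * (z + t * x)) + b * (c * y * (c * y))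
    e' = trans (norm z t a x) (cong (_+_ (a * ((z + t * x) * (z + t * x)))) (trans (cong₂ _*_ e0 eq) (lem b c y)))
      where lem : ∀ b c y → c * (y * y) * (b * c) ≡ b * (c * y * (c * y))
            lem = solve-∀
    nz : ∀ {u v} → u ≢ + 0 → u * v ≡ + 0 → v ≡ + 0
    nz {u} u≢0 h with i*j≡0⇒i≡0∨j≡0 u h
    ... | inj₁ e = ⊥-elim (u≢0 e)
    ... | inj₂ e = e
    nt' : ¬ (z * t + a * x ≡ + 0 × z + t * x ≡ + 0 × c * y ≡ + 0)
    nt' (h1 , h2 , h3) = nt (z0 , x0 , nz c≢0 h3)
      where
      lem : ∀ b c t a x z → (t * t - a) * x ≡ t * (z + t * x) - (z * t + a * x)
      lem b c = solve-∀
      -- The substitution `(z , x) ↦ (z t + a x , z + t x)` has determinant `t² - a = b c`, which is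
      -- nonzero.
      x0 : x ≡ + 0
      x0 = nz c≢0 (nz b≢0 (trans (sym (*-assoc b c x)) (trans (cong (_* x) (sym eq))
         (trans (lem b c t a x z) (trans (cong₂ (λ u v → t * u - v) h2 h1) (trans (+-identityʳ (t * + 0)) (*-zeroʳ t)))))))
      z0 : z ≡ + 0
      z0 = trans (sym (+-identityʳ z)) (trans (cong (_+_ z) (sym (*-zeroʳ t))) (trans (cong (λ u → z + t * u) (sym x0)) h2))
  hasse-descend a b c t b≢0 c≢0 eq (inj₂ (l , pl , h)) = inj₂ (l , pl , λ j →
    let (k , f) = h (j ℕ.+ ∣ b * c ∣ ℕ.+ ∣ b ∣) in k , λ z x y d →
    let (u , v , w) = f (z * t + a * x) (z + t * x) (b * y) (∣-eq (∣m⇒∣m*n (t * t - a) d) (lem1 z x y))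
        u' = lo j u ; v' = lo j v
    in prime-pow-divide-outℤ pl (b * c) bc≢0 j (∣-eq (∣m∣n⇒∣m-n (∣*ˡ t u') (∣*ˡ a v')) (trans (lem3 t a z x) (cong (_* z) eq)))
     , prime-pow-divide-outℤ pl (b * c) bc≢0 j (∣-eq (∣m∣n⇒∣m-n (∣*ˡ t v') u') (trans (lem2 t a z x) (cong (_* x) eq)))
     , prime-pow-divide-outℤ pl b b≢0 j (∣-trans (^-∣ l (ℕP.+-monoˡ-≤ ∣ b ∣ (ℕP.m≤m+n j ∣ b * c ∣))) w))
    where
    lo : ∀ j {x} → + (l ℕ.^ (j ℕ.+ ∣ b * c ∣ ℕ.+ ∣ b ∣)) ∣ x → + (l ℕ.^ (j ℕ.+ ∣ b * c ∣)) ∣ x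
    lo j = ∣-trans (^-∣ l (ℕP.m≤m+n (j ℕ.+ ∣ b * c ∣) ∣ b ∣))
    bc≢0 : b * c ≢ + 0
    bc≢0 h with i*j≡0⇒i≡0∨j≡0 b h
    ... | inj₁ e = b≢0 e
    ... | inj₂ e = c≢0 e
    norm : ∀ a b t z x y → (z * z - a * (x * x) - b * (y * y)) * (t * t - a) ≡
           (z * t + a * x) * (z * t + a * x) - a * ((z + t * x) * (z + t * x)) - b * (y * y) * (t * t - a)
    norm = solve-∀
    lem : ∀ b c y → b * (y * y) * (b * c) ≡ c * (b * y * (b * y))
    lem = solve-∀
    lem1 : ∀ z x y → (z * z - a * (x * x) - b * (y * y)) * (t * t - a) ≡
           (z * t + a * x) * (z * t + a * x) - a * ((z + t * x) * (z + t * x)) - c * (b * y * (b * y))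
    lem1 z x y = trans (norm a b t z x y) (cong (λ u → (z * t + a * x) * (z * t + a * x) - a * ((z + t * x) * (z + t * x)) - u)
       (trans (cong (b * (y * y) *_) eq) (lem b c y)))
    lem2 : ∀ t a z x → t * (z + t * x) - (z * t + a * x) ≡ (t * t - a) * x
    lem2 = solve-∀
    lem3 : ∀ t a z x → t * (z * t + a * x) - a * (z + t * x) ≡ (t * t - a) * z
    lem3 = solve-∀

  -- Squares modulo n

  %ℕ-∣ : ∀ t p .{{_ : ℕ.NonZero p}} → + p ∣ t - + (t %ℕ p)
  %ℕ-∣ t p = divides (t /ℕ p) (trans (cong (_- + (t %ℕ p)) (a≡a%ℕn+[a/ℕn]*n t p)) (lem (+ (t %ℕ p)) ((t /ℕ p) * + p)))
    where lem : ∀ u v → u + v - u ≡ v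
          lem = solve-∀

  ∣-sq-shift : ∀ {m} s t a → m ∣ t - s → m ∣ t * t - a → m ∣ s * s - a
  ∣-sq-shift s t a d e = ∣-eq (∣m∣n⇒∣m-n e (∣*ˡ (t + s) d)) (lem s t a)
    where lem : ∀ s t a → t * t - a - (t + s) * (t - s) ≡ s * s - a
          lem = solve-∀

  SquareMod : ℤ → ℕ → Set
  SquareMod a n = ∃[ t ] + n ∣ t * t - a

  squareMod? : ∀ a n .{{_ : ℕ.NonZero n}} → Dec (SquareMod a n)
  squareMod? a n = map′ (λ (t , _ , d) → + t , d)
    (λ (t , d) → t %ℕ n , n%ℕd<d t n , ∣-sq-shift (+ (t %ℕ n)) t a (%ℕ-∣ t n) d)
    (ℕP.anyUpTo? (λ t → (+ n) ∣? (+ t * + t - a)) n)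

  squareMod-* : ∀ {p m} a → Prime p → ¬ p ℕD.∣ m → SquareMod a p → SquareMod a m → SquareMod a (m ℕ.* p)
  squareMod-* {p} {m} a pp p∤m (s , ds) (t , dt) = r , subst (_∣ r * r - a) (trans (sym (pos-* p m)) (cong +_ (ℕP.*-comm p m)))
      (coprime-∣-* (prime⇒coprime-∤ pp p∤m) {r * r - a} (∣-sq-shift r s a p∣ ds) (∣-sq-shift r t a m∣ dt))
    where
    bez = bézoutℤ (prime⇒coprime-∤ pp p∤m)
    u = proj₁ bez
    v = proj₁ (proj₂ bez)
    e = proj₂ (proj₂ bez)
    r = t * (u * + p) + s * (v * + m)
    lem : ∀ t s u v p m → t * (u * p + v * m) - (t * (u * p) + s * (v * m)) ≡ v * (t - s) * m
    lem = solve-∀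
    m∣ : + m ∣ t - r
    m∣ = divides (v * (t - s)) (trans (cong (_- r) (trans (sym (*-identityʳ t)) (cong (t *_) (sym e)))) (lem t s u v (+ p) (+ m)))
    p∣ : + p ∣ s - r
    p∣ = divides (u * (s - t)) (trans (cong (_- r) (trans (sym (*-identityʳ s)) (cong (s *_) (sym (trans (+-comm (v * + m) (u * + p)) e)))))
      (trans (cong (λ z → s * (v * + m + u * + p) - z) (+-comm (t * (u * + p)) (s * (v * + m)))) (lem s t v u (+ m) (+ p))))

  -- The two ways in which assembling a root modulo `n` prime by prime can stop. In the descent the
  -- first gives a square factor to remove, the second a prime of anisotropy.
  Obstruction : ℤ → ℕ → Set
  Obstruction a n = ∃[ p ] ∃[ m ] Prime p × n ≡ m ℕ.* p × (p ℕD.∣ m ⊎ ¬ SquareMod a p)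

  squareMod-or-obstruction : ∀ a n → 1 ℕ.≤ n → SquareMod a n ⊎ Obstruction a n
  squareMod-or-obstruction a = <-rec _ step
    where
    lift : ∀ {m} p → Obstruction a m → Obstruction a (m ℕ.* p)
    lift p (p' , m' , pp' , refl , ob) = p' , m' ℕ.* p , pp' , swap m' p' p , [ (λ d → inj₁ (ℕD.∣m⇒∣m*n p d)) , inj₂ ]′ ob
      where swap : ∀ x y z → x ℕ.* y ℕ.* z ≡ x ℕ.* z ℕ.* y
            swap x y z = trans (ℕP.*-assoc x y z) (trans (cong (x ℕ.*_) (ℕP.*-comm y z)) (sym (ℕP.*-assoc x z y)))
    split : ∀ n → (∀ {m} → m ℕ.< n → 1 ℕ.≤ m → SquareMod a m ⊎ Obstruction a m) → n ≢ 0 →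
      ∀ p m → Prime p → n ≡ m ℕ.* p → SquareMod a n ⊎ Obstruction a n
    split n rec n≢0 p m pp eq = go (p ℕD.∣? m) (squareMod? a p {{prime⇒nonZero pp}})
      where
      m≢0 : m ≢ 0
      m≢0 h = n≢0 (trans eq (cong (ℕ._* p) h))
      m<n : m ℕ.< n
      m<n = subst (m ℕ.<_) (sym eq) (ℕP.m<m*n m p {{ℕ.≢-nonZero m≢0}} (prime⇒≥2 pp))
      go : Dec (p ℕD.∣ m) → Dec (SquareMod a p) → SquareMod a n ⊎ Obstruction a n
      go (yes p∣m) _ = inj₂ (p , m , pp , eq , inj₁ p∣m)
      go (no _) (no nsq) = inj₂ (p , m , pp , eq , inj₂ nsq)
      go (no p∤m) (yes sq) = [ (λ sq' → inj₁ (subst (SquareMod a) (sym eq) (squareMod-* a pp p∤m sq sq'))) , (λ ob → inj₂ (subst (Obstruction a) (sym eq) (lift p ob))) ]′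
        (rec {m} m<n (ℕP.n≢0⇒n>0 m≢0))
    step : ∀ n → (∀ {m} → m ℕ.< n → 1 ℕ.≤ m → SquareMod a m ⊎ Obstruction a m) → 1 ℕ.≤ n → SquareMod a n ⊎ Obstruction a n
    step (suc zero) rec _ = inj₁ (+ 0 , divides (+ 0 * + 0 - a) (sym (*-identityʳ _)))
    step n@(suc (suc _)) rec _ = let (p , pp , p∣n) = exists-prime-divisor n (s≤s (s≤s z≤n)) in
      split n rec (λ ()) p (ℕD.quotient p∣n) pp (ℕD.m∣n⇒n≡quotient*m p∣n)

  -- If `p` did not divide `x`, then `z / x` would be a root of `a` modulo `p`. So `p` divides `x`
  -- and `z`, hence `p²` divides `b p y²`, and `p` divides `y` because it divides the coefficient
  -- only once.
  locallyAnisotropic-nonsquare : ∀ a b p → Prime p → ¬ SquareMod a p → ¬ (+ p ∣ b) → LocallyAnisotropic a (b * + p)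
  locallyAnisotropic-nonsquare a b p pp nsq p∤b = locallyAnisotropic-iterate a (b * + p) p 2 pp base
    where
    instance _ = prime⇒nonZero pp
    root : ∀ z x → + p ∣ z * z - a * (x * x) → ¬ (+ p ∣ x) → SquareMod a p
    root z x d p∤x with bézoutℤ (prime⇒coprime-∤ pp (λ e → p∤x (∣ᵤ⇒∣ {+ p} {x} e)))
    ... | u , v , e = v * z , ∣-eq (∣m∣n⇒∣m-n (∣*ˡ (v * v) d) (∣*ˡ (a * (+ 1 + v * w) * u) (∣-refl {+ p}))) fin
      where
      w = + ∣ x ∣
      up : u * + p ≡ + 1 - v * w
      up = trans (lem (u * + p) (v * w)) (cong (_- v * w) e)
        where lem : ∀ s t → s ≡ s + t - t
              lem = solve-∀
      fin : v * v * (z * z - a * (x * x)) - a * (+ 1 + v * w) * u * + p ≡ v * z * (v * z) - a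
      fin = trans (cong₂ (λ h k → v * v * (z * z - a * h) - k) (sym (abs-square x))
                    (trans (*-assoc (a * (+ 1 + v * w)) u (+ p)) (cong (a * (+ 1 + v * w) *_) up)))
                  (lem v z a w)
        where lem : ∀ v z a w → v * v * (z * z - a * (w * w)) - a * (+ 1 + v * w) * (+ 1 - v * w) ≡ v * z * (v * z) - a
              lem = solve-∀
    last : ∀ z x y → + p * + p ∣ z * z - a * (x * x) - b * + p * (y * y) → + p ∣ z → + p ∣ x → + p ∣ y
    last _ _ y d (divides z' refl) (divides x' refl) = [ (λ e → ⊥-elim (p∤b e)) , prime-∣-sq pp y ]′ (euclidℤ pp b (y * y) p∣by²)
      where
      lem : ∀ z a x b p y → (z * z - a * (x * x)) * (p * p) - (z * p * (z * p) - a * (x * p * (x * p)) - b * p * (y * y)) ≡ p * (b * (y * y))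
      lem = solve-∀
      p∣by² : + p ∣ b * (y * y)
      p∣by² = *-cancelˡ-∣ (+ p) (∣-eq (∣m∣n⇒∣m-n (∣*ˡ (z' * z' - a * (x' * x')) (∣-refl {+ p * + p})) d) (lem z' a x' b (+ p) y))
    base : ∀ z x y → + (p ℕ.^ 2) ∣ z * z - a * (x * x) - b * + p * (y * y) → (+ p ∣ z) × (+ p ∣ x) × (+ p ∣ y)
    base z x y d = case ((+ p) ∣? x)
      where
      d2 : + p * + p ∣ z * z - a * (x * x) - b * + p * (y * y)
      d2 = subst (_∣ z * z - a * (x * x) - b * + p * (y * y)) (trans (cong (λ u → + (p ℕ.* u)) (ℕP.*-identityʳ p)) (pos-* p p)) d
      dzx : + p ∣ z * z - a * (x * x)
      dzx = ∣-eq (∣m∣n⇒∣m+n (∣-trans (∣*ˡ (+ p) (∣-refl {+ p})) d2) (∣*ˡ (b * (y * y)) (∣-refl {+ p}))) (lem z a x b (+ p) y)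
        where lem : ∀ z a x b p y → z * z - a * (x * x) - b * p * (y * y) + b * (y * y) * p ≡ z * z - a * (x * x)
              lem = solve-∀
      case : Dec (+ p ∣ x) → (+ p ∣ z) × (+ p ∣ x) × (+ p ∣ y)
      case (no p∤x) = ⊥-elim (nsq (root z x dzx p∤x))
      case (yes p∣x) = p∣z , p∣x , last z x y d2 p∣z p∣x
        where
        p∣z : + p ∣ z
        p∣z = prime-∣-sq pp z (∣-eq (∣m∣n⇒∣m+n dzx (∣*ˡ (a * x) p∣x)) (lem z a x))
          where lem : ∀ z a x → z * z - a * (x * x) + a * x * x ≡ z * z
                lem = solve-∀

  -- Squares are 0 or 1 modulo 4, so three of them sum to a multiple of 4 only if all are even.
  -- Among pairs of units this is the only one without a rational zero.
  hasse-base : LocallyAnisotropic (- + 1) (- + 1)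
  hasse-base = locallyAnisotropic-iterate (- + 1) (- + 1) 2 2 prime[2] base
    where
    n1 : ¬ (+ 4 ∣ + 1)
    n1 d with ℕD.∣⇒≤ (∣⇒∣ᵤ d)
    ... | s≤s ()
    n2 : ¬ (+ 4 ∣ + 2)
    n2 d with ℕD.∣⇒≤ (∣⇒∣ᵤ d)
    ... | s≤s (s≤s ())
    n3 : ¬ (+ 4 ∣ + 3)
    n3 d with ℕD.∣⇒≤ (∣⇒∣ᵤ d)
    ... | s≤s (s≤s (s≤s ()))
    all-even : ∀ r s t → r ℕ.< 2 → s ℕ.< 2 → t ℕ.< 2 → + 4 ∣ + r * + r + + s * + s + + t * + t → r ≡ 0 × s ≡ 0 × t ≡ 0
    all-even 0 0 0 _ _ _ _ = refl , refl , refl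
    all-even 0 0 1 _ _ _ d = ⊥-elim (n1 d)
    all-even 0 1 0 _ _ _ d = ⊥-elim (n1 d)
    all-even 1 0 0 _ _ _ d = ⊥-elim (n1 d)
    all-even 0 1 1 _ _ _ d = ⊥-elim (n2 d)
    all-even 1 0 1 _ _ _ d = ⊥-elim (n2 d)
    all-even 1 1 0 _ _ _ d = ⊥-elim (n2 d)
    all-even 1 1 1 _ _ _ d = ⊥-elim (n3 d)
    all-even (suc (suc _)) _ _ (s≤s (s≤s ())) _ _ _
    all-even 0 (suc (suc _)) _ _ (s≤s (s≤s ())) _ _
    all-even 1 (suc (suc _)) _ _ (s≤s (s≤s ())) _ _
    all-even 0 0 (suc (suc _)) _ _ (s≤s (s≤s ())) _
    all-even 0 1 (suc (suc _)) _ _ (s≤s (s≤s ())) _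
    all-even 1 0 (suc (suc _)) _ _ (s≤s (s≤s ())) _
    all-even 1 1 (suc (suc _)) _ _ (s≤s (s≤s ())) _
    euclid : ∀ z → z ≡ + (z %ℕ 2) + (z /ℕ 2) * + 2
    euclid z = a≡a%ℕn+[a/ℕn]*n z 2
    lem : ∀ r s t a b c → (r + a * + 2) * (r + a * + 2) - (- + 1) * ((s + b * + 2) * (s + b * + 2)) - (- + 1) * ((t + c * + 2) * (t + c * + 2))
      ≡ (a * a + a * r + (b * b + b * s) + (c * c + c * t)) * + 4 + (r * r + s * s + t * t)
    lem = solve-∀
    even : ∀ z → z %ℕ 2 ≡ 0 → + 2 ∣ z
    even z e = divides (z /ℕ 2) (trans (euclid z) (trans (cong (λ r → + r + (z /ℕ 2) * + 2) e) (+-identityˡ ((z /ℕ 2) * + 2))))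
    base : ∀ z x y → + 4 ∣ z * z - (- + 1) * (x * x) - (- + 1) * (y * y) → (+ 2 ∣ z) × (+ 2 ∣ x) × (+ 2 ∣ y)
    base z x y d = even z (proj₁ zeros) , even x (proj₁ (proj₂ zeros)) , even y (proj₂ (proj₂ zeros))
      where
      r = z %ℕ 2
      s = x %ℕ 2
      t = y %ℕ 2
      a = z /ℕ 2
      b = x /ℕ 2
      c = y /ℕ 2
      K = a * a + a * + r + (b * b + b * + s) + (c * c + c * + t)
      subst₃ : ∀ {z z' x x' y y'} → z ≡ z' → x ≡ x' → y ≡ y' → z * z - (- + 1) * (x * x) - (- + 1) * (y * y) ≡ z' * z' - (- + 1) * (x' * x') - (- + 1) * (y' * y')
      subst₃ refl refl refl = refl
      zeros : r ≡ 0 × s ≡ 0 × t ≡ 0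
      zeros = all-even r s t (n%ℕd<d z 2) (n%ℕd<d x 2) (n%ℕd<d y 2)
        (∣m+n∣m⇒∣n {+ 4} {K * + 4} {+ r * + r + + s * + s + + t * + t} (∣-eq d (trans (subst₃ (euclid z) (euclid x) (euclid y)) (lem (+ r) (+ s) (+ t) a b c))) (∣*ˡ K (∣-refl {+ 4})))

  -- The absolutely smallest representative is taken so that the cofactor of `b` in `t² - a` becomes
  -- smaller than `b`.
  small-root : ∀ a n → 1 ℕ.≤ n → SquareMod a n → ∃[ t ] (+ n ∣ t * t - a) × (2 ℕ.* ∣ t ∣ ℕ.≤ n)
  small-root a n 1≤n (t , d) with ℕP.≤-total (2 ℕ.* r) n
    where
    instance _ = ℕ.>-nonZero 1≤n
    r = t %ℕ n
  ... | inj₁ le = + (t %ℕ n) , ∣-sq-shift (+ (t %ℕ n)) t a (%ℕ-∣ t n) d , le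
    where instance _ = ℕ.>-nonZero 1≤n
  ... | inj₂ ge = + r - + n , ∣-sq-shift (+ r - + n) t a d' d , bound
    where
    instance _ = ℕ.>-nonZero 1≤n
    r = t %ℕ n
    d' : + n ∣ t - (+ r - + n)
    d' = ∣-eq (∣m∣n⇒∣m+n (%ℕ-∣ t n) (∣-refl {+ n})) (lem t (+ r) (+ n))
      where lem : ∀ t r n → t - r + n ≡ t - (r - n)
            lem = solve-∀
    r≤n : r ℕ.≤ n
    r≤n = ℕP.<⇒≤ (n%ℕd<d t n)
    abs-eq : ∣ + r - + n ∣ ≡ n ℕ.∸ r
    abs-eq = trans (cong ∣_∣ (m-n≡m⊖n r n)) (∣⊖∣-≤ r≤n)
    bound : 2 ℕ.* ∣ + r - + n ∣ ℕ.≤ n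
    bound = subst (λ u → 2 ℕ.* u ℕ.≤ n) (sym abs-eq) (ℕP.≤-trans (ℕP.≤-reflexive (ℕP.*-distribˡ-∸ 2 n r))
      (ℕP.≤-trans (ℕP.∸-monoʳ-≤ (2 ℕ.* n) ge) (ℕP.≤-reflexive (trans (cong (ℕ._∸ n) (cong (n ℕ.+_) (ℕP.+-identityʳ n))) (ℕP.m+n∸n≡m n n)))))

  -- Induction on `|a| + |b|`, arranged with `|a| ≤ |b|`. A root `t` of `a` modulo `b` gives
  -- `t² - a = c b` and a descent from `b` to `c`, unless `c = 0` and `a` is a square. Without a
  -- root, either `b` loses a square factor or some prime dividing `b` exactly once is a prime of
  -- anisotropy.
  hasse : ∀ a b → a ≢ + 0 → b ≢ + 0 → HasseAlternative a b
  hasse a b a≢0 b≢0 = <-rec (λ s → ∀ a b → ∣ a ∣ ℕ.+ ∣ b ∣ ≡ s → a ≢ + 0 → b ≢ + 0 → HasseAlternative a b) both (∣ a ∣ ℕ.+ ∣ b ∣) a b refl a≢0 b≢0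
    where
    Rec : ℕ → Set
    Rec s = ∀ {s'} → s' ℕ.< s → ∀ a b → ∣ a ∣ ℕ.+ ∣ b ∣ ≡ s' → a ≢ + 0 → b ≢ + 0 → HasseAlternative a b
    small : ∀ a b → ∣ a ∣ ℕ.≤ ∣ b ∣ → ∣ b ∣ ℕ.≤ 1 → a ≢ + 0 → b ≢ + 0 → HasseAlternative a b
    small (+ 0) b _ _ a≢0 _ = ⊥-elim (a≢0 refl)
    small a (+ 0) _ _ _ b≢0 = ⊥-elim (b≢0 refl)
    small (+ 1) b _ _ _ _ = inj₁ (+ 1 , + 1 , + 0 , (λ ()) , sym (trans (cong (_+_ (+ 1)) (*-zeroʳ b)) refl))
    small a@(-[1+ _ ]) (+ 1) _ _ _ _ = inj₁ (+ 1 , + 0 , + 1 , (λ ()) , sym (trans (cong (_+ + 1) (*-zeroʳ a)) refl))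
    small -[1+ 0 ] -[1+ 0 ] _ _ _ _ = inj₂ hasse-base
    small (+ (suc (suc _))) (+ 1) (s≤s ()) _ _ _
    small (+ (suc (suc _))) (+ (suc (suc _))) _ (s≤s ()) _ _
    small (+ (suc (suc _))) -[1+ 0 ] (s≤s ()) _ _ _
    small (+ (suc (suc _))) -[1+ suc _ ] _ (s≤s ()) _ _
    small -[1+ _ ] (+ (suc (suc _))) _ (s≤s ()) _ _
    small -[1+ suc _ ] -[1+ 0 ] (s≤s ()) _ _ _
    small -[1+ _ ] -[1+ suc _ ] _ (s≤s ()) _ _
    root-case : ∀ a b → Rec (∣ a ∣ ℕ.+ ∣ b ∣) → ∣ a ∣ ℕ.≤ ∣ b ∣ → 2 ℕ.≤ ∣ b ∣ → a ≢ + 0 → b ≢ + 0 →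
      ∀ t c → t * t - a ≡ c * b → 2 ℕ.* ∣ t ∣ ℕ.≤ ∣ b ∣ → Dec (c ≡ + 0) → HasseAlternative a b
    root-case a b rec a≤b 2≤b a≢0 b≢0 t c eq t≤ (yes refl) = inj₁ (t , + 1 , + 0 , (λ ()) , trans (trans (lem t a) (cong (_+_ a) eq)) (lem2 a b))
      where
      lem : ∀ t a → t * t ≡ a + (t * t - a)
      lem = solve-∀
      lem2 : ∀ a b → a + + 0 * b ≡ a * (+ 1 * + 1) + b * (+ 0 * + 0)
      lem2 = solve-∀
    root-case a b rec a≤b 2≤b a≢0 b≢0 t c eq t≤ (no c≢0) = hasse-descend a b c t b≢0 c≢0 (trans eq (*-comm c b)) (rec lt a c refl a≢0 c≢0)
      where
      B = ∣ b ∣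
      C = ∣ c ∣
      bc : C ℕ.* B ℕ.≤ ∣ t ∣ ℕ.* ∣ t ∣ ℕ.+ B
      bc = ℕP.≤-trans (ℕP.≤-reflexive (trans (sym (abs-* c b)) (cong ∣_∣ (sym eq))))
          (ℕP.≤-trans (∣i-j∣≤∣i∣+∣j∣ (t * t) a) (ℕP.+-mono-≤ (ℕP.≤-reflexive (abs-* t t)) a≤b))
      -- From `|c| |b| ≤ t² + |a|` and `2 |t| ≤ |b|` follows `4 |c| ≤ |b| + 4`, which is below
      -- `4 |b|` once `|b| ≥ 2`.
      bound4 : 4 ℕ.* C ℕ.* B ℕ.≤ (B ℕ.+ 4) ℕ.* B
      bound4 = ℕP.≤-trans (ℕP.≤-reflexive (ℕP.*-assoc 4 C B)) (ℕP.≤-trans (ℕP.*-monoʳ-≤ 4 bc)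
         (ℕP.≤-trans (ℕP.≤-reflexive (l1 ∣ t ∣ B)) (ℕP.≤-trans (ℕP.+-monoˡ-≤ (4 ℕ.* B) (ℕP.*-mono-≤ t≤ t≤)) (ℕP.≤-reflexive (sym (ℕP.*-distribʳ-+ B B 4))))))
        where
        l1 : ∀ t b → 4 ℕ.* (t ℕ.* t ℕ.+ b) ≡ 2 ℕ.* t ℕ.* (2 ℕ.* t) ℕ.+ 4 ℕ.* b
        l1 = ℕRing.solve-∀
      C<B : C ℕ.< B
      C<B = ℕP.≰⇒> λ B≤C → ℕP.<-irrefl refl (ℕP.<-≤-trans (strict B 2≤b) (ℕP.≤-trans (ℕP.*-monoʳ-≤ 4 B≤C) (ℕP.*-cancelʳ-≤ (4 ℕ.* C) (B ℕ.+ 4) B {{ℕ.>-nonZero (ℕP.≤-trans (s≤s z≤n) 2≤b)}} bound4)))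
        where
        strict : ∀ n → 2 ℕ.≤ n → n ℕ.+ 4 ℕ.< 4 ℕ.* n
        strict n le = ℕP.≤-trans (ℕP.≤-reflexive (trans (sym (ℕP.+-suc n 4)) refl)) (ℕP.+-monoʳ-≤ n (ℕP.≤-trans (s≤s (s≤s (s≤s (s≤s (s≤s z≤n))))) (ℕP.*-monoʳ-≤ 3 le)))
      lt : ∣ a ∣ ℕ.+ C ℕ.< ∣ a ∣ ℕ.+ B
      lt = ℕP.+-monoʳ-< ∣ a ∣ C<B
    square-case : ∀ a b' p → Prime p → Rec (∣ a ∣ ℕ.+ ∣ b' * (+ p * + p) ∣) → a ≢ + 0 → b' * (+ p * + p) ≢ + 0 → HasseAlternative a (b' * (+ p * + p))
    square-case a b' p pp rec a≢0 b≢0 = hasse-square-factor a b' (+ p) p≢0 (rec lt a b' refl a≢0 b'≢0)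
      where
      p≢0 : + p ≢ + 0
      p≢0 e = ℕ.≢-nonZero⁻¹ p {{prime⇒nonZero pp}} (+-injective e)
      b'≢0 : b' ≢ + 0
      b'≢0 refl = b≢0 refl
      lt : ∣ a ∣ ℕ.+ ∣ b' ∣ ℕ.< ∣ a ∣ ℕ.+ ∣ b' * (+ p * + p) ∣
      lt = ℕP.+-monoʳ-< ∣ a ∣ (subst (∣ b' ∣ ℕ.<_) (sym (trans (abs-* b' (+ p * + p)) (cong (∣ b' ∣ ℕ.*_) (abs-* (+ p) (+ p)))))
         (ℕP.m<m*n ∣ b' ∣ (p ℕ.* p) {{ℕ.≢-nonZero (b'≢0 ∘ ∣i∣≡0⇒i≡0)}} (ℕP.≤-trans (prime⇒≥2 pp) (ℕP.m≤m*n p p {{prime⇒nonZero pp}}))))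
    nonsquare-case : ∀ a b' p m → Prime p → ∣ b' * + p ∣ ≡ m ℕ.* p → ¬ p ℕD.∣ m → ¬ SquareMod a p → HasseAlternative a (b' * + p)
    nonsquare-case a b' p m pp eq p∤m nsq = inj₂ (locallyAnisotropic-nonsquare a b' p pp nsq λ d → p∤m (subst (p ℕD.∣_) b'≡m (∣⇒∣ᵤ d)))
      where
      b'≡m : ∣ b' ∣ ≡ m
      b'≡m = ℕP.*-cancelʳ-≡ ∣ b' ∣ m p {{prime⇒nonZero pp}} (trans (sym (abs-* b' (+ p))) eq)
    obstruction-case : ∀ a b → Rec (∣ a ∣ ℕ.+ ∣ b ∣) → a ≢ + 0 → b ≢ + 0 → ∀ p m → Prime p → ∣ b ∣ ≡ m ℕ.* p → (p ℕD.∣ m ⊎ ¬ SquareMod a p) → Dec (p ℕD.∣ m) → HasseAlternative a b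
    obstruction-case a b rec a≢0 b≢0 p m pp eq ob (yes (ℕD.divides m' refl)) = go (subst (_∣ b) (pos-* p p) (∣ᵤ⇒∣ (ℕD.divides m' (trans eq (ℕP.*-assoc m' p p)))))
      where go : + p * + p ∣ b → HasseAlternative a b
            go (divides b' refl) = square-case a b' p pp rec a≢0 b≢0
    obstruction-case a b rec a≢0 b≢0 p m pp eq (inj₁ p∣m) (no p∤m) = ⊥-elim (p∤m p∣m)
    obstruction-case a b rec a≢0 b≢0 p m pp eq (inj₂ nsq) (no p∤m) = go (∣ᵤ⇒∣ (ℕD.divides m eq))
      where go : + p ∣ b → HasseAlternative a b
            go (divides b' refl) = nonsquare-case a b' p m pp eq p∤m nsq
    big : ∀ a b → Rec (∣ a ∣ ℕ.+ ∣ b ∣) → ∣ a ∣ ℕ.≤ ∣ b ∣ → 2 ℕ.≤ ∣ b ∣ → a ≢ + 0 → b ≢ + 0 → HasseAlternative a b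
    big a b rec a≤b 2≤b a≢0 b≢0 = [ root , (λ (p , m , pp , eq , ob) → obstruction-case a b rec a≢0 b≢0 p m pp eq ob (p ℕD.∣? m)) ]′ (squareMod-or-obstruction a ∣ b ∣ 1≤b)
      where
      1≤b : 1 ℕ.≤ ∣ b ∣
      1≤b = ℕP.≤-trans (s≤s z≤n) 2≤b
      root : SquareMod a ∣ b ∣ → HasseAlternative a b
      root sq = let (t , d , t≤) = small-root a ∣ b ∣ 1≤b sq ; b∣ = ∣-trans (m∣∣m∣ {b}) d in
        root-case a b rec a≤b 2≤b a≢0 b≢0 t (quotient b∣) (_∣_.equality b∣) t≤ (quotient b∣ ≟ + 0)
    both : ∀ s → Rec s → ∀ a b → ∣ a ∣ ℕ.+ ∣ b ∣ ≡ s → a ≢ + 0 → b ≢ + 0 → HasseAlternative a b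
    ordered : ∀ a b → Rec (∣ a ∣ ℕ.+ ∣ b ∣) → ∣ a ∣ ℕ.≤ ∣ b ∣ → a ≢ + 0 → b ≢ + 0 → HasseAlternative a b
    ordered a b rec le a≢0 b≢0 with ∣ b ∣ ℕP.≤? 1
    ... | yes b≤1 = small a b le b≤1 a≢0 b≢0
    ... | no b≰1 = big a b rec le (ℕP.≰⇒> b≰1) a≢0 b≢0
    both s rec a b refl a≢0 b≢0 with ℕP.≤-total ∣ a ∣ ∣ b ∣
    ... | inj₁ le = ordered a b rec le a≢0 b≢0
    ... | inj₂ ge = hasse-swap b a (ordered b a (subst Rec (ℕP.+-comm ∣ a ∣ ∣ b ∣) rec) ge b≢0 a≢0)

  open import Defs
  import Data.Rational as ℚ
  import Data.Rational.Properties as ℚP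
  import Data.Rational.Unnormalised as ℚᵘ
  import Data.Rational.Unnormalised.Properties as ℚᵘP

  -- Ternary forms as quadratic maps on ℤ³

  V : Set
  V = ℤ × ℤ × ℤ

  0V : V
  0V = + 0 , + 0 , + 0

  infixl 6 _⊕_
  infixr 7 _⊛_

  _⊕_ : V → V → V
  (x , y , z) ⊕ (x' , y' , z') = x + x' , y + y' , z + z'

  _⊛_ : ℤ → V → V
  k ⊛ (x , y , z) = k * x , k * y , k * z

  ev : TernaryForm → V → ℤ
  ev f (x , y , z) = evalℤ f x y z

  grad : TernaryForm → V → V
  grad f (x , y , z) =
    + 2 * a f * x + d f * y + e f * z , d f * x + + 2 * b f * y + g f * z , e f * x + g f * y + + 2 * c f * z

  dot : V → V → ℤ
  dot (x , y , z) (x' , y' , z') = x * x' + y * y' + z * z'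

  cross : V → V → V
  cross (x , y , z) (x' , y' , z') = y * z' - z * y' , z * x' - x * z' , x * y' - y * x'

  -- The polar form `f(u + v) - f(u) - f(v)`, which avoids halving the mixed coefficients; on the
  -- diagonal it equals `2 f(u)`.
  bil : TernaryForm → V → V → ℤ
  bil f u v = dot (grad f u) v

  module _ (f : TernaryForm) where
    private
      A = a f ; B = b f ; C = c f ; D' = d f ; E = e f ; G = g f

    ev-⊕ : ∀ u v → ev f (u ⊕ v) ≡ ev f u + bil f u v + ev f v
    ev-⊕ (x , y , z) (x' , y' , z') = lem A B C D' E G x y z x' y' z'
      where
      lem : ∀ a b c d e g x y z x' y' z' →
        a * (x + x') * (x + x') + b * (y + y') * (y + y') + c * (z + z') * (z + z') + d * (x + x') * (y + y') + e * (x + x') * (z + z') + g * (y + y') * (z + z')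
        ≡ (a * x * x + b * y * y + c * z * z + d * x * y + e * x * z + g * y * z)
          + ((+ 2 * a * x + d * y + e * z) * x' + (d * x + + 2 * b * y + g * z) * y' + (e * x + g * y + + 2 * c * z) * z')
          + (a * x' * x' + b * y' * y' + c * z' * z' + d * x' * y' + e * x' * z' + g * y' * z')
      lem = solve-∀

    ev-⊛ : ∀ k u → ev f (k ⊛ u) ≡ k * k * ev f u
    ev-⊛ k (x , y , z) = lem A B C D' E G k x y z
      where
      lem : ∀ a b c d e g k x y z →
        a * (k * x) * (k * x) + b * (k * y) * (k * y) + c * (k * z) * (k * z) + d * (k * x) * (k * y) + e * (k * x) * (k * z) + g * (k * y) * (k * z)
        ≡ k * k * (a * x * x + b * y * y + c * z * z + d * x * y + e * x * z + g * y * z)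
      lem = solve-∀

    bil-⊕ʳ : ∀ u v w → bil f u (v ⊕ w) ≡ bil f u v + bil f u w
    bil-⊕ʳ u (x , y , z) (x' , y' , z') = lem (proj₁ (grad f u)) (proj₁ (proj₂ (grad f u))) (proj₂ (proj₂ (grad f u))) x y z x' y' z'
      where
      lem : ∀ p q r x y z x' y' z' → p * (x + x') + q * (y + y') + r * (z + z') ≡ (p * x + q * y + r * z) + (p * x' + q * y' + r * z')
      lem = solve-∀

    bil-⊛ʳ : ∀ u k v → bil f u (k ⊛ v) ≡ k * bil f u v
    bil-⊛ʳ u k (x , y , z) = lem (proj₁ (grad f u)) (proj₁ (proj₂ (grad f u))) (proj₂ (proj₂ (grad f u))) k x y z
      where
      lem : ∀ p q r k x y z → p * (k * x) + q * (k * y) + r * (k * z) ≡ k * (p * x + q * y + r * z)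
      lem = solve-∀

    bil-⊕⁴ : ∀ u k₀ v₀ k₁ v₁ k₂ v₂ k₃ v₃ → bil f u (k₀ ⊛ v₀ ⊕ k₁ ⊛ v₁ ⊕ k₂ ⊛ v₂ ⊕ k₃ ⊛ v₃) ≡ k₀ * bil f u v₀ + k₁ * bil f u v₁ + k₂ * bil f u v₂ + k₃ * bil f u v₃
    bil-⊕⁴ u k₀ v₀ k₁ v₁ k₂ v₂ k₃ v₃ = trans (bil-⊕ʳ u (k₀ ⊛ v₀ ⊕ k₁ ⊛ v₁ ⊕ k₂ ⊛ v₂) (k₃ ⊛ v₃)) (cong₂ _+_ (trans (bil-⊕ʳ u (k₀ ⊛ v₀ ⊕ k₁ ⊛ v₁) (k₂ ⊛ v₂)) (cong₂ _+_
      (trans (bil-⊕ʳ u (k₀ ⊛ v₀) (k₁ ⊛ v₁)) (cong₂ _+_ (bil-⊛ʳ u k₀ v₀) (bil-⊛ʳ u k₁ v₁))) (bil-⊛ʳ u k₂ v₂))) (bil-⊛ʳ u k₃ v₃))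

    bil-0ʳ : ∀ u → bil f u 0V ≡ + 0
    bil-0ʳ u = lem (proj₁ (grad f u)) (proj₁ (proj₂ (grad f u))) (proj₂ (proj₂ (grad f u)))
      where lem : ∀ p q r → p * + 0 + q * + 0 + r * + 0 ≡ + 0
            lem = solve-∀

    bil-sym : ∀ u v → bil f u v ≡ bil f v u
    bil-sym (x , y , z) (x' , y' , z') = lem A B C D' E G x y z x' y' z'
      where
      lem : ∀ a b c d e g x y z x' y' z' →
        (+ 2 * a * x + d * y + e * z) * x' + (d * x + + 2 * b * y + g * z) * y' + (e * x + g * y + + 2 * c * z) * z'
        ≡ (+ 2 * a * x' + d * y' + e * z') * x + (d * x' + + 2 * b * y' + g * z') * y + (e * x' + g * y' + + 2 * c * z') * z
      lem = solve-∀

    bil-self : ∀ u → bil f u u ≡ + 2 * ev f u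
    bil-self (x , y , z) = lem A B C D' E G x y z
      where
      lem : ∀ a b c d e g x y z →
        (+ 2 * a * x + d * y + e * z) * x + (d * x + + 2 * b * y + g * z) * y + (e * x + g * y + + 2 * c * z) * z
        ≡ + 2 * (a * x * x + b * y * y + c * z * z + d * x * y + e * x * z + g * y * z)
      lem = solve-∀

    bil-⊕ˡ : ∀ u v w → bil f (u ⊕ v) w ≡ bil f u w + bil f v w
    bil-⊕ˡ u v w = trans (bil-sym (u ⊕ v) w) (trans (bil-⊕ʳ w u v) (cong₂ _+_ (bil-sym w u) (bil-sym w v)))

    bil-⊛ˡ : ∀ k u w → bil f (k ⊛ u) w ≡ k * bil f u w
    bil-⊛ˡ k u w = trans (bil-sym (k ⊛ u) w) (trans (bil-⊛ʳ w k u) (cong (k *_) (bil-sym w u)))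

  AnisotropicZ : TernaryForm → Set
  AnisotropicZ f = ∀ v → ev f v ≡ + 0 → v ≡ 0V

  private
    ι : ℤ → ℚ.ℚ
    ι n = n ℚ./ 1

    toι : ∀ n → ℚ.toℚᵘ (ι n) ℚᵘ.≃ ℚᵘ.mkℚᵘ n 0
    toι n = ℚP.toℚᵘ-fromℚᵘ (ℚᵘ.mkℚᵘ n 0)

    ι-+ : ∀ m n → ι m ℚ.+ ι n ≡ ι (m + n)
    ι-+ m n = ℚP.toℚᵘ-injective (ℚᵘP.≃-trans (ℚP.toℚᵘ-homo-+ (ι m) (ι n))
      (ℚᵘP.≃-trans (ℚᵘP.+-cong (toι m) (toι n)) (ℚᵘP.≃-trans (ℚᵘ.*≡* (lem m n)) (ℚᵘP.≃-sym (toι (m + n))))))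
      where lem : ∀ m n → (m * + 1 + n * + 1) * + 1 ≡ (m + n) * + 1
            lem = solve-∀

    ι-* : ∀ m n → ι m ℚ.* ι n ≡ ι (m * n)
    ι-* m n = ℚP.toℚᵘ-injective (ℚᵘP.≃-trans (ℚP.toℚᵘ-homo-* (ι m) (ι n))
      (ℚᵘP.≃-trans (ℚᵘP.*-cong (toι m) (toι n)) (ℚᵘP.≃-trans (ℚᵘ.*≡* refl) (ℚᵘP.≃-sym (toι (m * n))))))

    ι-injective : ∀ m → ι m ≡ ℚ.0ℚ → m ≡ + 0
    ι-injective m eq = trans (sym (*-identityʳ m)) (ℚᵘP.drop-*≡* (ℚᵘP.≃-trans (ℚᵘP.≃-sym (toι m)) (ℚᵘP.≃-reflexive (cong ℚ.toℚᵘ eq))))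

  anisotropic⇒anisotropicZ : ∀ f → Anisotropic f → AnisotropicZ f
  anisotropic⇒anisotropicZ f an (x , y , z) eq =
    let (h1 , h2 , h3) = an (ι x) (ι y) (ι z) (trans evι (cong ι eq))
    in cong₂ _,_ (ι-injective x h1) (cong₂ _,_ (ι-injective y h2) (ι-injective z h3))
    where
    mono : ∀ k u v → ι k ℚ.* ι u ℚ.* ι v ≡ ι (k * u * v)
    mono k u v = trans (cong (ℚ._* ι v) (ι-* k u)) (ι-* (k * u) v)
    add : ∀ {p q} m n → p ≡ ι m → q ≡ ι n → p ℚ.+ q ≡ ι (m + n)
    add m n refl refl = ι-+ m n
    m₁ = a f * x * x
    m₂ = b f * y * y
    m₃ = c f * z * z
    m₄ = d f * x * y
    m₅ = e f * x * z
    m₆ = g f * y * z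
    evι : evalℚ f (ι x) (ι y) (ι z) ≡ ι (evalℤ f x y z)
    evι = add (m₁ + m₂ + m₃ + m₄ + m₅) m₆ (add (m₁ + m₂ + m₃ + m₄) m₅ (add (m₁ + m₂ + m₃) m₄ (add (m₁ + m₂) m₃
      (add m₁ m₂ (mono (a f) x x) (mono (b f) y y)) (mono (c f) z z)) (mono (d f) x y)) (mono (e f) x z)) (mono (g f) y z)

  -- Orthogonal frames

  -- An orthogonal basis of rational space that need not generate the lattice. Accordingly `expand`
  -- expresses `f(v)` through the pairings of `v` with the basis rather than through coordinates: it
  -- is the diagonalisation with denominators cleared.
  record Frame (f : TernaryForm) : Set where
    field
      e₁ e₂ e₃ : V
      e₁⊥e₂ : bil f e₁ e₂ ≡ + 0
      e₁⊥e₃ : bil f e₁ e₃ ≡ + 0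
      e₂⊥e₃ : bil f e₂ e₃ ≡ + 0
      A B C : ℤ
      ev₁ : ev f e₁ ≡ A
      ev₂ : ev f e₂ ≡ B
      ev₃ : ev f e₃ ≡ C
      A≢0 : A ≢ + 0
      B≢0 : B ≢ + 0
      C≢0 : C ≢ + 0
      expand : ∀ v → + 4 * A * B * C * ev f v ≡
        B * C * (bil f v e₁ * bil f v e₁) + A * C * (bil f v e₂ * bil f v e₂) + A * B * (bil f v e₃ * bil f v e₃)

    bil₁₁ : bil f e₁ e₁ ≡ + 2 * A
    bil₁₁ = trans (bil-self f e₁) (cong (_*_ (+ 2)) ev₁)
    bil₂₂ : bil f e₂ e₂ ≡ + 2 * B
    bil₂₂ = trans (bil-self f e₂) (cong (_*_ (+ 2)) ev₂)
    bil₃₃ : bil f e₃ e₃ ≡ + 2 * C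
    bil₃₃ = trans (bil-self f e₃) (cong (_*_ (+ 2)) ev₃)
    e₂⊥e₁ : bil f e₂ e₁ ≡ + 0
    e₂⊥e₁ = trans (bil-sym f e₂ e₁) e₁⊥e₂
    e₃⊥e₁ : bil f e₃ e₁ ≡ + 0
    e₃⊥e₁ = trans (bil-sym f e₃ e₁) e₁⊥e₃
    e₃⊥e₂ : bil f e₃ e₂ ≡ + 0
    e₃⊥e₂ = trans (bil-sym f e₃ e₂) e₂⊥e₃

  *≢0 : ∀ {x y} → x ≢ + 0 → y ≢ + 0 → x * y ≢ + 0
  *≢0 {x} x≢0 y≢0 h = [ x≢0 , y≢0 ]′ (i*j≡0⇒i≡0∨j≡0 x h)

  *≡0⇒ʳ : ∀ x {y} → x ≢ + 0 → x * y ≡ + 0 → y ≡ + 0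
  *≡0⇒ʳ x x≢0 h = [ (λ e → ⊥-elim (x≢0 e)) , (λ e → e) ]′ (i*j≡0⇒i≡0∨j≡0 x h)

  private
    dot-0 : ∀ v → dot 0V v ≡ + 0
    dot-0 (x , y , z) = lem x y z where lem : ∀ x y z → + 0 * x + + 0 * y + + 0 * z ≡ + 0
                                        lem = solve-∀

  module _ (f : TernaryForm) (an : AnisotropicZ f) where
    private
      ev≢0 : ∀ v → v ≢ 0V → ev f v ≢ + 0
      ev≢0 v nz h = nz (an v h)

      perp : V → V
      perp (l , m , n) with l ≟ + 0 | m ≟ + 0
      ... | yes _ | yes _ = + 1 , + 0 , + 0
      ... | _ | _ = - m , l , + 0

      perp-dot : ∀ v → dot v (perp v) ≡ + 0
      perp-dot (l , m , n) with l ≟ + 0 | m ≟ + 0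
      ... | yes refl | yes refl = lem n where lem : ∀ n → + 0 * + 1 + + 0 * + 0 + n * + 0 ≡ + 0
                                              lem = solve-∀
      ... | yes _ | no _ = lem l m n where lem : ∀ l m n → l * (- m) + m * l + n * + 0 ≡ + 0
                                           lem = solve-∀
      ... | no _ | yes _ = lem l m n where lem : ∀ l m n → l * (- m) + m * l + n * + 0 ≡ + 0
                                           lem = solve-∀
      ... | no _ | no _ = lem l m n where lem : ∀ l m n → l * (- m) + m * l + n * + 0 ≡ + 0
                                          lem = solve-∀

      perp≢0 : ∀ v → perp v ≢ 0V
      perp≢0 (l , m , n) with l ≟ + 0 | m ≟ + 0
      ... | yes refl | yes refl = λ ()
      ... | yes _ | no m≢0 = λ h → m≢0 (trans (sym (neg-involutive m)) (cong -_ (cong proj₁ h)))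
      ... | no l≢0 | yes _ = λ h → l≢0 (cong (proj₁ ∘ proj₂) h)
      ... | no l≢0 | no _ = λ h → l≢0 (cong (proj₁ ∘ proj₂) h)

      cross-⊥ˡ : ∀ u v → dot u (cross u v) ≡ + 0
      cross-⊥ˡ (x , y , z) (x' , y' , z') = lem x y z x' y' z'
        where lem : ∀ x y z x' y' z' → x * (y * z' - z * y') + y * (z * x' - x * z') + z * (x * y' - y * x') ≡ + 0
              lem = solve-∀
      cross-⊥ʳ : ∀ u v → dot v (cross u v) ≡ + 0
      cross-⊥ʳ (x , y , z) (x' , y' , z') = lem x y z x' y' z'
        where lem : ∀ x y z x' y' z' → x' * (y * z' - z * y') + y' * (z * x' - x * z') + z' * (x * y' - y * x') ≡ + 0
              lem = solve-∀
      lagrange : ∀ u v p q → dot u p * dot v q - dot u q * dot v p ≡ dot (cross u v) (cross p q)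
      lagrange (x , y , z) (x' , y' , z') (p , q , r) (p' , q' , r') = lem x y z x' y' z' p q r p' q' r'
        where lem : ∀ x y z x' y' z' p q r p' q' r' →
                (x * p + y * q + z * r) * (x' * p' + y' * q' + z' * r') - (x * p' + y * q' + z * r') * (x' * p + y' * q + z' * r)
                ≡ (y * z' - z * y') * (q * r' - r * q') + (z * x' - x * z') * (r * p' - p * r') + (x * y' - y * x') * (p * q' - q * p')
              lem = solve-∀

      parallel : ∀ ℓ₁ ℓ₂ w → dot ℓ₁ w ≡ + 0 → dot ℓ₂ w ≡ + 0 → cross w (cross ℓ₁ ℓ₂) ≡ 0V
      parallel (p , q , r) (p' , q' , r') (x , y , z) h1 h2 =
         cong₂ _,_ (trans (l1 x y z p q r p' q' r') (zero' p p')) (cong₂ _,_ (trans (l2 x y z p q r p' q' r') (zero' q q')) (trans (l3 x y z p q r p' q' r') (zero' r r')))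
        where
        zero' : ∀ s t → s * (p' * x + q' * y + r' * z) - t * (p * x + q * y + r * z) ≡ + 0
        zero' s t = trans (cong₂ (λ X Y → s * X - t * Y) h2 h1) (lem s t)
          where lem : ∀ p q → p * + 0 - q * + 0 ≡ + 0
                lem = solve-∀
        l1 : ∀ x y z p q r p' q' r' → y * (p * q' - q * p') - z * (r * p' - p * r') ≡ p * (p' * x + q' * y + r' * z) - p' * (p * x + q * y + r * z)
        l1 = solve-∀
        l2 : ∀ x y z p q r p' q' r' → z * (q * r' - r * q') - x * (p * q' - q * p') ≡ q * (p' * x + q' * y + r' * z) - q' * (p * x + q * y + r * z)
        l2 = solve-∀
        l3 : ∀ x y z p q r p' q' r' → x * (r * p' - p * r') - y * (q * r' - r * q') ≡ r * (p' * x + q' * y + r' * z) - r' * (p * x + q * y + r * z)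
        l3 = solve-∀

      parallel-⊥⇒0 : ∀ ℓ e w s → dot ℓ e ≡ s → s ≢ + 0 → cross w e ≡ 0V → dot ℓ w ≡ + 0 → w ≡ 0V
      parallel-⊥⇒0 (l , m , n) (p , q , r) (x , y , z) s es s≢0 h k = cong₂ _,_ (*≡0⇒ʳ s s≢0 hx) (cong₂ _,_ (*≡0⇒ʳ s s≢0 hy) (*≡0⇒ʳ s s≢0 hz))
        where
        c1 : y * r - z * q ≡ + 0
        c1 = cong proj₁ h
        c2 : z * p - x * r ≡ + 0
        c2 = cong (proj₁ ∘ proj₂) h
        c3 : x * q - y * p ≡ + 0
        c3 = cong (proj₂ ∘ proj₂) h
        vanish : ∀ p m n {X Y Z} → X ≡ + 0 → Y ≡ + 0 → Z ≡ + 0 → p * X + m * Y + n * (- Z) ≡ + 0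
        vanish p m n refl refl refl = zz p m n
          where zz : ∀ p m n → p * + 0 + m * + 0 + n * (- + 0) ≡ + 0
                zz = solve-∀
        lem : ∀ l m n p q r x y z → (l * p + m * q + n * r) * x ≡ p * (l * x + m * y + n * z) + m * (x * q - y * p) + n * (- (z * p - x * r))
        lem = solve-∀
        turn : ∀ l m n p q r → m * q + n * r + l * p ≡ l * p + m * q + n * r
        turn = solve-∀
        turn' : ∀ l m n p q r → n * r + l * p + m * q ≡ l * p + m * q + n * r
        turn' = solve-∀
        hx : s * x ≡ + 0
        hx = trans (cong (_* x) (sym es)) (trans (lem l m n p q r x y z) (vanish p m n k c3 c2))
        hy : s * y ≡ + 0
        hy = trans (cong (_* y) (sym (trans (turn l m n p q r) es))) (trans (lem m n l q r p y z x) (vanish q n l (trans (turn l m n x y z) k) c1 c3))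
        hz : s * z ≡ + 0
        hz = trans (cong (_* z) (sym (trans (turn' l m n p q r) es))) (trans (lem n l m r p q z x y) (vanish r l m (trans (turn' l m n x y z) k) c2 c1))

      -- A multiple of `v` minus its components along the frame is orthogonal to all three vectors,
      -- hence zero; pairing it with `v` yields the identity.
      orthogonal-expansion : ∀ e₁ e₂ e₃ A B C → bil f e₁ e₁ ≡ + 2 * A → bil f e₂ e₂ ≡ + 2 * B → bil f e₃ e₃ ≡ + 2 * C →
        bil f e₁ e₂ ≡ + 0 → bil f e₁ e₃ ≡ + 0 → bil f e₂ e₃ ≡ + 0 →
        (∀ w → bil f e₁ w ≡ + 0 → bil f e₂ w ≡ + 0 → bil f e₃ w ≡ + 0 → w ≡ 0V) →
        ∀ v → + 4 * A * B * C * ev f v ≡ B * C * (bil f v e₁ * bil f v e₁) + A * C * (bil f v e₂ * bil f v e₂) + A * B * (bil f v e₃ * bil f v e₃)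
      orthogonal-expansion e₁ e₂ e₃ A B C b₁₁ b₂₂ b₃₃ e₁⊥e₂ e₁⊥e₃ e₂⊥e₃ nondegenerate v =
        trans (lem0 A B C (ev f v) (B * C * (x * x) + A * C * (y * y) + A * B * (z * z)))
          (trans (cong (_+ (B * C * (x * x) + A * C * (y * y) + A * B * (z * z))) (trans (sym wv) w·v)) (+-identityˡ (B * C * (x * x) + A * C * (y * y) + A * B * (z * z))))
        where
        x = bil f v e₁
        y = bil f v e₂
        z = bil f v e₃
        w = (+ 2 * A * B * C) ⊛ v ⊕ (- (B * C * x)) ⊛ e₁ ⊕ (- (A * C * y)) ⊛ e₂ ⊕ (- (A * B * z)) ⊛ e₃
        bw : ∀ u {s t t' t''} → bil f u v ≡ s → bil f u e₁ ≡ t → bil f u e₂ ≡ t' → bil f u e₃ ≡ t'' →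
          bil f u w ≡ + 2 * A * B * C * s + (- (B * C * x)) * t + (- (A * C * y)) * t' + (- (A * B * z)) * t''
        bw u refl refl refl refl = bil-⊕⁴ f u (+ 2 * A * B * C) v (- (B * C * x)) e₁ (- (A * C * y)) e₂ (- (A * B * z)) e₃
        w⊥1 : bil f e₁ w ≡ + 0
        w⊥1 = trans (bw e₁ (bil-sym f e₁ v) b₁₁ e₁⊥e₂ e₁⊥e₃) (lem A B C x y z)
          where lem : ∀ A B C x y z → + 2 * A * B * C * x + (- (B * C * x)) * (+ 2 * A) + (- (A * C * y)) * + 0 + (- (A * B * z)) * + 0 ≡ + 0
                lem = solve-∀
        w⊥2 : bil f e₂ w ≡ + 0
        w⊥2 = trans (bw e₂ (bil-sym f e₂ v) (trans (bil-sym f e₂ e₁) e₁⊥e₂) b₂₂ e₂⊥e₃) (lem A B C x y z)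
          where lem : ∀ A B C x y z → + 2 * A * B * C * y + (- (B * C * x)) * + 0 + (- (A * C * y)) * (+ 2 * B) + (- (A * B * z)) * + 0 ≡ + 0
                lem = solve-∀
        w⊥3 : bil f e₃ w ≡ + 0
        w⊥3 = trans (bw e₃ (bil-sym f e₃ v) (trans (bil-sym f e₃ e₁) e₁⊥e₃) (trans (bil-sym f e₃ e₂) e₂⊥e₃) b₃₃) (lem A B C x y z)
          where lem : ∀ A B C x y z → + 2 * A * B * C * z + (- (B * C * x)) * + 0 + (- (A * C * y)) * + 0 + (- (A * B * z)) * (+ 2 * C) ≡ + 0
                lem = solve-∀
        w·v : bil f v w ≡ + 0
        w·v = trans (cong (bil f v) (nondegenerate w w⊥1 w⊥2 w⊥3)) (bil-0ʳ f v)
        wv : bil f v w ≡ + 4 * A * B * C * ev f v - (B * C * (x * x) + A * C * (y * y) + A * B * (z * z))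
        wv = trans (bw v (bil-self f v) refl refl refl) (lem A B C x y z (ev f v))
          where lem : ∀ A B C x y z E → + 2 * A * B * C * (+ 2 * E) + (- (B * C * x)) * x + (- (A * C * y)) * y + (- (A * B * z)) * z ≡ + 4 * A * B * C * E - (B * C * (x * x) + A * C * (y * y) + A * B * (z * z))
                lem = solve-∀
        lem0 : ∀ A B C E p → + 4 * A * B * C * E ≡ + 4 * A * B * C * E - p + p
        lem0 = solve-∀

      -- By Lagrange's identity the scalar product of this vector with `e₁ × e₂` is the Gram
      -- determinant of `e₁`, `e₂`, that is `4 f(e₁) f(e₂)`.
      cross-grad≢0 : ∀ e₁ e₂ → bil f e₁ e₂ ≡ + 0 → ev f e₁ ≢ + 0 → ev f e₂ ≢ + 0 → cross (grad f e₁) (grad f e₂) ≢ 0V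
      cross-grad≢0 e₁ e₂ e₁⊥e₂ A≢0 B≢0 h = *≢0 (*≢0 {+ 2} (λ ()) A≢0) (*≢0 {+ 2} (λ ()) B≢0)
        (trans (lem (+ 2 * ev f e₁) (+ 2 * ev f e₂))
        (trans (cong₂ _-_ (cong₂ _*_ (sym (bil-self f e₁)) (sym (bil-self f e₂))) (cong₂ _*_ (sym e₁⊥e₂) (sym (trans (bil-sym f e₂ e₁) e₁⊥e₂))))
        (trans (lagrange (grad f e₁) (grad f e₂) e₁ e₂) (trans (cong (λ u → dot u (cross e₁ e₂)) h) (dot-0 (cross e₁ e₂))))))
        where lem : ∀ x y → x * y ≡ x * y - + 0 * + 0
              lem = solve-∀

      -- With e₃ = ∇e₁ × ∇e₂, a vector orthogonal to e₁ and e₂ is parallel to e₃.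
      complete-frame : ∀ e₁ e₂ e₃ → e₃ ≡ cross (grad f e₁) (grad f e₂) → bil f e₁ e₂ ≡ + 0 → ev f e₁ ≢ + 0 → ev f e₂ ≢ + 0 → Frame f
      complete-frame e₁ e₂ e₃ e₃≡ e₁⊥e₂ A≢0 B≢0 = record
        { e₁ = e₁ ; e₂ = e₂ ; e₃ = e₃ ; e₁⊥e₂ = e₁⊥e₂ ; e₁⊥e₃ = e₁⊥e₃ ; e₂⊥e₃ = e₂⊥e₃
        ; A = ev f e₁ ; B = ev f e₂ ; C = ev f e₃ ; ev₁ = refl ; ev₂ = refl ; ev₃ = refl ; A≢0 = A≢0 ; B≢0 = B≢0 ; C≢0 = C≢0
        ; expand = orthogonal-expansion e₁ e₂ e₃ (ev f e₁) (ev f e₂) (ev f e₃) (bil-self f e₁) (bil-self f e₂) (bil-self f e₃) e₁⊥e₂ e₁⊥e₃ e₂⊥e₃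
            (λ w h₁ h₂ → parallel-⊥⇒0 (grad f e₃) e₃ w (+ 2 * ev f e₃) (bil-self f e₃) (*≢0 {+ 2} (λ ()) C≢0)
              (trans (cong (cross w) e₃≡) (parallel (grad f e₁) (grad f e₂) w h₁ h₂))) }
        where
        e₁⊥e₃ : bil f e₁ e₃ ≡ + 0
        e₁⊥e₃ = trans (cong (bil f e₁) e₃≡) (cross-⊥ˡ (grad f e₁) (grad f e₂))
        e₂⊥e₃ : bil f e₂ e₃ ≡ + 0
        e₂⊥e₃ = trans (cong (bil f e₂) e₃≡) (cross-⊥ʳ (grad f e₁) (grad f e₂))
        C≢0 : ev f e₃ ≢ + 0
        C≢0 = ev≢0 e₃ (λ h → cross-grad≢0 e₁ e₂ e₁⊥e₂ A≢0 B≢0 (trans (sym e₃≡) h))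

    -- The first vector is left free so that `A` can later be made positive.
    frame-from : ∀ v → ev f v ≢ + 0 → Frame f
    frame-from v A≢0 = complete-frame v (perp (grad f v)) (cross (grad f v) (grad f (perp (grad f v)))) refl (perp-dot (grad f v)) A≢0 (ev≢0 (perp (grad f v)) (perp≢0 (grad f v)))

  module _ {f : TernaryForm} (an : AnisotropicZ f) (F : Frame f) where
    open Frame F

    private
      A₀ = - (B * C)
      B₀ = - (A * C)

      -- At `v = C y e₁ + C x e₂ + z e₃` the form takes the value `C (z² + B C x² + A C y²)`, so a
      -- point of the conic would be a zero of `f`.
      not-isotropic : ¬ Isotropic A₀ B₀
      not-isotropic (z , x , y , nt , h) = nt (z≡0 , x≡0 , y≡0)
        where
        v = (C * y) ⊛ e₁ ⊕ (C * x) ⊛ e₂ ⊕ z ⊛ e₃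
        evv : ev f v ≡ + 0
        evv = *≡0⇒ʳ (+ 4 * A * B * C) (*≢0 (*≢0 (*≢0 {+ 4} (λ ()) A≢0) B≢0) C≢0)
          (trans (expand v) (trans (cong₂ _+_ (cong₂ _+_ (cong (λ u → B * C * (u * u)) v1) (cong (λ u → A * C * (u * u)) v2)) (cong (λ u → A * B * (u * u)) v3))
             (trans (lem A B C x y z) (trans (cong (λ u → + 4 * A * B * C * (C * (u - (A₀ * (x * x) + B₀ * (y * y))))) h) (lem' (+ 4 * A * B * C) C (A₀ * (x * x) + B₀ * (y * y)))))))
          where
          lin : ∀ u → bil f v u ≡ C * y * bil f e₁ u + C * x * bil f e₂ u + z * bil f e₃ u
          lin u = trans (bil-⊕ˡ f _ (z ⊛ e₃) u) (cong₂ _+_ (trans (bil-⊕ˡ f ((C * y) ⊛ e₁) ((C * x) ⊛ e₂) u) (cong₂ _+_ (bil-⊛ˡ f (C * y) e₁ u) (bil-⊛ˡ f (C * x) e₂ u))) (bil-⊛ˡ f z e₃ u))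
          three : ∀ {s s' t t' u u'} → s ≡ s' → t ≡ t' → u ≡ u' → C * y * s + C * x * t + z * u ≡ C * y * s' + C * x * t' + z * u'
          three refl refl refl = refl
          v1 : bil f v e₁ ≡ C * y * (+ 2 * A) + C * x * + 0 + z * + 0
          v1 = trans (lin e₁) (three bil₁₁ e₂⊥e₁ e₃⊥e₁)
          v2 : bil f v e₂ ≡ C * y * + 0 + C * x * (+ 2 * B) + z * + 0
          v2 = trans (lin e₂) (three e₁⊥e₂ bil₂₂ e₃⊥e₂)
          v3 : bil f v e₃ ≡ C * y * + 0 + C * x * + 0 + z * (+ 2 * C)
          v3 = trans (lin e₃) (three e₁⊥e₃ e₂⊥e₃ bil₃₃)
          lem : ∀ A B C x y z → B * C * ((C * y * (+ 2 * A) + C * x * + 0 + z * + 0) * (C * y * (+ 2 * A) + C * x * + 0 + z * + 0))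
              + A * C * ((C * y * + 0 + C * x * (+ 2 * B) + z * + 0) * (C * y * + 0 + C * x * (+ 2 * B) + z * + 0))
              + A * B * ((C * y * + 0 + C * x * + 0 + z * (+ 2 * C)) * (C * y * + 0 + C * x * + 0 + z * (+ 2 * C)))
              ≡ + 4 * A * B * C * (C * (z * z - ((- (B * C)) * (x * x) + (- (A * C)) * (y * y))))
          lem = solve-∀
          lem' : ∀ p c s → p * (c * (s - s)) ≡ + 0
          lem' = solve-∀
        v≡0 = an v evv
        bv : ∀ u → bil f u v ≡ + 0
        bv u = trans (cong (bil f u) v≡0) (trans (bil-⊛0 u) refl)
          where
          bil-⊛0 : ∀ u → bil f u 0V ≡ + 0
          bil-⊛0 u = lem (proj₁ (grad f u)) (proj₁ (proj₂ (grad f u))) (proj₂ (proj₂ (grad f u)))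
            where lem : ∀ p q r → p * + 0 + q * + 0 + r * + 0 ≡ + 0
                  lem = solve-∀
        coord : ∀ u → C * y * bil f u e₁ + C * x * bil f u e₂ + z * bil f u e₃ ≡ + 0
        coord u = trans (sym (trans (bil-⊕ʳ f u _ (z ⊛ e₃)) (cong₂ _+_ (trans (bil-⊕ʳ f u ((C * y) ⊛ e₁) ((C * x) ⊛ e₂)) (cong₂ _+_ (bil-⊛ʳ f u (C * y) e₁) (bil-⊛ʳ f u (C * x) e₂))) (bil-⊛ʳ f u z e₃)))) (bv u)
        three : ∀ {s s' t t' u u'} → s ≡ s' → t ≡ t' → u ≡ u' → C * y * s + C * x * t + z * u ≡ C * y * s' + C * x * t' + z * u'
        three refl refl refl = refl
        y≡0 : y ≡ + 0
        y≡0 = *≡0⇒ʳ (C * (+ 2 * A)) (*≢0 C≢0 (*≢0 {+ 2} (λ ()) A≢0)) (trans (lem C A x y z) (trans (sym (three bil₁₁ e₁⊥e₂ e₁⊥e₃)) (coord e₁)))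
          where lem : ∀ C A x y z → C * (+ 2 * A) * y ≡ C * y * (+ 2 * A) + C * x * + 0 + z * + 0
                lem = solve-∀
        x≡0 : x ≡ + 0
        x≡0 = *≡0⇒ʳ (C * (+ 2 * B)) (*≢0 C≢0 (*≢0 {+ 2} (λ ()) B≢0)) (trans (lem C B x y z) (trans (sym (three e₂⊥e₁ bil₂₂ e₂⊥e₃)) (coord e₂)))
          where lem : ∀ C A x y z → C * (+ 2 * A) * x ≡ C * y * + 0 + C * x * (+ 2 * A) + z * + 0
                lem = solve-∀
        z≡0 : z ≡ + 0
        z≡0 = *≡0⇒ʳ (+ 2 * C) (*≢0 {+ 2} (λ ()) C≢0) (trans (lem C x y z) (trans (sym (three e₃⊥e₁ e₃⊥e₂ bil₃₃)) (coord e₃)))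
          where lem : ∀ C x y z → + 2 * C * z ≡ C * y * + 0 + C * x * + 0 + z * (+ 2 * C)
                lem = solve-∀

    -- -4ABC lies in the square class of -det f, the one class a locally anisotropic
    -- form does not represent.
    missed-class : ∃[ q ] q ≢ 0 × ∀ v → ¬ (+ q ∣ ev f v + + 4 * A * B * C)
    missed-class = [ (λ i → ⊥-elim (not-isotropic i)) , build ]′ (hasse A₀ B₀ (neg≢0 (*≢0 B≢0 C≢0)) (neg≢0 (*≢0 A≢0 C≢0)))
      where
      neg≢0 : ∀ {x} → x ≢ + 0 → - x ≢ + 0
      neg≢0 {x} h k = h (trans (sym (neg-involutive x)) (cong -_ k))
      build : LocallyAnisotropic A₀ B₀ → ∃[ q ] q ≢ 0 × ∀ v → ¬ (+ q ∣ ev f v + + 4 * A * B * C)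
      build (p , pp , h) = p ℕ.^ (k₁ ℕ.+ k₂) , ℕ.≢-nonZero⁻¹ _ {{ℕP.m^n≢0 p (k₁ ℕ.+ k₂) {{prime⇒nonZero pp}}}} , contra
        where
        W = + 4 * A * B * C
        Z = C * W
        Z≢0 : Z ≢ + 0
        Z≢0 = *≢0 C≢0 (*≢0 (*≢0 (*≢0 {+ 4} (λ ()) A≢0) B≢0) C≢0)
        -- Chosen backwards: the power `1 + ∣ Z ∣` of `p` cannot divide `Z`. Order `k₁` at a zero
        -- forces that power on `Z`, and order `k₂` forces the power `k₁` on `n₂`.
        k₁ = proj₁ (h (1 ℕ.+ ∣ Z ∣))
        k₂ = proj₁ (h k₁)
        contra : ∀ v → ¬ (+ (p ℕ.^ (k₁ ℕ.+ k₂)) ∣ ev f v + + 4 * A * B * C)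
        contra v dv = ℕP.<-irrefl refl (ℕP.≤-trans (prime⇒≥2 pp) (ℕD.∣⇒≤ (∣⇒∣ᵤ p∣1)))
          where
          x = bil f v e₁
          y = bil f v e₂
          z = bil f v e₃
          X = C * x
          n₂ = C * y * (C * y) - A₀ * (z * z)
          -- The norm form of the quaternion algebra `(A₀ , B₀)`. By `expand` it equals
          -- `C² W (f(v) + W)`, so a value of `f` near `-W` makes it nearly vanish.
          E = Z * Z - A₀ * (X * X) - B₀ * n₂
          E≡ : E ≡ C * C * (W * (ev f v + W))
          E≡ = trans (lem A B C W x y z) (trans (cong (λ u → C * C * (W * W + u)) (sym (expand v))) (lem' C W (ev f v)))
            where lem : ∀ A B C W x y z → C * W * (C * W) - (- (B * C)) * (C * x * (C * x)) - (- (A * C)) * (C * y * (C * y) - (- (B * C)) * (z * z))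
                        ≡ C * C * (W * W + (B * C * (x * x) + A * C * (y * y) + A * B * (z * z)))
                  lem = solve-∀
                  lem' : ∀ C W E → C * C * (W * W + W * E) ≡ C * C * (W * (E + W))
                  lem' = solve-∀
          dE : + (p ℕ.^ (k₁ ℕ.+ k₂)) ∣ E
          dE = ∣-eq (∣*ˡ (C * C) (∣*ˡ W dv)) (sym E≡)
          -- Both `n₂` and `Z² - A₀ X²` are norms from `ℚ(√A₀)`, so `n₂ E` is a value of the ternary
          -- form whose last coordinate is `n₂` itself.
          dn₂ : + (p ℕ.^ k₁) ∣ n₂
          dn₂ = proj₂ (proj₂ (proj₂ (h k₁) (Z * (C * y) + A₀ * X * z) (Z * z + X * (C * y)) n₂
            (∣-eq (∣*ˡ n₂ (∣-trans (^-∣ p (ℕP.m≤n+m k₂ k₁)) dE)) (lem A₀ B₀ Z X (C * y) z))))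
            where lem : ∀ A B Z X Y z → (Y * Y - A * (z * z)) * (Z * Z - A * (X * X) - B * (Y * Y - A * (z * z))) ≡
                        (Z * Y + A * X * z) * (Z * Y + A * X * z) - A * ((Z * z + X * Y) * (Z * z + X * Y)) - B * ((Y * Y - A * (z * z)) * (Y * Y - A * (z * z)))
                  lem = solve-∀
          dZ : + (p ℕ.^ (1 ℕ.+ ∣ Z ∣)) ∣ Z
          dZ = proj₁ (proj₂ (h (1 ℕ.+ ∣ Z ∣)) Z X (+ 0) (∣-eq (∣m∣n⇒∣m+n (∣-trans (^-∣ p (ℕP.m≤m+n k₁ k₂)) dE) (∣*ˡ B₀ dn₂)) (lem (Z * Z - A₀ * (X * X)) B₀ n₂)))
            where lem : ∀ s B n → s - B * n + B * n ≡ s - B * (+ 0 * + 0)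
                  lem = solve-∀
          p∣1 : + p ∣ + 1
          p∣1 = subst (λ u → + u ∣ + 1) (ℕP.*-identityʳ p) (prime-pow-divide-outℤ pp Z Z≢0 1 (∣-eq dZ (sym (*-identityʳ Z))))

module Counting where

  open import Data.Nat hiding (parity)
  open import Data.Nat.Properties
  open import Data.Nat.DivMod using (m/n*n≤m; m≡m%n+[m/n]*n; m%n<n)
  open import Data.Nat.Coprimality as Cop using (Coprime; coprime?)
  open import Data.Nat.Tactic.RingSolver using (solve-∀)
  open import Data.List using (List; []; _∷_; length)
  open import Data.List.Membership.Propositional using (_∈_)
  open import Data.List.Relation.Unary.Any using (here; there)
  open import Data.List.Relation.Unary.All as All using ([]; _∷_)
  open import Data.List.Relation.Unary.AllPairs using ([]; _∷_)
  open import Data.List.Relation.Unary.Unique.Propositional using (Unique)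
  open import Data.Product using (Σ; ∃-syntax; _×_; _,_; proj₁; proj₂)
  open import Data.Sum using (_⊎_; inj₁; inj₂; [_,_]′)
  open import Data.Empty using (⊥; ⊥-elim)
  open import Function using (_∘_)
  open import Relation.Nullary using (¬_; Dec; yes; no)
  open import Relation.Nullary.Decidable using (map′; _×-dec_)
  open import Relation.Binary.Definitions using (tri<; tri≈; tri>)
  open import Relation.Binary.PropositionalEquality hiding (J)
  open import Relation.Nullary.Decidable using (toSum; decidable-stable)

  -- Finite sums of natural numbers

  ∑ : ℕ → (ℕ → ℕ) → ℕ
  ∑ zero f = 0
  ∑ (suc n) f = ∑ n f + f n

  ∑-cong : ∀ n {f h : ℕ → ℕ} → (∀ i → i < n → f i ≡ h i) → ∑ n f ≡ ∑ n h
  ∑-cong zero eq = refl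
  ∑-cong (suc n) eq = cong₂ _+_ (∑-cong n (λ i i<n → eq i (m<n⇒m<1+n i<n))) (eq n ≤-refl)

  ∑-mono : ∀ n {f h : ℕ → ℕ} → (∀ i → i < n → f i ≤ h i) → ∑ n f ≤ ∑ n h
  ∑-mono zero le = z≤n
  ∑-mono (suc n) le = +-mono-≤ (∑-mono n (λ i i<n → le i (m<n⇒m<1+n i<n))) (le n ≤-refl)

  ∑-const : ∀ n k → ∑ n (λ _ → k) ≡ n * k
  ∑-const zero k = refl
  ∑-const (suc n) k = trans (cong (_+ k) (∑-const n k)) (+-comm (n * k) k)

  ∑-zero : ∀ n {f : ℕ → ℕ} → (∀ i → i < n → f i ≡ 0) → ∑ n f ≡ 0
  ∑-zero n h = trans (∑-cong n h) (trans (∑-const n 0) (*-zeroʳ n))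

  ∑-+ : ∀ n (f h : ℕ → ℕ) → ∑ n (λ i → f i + h i) ≡ ∑ n f + ∑ n h
  ∑-+ zero f h = refl
  ∑-+ (suc n) f h = trans (cong (_+ (f n + h n)) (∑-+ n f h)) (lem (∑ n f) (∑ n h) (f n) (h n))
    where lem : ∀ w x y z → w + x + (y + z) ≡ w + y + (x + z)
          lem = solve-∀

  ∑-*ˡ : ∀ n k (f : ℕ → ℕ) → ∑ n (λ i → k * f i) ≡ k * ∑ n f
  ∑-*ˡ zero k f = sym (*-zeroʳ k)
  ∑-*ˡ (suc n) k f = trans (cong (_+ k * f n) (∑-*ˡ n k f)) (sym (*-distribˡ-+ k (∑ n f) (f n)))

  ∑-*ʳ : ∀ n k (f : ℕ → ℕ) → ∑ n (λ i → f i * k) ≡ ∑ n f * k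
  ∑-*ʳ n k f = trans (∑-cong n (λ i _ → *-comm (f i) k)) (trans (∑-*ˡ n k f) (*-comm k (∑ n f)))

  ∑-swap : ∀ m n (f : ℕ → ℕ → ℕ) → ∑ m (λ i → ∑ n (λ j → f i j)) ≡ ∑ n (λ j → ∑ m (λ i → f i j))
  ∑-swap zero n f = sym (∑-zero n (λ _ _ → refl))
  ∑-swap (suc m) n f = trans (cong (_+ ∑ n (f m)) (∑-swap m n f)) (sym (∑-+ n (λ j → ∑ m (λ i → f i j)) (f m)))

  ∑-split : ∀ m n (f : ℕ → ℕ) → ∑ (m + n) f ≡ ∑ m f + ∑ n (λ i → f (m + i))
  ∑-split m zero f = trans (cong (λ k → ∑ k f) (+-identityʳ m)) (sym (+-identityʳ _))
  ∑-split m (suc n) f = trans (cong (λ k → ∑ k f) (+-suc m n)) (trans (cong (_+ f (m + n)) (∑-split m n f)) (+-assoc (∑ m f) _ _))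

  ∑-first : ∀ n (f : ℕ → ℕ) → ∑ (suc n) f ≡ f 0 + ∑ n (f ∘ suc)
  ∑-first n f = ∑-split 1 n f

  ∑-extend : ∀ {m n} (f : ℕ → ℕ) → m ≤ n → ∑ m f ≤ ∑ n f
  ∑-extend {m} {n} f m≤n = subst (λ k → ∑ m f ≤ ∑ k f) (m+[n∸m]≡n m≤n)
    (≤-trans (m≤m+n (∑ m f) _) (≤-reflexive (sym (∑-split m (n ∸ m) f))))

  ∑-term : ∀ n (f : ℕ → ℕ) i → i < n → f i ≤ ∑ n f
  ∑-term (suc n) f i (s≤s i≤n) with m≤n⇒m<n∨m≡n i≤n
  ... | inj₁ i<n = ≤-trans (∑-term n f i i<n) (m≤m+n _ _)
  ... | inj₂ refl = m≤n+m (f n) (∑ n f)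

  ∑-block : ∀ B M (f : ℕ → ℕ) → ∑ (B * M) f ≡ ∑ B (λ j → ∑ M (λ r → f (j * M + r)))
  ∑-block zero M f = refl
  ∑-block (suc B) M f = trans (cong (λ k → ∑ k f) (+-comm M (B * M)))
    (trans (∑-split (B * M) M f) (cong (_+ ∑ M (λ r → f (B * M + r))) (∑-block B M f)))

  ∑-positive : ∀ n (f : ℕ → ℕ) → ∑ n f ≢ 0 → ∃[ i ] i < n × f i ≢ 0
  ∑-positive zero f h = ⊥-elim (h refl)
  ∑-positive (suc n) f h with f n ≟ 0
  ... | no fn≢0 = n , ≤-refl , fn≢0
  ... | yes fn≡0 = let (i , i<n , fi) = ∑-positive n f (λ e → h (cong₂ _+_ e fn≡0)) in i , m<n⇒m<1+n i<n , fi

  ∑-at-most-one : ∀ n (f : ℕ → ℕ) k → (∀ i → i < n → f i ≤ k) →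
    (∀ i j → i < n → j < n → f i ≢ 0 → f j ≢ 0 → i ≡ j) → ∑ n f ≤ k
  ∑-at-most-one zero f k le un = z≤n
  ∑-at-most-one (suc n) f k le un with f n ≟ 0
  ... | yes fn≡0 = ≤-trans (≤-reflexive (trans (cong (∑ n f +_) fn≡0) (+-identityʳ _)))
     (∑-at-most-one n f k (λ i i<n → le i (m<n⇒m<1+n i<n)) (λ i j i<n j<n → un i j (m<n⇒m<1+n i<n) (m<n⇒m<1+n j<n)))
  ... | no fn≢0 = ≤-trans (≤-reflexive (cong (_+ f n) (∑-zero n zero'))) (le n ≤-refl)
    where
    zero' : ∀ i → i < n → f i ≡ 0
    zero' i i<n with f i ≟ 0
    ... | yes e = e
    ... | no fi≢0 = ⊥-elim (<-irrefl (un i n (m<n⇒m<1+n i<n) ≤-refl fi≢0 fn≢0) i<n)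

  ∑-spaced : ∀ B M (f : ℕ → ℕ) → (∀ i → f i ≤ 1) →
    (∀ i j → i < j → j < B * M → f i ≢ 0 → f j ≢ 0 → M ≤ j ∸ i) → ∑ (B * M) f ≤ B
  ∑-spaced B M f le sp = ≤-trans (≤-reflexive (∑-block B M f)) (≤-trans (∑-mono B block) (≤-reflexive (trans (∑-const B 1) (*-identityʳ B))))
    where
    block : ∀ j → j < B → ∑ M (λ r → f (j * M + r)) ≤ 1
    block j j<B = ∑-at-most-one M _ 1 (λ r _ → le (j * M + r)) un
      where
      bound : ∀ r → r < M → j * M + r < B * M
      bound r r<M = ≤-trans (+-monoʳ-< (j * M) r<M) (≤-trans (≤-reflexive (+-comm (j * M) M)) (*-monoˡ-≤ M j<B))
      sep : ∀ r s → r < s → s < M → f (j * M + r) ≢ 0 → f (j * M + s) ≢ 0 → ⊥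
      sep r s r<s s<M p q = <-irrefl refl (<-≤-trans s<M (≤-trans (sp (j * M + r) (j * M + s) (+-monoʳ-< (j * M) r<s) (bound s s<M) p q)
         (≤-trans (≤-reflexive ([m+n]∸[m+o]≡n∸o (j * M) s r)) (m∸n≤m s r))))
      un : ∀ r s → r < M → s < M → f (j * M + r) ≢ 0 → f (j * M + s) ≢ 0 → r ≡ s
      un r s r<M s<M p q with <-cmp r s
      ... | tri< r<s _ _ = ⊥-elim (sep r s r<s s<M p q)
      ... | tri≈ _ e _ = e
      ... | tri> _ _ s<r = ⊥-elim (sep s r s<r r<M q p)

  ∑-clustered : ∀ n Δ (f : ℕ → ℕ) → (∀ i → f i ≤ 1) →
    (∀ i j → i < j → j < n → f i ≢ 0 → f j ≢ 0 → j ≤ i + Δ) → ∑ n f ≤ suc Δ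
  ∑-clustered zero Δ f le cl = z≤n
  ∑-clustered (suc n) Δ f le cl with f n ≟ 0
  ... | yes fn≡0 = ≤-trans (≤-reflexive (trans (cong (∑ n f +_) fn≡0) (+-identityʳ _)))
     (∑-clustered n Δ f le (λ i j i<j j<n → cl i j i<j (m<n⇒m<1+n j<n)))
  ... | no fn≢0 = ≤-trans (≤-reflexive (+-comm (∑ n f) (f n))) (+-mono-≤ (le n) tail)
    where
    tail : ∑ n f ≤ Δ
    tail = ≤-trans (≤-reflexive (trans (cong (λ k → ∑ k f) (sym (m∸n+n≡m (m⊓n≤m n Δ)))) (∑-split (n ∸ (n ⊓ Δ)) (n ⊓ Δ) f)))
      (≤-trans (≤-reflexive (cong (_+ ∑ (n ⊓ Δ) (λ i → f (n ∸ (n ⊓ Δ) + i))) (∑-zero (n ∸ (n ⊓ Δ)) early)))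
      (≤-trans (∑-mono (n ⊓ Δ) (λ i _ → le (n ∸ (n ⊓ Δ) + i))) (≤-trans (≤-reflexive (trans (∑-const (n ⊓ Δ) 1) (*-identityʳ _))) (m⊓n≤n n Δ))))
      where
      early : ∀ i → i < n ∸ (n ⊓ Δ) → f i ≡ 0
      early i i< with f i ≟ 0
      ... | yes e = e
      ... | no fi≢0 = ⊥-elim (<-irrefl refl (<-≤-trans i+Δ<n (cl i n (≤-trans i< (m∸n≤m n (n ⊓ Δ))) ≤-refl fi≢0 fn≢0)))
        where
        i+Δ<n : i + Δ < n
        i+Δ<n with ≤-total n Δ
        ... | inj₁ n≤Δ = ⊥-elim (n≮0 (subst (i <_) (trans (cong (n ∸_) (m≤n⇒m⊓n≡m n≤Δ)) (n∸n≡0 n)) i<))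
        ... | inj₂ Δ≤n = ≤-trans (+-monoˡ-≤ Δ (subst (i <_) (cong (n ∸_) (m≥n⇒m⊓n≡n Δ≤n)) i<)) (≤-reflexive (m∸n+n≡m Δ≤n))

  ∑-shift : ∀ M (φ : ℕ → ℕ) → (∀ x → φ (x + M) ≡ φ x) → ∀ t → ∑ M (λ x → φ (t + x)) ≡ ∑ M φ
  ∑-shift M φ per zero = refl
  ∑-shift M φ per (suc t) = trans (+-cancelˡ-≡ (φ t) _ _ (trans (sym step) (+-comm _ (φ t)))) (∑-shift M φ per t)
    where
    step : ∑ M (λ x → φ (t + x)) + φ t ≡ φ t + ∑ M (λ x → φ (suc t + x))
    step = trans (cong (∑ M (λ x → φ (t + x)) +_) (sym (per t))) (trans (∑-first M (λ x → φ (t + x)))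
       (cong₂ _+_ (cong φ (+-identityʳ t)) (∑-cong M (λ x _ → cong φ (+-suc t x)))))

  ∑-triangle : ∀ n (f : ℕ → ℕ → ℕ) → (∀ i j → f i j ≡ f j i) →
    ∑ n (λ i → ∑ n (f i)) ≡ ∑ n (λ i → f i i) + 2 * ∑ n (λ i → ∑ i (f i))
  ∑-triangle zero f sy = refl
  ∑-triangle (suc n) f sy = trans (cong₂ _+_ (trans (∑-+ n (λ i → ∑ n (f i)) (λ i → f i n)) (cong₂ _+_ (∑-triangle n f sy) (∑-cong n (λ i _ → sy i n)))) refl)
    (lem (∑ n (λ i → f i i)) (∑ n (λ i → ∑ i (f i))) (∑ n (f n)) (f n n))
    where lem : ∀ d t r x → d + 2 * t + r + (r + x) ≡ d + x + 2 * (t + r)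
          lem = solve-∀

  -- Pairs are regrouped by the difference of their indices. It is only an inequality because every
  -- diagonal is lengthened to `n` terms, which makes all ranges independent of the difference.
  ∑-diagonals : ∀ n (f : ℕ → ℕ → ℕ) → ∑ n (λ i → ∑ i (f i)) ≤ ∑ n (λ d → ∑ n (λ j → f (j + suc d) j))
  ∑-diagonals zero f = z≤n
  ∑-diagonals (suc n) f = ≤-trans (≤-reflexive (trans (∑-first n (λ i → ∑ i (f i))) (trans (∑-cong n (λ i _ → ∑-first i (f (suc i)))) (∑-+ n (λ i → f (suc i) 0) (λ i → ∑ i (λ j → f (suc i) (suc j)))))))
    (≤-trans (+-monoʳ-≤ (∑ n (λ i → f (suc i) 0)) (∑-diagonals n (λ i j → f (suc i) (suc j))))
    (≤-trans (≤-reflexive (sym (∑-+ n (λ d → f (suc d) 0) (λ d → ∑ n (λ j → f (suc j + suc d) (suc j))))))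
    (≤-trans (≤-reflexive (∑-cong n (λ d _ → sym (∑-first n (λ j → f (j + suc d) j))))) (m≤m+n _ _))))

  -- Double and quadruple sums

  ∑² : ℕ → (ℕ → ℕ → ℕ) → ℕ
  ∑² n f = ∑ n (λ t → ∑ n (λ u → f t u))

  ∑²-cong : ∀ n {f h : ℕ → ℕ → ℕ} → (∀ t u → t < n → u < n → f t u ≡ h t u) → ∑² n f ≡ ∑² n h
  ∑²-cong n eq = ∑-cong n (λ t t<n → ∑-cong n (λ u u<n → eq t u t<n u<n))

  ∑²-mono : ∀ n {f h : ℕ → ℕ → ℕ} → (∀ t u → t < n → u < n → f t u ≤ h t u) → ∑² n f ≤ ∑² n h
  ∑²-mono n le = ∑-mono n (λ t t<n → ∑-mono n (λ u u<n → le t u t<n u<n))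

  ∑²-+ : ∀ n (f h : ℕ → ℕ → ℕ) → ∑² n (λ t u → f t u + h t u) ≡ ∑² n f + ∑² n h
  ∑²-+ n f h = trans (∑-cong n (λ t _ → ∑-+ n (f t) (h t))) (∑-+ n (λ t → ∑ n (f t)) (λ t → ∑ n (h t)))

  ∑²-*ˡ : ∀ n k (f : ℕ → ℕ → ℕ) → ∑² n (λ t u → k * f t u) ≡ k * ∑² n f
  ∑²-*ˡ n k f = trans (∑-cong n (λ t _ → ∑-*ˡ n k (f t))) (∑-*ˡ n k (λ t → ∑ n (f t)))

  ∑²-const : ∀ n k → ∑² n (λ _ _ → k) ≡ n * (n * k)
  ∑²-const n k = trans (∑-cong n (λ _ _ → ∑-const n k)) (∑-const n (n * k))

  ∑-∑²-swap : ∀ m n (f : ℕ → ℕ → ℕ → ℕ) → ∑ m (λ i → ∑² n (f i)) ≡ ∑² n (λ t u → ∑ m (λ i → f i t u))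
  ∑-∑²-swap m n f = trans (∑-swap m n (λ i t → ∑ n (f i t))) (∑-cong n (λ t _ → ∑-swap m n (λ i u → f i t u)))

  ∑²-swap : ∀ m n (f : ℕ → ℕ → ℕ → ℕ → ℕ) → ∑² m (λ t u → ∑² n (λ t' u' → f t u t' u')) ≡ ∑² n (λ t' u' → ∑² m (λ t u → f t u t' u'))
  ∑²-swap m n f = trans (∑-cong m (λ t _ → ∑-∑²-swap m n (f t))) (∑-∑²-swap m n (λ t t' u' → ∑ m (λ u → f t u t' u')))

  ∑²-extend : ∀ {m n} (f : ℕ → ℕ → ℕ) → m ≤ n → ∑² m f ≤ ∑² n f
  ∑²-extend {m} {n} f m≤n = ≤-trans (∑-mono m (λ t _ → ∑-extend (f t) m≤n)) (∑-extend (λ t → ∑ n (f t)) m≤n)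

  ∑²-block : ∀ B M (f : ℕ → ℕ → ℕ) → ∑² (B * M) f ≡ ∑² B (λ j k → ∑² M (λ r s → f (j * M + r) (k * M + s)))
  ∑²-block B M f = trans (∑-block B M (λ t → ∑ (B * M) (f t)))
    (∑-cong B (λ j _ → trans (∑-cong M (λ r _ → ∑-block B M (f (j * M + r)))) (∑-swap M B (λ r k → ∑ M (λ s → f (j * M + r) (k * M + s))))))

  ∑⁴ : ℕ → (ℕ → ℕ → ℕ → ℕ → ℕ) → ℕ
  ∑⁴ n f = ∑² n (λ t u → ∑² n (λ t' u' → f t u t' u'))

  ∑⁴-mono : ∀ n {f h : ℕ → ℕ → ℕ → ℕ → ℕ} → (∀ t u t' u' → t < n → u < n → t' < n → u' < n → f t u t' u' ≤ h t u t' u') → ∑⁴ n f ≤ ∑⁴ n h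
  ∑⁴-mono n le = ∑²-mono n (λ t u t< u< → ∑²-mono n (λ t' u' t'< u'< → le t u t' u' t< u< t'< u'<))

  ∑⁴-cong : ∀ n {f h : ℕ → ℕ → ℕ → ℕ → ℕ} → (∀ t u t' u' → t < n → u < n → t' < n → u' < n → f t u t' u' ≡ h t u t' u') → ∑⁴ n f ≡ ∑⁴ n h
  ∑⁴-cong n eq = ∑²-cong n (λ t u t< u< → ∑²-cong n (λ t' u' t'< u'< → eq t u t' u' t< u< t'< u'<))

  ∑⁴-+ : ∀ n (f h : ℕ → ℕ → ℕ → ℕ → ℕ) → ∑⁴ n (λ t u t' u' → f t u t' u' + h t u t' u') ≡ ∑⁴ n f + ∑⁴ n h
  ∑⁴-+ n f h = trans (∑²-cong n (λ t u _ _ → ∑²-+ n (f t u) (h t u))) (∑²-+ n (λ t u → ∑² n (f t u)) (λ t u → ∑² n (h t u)))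

  ∑⁴-*ˡ : ∀ n k (f : ℕ → ℕ → ℕ → ℕ → ℕ) → ∑⁴ n (λ t u t' u' → k * f t u t' u') ≡ k * ∑⁴ n f
  ∑⁴-*ˡ n k f = trans (∑²-cong n (λ t u _ _ → ∑²-*ˡ n k (f t u))) (∑²-*ˡ n k (λ t u → ∑² n (f t u)))

  ∑⁴-const : ∀ n k → ∑⁴ n (λ _ _ _ _ → k) ≡ n * (n * (n * (n * k)))
  ∑⁴-const n k = trans (∑²-cong n (λ _ _ _ _ → ∑²-const n k)) (∑²-const n (n * (n * k)))

  ∑-∑⁴-swap : ∀ m n (f : ℕ → ℕ → ℕ → ℕ → ℕ → ℕ) → ∑ m (λ i → ∑⁴ n (f i)) ≡ ∑⁴ n (λ t u t' u' → ∑ m (λ i → f i t u t' u'))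
  ∑-∑⁴-swap m n f = trans (∑-∑²-swap m n (λ i t u → ∑² n (f i t u))) (∑²-cong n (λ t u _ _ → ∑-∑²-swap m n (λ i → f i t u)))

  ∑⁴-extend : ∀ {m n} (f : ℕ → ℕ → ℕ → ℕ → ℕ) → m ≤ n → ∑⁴ m f ≤ ∑⁴ n f
  ∑⁴-extend {m} {n} f m≤n = ≤-trans (∑²-mono m (λ t u _ _ → ∑²-extend (f t u) m≤n)) (∑²-extend (λ t u → ∑² n (f t u)) m≤n)

  -- Averaging over cells: a function supported on a periodic set and dominated on
  -- each cell by every value of Φ on that cell.
  ∑⁴-cells : ∀ B M k (ψ Φ χ : ℕ → ℕ → ℕ → ℕ → ℕ) →
    (∀ j r k s l t m v → χ (j * M + r) (k * M + s) (l * M + t) (m * M + v) ≡ χ r s t v) →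
    (∀ t u t' u' → χ t u t' u' ≡ 0 → ψ t u t' u' ≡ 0) →
    (∀ t u t' u' → χ t u t' u' ≤ 1) →
    (∀ j₁ j₂ j₃ j₄ → j₁ < B → j₂ < B → j₃ < B → j₄ < B → ∀ r₁ r₂ r₃ r₄ s₁ s₂ s₃ s₄ → r₁ < M → r₂ < M → r₃ < M → r₄ < M → s₁ < M → s₂ < M → s₃ < M → s₄ < M →
       k * ψ (j₁ * M + r₁) (j₂ * M + r₂) (j₃ * M + r₃) (j₄ * M + r₄) ≤ Φ (j₁ * M + s₁) (j₂ * M + s₂) (j₃ * M + s₃) (j₄ * M + s₄)) →
    M * (M * (M * (M * k))) * ∑⁴ (B * M) ψ ≤ ∑⁴ M χ * ∑⁴ (B * M) Φ
  ∑⁴-cells B M k ψ Φ χ per supp χ≤1 dom =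
    ≤-trans (≤-reflexive (trans (cong (M⁴k *_) (blocks ψ)) (sym (∑⁴-*ˡ B M⁴k (λ j₁ j₂ j₃ j₄ → ∑⁴ M (cell ψ j₁ j₂ j₃ j₄))))))
    (≤-trans (∑⁴-mono B cellwise)
    (≤-reflexive (trans (∑⁴-*ˡ B (∑⁴ M χ) (λ j₁ j₂ j₃ j₄ → ∑⁴ M (cell Φ j₁ j₂ j₃ j₄))) (cong (∑⁴ M χ *_) (sym (blocks Φ))))))
    where
    M⁴k = M * (M * (M * (M * k)))
    cell : (ℕ → ℕ → ℕ → ℕ → ℕ) → ℕ → ℕ → ℕ → ℕ → ℕ → ℕ → ℕ → ℕ → ℕ
    cell f j₁ j₂ j₃ j₄ r₁ r₂ r₃ r₄ = f (j₁ * M + r₁) (j₂ * M + r₂) (j₃ * M + r₃) (j₄ * M + r₄)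
    blocks : ∀ f → ∑⁴ (B * M) f ≡ ∑⁴ B (λ j₁ j₂ j₃ j₄ → ∑⁴ M (cell f j₁ j₂ j₃ j₄))
    blocks f = trans (∑²-block B M (λ t u → ∑² (B * M) (f t u)))
      (∑²-cong B (λ j₁ j₂ _ _ → trans (∑²-cong M (λ r₁ r₂ _ _ → ∑²-block B M (f (j₁ * M + r₁) (j₂ * M + r₂))))
        (∑²-swap M B (λ r₁ r₂ j₃ j₄ → ∑² M (cell f j₁ j₂ j₃ j₄ r₁ r₂)))))
    cellwise : ∀ j₁ j₂ j₃ j₄ → j₁ < B → j₂ < B → j₃ < B → j₄ < B → M⁴k * ∑⁴ M (cell ψ j₁ j₂ j₃ j₄) ≤ ∑⁴ M χ * ∑⁴ M (cell Φ j₁ j₂ j₃ j₄)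
    cellwise j₁ j₂ j₃ j₄ b₁ b₂ b₃ b₄ = ≤-trans (≤-reflexive (trans (lem M k (∑⁴ M (cell ψ j₁ j₂ j₃ j₄))) (cong (M⁴ *_) (sym (∑⁴-*ˡ M k (cell ψ j₁ j₂ j₃ j₄))))))
      (≤-trans (*-monoʳ-≤ M⁴ (∑⁴-mono M one))
      (≤-trans (≤-reflexive (trans (cong (M⁴ *_) (trans (∑⁴-cong M (λ r₁ r₂ r₃ r₄ _ _ _ _ → *-comm (χ r₁ r₂ r₃ r₄) _)) (∑⁴-*ˡ M m₀ χ))) (swap M⁴ m₀ (∑⁴ M χ))))
      (*-monoʳ-≤ (∑⁴ M χ) (≤-trans (≤-reflexive (trans (lem' M m₀) (sym (∑⁴-const M m₀)))) (∑⁴-mono M (λ s₁ s₂ s₃ s₄ h₁ h₂ h₃ h₄ → m₀≤ s₁ s₂ s₃ s₄ h₁ h₂ h₃ h₄))))))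
      where
      M⁴ = M * (M * (M * M))
      lem : ∀ M k x → M * (M * (M * (M * k))) * x ≡ M * (M * (M * M)) * (k * x)
      lem = solve-∀
      lem' : ∀ M x → M * (M * (M * M)) * x ≡ M * (M * (M * (M * x)))
      lem' = solve-∀
      swap : ∀ x y z → x * (y * z) ≡ z * (x * y)
      swap = solve-∀
      maxₙ : ℕ → (ℕ → ℕ) → ℕ
      maxₙ zero f = 0
      maxₙ (suc n) f = maxₙ n f ⊔ f n
      maxₙ-≥ : ∀ n f i → i < n → f i ≤ maxₙ n f
      maxₙ-≥ (suc n) f i (s≤s i≤n) with m≤n⇒m<n∨m≡n i≤n
      ... | inj₁ i<n = ≤-trans (maxₙ-≥ n f i i<n) (m≤m⊔n _ _)
      ... | inj₂ refl = m≤n⊔m (maxₙ n f) (f n)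
      maxₙ-≤ : ∀ n f b → (∀ i → i < n → f i ≤ b) → maxₙ n f ≤ b
      maxₙ-≤ zero f b h = z≤n
      maxₙ-≤ (suc n) f b h = ⊔-lub (maxₙ-≤ n f b (λ i i<n → h i (m<n⇒m<1+n i<n))) (h n ≤-refl)
      kψ : ℕ → ℕ → ℕ → ℕ → ℕ
      kψ r₁ r₂ r₃ r₄ = k * cell ψ j₁ j₂ j₃ j₄ r₁ r₂ r₃ r₄
      -- The largest value of `k * ψ` on the cell, hence below every value of `Φ` there. Each point
      -- of the support of `χ` costs at most `m₀`, while the sum of `Φ` over the cell is at least
      -- `M⁴ m₀`.
      m₀ = maxₙ M (λ r₁ → maxₙ M (λ r₂ → maxₙ M (λ r₃ → maxₙ M (λ r₄ → kψ r₁ r₂ r₃ r₄))))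
      m₀≤ : ∀ s₁ s₂ s₃ s₄ → s₁ < M → s₂ < M → s₃ < M → s₄ < M → m₀ ≤ cell Φ j₁ j₂ j₃ j₄ s₁ s₂ s₃ s₄
      m₀≤ s₁ s₂ s₃ s₄ h₁ h₂ h₃ h₄ = maxₙ-≤ M _ _ λ r₁ g₁ → maxₙ-≤ M _ _ λ r₂ g₂ → maxₙ-≤ M _ _ λ r₃ g₃ → maxₙ-≤ M _ _ λ r₄ g₄ →
        dom j₁ j₂ j₃ j₄ b₁ b₂ b₃ b₄ r₁ r₂ r₃ r₄ s₁ s₂ s₃ s₄ g₁ g₂ g₃ g₄ h₁ h₂ h₃ h₄
      one : ∀ r₁ r₂ r₃ r₄ → r₁ < M → r₂ < M → r₃ < M → r₄ < M → kψ r₁ r₂ r₃ r₄ ≤ χ r₁ r₂ r₃ r₄ * m₀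
      one r₁ r₂ r₃ r₄ g₁ g₂ g₃ g₄ = go (χ r₁ r₂ r₃ r₄) refl
        where
        go : ∀ x → χ r₁ r₂ r₃ r₄ ≡ x → kψ r₁ r₂ r₃ r₄ ≤ x * m₀
        go zero e = ≤-reflexive (trans (cong (k *_) (supp _ _ _ _ (trans (per j₁ r₁ j₂ r₂ j₃ r₃ j₄ r₄) e))) (*-zeroʳ k))
        go (suc x) e = ≤-trans (≤-trans (maxₙ-≥ M (λ r₄ → kψ r₁ r₂ r₃ r₄) r₄ g₄) (≤-trans (maxₙ-≥ M (λ r₃ → maxₙ M (λ r₄ → kψ r₁ r₂ r₃ r₄)) r₃ g₃)
          (≤-trans (maxₙ-≥ M (λ r₂ → maxₙ M (λ r₃ → maxₙ M (λ r₄ → kψ r₁ r₂ r₃ r₄))) r₂ g₂)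
            (maxₙ-≥ M (λ r₁ → maxₙ M (λ r₂ → maxₙ M (λ r₃ → maxₙ M (λ r₄ → kψ r₁ r₂ r₃ r₄)))) r₁ g₁)))) (m≤m+n m₀ (x * m₀))

  -- Indicators

  𝟙 : ∀ {P : Set} → Dec P → ℕ
  𝟙 (yes _) = 1
  𝟙 (no _) = 0

  𝟙≤1 : ∀ {P : Set} (d : Dec P) → 𝟙 d ≤ 1
  𝟙≤1 (yes _) = ≤-refl
  𝟙≤1 (no _) = z≤n

  𝟙-yes : ∀ {P : Set} (d : Dec P) → P → 𝟙 d ≡ 1
  𝟙-yes (yes _) _ = refl
  𝟙-yes (no n) p = ⊥-elim (n p)

  𝟙-no : ∀ {P : Set} (d : Dec P) → ¬ P → 𝟙 d ≡ 0
  𝟙-no (yes p) n = ⊥-elim (n p)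
  𝟙-no (no _) _ = refl

  𝟙-true : ∀ {P : Set} (d : Dec P) → 𝟙 d ≢ 0 → P
  𝟙-true (yes p) _ = p
  𝟙-true (no _) h = ⊥-elim (h refl)

  𝟙-mono : ∀ {P Q : Set} (d : Dec P) (d' : Dec Q) → (P → Q) → 𝟙 d ≤ 𝟙 d'
  𝟙-mono (no _) d' h = z≤n
  𝟙-mono (yes p) d' h = ≤-reflexive (sym (𝟙-yes d' (h p)))

  𝟙-cong : ∀ {P Q : Set} (d : Dec P) (d' : Dec Q) → (P → Q) → (Q → P) → 𝟙 d ≡ 𝟙 d'
  𝟙-cong d d' h k = ≤-antisym (𝟙-mono d d' h) (𝟙-mono d' d k)

  *≢0⇒ˡ : ∀ {x y} → x * y ≢ 0 → x ≢ 0
  *≢0⇒ˡ h refl = h refl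

  *≢0⇒ʳ : ∀ x {y} → x * y ≢ 0 → y ≢ 0
  *≢0⇒ʳ x h refl = h (*-zeroʳ x)

  -- Sums over lists

  ∑ᴸ : ∀ {A : Set} → List A → (A → ℕ) → ℕ
  ∑ᴸ [] f = 0
  ∑ᴸ (x ∷ xs) f = f x + ∑ᴸ xs f

  module _ {A : Set} where
    ∑ᴸ-mono : ∀ (xs : List A) {f h : A → ℕ} → (∀ x → x ∈ xs → f x ≤ h x) → ∑ᴸ xs f ≤ ∑ᴸ xs h
    ∑ᴸ-mono [] le = z≤n
    ∑ᴸ-mono (x ∷ xs) le = +-mono-≤ (le x (here refl)) (∑ᴸ-mono xs (λ y y∈ → le y (there y∈)))

    ∑ᴸ-cong : ∀ (xs : List A) {f h : A → ℕ} → (∀ x → x ∈ xs → f x ≡ h x) → ∑ᴸ xs f ≡ ∑ᴸ xs h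
    ∑ᴸ-cong [] eq = refl
    ∑ᴸ-cong (x ∷ xs) eq = cong₂ _+_ (eq x (here refl)) (∑ᴸ-cong xs (λ y y∈ → eq y (there y∈)))

    ∑ᴸ-+ : ∀ (xs : List A) (f h : A → ℕ) → ∑ᴸ xs (λ x → f x + h x) ≡ ∑ᴸ xs f + ∑ᴸ xs h
    ∑ᴸ-+ [] f h = refl
    ∑ᴸ-+ (x ∷ xs) f h = trans (cong (f x + h x +_) (∑ᴸ-+ xs f h)) (lem (f x) (h x) (∑ᴸ xs f) (∑ᴸ xs h))
      where lem : ∀ w x y z → w + x + (y + z) ≡ w + y + (x + z)
            lem = solve-∀

    ∑ᴸ-*ˡ : ∀ (xs : List A) k (f : A → ℕ) → ∑ᴸ xs (λ x → k * f x) ≡ k * ∑ᴸ xs f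
    ∑ᴸ-*ˡ [] k f = sym (*-zeroʳ k)
    ∑ᴸ-*ˡ (x ∷ xs) k f = trans (cong (k * f x +_) (∑ᴸ-*ˡ xs k f)) (sym (*-distribˡ-+ k (f x) _))

    ∑ᴸ-∑-swap : ∀ (xs : List A) n (f : A → ℕ → ℕ) → ∑ᴸ xs (λ x → ∑ n (f x)) ≡ ∑ n (λ i → ∑ᴸ xs (λ x → f x i))
    ∑ᴸ-∑-swap [] n f = sym (∑-zero n (λ _ _ → refl))
    ∑ᴸ-∑-swap (x ∷ xs) n f = trans (cong (∑ n (f x) +_) (∑ᴸ-∑-swap xs n f)) (sym (∑-+ n (f x) (λ i → ∑ᴸ xs (λ x → f x i))))

    ∑ᴸ-member : ∀ (xs : List A) (f : A → ℕ) {x} → x ∈ xs → f x ≤ ∑ᴸ xs f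
    ∑ᴸ-member (x ∷ xs) f (here refl) = m≤m+n (f x) _
    ∑ᴸ-member (x ∷ xs) f (there x∈) = ≤-trans (∑ᴸ-member xs f x∈) (m≤n+m _ (f x))

    ∑ᴸ-zero : ∀ (xs : List A) {f : A → ℕ} → (∀ x → x ∈ xs → f x ≡ 0) → ∑ᴸ xs f ≡ 0
    ∑ᴸ-zero [] h = refl
    ∑ᴸ-zero (x ∷ xs) h = cong₂ _+_ (h x (here refl)) (∑ᴸ-zero xs (λ y y∈ → h y (there y∈)))

    ∑ᴸ-at-most-one : ∀ {xs : List A} (f : A → ℕ) k → Unique xs → (∀ x → f x ≤ k) → (∀ x y → f x ≢ 0 → f y ≢ 0 → x ≡ y) → ∑ᴸ xs f ≤ k
    ∑ᴸ-at-most-one f k [] le un = z≤n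
    ∑ᴸ-at-most-one {x ∷ xs} f k (x∉ ∷ u) le un with f x ≟ 0
    ... | yes e = ≤-trans (≤-reflexive (cong (_+ ∑ᴸ xs f) e)) (∑ᴸ-at-most-one f k u le un)
    ... | no fx≢0 = ≤-trans (≤-reflexive (trans (cong (f x +_) (∑ᴸ-zero xs zero')) (+-identityʳ (f x)))) (le x)
      where
      zero' : ∀ y → y ∈ xs → f y ≡ 0
      zero' y y∈ with f y ≟ 0
      ... | yes e = e
      ... | no fy≢0 = ⊥-elim (All.lookup x∉ y∈ (un x y fx≢0 fy≢0))

  -- Tails of ∑ 1/d³ and ∑ 1/e², with denominators cleared

  -- Telescoping: `1/(2p(p+1)) - 1/(2(p+1)(p+2)) = 1/(p(p+1)(p+2))`, which is at least `1/(p+1)³`.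
  -- The bound has the right leading constant 1/2, which the asymptotic second moment requires.
  cube-tail : ∀ n p Z (x : ℕ → ℕ) → (∀ d → 1 ≤ d → d * d * d * x d ≤ Z) →
    2 * p * suc p * ∑ n (λ i → x (suc p + i)) ≤ Z
  cube-tail zero p Z x h = ≤-trans (≤-reflexive (*-zeroʳ (2 * p * suc p))) z≤n
  cube-tail (suc n) p Z x h = *-cancelˡ-≤ (suc (suc p)) (≤-trans (≤-reflexive (trans (cong (λ s → suc (suc p) * (2 * p * suc p * s)) split) (l₁ p (x (suc p)) S)))
      (≤-trans (+-mono-≤ (*-monoʳ-≤ 2 (≤-trans first (h (suc p) (s≤s z≤n)))) (*-monoʳ-≤ p (cube-tail n (suc p) Z x h))) (≤-reflexive (l₂ p Z))))
    where
    S = ∑ n (λ i → x (suc (suc p) + i))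
    split : ∑ (suc n) (λ i → x (suc p + i)) ≡ x (suc p) + S
    split = trans (∑-first n (λ i → x (suc p + i))) (cong₂ _+_ (cong x (+-identityʳ (suc p))) (∑-cong n (λ i _ → cong x (+-suc (suc p) i))))
    l₁ : ∀ p x S → suc (suc p) * (2 * p * suc p * (x + S)) ≡ 2 * (p * suc p * suc (suc p) * x) + p * (2 * suc p * suc (suc p) * S)
    l₁ = solve-∀
    l₂ : ∀ p Z → 2 * Z + p * Z ≡ suc (suc p) * Z
    l₂ = solve-∀
    first : p * suc p * suc (suc p) * x (suc p) ≤ suc p * suc p * suc p * x (suc p)
    first = *-monoˡ-≤ (x (suc p)) (≤-trans (m≤m+n (p * suc p * suc (suc p)) (suc p)) (≤-reflexive (l p)))
      where l : ∀ p → p * suc p * suc (suc p) + suc p ≡ suc p * suc p * suc p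
            l = solve-∀

  -- Telescoping with `1/m - 1/(m+1) ≥ 1/(m+1)²`.
  square-tail : ∀ n m Y (X : ℕ → ℕ) → (∀ e → m < e → e * e * X e ≤ Y) → m * ∑ n (λ i → X (suc m + i)) ≤ Y
  square-tail zero m Y X h = ≤-trans (≤-reflexive (*-zeroʳ m)) z≤n
  square-tail (suc n) m Y X h = *-cancelˡ-≤ (suc m) (≤-trans (≤-reflexive (trans (cong (λ s → suc m * (m * s)) split) (l₁ m (X (suc m)) S)))
      (≤-trans (+-mono-≤ (≤-trans first (h (suc m) ≤-refl)) (*-monoʳ-≤ m (square-tail n (suc m) Y X (λ e lt → h e (<⇒≤ lt))))) ≤-refl))
    where
    S = ∑ n (λ i → X (suc (suc m) + i))
    split : ∑ (suc n) (λ i → X (suc m + i)) ≡ X (suc m) + S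
    split = trans (∑-first n (λ i → X (suc m + i))) (cong₂ _+_ (cong X (+-identityʳ (suc m))) (∑-cong n (λ i _ → cong X (+-suc (suc m) i))))
    l₁ : ∀ m x S → suc m * (m * (x + S)) ≡ suc m * m * x + m * (suc m * S)
    l₁ = solve-∀
    first : suc m * m * X (suc m) ≤ suc m * suc m * X (suc m)
    first = *-monoˡ-≤ (X (suc m)) (*-monoʳ-≤ (suc m) (n≤1+n m))

  bracket : ∀ A L → A ≢ 0 → L ≢ 0 → ∃[ p ] A * p < L × L ≤ A * suc p
  bracket A L A≢0 L≢0 = p , lo , hi
    where
    instance _ = ≢-nonZero A≢0
    -- This is `⌈L/A⌉ - 1`, so that `L ≤ A d` holds exactly for `d > p`.
    p = pred L / A
    L-eq : suc (pred L) ≡ L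
    L-eq = suc-pred L {{≢-nonZero L≢0}}
    lo : A * p < L
    lo = subst (A * p <_) L-eq (s≤s (≤-trans (≤-reflexive (*-comm A p)) (m/n*n≤m (pred L) A)))
    hi : L ≤ A * suc p
    hi = subst (_≤ A * suc p) L-eq (≤-trans (+-monoˡ-< (p * A) (m%n<n (pred L) A) |≤ cong suc (m≡m%n+[m/n]*n (pred L) A)) (≤-reflexive (l A p)))
      where
      _|≤_ : ∀ {x y z} → x ≤ y → z ≡ x → z ≤ y
      h |≤ e = ≤-trans (≤-reflexive e) h
      l : ∀ A p → A + p * A ≡ A * suc p
      l = solve-∀

  module CubeTail (n A L Z : ℕ) (x : ℕ → ℕ) (A≢0 : A ≢ 0) (L≢0 : L ≢ 0) (h : ∀ d → 1 ≤ d → d * d * d * x d ≤ Z) where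
    tail : ℕ
    tail = ∑ n (λ i → 𝟙 (L ≤? A * suc i) * x (suc i))

    private
      from : ∀ p → A * p < L → tail ≤ ∑ n (λ i → x (suc p + i))
      from p lt = ≤-trans (∑-extend _ (m≤n+m n p)) (≤-trans (≤-reflexive (∑-split p n (λ i → 𝟙 (L ≤? A * suc i) * x (suc i))))
        (≤-trans (≤-reflexive (cong (_+ ∑ n (λ i → 𝟙 (L ≤? A * suc (p + i)) * x (suc (p + i)))) (∑-zero p (λ i i<p → cong (_* x (suc i)) (𝟙-no (L ≤? A * suc i) (λ le → <-irrefl refl (<-≤-trans lt (≤-trans le (*-monoʳ-≤ A i<p)))))))))
        (∑-mono n (λ i _ → ≤-trans (*-monoˡ-≤ (x (suc (p + i))) (𝟙≤1 (L ≤? A * suc (p + i)))) (≤-reflexive (+-identityʳ _))))))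

      p₀ = proj₁ (bracket A L A≢0 L≢0)
      lo = proj₁ (proj₂ (bracket A L A≢0 L≢0))
      hi = proj₂ (proj₂ (bracket A L A≢0 L≢0))

      L²≤ : L * L ≤ A * A * (suc p₀ * suc p₀)
      L²≤ = ≤-trans (*-mono-≤ hi hi) (≤-reflexive (l A (suc p₀)))
        where l : ∀ A p → A * p * (A * p) ≡ A * A * (p * p)
              l = solve-∀

      bound : 2 * p₀ * (suc p₀ * suc p₀ * tail) ≤ suc p₀ * Z
      bound = ≤-trans (*-monoʳ-≤ (2 * p₀) (*-monoʳ-≤ (suc p₀ * suc p₀) (from p₀ lo))) (≤-trans (≤-reflexive (l p₀ _)) (*-monoʳ-≤ (suc p₀) (cube-tail n p₀ Z x h)))
        where l : ∀ p s → 2 * p * (suc p * suc p * s) ≡ suc p * (2 * p * suc p * s)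
              l = solve-∀

      case-p : ∀ p → p ≡ p₀ → suc p₀ * suc p₀ * tail ≤ 2 * Z
      -- At `p₀ = 0` the estimate by `cube-tail` is void. The first term is split off and the rest
      -- is bounded by `cube-tail` at 1.
      case-p zero e = ≤-trans (≤-reflexive (trans (cong (λ p → suc p * suc p * tail) (sym e)) (+-identityʳ tail))) (≤-trans (from 0 (subst (λ p → A * p < L) (sym e) lo)) (zero-case n))
        where
        zero-case : ∀ n → ∑ n (λ i → x (1 + i)) ≤ 2 * Z
        zero-case zero = z≤n
        zero-case (suc n) = ≤-trans (≤-reflexive (∑-first n (λ i → x (1 + i)))) (≤-trans (+-mono-≤ (≤-trans (≤-reflexive (sym (+-identityʳ (x 1)))) (h 1 ≤-refl))
           (≤-trans (m≤m+n (∑ n (λ i → x (2 + i))) (3 * ∑ n (λ i → x (2 + i)))) (cube-tail n 1 Z x h))) (≤-reflexive (cong (Z +_) (sym (+-identityʳ Z)))))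
      case-p (suc p) e = *-cancelˡ-≤ (2 * p₀) {{≢-nonZero (λ e' → 1+n≢0 (trans e (m*n≡0⇒n≡0 1 e')))}} (≤-trans bound (≤-trans (*-monoˡ-≤ Z (≤-trans (+-monoˡ-≤ p₀ (subst (1 ≤_) e (s≤s z≤n))) (m≤m+n (p₀ + p₀) (2 * p₀)))) (≤-reflexive (l p₀ Z))))
        where
        m*n≡0⇒n≡0 : ∀ m {n} → suc m * n ≡ 0 → n ≡ 0
        m*n≡0⇒n≡0 m {zero} _ = refl
        l : ∀ p Z → (p + p + 2 * p) * Z ≡ 2 * p * (2 * Z)
        l = solve-∀

    crude : L * L * tail ≤ 2 * (A * A * Z)
    crude = ≤-trans (*-monoˡ-≤ tail L²≤) (≤-trans (≤-reflexive (*-assoc (A * A) (suc p₀ * suc p₀) tail)) (≤-trans (*-monoʳ-≤ (A * A) (case-p p₀ refl)) (≤-reflexive (l (A * A) Z))))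
      where l : ∀ a z → a * (2 * z) ≡ 2 * (a * z)
            l = solve-∀

    -- With `p₀ = ⌈L/A⌉ - 1`, the tail is at most `Z / (2 p₀ (p₀ + 1))` and `L ≤ A (p₀ + 1)`.
    -- Together they give the factor `(p₀ + 1) / (2 p₀)`, which decreases to 1/2; the hypothesis
    -- says that `p₀ ≥ m`.
    sharp : ∀ m → m ≢ 0 → ¬ (L ≤ A * m) → 2 * m * (L * L * tail) ≤ suc m * (A * A * Z)
    sharp m m≢0 nle = ≤-trans (*-monoʳ-≤ (2 * m) (≤-trans (*-monoˡ-≤ tail L²≤) (≤-reflexive (*-assoc (A * A) (suc p₀ * suc p₀) tail))))
        (≤-trans (≤-reflexive (l₁ m (A * A) (suc p₀ * suc p₀ * tail))) (≤-trans (*-monoʳ-≤ (A * A) key) (≤-reflexive (l₂ (A * A) m Z))))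
      where
      m≤p : m ≤ p₀
      m≤p = ≮⇒≥ (λ lt → nle (≤-trans hi (*-monoʳ-≤ A lt)))
      p≢0 : p₀ ≢ 0
      p≢0 e = m≢0 (n≤0⇒n≡0 (subst (m ≤_) e m≤p))
      key : 2 * m * (suc p₀ * suc p₀ * tail) ≤ suc m * Z
      key = *-cancelˡ-≤ p₀ {{≢-nonZero p≢0}} (≤-trans (≤-reflexive (l₃ p₀ m (suc p₀ * suc p₀ * tail))) (≤-trans (*-monoʳ-≤ m bound)
        (≤-trans (≤-reflexive (l₄ m p₀ Z)) (≤-trans (+-monoˡ-≤ (p₀ * (m * Z)) (*-monoˡ-≤ Z m≤p)) (≤-reflexive (l₅ p₀ m Z))))))
        where
        l₃ : ∀ p m s → p * (2 * m * s) ≡ m * (2 * p * s)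
        l₃ = solve-∀
        l₄ : ∀ m p Z → m * (suc p * Z) ≡ m * Z + p * (m * Z)
        l₄ = solve-∀
        l₅ : ∀ p m Z → p * Z + p * (m * Z) ≡ p * (suc m * Z)
        l₅ = solve-∀
      l₁ : ∀ m a s → 2 * m * (a * s) ≡ a * (2 * m * s)
      l₁ = solve-∀
      l₂ : ∀ a m Z → a * (suc m * Z) ≡ suc m * (a * Z)
      l₂ = solve-∀

  -- G sums, over d = e d' with e prime to F, the quantity d' L² / d⁴ (scaled by Z).
  module DivisorTail (n m A L Z F : ℕ) (Y : ℕ → ℕ) (A≢0 : A ≢ 0) (L≢0 : L ≢ 0) (m≢0 : m ≢ 0)
      (Y≤ : ∀ d → 1 ≤ d → Y d * (d * d * d * d) ≤ Z)
      (rough : ∀ e → Coprime e F → e ≢ 1 → m < e) where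

    w : ℕ → ℕ → ℕ
    w e d' = 𝟙 (coprime? e F) * (d' * Y (e * d') * (𝟙 (L ≤? A * (e * d')) * (L * L)))

    G : ℕ
    G = ∑ n (λ δ → ∑ (suc (suc δ)) (λ e → ∑ (suc (suc δ)) (λ d' → 𝟙 (e * d' ≟ suc δ) * w e d')))

    private
      X : ℕ → ℕ
      X e = ∑ n (λ j → w e (suc j))

      reindex : G ≤ ∑ n (λ i → X (suc i))
      reindex = ≤-trans (∑-mono n (λ δ δ<n → ≤-trans (∑-mono (suc (suc δ)) (λ e _ → ∑-extend (λ d' → 𝟙 (e * d' ≟ suc δ) * w e d') (s≤s δ<n)))
                                   (∑-extend (λ e → ∑ (suc n) (λ d' → 𝟙 (e * d' ≟ suc δ) * w e d')) (s≤s δ<n))))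
        (≤-trans (≤-reflexive (trans (∑-swap n (suc n) (λ δ e → ∑ (suc n) (λ d' → 𝟙 (e * d' ≟ suc δ) * w e d')))
                   (∑-cong (suc n) (λ e _ → trans (∑-swap n (suc n) (λ δ d' → 𝟙 (e * d' ≟ suc δ) * w e d')) (∑-cong (suc n) (λ d' _ → ∑-*ʳ n (w e d') (λ δ → 𝟙 (e * d' ≟ suc δ))))))))
        (≤-trans (≤-reflexive (trans (∑-first n (λ e → ∑ (suc n) (λ d' → ∑ n (λ δ → 𝟙 (e * d' ≟ suc δ)) * w e d')))
                    (cong (_+ ∑ n (λ i → ∑ (suc n) (λ d' → ∑ n (λ δ → 𝟙 (suc i * d' ≟ suc δ)) * w (suc i) d')))
                      (∑-zero (suc n) (λ d' _ → cong (_* w 0 d') (∑-zero n (λ δ _ → 𝟙-no (0 ≟ suc δ) (λ ()))))))))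
        (∑-mono n (λ i _ → row i))))
        where
        row : ∀ i → ∑ (suc n) (λ d' → ∑ n (λ δ → 𝟙 (suc i * d' ≟ suc δ)) * w (suc i) d') ≤ X (suc i)
        row i = ≤-trans (≤-reflexive (trans (∑-first n (λ d' → ∑ n (λ δ → 𝟙 (suc i * d' ≟ suc δ)) * w (suc i) d'))
            (cong (_+ ∑ n (λ j → ∑ n (λ δ → 𝟙 (suc i * suc j ≟ suc δ)) * w (suc i) (suc j)))
              (cong (_* w (suc i) 0) (∑-zero n (λ δ _ → 𝟙-no (suc i * 0 ≟ suc δ) (λ e → 1+n≢0 (trans (sym e) (*-zeroʳ i)))))))))
          (∑-mono n (λ j _ → ≤-trans (*-monoˡ-≤ (w (suc i) (suc j)) (∑-at-most-one n (λ δ → 𝟙 (suc i * suc j ≟ suc δ)) 1 (λ δ _ → 𝟙≤1 (suc i * suc j ≟ suc δ))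
              (λ δ δ' _ _ p p' → suc-injective (trans (sym (𝟙-true (suc i * suc j ≟ suc δ) p)) (𝟙-true (suc i * suc j ≟ suc δ') p')))))
            (≤-reflexive (+-identityʳ _))))

      module _ (e : ℕ) (1≤e : 1 ≤ e) where
        x : ℕ → ℕ
        x d' = e * e * e * e * (d' * Y (e * d'))
        x≤ : ∀ d → 1 ≤ d → d * d * d * x d ≤ Z
        x≤ d 1≤d = ≤-trans (≤-reflexive (l e d (Y (e * d)))) (Y≤ (e * d) (*-mono-≤ 1≤e 1≤d))
          where l : ∀ e d y → d * d * d * (e * e * e * e * (d * y)) ≡ y * (e * d * (e * d) * (e * d) * (e * d))
                l = solve-∀
        open CubeTail n (A * e) L Z x (λ z → [ A≢0 , (λ e≡0 → n≮0 (subst (1 ≤_) e≡0 1≤e)) ]′ (m*n≡0⇒m≡0∨n≡0 A z)) L≢0 x≤ public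
        X-tail : e * e * e * e * X e ≤ L * L * tail
        X-tail = ≤-trans (≤-reflexive (sym (∑-*ˡ n (e * e * e * e) (λ j → w e (suc j)))))
          (≤-trans (∑-mono n (λ j _ → ≤-trans (*-monoʳ-≤ (e * e * e * e) (≤-trans (*-monoˡ-≤ _ (𝟙≤1 (coprime? e F))) (≤-reflexive (+-identityʳ _))))
              (≤-reflexive (trans (cong (λ z → e * e * e * e * (suc j * Y (e * suc j) * (𝟙 (L ≤? z) * (L * L)))) (sym (*-assoc A e (suc j)))) (l e (suc j * Y (e * suc j)) (𝟙 (L ≤? A * e * suc j)) (L * L))))))
          (≤-reflexive (∑-*ˡ n (L * L) (λ i → 𝟙 (L ≤? A * e * suc i) * x (suc i)))))
          where l : ∀ e y i s → e * e * e * e * (y * (i * s)) ≡ s * (i * (e * e * e * e * y))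
                l = solve-∀
        X-square : e * e * X e ≤ 2 * (A * A * Z)
        X-square = *-cancelˡ-≤ (e * e) {{>-nonZero (*-mono-≤ 1≤e 1≤e)}} (≤-trans (≤-reflexive (l₁ e (X e))) (≤-trans X-tail (≤-trans crude (≤-reflexive (l₂ A e Z)))))
          where l₁ : ∀ e x → e * e * (e * e * x) ≡ e * e * e * e * x
                l₁ = solve-∀
                l₂ : ∀ A e Z → 2 * (A * e * (A * e) * Z) ≡ e * e * (2 * (A * A * Z))
                l₂ = solve-∀

      X-rough : ∀ e → 1 < e → e ≤ m → X e ≡ 0
      X-rough e 1<e e≤m = ∑-zero n (λ j _ → cong (_* (suc j * Y (e * suc j) * (𝟙 (L ≤? A * (e * suc j)) * (L * L)))) (𝟙-no (coprime? e F) (λ cop → <-irrefl refl (<-≤-trans (rough e cop (λ e≡1 → <-irrefl (sym e≡1) 1<e)) e≤m))))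

      rest : m * ∑ n (λ i → X (2 + i)) ≤ 2 * (A * A * Z)
      rest = ≤-trans (*-monoʳ-≤ m shifted) (square-tail n m (2 * (A * A * Z)) X (λ e m<e → X-square e (≤-trans (s≤s z≤n) m<e)))
        where
        shifted : ∑ n (λ i → X (2 + i)) ≤ ∑ n (λ i → X (suc m + i))
        shifted = ≤-trans (∑-extend (λ i → X (2 + i)) (m≤n+m n (pred m))) (≤-trans (≤-reflexive (∑-split (pred m) n (λ i → X (2 + i))))
          (≤-reflexive (cong₂ _+_ (∑-zero (pred m) (λ i i< → X-rough (2 + i) (s≤s (s≤s z≤n)) (≤-trans (s≤s i<) (≤-reflexive (suc-pred m {{≢-nonZero m≢0}})))))
            (∑-cong n (λ i _ → cong X (cong (λ z → suc z + i) (suc-pred m {{≢-nonZero m≢0}})))))))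

      1-tail : X 1 ≤ L * L * tail 1 ≤-refl
      1-tail = ≤-trans (≤-reflexive (sym (+-identityʳ (X 1)))) (X-tail 1 ≤-refl)

    -- In units of `A² Z`, the terms with `e = 1` contribute `(m + 1) / (2m)`, or 2 if `L ≤ A m`.
    -- Every other `e` prime to `F` exceeds `m`, and as `X e` is at most `2 / e²` these contribute
    -- at most `2 / m`.
    G-bound : 2 * m * G ≤ A * A * Z * (m + 5 + 4 * m * 𝟙 (L ≤? A * m))
    G-bound = ≤-trans (*-monoʳ-≤ (2 * m) (≤-trans reindex (≤-trans (∑-extend (λ i → X (suc i)) (n≤1+n n)) (≤-reflexive (∑-first n (λ i → X (suc i)))))))
        (≤-trans (≤-reflexive (l₁ m (X 1) (∑ n (λ i → X (2 + i))))) (≤-trans (+-mono-≤ head (*-monoʳ-≤ 2 rest)) (≤-reflexive (l₂ (A * A * Z) m (𝟙 (L ≤? A * m))))))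
      where
      l₁ : ∀ m x s → 2 * m * (x + s) ≡ 2 * m * x + 2 * (m * s)
      l₁ = solve-∀
      l₂ : ∀ a m i → a * (suc m + 4 * m * i) + 2 * (2 * a) ≡ a * (m + 5 + 4 * m * i)
      l₂ = solve-∀
      head : 2 * m * X 1 ≤ A * A * Z * (suc m + 4 * m * 𝟙 (L ≤? A * m))
      head = go (L ≤? A * m)
        where
        A1 : A * 1 ≡ A
        A1 = *-identityʳ A
        go : (dec : Dec (L ≤ A * m)) → 2 * m * X 1 ≤ A * A * Z * (suc m + 4 * m * 𝟙 dec)
        go (yes _) = ≤-trans (*-monoʳ-≤ (2 * m) (≤-trans 1-tail (crude 1 ≤-refl))) (≤-trans (≤-reflexive (trans (cong (λ z → 2 * m * (2 * (z * z * Z))) A1) (l m (A * A * Z)))) (*-monoʳ-≤ (A * A * Z) (m≤n+m _ (suc m))))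
          where l : ∀ m a → 2 * m * (2 * a) ≡ a * (4 * m * 1)
                l = solve-∀
        go (no nle) = ≤-trans (*-monoʳ-≤ (2 * m) 1-tail) (≤-trans (sharp 1 ≤-refl m m≢0 (λ le → nle (subst (λ z → L ≤ z * m) A1 le))) (≤-reflexive (trans (cong (λ z → suc m * (z * z * Z)) A1) (l m (A * A * Z)))))
          where l : ∀ m a → suc m * a ≡ a * (suc m + 4 * m * 0)
                l = solve-∀

  -- `Y d / Z` plays the part of `1 / d⁴`: exactly for `d ≤ n`, and as an upper bound for it to hold
  -- beyond. It allows inequalities with different powers of `d` on the left to be summed over `d`
  -- in the natural numbers.
  commonMultiple : ∀ n → Σ ℕ λ Z → Σ (ℕ → ℕ) λ Y → Z ≢ 0 × (∀ d → 1 ≤ d → Y d * (d * d * d * d) ≤ Z) × (∀ d → 1 ≤ d → d ≤ n → Y d * (d * d * d * d) ≡ Z)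
  commonMultiple n = Z , Y , Z≢0 , Y≤ , Y≡
    where
    open import Data.Nat.Divisibility
    N = n !
    instance N≢0 = n !≢0
    Z = N * N * N * N
    Z≢0 : Z ≢ 0
    Z≢0 = ≢-nonZero⁻¹ Z {{m*n≢0 (N * N * N) N {{m*n≢0 (N * N) N {{m*n≢0 N N}}}}}}
    y : ∀ d → Dec (d ∣ N) → ℕ
    y d (yes h) = quotient h * quotient h * quotient h * quotient h
    y d (no _) = 0
    Y : ℕ → ℕ
    Y d = y d (d ∣? N)
    exact : ∀ d (h : d ∣ N) → quotient h * quotient h * quotient h * quotient h * (d * d * d * d) ≡ Z
    exact d h = trans (l (quotient h) d) (cong (λ z → z * z * z * z) (sym (m∣n⇒n≡quotient*m h)))
      where l : ∀ q d → q * q * q * q * (d * d * d * d) ≡ q * d * (q * d) * (q * d) * (q * d)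
            l = solve-∀
    Y≤ : ∀ d → 1 ≤ d → Y d * (d * d * d * d) ≤ Z
    Y≤ d _ with d ∣? N
    ... | yes h = ≤-reflexive (exact d h)
    ... | no _ = z≤n
    Y≡ : ∀ d → 1 ≤ d → d ≤ n → Y d * (d * d * d * d) ≡ Z
    Y≡ (suc d) _ d≤n with suc d ∣? N
    ... | yes h = exact (suc d) h
    ... | no nd = ⊥-elim (nd (∣-trans (m∣m*n (d !)) (m≤n⇒m!∣n! d≤n)))

  open import Defs using (TernaryForm)
  open Arithmetic
  import Data.Nat.Divisibility as ℕD
  open import Data.Nat.GCD using (gcd; gcd[m,n]∣m; gcd[m,n]∣n; gcd-greatest)
  open import Data.Nat.Primality using (Prime; prime?; prime[2])
  open import Data.Integer using (ℤ; +_; -[1+_]; ∣_∣) renaming (_+_ to _+ᶻ_; _*_ to _*ᶻ_; _-_ to _-ᶻ_; -_ to -ᶻ_)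
  import Data.Integer as ℤ
  import Data.Integer.Properties as ℤP
  open import Data.Integer.DivMod using (_%ℕ_; _/ℕ_; n%ℕd<d; a≡a%ℕn+[a/ℕn]*n)
  open import Data.Integer.Divisibility.Signed as ℤD using (_∣_; divides; _∣?_; ∣ᵤ⇒∣; ∣⇒∣ᵤ; ∣m∣n⇒∣m-n; ∣m∣n⇒∣m+n)
  open import Data.Integer.Tactic.RingSolver using () renaming (solve-∀ to solveᶻ)

  -- Counting solutions of congruences

  coprime-of-primes : ∀ m n → n ≢ 0 → (∀ p → Prime p → p ℕD.∣ m → p ℕD.∣ n → ⊥) → Coprime m n
  coprime-of-primes m n n≢0 h {zero} (_ , d) = ⊥-elim (n≢0 (ℕD.0∣⇒≡0 d))
  coprime-of-primes m n n≢0 h {suc zero} _ = refl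
  coprime-of-primes m n n≢0 h {suc (suc d)} (d∣m , d∣n) =
    let (p , pp , p∣d) = exists-prime-divisor (suc (suc d)) (s≤s (s≤s z≤n))
    in ⊥-elim (h p pp (ℕD.∣-trans p∣d d∣m) (ℕD.∣-trans p∣d d∣n))

  pos-∸ : ∀ {i j} → i ≤ j → + (j ∸ i) ≡ + j -ᶻ + i
  pos-∸ {i} {j} i≤j = sym (trans (ℤP.m-n≡m⊖n j i) (ℤP.⊖-≥ i≤j))

  reduced-divides : ∀ x m → m ≢ 0 → let β = gcd ∣ x ∣ m in ∀ m' → m ≡ m' * β → ∀ δ → + m ∣ x *ᶻ δ → + m' ∣ δ
  reduced-divides x m m≢0 m' eq δ d = ∣ᵤ⇒∣ (Cop.coprime-divisor cop (ℕD.*-cancelˡ-∣ β d'))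
    where
    β = gcd ∣ x ∣ m
    instance
      β≢0 : NonZero β
      β≢0 = ≢-nonZero (λ e → m≢0 (ℕD.0∣⇒≡0 (subst (ℕD._∣ m) e (gcd[m,n]∣n ∣ x ∣ m))))
    x' = ℕD.quotient (gcd[m,n]∣m ∣ x ∣ m)
    ex : ∣ x ∣ ≡ x' * β
    ex = ℕD.m∣n⇒n≡quotient*m (gcd[m,n]∣m ∣ x ∣ m)
    cop : Coprime m' x'
    cop {d} (d∣m' , d∣x') = ℕD.∣1⇒≡1 (ℕD.*-cancelˡ-∣ β (subst₂ ℕD._∣_ (*-comm d β) (sym (*-identityʳ β))
       (gcd-greatest (subst (d * β ℕD.∣_) (sym ex) (ℕD.*-monoˡ-∣ β d∣x')) (subst (d * β ℕD.∣_) (sym eq) (ℕD.*-monoˡ-∣ β d∣m')))))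
    d' : β * m' ℕD.∣ β * (x' * ∣ δ ∣)
    d' = subst₂ ℕD._∣_ (trans eq (*-comm m' β)) (trans (ℤP.abs-* x δ) (trans (cong (_* ∣ δ ∣) (trans ex (*-comm x' β))) (*-assoc β x' ∣ δ ∣))) (∣⇒∣ᵤ d)

  spaced-of-∣ : ∀ {m i j} → i < j → + m ∣ + j -ᶻ + i → m ≤ j ∸ i
  spaced-of-∣ {m} {i} {j} i<j d = ℕD.∣⇒≤ {{>-nonZero (m<n⇒0<n∸m i<j)}} (subst (λ z → m ℕD.∣ ∣ z ∣) (sym (pos-∸ (<⇒≤ i<j))) (∣⇒∣ᵤ d))

  count-residue : ∀ B m (χ : ℕ → ℕ) → (∀ i → χ i ≤ 1) → (∀ i j → χ i ≢ 0 → χ j ≢ 0 → + m ∣ + j -ᶻ + i) → ∑ (B * m) χ ≤ B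
  count-residue B m χ χ≤1 h = ∑-spaced B m χ χ≤1 (λ i j i<j _ p q → spaced-of-∣ i<j (h i j p q))

  -- Differences of solutions satisfy a linear congruence modulo `m`. With `β = gcd(y , m)` and
  -- `γ = gcd(x , β)`, a row has at most `2 β` solutions, and rows with any solution lie in one
  -- class modulo `β / γ`, so there are at most `2 m γ / β` of them.
  count-linear : ∀ (P x y : ℤ) m → m ≢ 0 →
    ∑² (2 * m) (λ t u → 𝟙 (+ (2 * m) ∣? P -ᶻ + 2 *ᶻ + t *ᶻ x -ᶻ + 2 *ᶻ + u *ᶻ y)) ≤ 4 * (m * gcd ∣ x ∣ (gcd ∣ y ∣ m))
  count-linear P x y m m≢0 = ≤-trans (∑-mono (2 * m) row) (≤-trans (≤-reflexive (∑-*ˡ (2 * m) (2 * β) τ))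
      (≤-trans (*-monoʳ-≤ (2 * β) col) (≤-reflexive (trans (lem β m' γ) (cong (λ z → 4 * (z * γ)) (sym em))))))
    where
    β = gcd ∣ y ∣ m
    γ = gcd ∣ x ∣ β
    m' = ℕD.quotient (gcd[m,n]∣n ∣ y ∣ m)
    em : m ≡ m' * β
    em = ℕD.m∣n⇒n≡quotient*m (gcd[m,n]∣n ∣ y ∣ m)
    β≢0 : β ≢ 0
    β≢0 e = m≢0 (trans em (trans (cong (m' *_) e) (*-zeroʳ m')))
    β' = ℕD.quotient (gcd[m,n]∣n ∣ x ∣ β)
    eβ : β ≡ β' * γ
    eβ = ℕD.m∣n⇒n≡quotient*m (gcd[m,n]∣n ∣ x ∣ β)
    lem : ∀ β m' γ → 2 * β * (2 * (m' * γ)) ≡ 4 * (m' * β * γ)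
    lem = solve-∀
    L : ℕ → ℕ → ℤ
    L t u = P -ᶻ + 2 *ᶻ + t *ᶻ x -ᶻ + 2 *ᶻ + u *ᶻ y
    χ : ℕ → ℕ → ℕ
    χ t u = 𝟙 (+ (2 * m) ∣? L t u)
    halve : ∀ z → + (2 * m) ∣ + 2 *ᶻ z → + m ∣ z
    halve z d = ℤD.*-cancelˡ-∣ (+ 2) {+ m} {z} (subst (_∣ + 2 *ᶻ z) (ℤP.pos-* 2 m) d)
    diff : ∀ t u t' u' → χ t u ≢ 0 → χ t' u' ≢ 0 → + m ∣ x *ᶻ (+ t' -ᶻ + t) +ᶻ y *ᶻ (+ u' -ᶻ + u)
    diff t u t' u' p q = halve _ (∣-eq (∣m∣n⇒∣m-n (𝟙-true (_ ∣? L t u) p) (𝟙-true (_ ∣? L t' u') q)) (id' P x y (+ t) (+ u) (+ t') (+ u')))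
      where id' : ∀ P x y t u t' u' → P -ᶻ + 2 *ᶻ t *ᶻ x -ᶻ + 2 *ᶻ u *ᶻ y -ᶻ (P -ᶻ + 2 *ᶻ t' *ᶻ x -ᶻ + 2 *ᶻ u' *ᶻ y) ≡ + 2 *ᶻ (x *ᶻ (t' -ᶻ t) +ᶻ y *ᶻ (u' -ᶻ u))
            id' = solveᶻ
    rowcount : ∀ t → ∑ (2 * m) (χ t) ≤ 2 * β
    rowcount t = subst (λ n → ∑ n (χ t) ≤ 2 * β) (trans (*-assoc 2 β m') (cong (2 *_) (trans (*-comm β m') (sym em))))
      (count-residue (2 * β) m' (χ t) (λ u → 𝟙≤1 (_ ∣? L t u)) λ u u' p q →
        reduced-divides y m m≢0 m' em (+ u' -ᶻ + u) (∣-eq (diff t u t u' p q) (id' x y (+ t) (+ u' -ᶻ + u))))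
      where id' : ∀ x y t s → x *ᶻ (t -ᶻ t) +ᶻ y *ᶻ s ≡ y *ᶻ s
            id' = solveᶻ
    τ : ℕ → ℕ
    τ t = 𝟙 (1 ≤? ∑ (2 * m) (χ t))
    row : ∀ t → t < 2 * m → ∑ (2 * m) (χ t) ≤ 2 * β * τ t
    row t _ = go (1 ≤? ∑ (2 * m) (χ t))
      where go : (dec : Dec (1 ≤ ∑ (2 * m) (χ t))) → ∑ (2 * m) (χ t) ≤ 2 * β * 𝟙 dec
            go (yes _) = ≤-trans (rowcount t) (≤-reflexive (sym (*-identityʳ (2 * β))))
            go (no h) = ≤-trans (≤-reflexive (n<1⇒n≡0 (≰⇒> h))) z≤n
    col : ∑ (2 * m) τ ≤ 2 * (m' * γ)
    col = subst (λ n → ∑ n τ ≤ 2 * (m' * γ)) (trans (lem' m' γ β') (cong (2 *_) (sym (trans em (cong (m' *_) eβ)))))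
      (count-residue (2 * (m' * γ)) β' τ (λ t → 𝟙≤1 (1 ≤? ∑ (2 * m) (χ t))) λ t t' p q →
        let (u , _ , pu) = ∑-positive (2 * m) (χ t) (λ e → n≮0 (subst (1 ≤_) e (𝟙-true (1 ≤? ∑ (2 * m) (χ t)) p)))
            (u' , _ , qu) = ∑-positive (2 * m) (χ t') (λ e → n≮0 (subst (1 ≤_) e (𝟙-true (1 ≤? ∑ (2 * m) (χ t')) q)))
        in reduced-divides x β β≢0 β' eβ (+ t' -ᶻ + t) (β∣ (+ t' -ᶻ + t) (+ u' -ᶻ + u) (diff t u t' u' pu qu)))
      where
      lem' : ∀ m γ β → 2 * (m * γ) * β ≡ 2 * (m * (β * γ))
      lem' = solve-∀
      β∣ : ∀ s r → + m ∣ x *ᶻ s +ᶻ y *ᶻ r → + β ∣ x *ᶻ s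
      β∣ s r d = ℤD.∣m+n∣n⇒∣m {+ β} {x *ᶻ s} {y *ᶻ r} (ℤD.∣-trans (∣ᵤ⇒∣ (gcd[m,n]∣n ∣ y ∣ m)) d) (ℤD.∣m⇒∣m*n {+ β} {y} r (∣ᵤ⇒∣ {+ β} {y} (gcd[m,n]∣m ∣ y ∣ m)))

  -- What the counting needs to know of the values of `f` along the frame. `H` is the factor built
  -- from primes of `F` that the linear coefficients share; it divides `q` and `α₀` too, so whole
  -- congruences can be divided by it. After that, `jointly-prime` excludes primes of `F` from the
  -- common divisors, and `coprime-F` makes all other primes harmless.
  record Family : Set where
    field
      a q' H F : ℕ
      b c α₀' α₁' α₂' : ℤ
      a≢0 : a ≢ 0
      q'≢0 : q' ≢ 0
      H≢0 : H ≢ 0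
      F≢0 : F ≢ 0
      2∣F : 2 ℕD.∣ F
      F∣q' : F ℕD.∣ q'
      jointly-prime : ∀ p → Prime p → p ℕD.∣ F → ¬ ((+ p ∣ α₁') × (+ p ∣ α₂'))
      coprime-F : ∀ e → Coprime e F → Coprime e (q' * a) × Coprime e (q' * ∣ b ∣) × Coprime e (q' * ∣ c ∣)
    q : ℕ
    q = H * q'
    α₀ : ℤ
    α₀ = + H *ᶻ α₀'
    α₁ : ℤ
    α₁ = + H *ᶻ α₁'
    α₂ : ℤ
    α₂ = + H *ᶻ α₂'
    -- values of the family, relative to the base point and divided by q
    g : ℕ → ℕ → ℤ
    g t u = α₁ *ᶻ + t +ᶻ α₂ *ᶻ + u +ᶻ + q *ᶻ (b *ᶻ (+ t *ᶻ + t) +ᶻ c *ᶻ (+ u *ᶻ + u))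
    k : ℕ → ℕ → ℕ → ℕ → ℤ
    k t u t' u' = g t' u' -ᶻ g t u
    modulus : ℕ → ℕ
    modulus d = 2 * (q * (a * d))
    -- For the quadratic `h(i) = α₀ i + q a i²` one has `h(j + d) - h(j) = κ d + j * modulus d`.
    -- Modulo `modulus d` the base index `j` of a collision therefore disappears.
    κ : ℕ → ℤ
    κ d = + d *ᶻ (α₀ +ᶻ + (q * (a * d)))
    χ : ℕ → ℕ → ℕ → ℕ → ℕ → ℕ
    χ d t u t' u' = 𝟙 (+ modulus d ∣? k t u t' u' -ᶻ κ d)

  module Count (𝓕 : Family) where
    open Family 𝓕
    module _ (d : ℕ) (d≢0 : d ≢ 0) where
      private
        m = q * (a * d)
        M = modulus d
        q≢0 : q ≢ 0
        q≢0 e = [ H≢0 , q'≢0 ]′ (m*n≡0⇒m≡0∨n≡0 H e)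
        m≢0 : m ≢ 0
        m≢0 e = [ q≢0 , (λ e' → [ a≢0 , d≢0 ]′ (m*n≡0⇒m≡0∨n≡0 a e')) ]′ (m*n≡0⇒m≡0∨n≡0 q e)

        ω₁' ω₂' ω₁ ω₂ : ℕ → ℤ
        ω₁' W = α₁' +ᶻ + q' *ᶻ b *ᶻ + W
        ω₂' W = α₂' +ᶻ + q' *ᶻ c *ᶻ + W
        ω₁ W = + H *ᶻ ω₁' W
        ω₂ W = + H *ᶻ ω₂' W
        P : ℕ → ℕ → ℤ
        P W₁ W₂ = + W₁ *ᶻ ω₁ W₁ +ᶻ + W₂ *ᶻ ω₂ W₂ -ᶻ κ d
        Q : ℕ → ℕ → ℕ → ℕ → ℤ
        Q t u W₁ W₂ = P W₁ W₂ -ᶻ + 2 *ᶻ + t *ᶻ ω₁ W₁ -ᶻ + 2 *ᶻ + u *ᶻ ω₂ W₂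

        k-W : ∀ t u t' u' → k t u t' u' -ᶻ κ d ≡ Q t u (t + t') (u + u')
        k-W t u t' u' = trans (cong (λ z →
            (α₁ *ᶻ + t' +ᶻ α₂ *ᶻ + u' +ᶻ z *ᶻ (b *ᶻ (+ t' *ᶻ + t') +ᶻ c *ᶻ (+ u' *ᶻ + u'))) -ᶻ (α₁ *ᶻ + t +ᶻ α₂ *ᶻ + u +ᶻ z *ᶻ (b *ᶻ (+ t *ᶻ + t) +ᶻ c *ᶻ (+ u *ᶻ + u))) -ᶻ κ d) (ℤP.pos-* H q'))
          (id' (+ H) (+ q') b c α₁' α₂' (κ d) (+ t) (+ u) (+ t') (+ u'))
          where
          id' : ∀ H q b c α β κ t u t' u' →
            (H *ᶻ α *ᶻ t' +ᶻ H *ᶻ β *ᶻ u' +ᶻ H *ᶻ q *ᶻ (b *ᶻ (t' *ᶻ t') +ᶻ c *ᶻ (u' *ᶻ u'))) -ᶻ (H *ᶻ α *ᶻ t +ᶻ H *ᶻ β *ᶻ u +ᶻ H *ᶻ q *ᶻ (b *ᶻ (t *ᶻ t) +ᶻ c *ᶻ (u *ᶻ u))) -ᶻ κ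
            ≡ ((t +ᶻ t') *ᶻ (H *ᶻ (α +ᶻ q *ᶻ b *ᶻ (t +ᶻ t'))) +ᶻ (u +ᶻ u') *ᶻ (H *ᶻ (β +ᶻ q *ᶻ c *ᶻ (u +ᶻ u'))) -ᶻ κ)
              -ᶻ + 2 *ᶻ t *ᶻ (H *ᶻ (α +ᶻ q *ᶻ b *ᶻ (t +ᶻ t'))) -ᶻ + 2 *ᶻ u *ᶻ (H *ᶻ (β +ᶻ q *ᶻ c *ᶻ (u +ᶻ u')))
          id' = solveᶻ

        φ : ℕ → ℕ → ℕ → ℕ → ℕ
        φ t u W₁ W₂ = 𝟙 (+ M ∣? Q t u W₁ W₂)

        periodic₁ : ∀ t u W₂ W₁ → φ t u (W₁ + M) W₂ ≡ φ t u W₁ W₂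
        periodic₁ t u W₂ W₁ = 𝟙-cong (+ M ∣? Q t u (W₁ + M) W₂) (+ M ∣? Q t u W₁ W₂)
          (λ h → ∣-eq (∣m∣n⇒∣m-n h (ℤD.∣m⇒∣m*n S (ℤD.∣-refl {+ M}))) (sym eq'))
          (λ h → ∣-eq (∣m∣n⇒∣m+n h (ℤD.∣m⇒∣m*n S (ℤD.∣-refl {+ M}))) (sym eq))
          where
          S : ℤ
          S = + H *ᶻ (α₁' +ᶻ + q' *ᶻ b *ᶻ (+ W₁ +ᶻ + W₁ +ᶻ + M) -ᶻ + 2 *ᶻ + t *ᶻ (+ q' *ᶻ b))
          eq : Q t u (W₁ + M) W₂ ≡ Q t u W₁ W₂ +ᶻ + M *ᶻ S
          eq = id' (+ H) (+ q' *ᶻ b) α₁' (+ W₁) (+ M) (+ t) (+ W₂ *ᶻ ω₂ W₂) (κ d) (+ 2 *ᶻ + u *ᶻ ω₂ W₂)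
            where id' : ∀ H b α w m t r κ v → (w +ᶻ m) *ᶻ (H *ᶻ (α +ᶻ b *ᶻ (w +ᶻ m))) +ᶻ r -ᶻ κ -ᶻ + 2 *ᶻ t *ᶻ (H *ᶻ (α +ᶻ b *ᶻ (w +ᶻ m))) -ᶻ v
                    ≡ (w *ᶻ (H *ᶻ (α +ᶻ b *ᶻ w)) +ᶻ r -ᶻ κ -ᶻ + 2 *ᶻ t *ᶻ (H *ᶻ (α +ᶻ b *ᶻ w)) -ᶻ v) +ᶻ m *ᶻ (H *ᶻ (α +ᶻ b *ᶻ (w +ᶻ w +ᶻ m) -ᶻ + 2 *ᶻ t *ᶻ b))
                  id' = solveᶻ
          eq' : Q t u W₁ W₂ ≡ Q t u (W₁ + M) W₂ -ᶻ + M *ᶻ S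
          eq' = trans (l (Q t u W₁ W₂) (+ M *ᶻ S)) (cong (_-ᶻ + M *ᶻ S) (sym eq))
            where l : ∀ x y → x ≡ x +ᶻ y -ᶻ y
                  l = solveᶻ

        periodic₂ : ∀ t u W₁ W₂ → φ t u W₁ (W₂ + M) ≡ φ t u W₁ W₂
        periodic₂ t u W₁ W₂ = 𝟙-cong (+ M ∣? Q t u W₁ (W₂ + M)) (+ M ∣? Q t u W₁ W₂)
          (λ h → ∣-eq (∣m∣n⇒∣m-n h (ℤD.∣m⇒∣m*n S (ℤD.∣-refl {+ M}))) (sym eq'))
          (λ h → ∣-eq (∣m∣n⇒∣m+n h (ℤD.∣m⇒∣m*n S (ℤD.∣-refl {+ M}))) (sym eq))
          where
          S : ℤ
          S = + H *ᶻ (α₂' +ᶻ + q' *ᶻ c *ᶻ (+ W₂ +ᶻ + W₂ +ᶻ + M) -ᶻ + 2 *ᶻ + u *ᶻ (+ q' *ᶻ c))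
          eq : Q t u W₁ (W₂ + M) ≡ Q t u W₁ W₂ +ᶻ + M *ᶻ S
          eq = id' (+ H) (+ q' *ᶻ c) α₂' (+ W₂) (+ M) (+ u) (+ W₁ *ᶻ ω₁ W₁) (κ d) (+ 2 *ᶻ + t *ᶻ ω₁ W₁)
            where id' : ∀ H b α w m t r κ v → r +ᶻ (w +ᶻ m) *ᶻ (H *ᶻ (α +ᶻ b *ᶻ (w +ᶻ m))) -ᶻ κ -ᶻ v -ᶻ + 2 *ᶻ t *ᶻ (H *ᶻ (α +ᶻ b *ᶻ (w +ᶻ m)))
                    ≡ (r +ᶻ w *ᶻ (H *ᶻ (α +ᶻ b *ᶻ w)) -ᶻ κ -ᶻ v -ᶻ + 2 *ᶻ t *ᶻ (H *ᶻ (α +ᶻ b *ᶻ w))) +ᶻ m *ᶻ (H *ᶻ (α +ᶻ b *ᶻ (w +ᶻ w +ᶻ m) -ᶻ + 2 *ᶻ t *ᶻ b))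
                  id' = solveᶻ
          eq' : Q t u W₁ W₂ ≡ Q t u W₁ (W₂ + M) -ᶻ + M *ᶻ S
          eq' = trans (l (Q t u W₁ W₂) (+ M *ᶻ S)) (cong (_-ᶻ + M *ᶻ S) (sym eq))
            where l : ∀ x y → x ≡ x +ᶻ y -ᶻ y
                  l = solveᶻ

        substitute : ∑⁴ M (χ d) ≡ ∑² M (λ W₁ W₂ → ∑² M (λ t u → φ t u W₁ W₂))
        substitute = trans (∑²-cong M (λ t u _ _ → trans (∑²-cong M (λ t' u' _ _ → cong (λ z → 𝟙 (+ M ∣? z)) (k-W t u t' u')))
            (trans (∑-cong M (λ t' _ → ∑-shift M (φ t u (t + t')) (periodic₂ t u (t + t')) u))
                   (∑-shift M (λ W₁ → ∑ M (φ t u W₁)) (λ W₁ → ∑-cong M (λ W₂ _ → periodic₁ t u W₂ W₁)) t))))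
          (∑²-swap M M φ)

        -- What solvability requires modulo 2 after division by `H`: `q'` and the coefficients of
        -- `t` and `u` are even. Only half of all `(W₁ , W₂)` survive, and this compensates for the
        -- doubled number of solutions that `count-linear` allows at the surviving ones.
        parity : ℕ → ℕ → ℤ
        parity W₁ W₂ = α₁' *ᶻ + W₁ +ᶻ α₂' *ᶻ + W₂ -ᶻ + d *ᶻ α₀'

        Cell : ℕ → ℕ → ℕ → ℕ
        Cell e W₁ W₂ = 𝟙 (+ e ∣? ω₁' W₁) * 𝟙 (+ e ∣? ω₂' W₂) * 𝟙 (+ 2 ∣? parity W₁ W₂)

        pairs : ∀ (X : ℕ → ℕ → ℕ) → ℕ
        pairs X = ∑ (suc d) (λ e → ∑ (suc d) (λ d' → 𝟙 (e * d' ≟ d) * 𝟙 (coprime? e F) * X e d'))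

        parity-of : ∀ W₁ W₂ t u → + M ∣ Q t u W₁ W₂ → + 2 ∣ parity W₁ W₂
        parity-of W₁ W₂ t u h = ∣-eq (∣m∣n⇒∣m-n (∣m∣n⇒∣m+n (ℤD.∣-trans 2∣2q'ad d1) (ℤD.∣m⇒∣m*n Y (ℤD.∣-refl {+ 2}))) (ℤD.∣m⇒∣m*n R 2∣q'))
            (id' (+ q') (+ a) (+ d) b c α₀' α₁' α₂' (+ W₁) (+ W₂) (+ t) (+ u))
          where
          x = + q' *ᶻ (+ a *ᶻ + d)
          Y = + t *ᶻ ω₁' W₁ +ᶻ + u *ᶻ ω₂' W₂
          R₁ = + W₁ *ᶻ ω₁' W₁ +ᶻ + W₂ *ᶻ ω₂' W₂ -ᶻ + d *ᶻ (α₀' +ᶻ x) -ᶻ + 2 *ᶻ + t *ᶻ ω₁' W₁ -ᶻ + 2 *ᶻ + u *ᶻ ω₂' W₂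
          R = b *ᶻ (+ W₁ *ᶻ + W₁) +ᶻ c *ᶻ (+ W₂ *ᶻ + W₂) -ᶻ + d *ᶻ (+ a *ᶻ + d)
          2∣q' : + 2 ∣ + q'
          2∣q' = ∣ᵤ⇒∣ (ℕD.∣-trans 2∣F F∣q')
          m-eq : + m ≡ + H *ᶻ x
          m-eq = trans (ℤP.pos-* q (a * d)) (trans (cong₂ _*ᶻ_ (ℤP.pos-* H q') (ℤP.pos-* a d)) (ℤP.*-assoc (+ H) (+ q') (+ a *ᶻ + d)))
          M-eq : + M ≡ + H *ᶻ (+ 2 *ᶻ x)
          M-eq = trans (ℤP.pos-* 2 m) (trans (cong (_*ᶻ_ (+ 2)) m-eq) (l (+ H) x))
            where l : ∀ h x → + 2 *ᶻ (h *ᶻ x) ≡ h *ᶻ (+ 2 *ᶻ x)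
                  l = solveᶻ
          Q-eq : Q t u W₁ W₂ ≡ + H *ᶻ R₁
          Q-eq = trans (cong (λ z → + W₁ *ᶻ ω₁ W₁ +ᶻ + W₂ *ᶻ ω₂ W₂ -ᶻ + d *ᶻ (α₀ +ᶻ z) -ᶻ + 2 *ᶻ + t *ᶻ ω₁ W₁ -ᶻ + 2 *ᶻ + u *ᶻ ω₂ W₂) m-eq)
             (l (+ H) (+ W₁) (ω₁' W₁) (+ W₂) (ω₂' W₂) (+ d) α₀' x (+ t) (+ u))
            where l : ∀ H w o w' o' d α m t u → w *ᶻ (H *ᶻ o) +ᶻ w' *ᶻ (H *ᶻ o') -ᶻ d *ᶻ (H *ᶻ α +ᶻ H *ᶻ m) -ᶻ + 2 *ᶻ t *ᶻ (H *ᶻ o) -ᶻ + 2 *ᶻ u *ᶻ (H *ᶻ o')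
                     ≡ H *ᶻ (w *ᶻ o +ᶻ w' *ᶻ o' -ᶻ d *ᶻ (α +ᶻ m) -ᶻ + 2 *ᶻ t *ᶻ o -ᶻ + 2 *ᶻ u *ᶻ o')
                  l = solveᶻ
          d1 : + 2 *ᶻ x ∣ R₁
          d1 = ℤD.*-cancelˡ-∣ (+ H) {{≢-nonZero H≢0}} (∣-eq (subst (_∣ Q t u W₁ W₂) M-eq h) Q-eq)
          2∣2q'ad : + 2 ∣ + 2 *ᶻ x
          2∣2q'ad = ℤD.∣m⇒∣m*n x (ℤD.∣-refl {+ 2})
          id' : ∀ q a d b c α₀ α₁ α₂ w w' t u →
            (w *ᶻ (α₁ +ᶻ q *ᶻ b *ᶻ w) +ᶻ w' *ᶻ (α₂ +ᶻ q *ᶻ c *ᶻ w') -ᶻ d *ᶻ (α₀ +ᶻ q *ᶻ (a *ᶻ d)) -ᶻ + 2 *ᶻ t *ᶻ (α₁ +ᶻ q *ᶻ b *ᶻ w) -ᶻ + 2 *ᶻ u *ᶻ (α₂ +ᶻ q *ᶻ c *ᶻ w'))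
              +ᶻ + 2 *ᶻ (t *ᶻ (α₁ +ᶻ q *ᶻ b *ᶻ w) +ᶻ u *ᶻ (α₂ +ᶻ q *ᶻ c *ᶻ w'))
              -ᶻ q *ᶻ (b *ᶻ (w *ᶻ w) +ᶻ c *ᶻ (w' *ᶻ w') -ᶻ d *ᶻ (a *ᶻ d))
            ≡ α₁ *ᶻ w +ᶻ α₂ *ᶻ w' -ᶻ d *ᶻ α₀
          id' = solveᶻ

        term-≤-pairs : ∀ X e d' → e * d' ≡ d → Coprime e F → X e d' ≤ pairs X
        term-≤-pairs X e d' eq cop = ≤-trans (≤-reflexive (sym (trans (cong₂ (λ y z → y * z * X e d') (𝟙-yes (e * d' ≟ d) eq) (𝟙-yes (coprime? e F) cop)) (+-identityʳ (X e d')))))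
          (≤-trans (∑-term (suc d) (λ d' → 𝟙 (e * d' ≟ d) * 𝟙 (coprime? e F) * X e d') d' (s≤s (ℕD.∣⇒≤ {{≢-nonZero d≢0}} (ℕD.divides e (sym eq)))))
                   (∑-term (suc d) (λ e → ∑ (suc d) (λ d' → 𝟙 (e * d' ≟ d) * 𝟙 (coprime? e F) * X e d')) e (s≤s (ℕD.∣⇒≤ {{≢-nonZero d≢0}} (ℕD.divides d' (trans (sym eq) (*-comm e d')))))))

        pairs-mono : ∀ X Y → (∀ e d' → e * d' ≡ d → Coprime e F → X e d' ≤ Y e d') → pairs X ≤ pairs Y
        pairs-mono X Y le = ∑-mono (suc d) (λ e _ → ∑-mono (suc d) (λ d' _ → go e d' (e * d' ≟ d) (coprime? e F)))
          where
          go : ∀ e d' (D : Dec (e * d' ≡ d)) (E : Dec (Coprime e F)) → 𝟙 D * 𝟙 E * X e d' ≤ 𝟙 D * 𝟙 E * Y e d'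
          go e d' (no _) _ = z≤n
          go e d' (yes _) (no _) = z≤n
          go e d' (yes eq) (yes cop) = *-monoʳ-≤ 1 (le e d' eq cop)

        -- The number of solutions is governed by the common divisor `H γ'` of `ω₁`, `ω₂` and `m`.
        -- By `jointly-prime`, `γ'` is prime to `F` and so divides `d`. Summing over all divisors
        -- prime to `F` removes its dependence on `W₁`, `W₂`.
        solved : ∀ W₁ W₂ t u → + M ∣ Q t u W₁ W₂ → 4 * (m * gcd ∣ ω₁ W₁ ∣ (gcd ∣ ω₂ W₂ ∣ m)) ≤ pairs (λ e d' → M * (2 * (H * e)) * Cell e W₁ W₂)
        solved W₁ W₂ t u h = ≤-trans (≤-reflexive val) (term-≤-pairs (λ e d' → M * (2 * (H * e)) * Cell e W₁ W₂) γ' d' γ'd' cop)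
          where
          γ = gcd ∣ ω₁ W₁ ∣ (gcd ∣ ω₂ W₂ ∣ m)
          abs₁ : ∣ ω₁ W₁ ∣ ≡ H * ∣ ω₁' W₁ ∣
          abs₁ = ℤP.abs-* (+ H) (ω₁' W₁)
          abs₂ : ∣ ω₂ W₂ ∣ ≡ H * ∣ ω₂' W₂ ∣
          abs₂ = ℤP.abs-* (+ H) (ω₂' W₂)
          m-eq : m ≡ H * (q' * a * d)
          m-eq = l H q' a d where l : ∀ h q a d → h * q * (a * d) ≡ h * (q * a * d)
                                  l = solve-∀
          H∣γ : H ℕD.∣ γ
          H∣γ = gcd-greatest (subst (H ℕD.∣_) (sym abs₁) (ℕD.m∣m*n _)) (gcd-greatest (subst (H ℕD.∣_) (sym abs₂) (ℕD.m∣m*n _)) (subst (H ℕD.∣_) (sym m-eq) (ℕD.m∣m*n _)))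
          γ' = ℕD.quotient H∣γ
          γ-eq : γ ≡ H * γ'
          γ-eq = ℕD.m∣n⇒n≡m*quotient H∣γ
          canc : ∀ {y z} → γ ℕD.∣ y → y ≡ H * z → γ' ℕD.∣ z
          canc {y} {z} dv e = ℕD.*-cancelˡ-∣ H {{≢-nonZero H≢0}} (subst₂ ℕD._∣_ γ-eq e dv)
          ∣₁ : γ' ℕD.∣ ∣ ω₁' W₁ ∣
          ∣₁ = canc (gcd[m,n]∣m ∣ ω₁ W₁ ∣ (gcd ∣ ω₂ W₂ ∣ m)) abs₁
          ∣₂ : γ' ℕD.∣ ∣ ω₂' W₂ ∣
          ∣₂ = canc (ℕD.∣-trans (gcd[m,n]∣n ∣ ω₁ W₁ ∣ (gcd ∣ ω₂ W₂ ∣ m)) (gcd[m,n]∣m ∣ ω₂ W₂ ∣ m)) abs₂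
          ∣₃ : γ' ℕD.∣ q' * a * d
          ∣₃ = canc (ℕD.∣-trans (gcd[m,n]∣n ∣ ω₁ W₁ ∣ (gcd ∣ ω₂ W₂ ∣ m)) (gcd[m,n]∣n ∣ ω₂ W₂ ∣ m)) m-eq
          strip : ∀ p α β W → p ℕD.∣ F → + p ∣ α +ᶻ + q' *ᶻ β *ᶻ + W → + p ∣ α
          strip p α β W p∣F dv = ℤD.∣m+n∣n⇒∣m {+ p} {α} {+ q' *ᶻ β *ᶻ + W} dv (ℤD.∣m⇒∣m*n {+ p} {+ q' *ᶻ β} (+ W) (ℤD.∣m⇒∣m*n {+ p} {+ q'} β (∣ᵤ⇒∣ {+ p} {+ q'} (ℕD.∣-trans p∣F F∣q'))))
          cop : Coprime γ' F
          cop = coprime-of-primes γ' F F≢0 λ p pp p∣γ' p∣F → jointly-prime p pp p∣F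
            (strip p α₁' b W₁ p∣F (∣ᵤ⇒∣ (ℕD.∣-trans p∣γ' ∣₁)) , strip p α₂' c W₂ p∣F (∣ᵤ⇒∣ (ℕD.∣-trans p∣γ' ∣₂)))
          γ'∣d : γ' ℕD.∣ d
          γ'∣d = Cop.coprime-divisor (proj₁ (coprime-F γ' cop)) ∣₃
          d' = ℕD.quotient γ'∣d
          γ'd' : γ' * d' ≡ d
          γ'd' = sym (ℕD.m∣n⇒n≡m*quotient γ'∣d)
          val : 4 * (m * γ) ≡ M * (2 * (H * γ')) * Cell γ' W₁ W₂
          val = trans (cong (λ z → 4 * (m * z)) γ-eq) (trans (l m (H * γ')) (sym (cong (M * (2 * (H * γ')) *_)
            (cong₂ _*_ (cong₂ _*_ (𝟙-yes (+ γ' ∣? ω₁' W₁) (∣ᵤ⇒∣ ∣₁)) (𝟙-yes (+ γ' ∣? ω₂' W₂) (∣ᵤ⇒∣ ∣₂))) (𝟙-yes (+ 2 ∣? parity W₁ W₂) (parity-of W₁ W₂ t u h))))))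
            where l : ∀ m z → 4 * (m * z) ≡ 2 * m * (2 * z) * 1
                  l = solve-∀

        inner : ∀ W₁ W₂ → ∑² M (λ t u → φ t u W₁ W₂) ≤ pairs (λ e d' → M * (2 * (H * e)) * Cell e W₁ W₂)
        inner W₁ W₂ = [ (λ e → ≤-trans (≤-reflexive e) z≤n) , some ]′ (toSum (∑² M (λ t u → φ t u W₁ W₂) ≟ 0))
          where
          some : ∑² M (λ t u → φ t u W₁ W₂) ≢ 0 → ∑² M (λ t u → φ t u W₁ W₂) ≤ pairs (λ e d' → M * (2 * (H * e)) * Cell e W₁ W₂)
          some ne = let (t , _ , h) = ∑-positive M (λ t → ∑ M (λ u → φ t u W₁ W₂)) ne
                        (u , _ , h') = ∑-positive M (λ u → φ t u W₁ W₂) h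
                    in ≤-trans (count-linear (P W₁ W₂) (ω₁ W₁) (ω₂ W₂) m m≢0) (solved W₁ W₂ t u (𝟙-true (+ M ∣? Q t u W₁ W₂) h'))

        class-∣ : ∀ e α β W W' → Coprime e (q' * ∣ β ∣) → + e ∣ α +ᶻ + q' *ᶻ β *ᶻ + W → + e ∣ α +ᶻ + q' *ᶻ β *ᶻ + W' → + e ∣ + W' -ᶻ + W
        class-∣ e α β W W' cop h h' = coprime-∣-cancel cop (subst (λ z → + e ∣ + z *ᶻ (+ W' -ᶻ + W)) (ℤP.abs-* (+ q') β)
            (+∣∣* (+ q' *ᶻ β) (+ W' -ᶻ + W) (∣-eq (∣m∣n⇒∣m-n h' h) (l α (+ q' *ᶻ β) (+ W) (+ W')))))
          where l : ∀ α β w w' → α +ᶻ β *ᶻ w' -ᶻ (α +ᶻ β *ᶻ w) ≡ β *ᶻ (w' -ᶻ w)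
                l = solveᶻ

        parity-∣ : ∀ e α x r r' → Coprime e F → ¬ (+ 2 ∣ α) → + e ∣ x → + 2 ∣ r → + 2 ∣ r' → r' -ᶻ r ≡ α *ᶻ x → + (2 * e) ∣ x
        parity-∣ e α x r r' cop odd e∣x h h' eq = subst (_∣ x) (sym (ℤP.pos-* 2 e)) (coprime-∣-* {2} {e} cop2 {x} 2∣x e∣x)
          where
          2∣x : + 2 ∣ x
          2∣x = [ (λ d → ⊥-elim (odd d)) , (λ d → d) ]′ (euclidℤ prime[2] α x (∣-eq (∣m∣n⇒∣m-n h' h) eq))
          cop2 : Coprime 2 e
          cop2 (d∣2 , d∣e) = cop (d∣e , ℕD.∣-trans d∣2 2∣F)

        -- Divisibility by `e` puts each of `W₁`, `W₂` into one class modulo `e`. Since 2 divides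
        -- `F`, one of `α₁'`, `α₂'` is odd, and for that coordinate the parity condition refines the
        -- class to one modulo `2 e`.
        cell-sum : ∀ e d' → e * d' ≡ d → Coprime e F → ∑² M (Cell e) ≤ 2 * (q * a * d') * (q * a * d')
        cell-sum e d' eq cop = by-parity (+ 2 ∣? α₁')
          where
          n = q * a * d'
          M₁ : 2 * n * e ≡ M
          M₁ = trans (l q a d' e) (cong (λ z → 2 * (q * (a * z))) eq)
            where l : ∀ q a d e → 2 * (q * a * d) * e ≡ 2 * (q * (a * (e * d)))
                  l = solve-∀
          M₂ : n * (2 * e) ≡ M
          M₂ = trans (l n e) M₁ where l : ∀ n e → n * (2 * e) ≡ 2 * n * e
                                      l = solve-∀
          χ₁ χ₂ : ℕ → ℕ
          χ₁ W = 𝟙 (+ e ∣? ω₁' W)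
          χ₂ W = 𝟙 (+ e ∣? ω₂' W)
          χₚ : ℕ → ℕ → ℕ
          χₚ W₁ W₂ = 𝟙 (+ 2 ∣? parity W₁ W₂)
          single : ∀ β α → Coprime e (q' * ∣ β ∣) → ∑ M (λ W → 𝟙 (+ e ∣? α +ᶻ + q' *ᶻ β *ᶻ + W)) ≤ 2 * n
          single β α cβ = subst (λ z → ∑ z χ' ≤ 2 * n) M₁ (count-residue (2 * n) e χ' (λ W → 𝟙≤1 (+ e ∣? α +ᶻ + q' *ᶻ β *ᶻ + W))
             λ W W' p p' → class-∣ e α β W W' cβ (𝟙-true (+ e ∣? _) p) (𝟙-true (+ e ∣? _) p'))
            where χ' : ℕ → ℕ
                  χ' W = 𝟙 (+ e ∣? α +ᶻ + q' *ᶻ β *ᶻ + W)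
          cb = proj₁ (proj₂ (coprime-F e cop))
          cc = proj₂ (proj₂ (coprime-F e cop))
          ≤1* : ∀ {x y} → x ≤ 1 → y ≤ 1 → x * y ≤ 1
          ≤1* x≤1 y≤1 = *-mono-≤ x≤1 y≤1
          by-parity : Dec (+ 2 ∣ α₁') → ∑² M (Cell e) ≤ 2 * n * n
          by-parity (no odd) = ≤-trans (≤-reflexive (trans (∑-swap M M (Cell e)) (∑-cong M (λ W₂ _ → trans (∑-cong M (λ W₁ _ → l (χ₁ W₁) (χ₂ W₂) (χₚ W₁ W₂))) (∑-*ˡ M (χ₂ W₂) (λ W₁ → χ₁ W₁ * χₚ W₁ W₂))))))
            (≤-trans (∑-mono M (λ W₂ _ → *-monoʳ-≤ (χ₂ W₂) (col W₂))) (≤-trans (≤-reflexive (∑-*ʳ M n χ₂)) (*-monoˡ-≤ n (single c α₂' cc))))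
            where
            l : ∀ x y z → x * y * z ≡ y * (x * z)
            l = solve-∀
            col : ∀ W₂ → ∑ M (λ W₁ → χ₁ W₁ * χₚ W₁ W₂) ≤ n
            col W₂ = subst (λ z → ∑ z (λ W₁ → χ₁ W₁ * χₚ W₁ W₂) ≤ n) M₂ (count-residue n (2 * e) (λ W₁ → χ₁ W₁ * χₚ W₁ W₂)
              (λ W₁ → ≤1* (𝟙≤1 (+ e ∣? ω₁' W₁)) (𝟙≤1 (+ 2 ∣? parity W₁ W₂)))
              λ W W' p p' → parity-∣ e α₁' (+ W' -ᶻ + W) (parity W W₂) (parity W' W₂) cop odd
                (class-∣ e α₁' b W W' cb (𝟙-true (+ e ∣? ω₁' W) (*≢0⇒ˡ p)) (𝟙-true (+ e ∣? ω₁' W') (*≢0⇒ˡ p')))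
                (𝟙-true (+ 2 ∣? parity W W₂) (*≢0⇒ʳ (χ₁ W) p)) (𝟙-true (+ 2 ∣? parity W' W₂) (*≢0⇒ʳ (χ₁ W') p')) (l' α₁' (+ W) (+ W') (α₂' *ᶻ + W₂) (+ d *ᶻ α₀')))
              where l' : ∀ α w w' s r → α *ᶻ w' +ᶻ s -ᶻ r -ᶻ (α *ᶻ w +ᶻ s -ᶻ r) ≡ α *ᶻ (w' -ᶻ w)
                    l' = solveᶻ
          by-parity (yes even) = ≤-trans (≤-reflexive (∑-cong M (λ W₁ _ → trans (∑-cong M (λ W₂ _ → *-assoc (χ₁ W₁) (χ₂ W₂) (χₚ W₁ W₂))) (∑-*ˡ M (χ₁ W₁) (λ W₂ → χ₂ W₂ * χₚ W₁ W₂)))))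
            (≤-trans (∑-mono M (λ W₁ _ → *-monoʳ-≤ (χ₁ W₁) (col W₁))) (≤-trans (≤-reflexive (∑-*ʳ M n χ₁)) (*-monoˡ-≤ n (single b α₁' cb))))
            where
            odd : ¬ (+ 2 ∣ α₂')
            odd h = jointly-prime 2 prime[2] 2∣F (even , h)
            col : ∀ W₁ → ∑ M (λ W₂ → χ₂ W₂ * χₚ W₁ W₂) ≤ n
            col W₁ = subst (λ z → ∑ z (λ W₂ → χ₂ W₂ * χₚ W₁ W₂) ≤ n) M₂ (count-residue n (2 * e) (λ W₂ → χ₂ W₂ * χₚ W₁ W₂)
              (λ W₂ → ≤1* (𝟙≤1 (+ e ∣? ω₂' W₂)) (𝟙≤1 (+ 2 ∣? parity W₁ W₂)))
              λ W W' p p' → parity-∣ e α₂' (+ W' -ᶻ + W) (parity W₁ W) (parity W₁ W') cop odd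
                (class-∣ e α₂' c W W' cc (𝟙-true (+ e ∣? ω₂' W) (*≢0⇒ˡ p)) (𝟙-true (+ e ∣? ω₂' W') (*≢0⇒ˡ p')))
                (𝟙-true (+ 2 ∣? parity W₁ W) (*≢0⇒ʳ (χ₂ W) p)) (𝟙-true (+ 2 ∣? parity W₁ W') (*≢0⇒ʳ (χ₂ W') p')) (l' α₂' (+ W) (+ W') (α₁' *ᶻ + W₁) (+ d *ᶻ α₀')))
              where l' : ∀ α w w' s r → s +ᶻ α *ᶻ w' -ᶻ r -ᶻ (s +ᶻ α *ᶻ w -ᶻ r) ≡ α *ᶻ (w' -ᶻ w)
                    l' = solveᶻ

      divisor-sum : (ℕ → ℕ → ℕ) → ℕ
      divisor-sum X = ∑ (suc d) (λ e → ∑ (suc d) (λ d' → 𝟙 (e * d' ≟ d) * 𝟙 (coprime? e F) * X e d'))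

      -- For `e = 1` the summand is `H M³`, the expected number among `M⁴` quadruples for a
      -- congruence modulo `M` whose two sides are multiples of `H`. A divisor `e` contributes
      -- `H M³ / e`.
      count-≤ : ∑⁴ M (χ d) ≤ divisor-sum (λ e d' → M * M * (H * (2 * (q * a * d'))))
      count-≤ = ≤-trans (≤-reflexive substitute) (≤-trans (∑²-mono M (λ W₁ W₂ _ _ → inner W₁ W₂))
        (≤-trans (≤-reflexive exchange) (pairs-mono _ _ λ e d' eq cop →
          ≤-trans (≤-reflexive (∑²-*ˡ M (M * (2 * (H * e))) (Cell e))) (≤-trans (*-monoʳ-≤ (M * (2 * (H * e))) (cell-sum e d' eq cop))
            (≤-reflexive (trans (l M H e q a d') (cong (λ z → M * (2 * (q * (a * z))) * (H * (2 * (q * a * d')))) eq)))))))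
        where
        l : ∀ M H e q a d → M * (2 * (H * e)) * (2 * (q * a * d) * (q * a * d)) ≡ M * (2 * (q * (a * (e * d)))) * (H * (2 * (q * a * d)))
        l = solve-∀
        exchange : ∑² M (λ W₁ W₂ → pairs (λ e d' → M * (2 * (H * e)) * Cell e W₁ W₂)) ≡ pairs (λ e d' → ∑² M (λ W₁ W₂ → M * (2 * (H * e)) * Cell e W₁ W₂))
        exchange = trans (sym (∑-∑²-swap (suc d) M _)) (∑-cong (suc d) (λ e _ → trans (sym (∑-∑²-swap (suc d) M _)) (∑-cong (suc d) (λ d' _ →
          ∑²-*ˡ M (𝟙 (e * d' ≟ d) * 𝟙 (coprime? e F)) (λ W₁ W₂ → M * (2 * (H * e)) * Cell e W₁ W₂)))))

  -- The off-diagonal part of the second moment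

  posPart : ℤ → ℕ
  posPart (+ n) = n
  posPart -[1+ _ ] = 0

  posPart-lower : ∀ X z e → + X ≡ z +ᶻ e → X ≤ posPart z + ∣ e ∣
  posPart-lower X (+ n) e eq = ≤-trans (≤-reflexive (cong ∣_∣ eq)) (ℤP.∣i+j∣≤∣i∣+∣j∣ (+ n) e)
  posPart-lower X -[1+ n ] e eq = ≤-trans (m≤m+n X (suc n)) (≤-reflexive (sym (cong ∣_∣ (trans (l -[1+ n ] e) (cong (_+ᶻ + suc n) (sym eq))))))
    where l : ∀ z e → e ≡ z +ᶻ e -ᶻ z
          l = solveᶻ

  posPart-upper : ∀ X z e → + X ≡ z +ᶻ e → posPart z ≤ X + ∣ e ∣
  posPart-upper X (+ n) e eq = ≤-trans (≤-reflexive (cong ∣_∣ (trans (l (+ n) e) (cong (_-ᶻ e) (sym eq))))) (ℤP.∣i-j∣≤∣i∣+∣j∣ (+ X) e)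
    where l : ∀ z e → z ≡ z +ᶻ e -ᶻ e
          l = solveᶻ
  posPart-upper X -[1+ n ] e eq = z≤n

  posPart-antisym : ∀ z → 𝟙 (0 <? posPart z) + 𝟙 (0 <? posPart (-ᶻ z)) ≤ 1
  posPart-antisym (+ zero) = z≤n
  posPart-antisym (+ suc n) = ≤-trans (+-monoˡ-≤ (𝟙 (0 <? posPart (-ᶻ (+ suc n)))) (𝟙≤1 (0 <? suc n))) (≤-reflexive (cong suc (𝟙-no (0 <? 0) (λ ()))))
  posPart-antisym -[1+ n ] = 𝟙≤1 (0 <? suc n)

  module Moment (𝓕 : Family) (m T₁ K : ℕ) where
    open Family 𝓕
    open Count 𝓕

    -- `Cc T` bounds the change of `g` per unit step in the box. Starting the indices at `I₀ = K₀ T`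
    -- makes the variation within a cell at most the fraction `1/(m+1)` of the main term, and `T'`
    -- leaves room for rounding `T` up to whole cells.
    x Cc K₀ T T' I₀ I₁ : ℕ
    x = q * a
    Cc = suc ((∣ α₁ ∣) + (∣ α₂ ∣) + 4 * (q * ((∣ b ∣) + (∣ c ∣))))
    K₀ = 8 * Cc * suc m
    T = m * T₁
    T' = suc m * T₁
    I₀ = K₀ * T
    I₁ = K * T

    -- A pair at distance `d` has weight `(j + d) j ≤ (2j + d)² / 4`. In a collision `2j + d` is
    -- determined by `d` and `k`, so the weight becomes a function of `k` and `d` alone.
    ω : ℕ → ℕ
    ω i = 𝟙 (I₀ ≤? i) * 𝟙 (i <? I₁) * i

    h : ℕ → ℤ
    h i = α₀ *ᶻ + i +ᶻ + x *ᶻ (+ i *ᶻ + i)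

    same : ℕ → ℕ → ℕ → ℕ → ℕ → ℕ → ℕ
    same i i' t u t' u' = 𝟙 (h i -ᶻ h i' ℤ.≟ k t u t' u')

    collisions : ℕ → ℕ → ℕ
    collisions i i' = ∑⁴ T (same i i')

    secondMoment : ℕ
    secondMoment = ∑ I₁ (λ i → ∑ I₁ (λ i' → ω i * ω i' * collisions i i'))

    -- `A d` is an upper bound for `(m + 1) k` near a collision at distance `d`. `small` collects
    -- the quadruples whose `k` is so small that only the crude tail estimate applies to them.
    positives small zeros : ℕ
    positives = ∑⁴ T' (λ t u t' u' → 𝟙 (0 <? posPart (k t u t' u')))
    A : ℕ
    A = 2 * (x * I₁) * (2 + m)
    small = ∑⁴ T' (λ t u t' u' → 𝟙 (0 <? posPart (k t u t' u')) * 𝟙 (suc m * posPart (k t u t' u') ≤? A * m))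
    zeros = ∑⁴ T (λ t u t' u' → 𝟙 (+ 0 ℤ.≟ k t u t' u'))

    private
      x≡ : ∀ d → q * (a * d) ≡ x * d
      x≡ d = sym (*-assoc q a d)

      q≢0 : q ≢ 0
      q≢0 e = [ H≢0 , q'≢0 ]′ (m*n≡0⇒m≡0∨n≡0 H e)
      x≢0 : x ≢ 0
      x≢0 e = [ q≢0 , a≢0 ]′ (m*n≡0⇒m≡0∨n≡0 q e)

      k-anti : ∀ t u t' u' → k t' u' t u ≡ -ᶻ k t u t' u'
      k-anti t u t' u' = l (g t u) (g t' u') where l : ∀ x y → x -ᶻ y ≡ -ᶻ (y -ᶻ x)
                                                   l = solveᶻ

      collisions-sym : ∀ i i' → collisions i i' ≡ collisions i' i
      collisions-sym i i' = trans (∑²-swap T T (same i i')) (∑⁴-cong T (λ t u t' u' _ _ _ _ →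
        𝟙-cong (h i -ᶻ h i' ℤ.≟ k t' u' t u) (h i' -ᶻ h i ℤ.≟ k t u t' u') (flip i i' t u t' u') (flip' i i' t u t' u')))
        where
        l : ∀ a b → b -ᶻ a ≡ -ᶻ (a -ᶻ b)
        l = solveᶻ
        flip : ∀ i i' t u t' u' → h i -ᶻ h i' ≡ k t' u' t u → h i' -ᶻ h i ≡ k t u t' u'
        flip i i' t u t' u' e = trans (l (h i) (h i')) (trans (cong -ᶻ_ e) (sym (k-anti t' u' t u)))
        flip' : ∀ i i' t u t' u' → h i' -ᶻ h i ≡ k t u t' u' → h i -ᶻ h i' ≡ k t' u' t u
        flip' i i' t u t' u' e = trans (l (h i') (h i)) (trans (cong -ᶻ_ e) (sym (k-anti t u t' u')))

    S : ℕ → ℕ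
    S d = ∑ I₁ (λ j → ω (j + d) * ω j * collisions (j + d) j)

    moment-split : secondMoment ≤ ∑ I₁ (λ i → ω i * ω i) * zeros + 2 * ∑ I₁ (λ δ → S (suc δ))
    moment-split = ≤-trans (≤-reflexive (∑-triangle I₁ (λ i i' → ω i * ω i' * collisions i i') (λ i i' → cong₂ _*_ (*-comm (ω i) (ω i')) (collisions-sym i i'))))
      (+-mono-≤ (≤-reflexive (trans (∑-cong I₁ (λ i _ → cong (ω i * ω i *_) (diag i))) (∑-*ʳ I₁ zeros (λ i → ω i * ω i))))
        (*-monoʳ-≤ 2 (∑-diagonals I₁ (λ i i' → ω i * ω i' * collisions i i'))))
      where
      diag : ∀ i → collisions i i ≡ zeros
      diag i = ∑⁴-cong T (λ t u t' u' _ _ _ _ → cong (λ z → 𝟙 (z ℤ.≟ k t u t' u')) (l (h i)))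
        where l : ∀ z → z -ᶻ z ≡ + 0
              l = solveᶻ

    -- Exchanging `(t , u)` with `(t' , u')` changes the sign of `k`. The half gained here cancels
    -- the factor 2 in front of the off-diagonal sum in `moment-split`.
    positives-half : 2 * positives ≤ T' * (T' * (T' * (T' * 1)))
    positives-half = ≤-trans (≤-reflexive (trans (cong (_+_ positives) (trans (+-identityʳ positives) swapped)) (sym (∑⁴-+ T' (λ t u t' u' → 𝟙 (0 <? posPart (k t u t' u'))) (λ t u t' u' → 𝟙 (0 <? posPart (k t' u' t u)))))))
      (≤-trans (∑⁴-mono T' (λ t u t' u' _ _ _ _ → subst (λ z → 𝟙 (0 <? posPart (k t u t' u')) + 𝟙 (0 <? posPart z) ≤ 1) (sym (k-anti t u t' u')) (posPart-antisym (k t u t' u'))))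
        (≤-reflexive (∑⁴-const T' 1)))
      where
      swapped : positives ≡ ∑⁴ T' (λ t u t' u' → 𝟙 (0 <? posPart (k t' u' t u)))
      swapped = ∑²-swap T' T' (λ t u t' u' → 𝟙 (0 <? posPart (k t u t' u')))

    module Off (m≢0 : m ≢ 0) (T₁≢0 : T₁ ≢ 0) (α₀≤T : (∣ α₀ ∣) ≤ T) (rough : ∀ e → Coprime e F → e ≢ 1 → m < e) where
      private
        1≤T : 1 ≤ T
        1≤T = *-mono-≤ (n≢0⇒n>0 m≢0) (n≢0⇒n>0 T₁≢0)

        h-diff : ∀ j d → h (j + d) -ᶻ h j ≡ κ d +ᶻ + (x * d) *ᶻ (+ 2 *ᶻ + j)
        h-diff j d = trans (l α₀ (+ x) (+ j) (+ d)) (cong₂ _+ᶻ_ (cong (λ z → + d *ᶻ (α₀ +ᶻ z)) (sym e2)) (cong (_*ᶻ (+ 2 *ᶻ + j)) (sym (ℤP.pos-* x d))))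
          where
          e2 : + (q * (a * d)) ≡ + x *ᶻ + d
          e2 = trans (cong +_ (x≡ d)) (ℤP.pos-* x d)
          l : ∀ α x j d → α *ᶻ (j +ᶻ d) +ᶻ x *ᶻ ((j +ᶻ d) *ᶻ (j +ᶻ d)) -ᶻ (α *ᶻ j +ᶻ x *ᶻ (j *ᶻ j)) ≡ d *ᶻ (α +ᶻ x *ᶻ d) +ᶻ x *ᶻ d *ᶻ (+ 2 *ᶻ j)
          l = solveᶻ

        h-diff-M : ∀ j d → h (j + d) -ᶻ h j ≡ κ d +ᶻ + j *ᶻ + modulus d
        h-diff-M j d = trans (h-diff j d) (cong (κ d +ᶻ_) (trans (l (+ (x * d)) (+ j)) (cong (+ j *ᶻ_) (trans (sym (ℤP.pos-* 2 (x * d))) (cong (λ z → + (2 * z)) (sym (x≡ d)))))))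
          where l : ∀ x j → x *ᶻ (+ 2 *ᶻ j) ≡ j *ᶻ (+ 2 *ᶻ x)
                l = solveᶻ

        h-diff-s : ∀ j d → h (j + d) -ᶻ h j ≡ + (x * d * (2 * j + d)) +ᶻ + d *ᶻ α₀
        h-diff-s j d = trans (h-diff j d) (trans (cong (λ z → + d *ᶻ (α₀ +ᶻ z) +ᶻ + (x * d) *ᶻ (+ 2 *ᶻ + j)) (cong +_ (x≡ d)))
           (trans (l (+ (x * d)) (+ d) α₀ (+ j)) (cong (_+ᶻ + d *ᶻ α₀) (trans (cong (λ z → + (x * d) *ᶻ (z +ᶻ + d)) (sym (ℤP.pos-* 2 j))) (sym (ℤP.pos-* (x * d) (2 * j + d)))))))
          where l : ∀ y d α j → d *ᶻ (α +ᶻ y) +ᶻ y *ᶻ (+ 2 *ᶻ j) ≡ y *ᶻ (+ 2 *ᶻ j +ᶻ d) +ᶻ d *ᶻ α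
                l = solveᶻ

        g-diff : ∀ t u t° u° → g t u -ᶻ g t° u° ≡ (+ t -ᶻ + t°) *ᶻ (α₁ +ᶻ + q *ᶻ b *ᶻ + (t + t°)) +ᶻ (+ u -ᶻ + u°) *ᶻ (α₂ +ᶻ + q *ᶻ c *ᶻ + (u + u°))
        g-diff t u t° u° = l α₁ α₂ (+ q) b c (+ t) (+ u) (+ t°) (+ u°)
          where l : ∀ α β q b c t u t' u' → (α *ᶻ t +ᶻ β *ᶻ u +ᶻ q *ᶻ (b *ᶻ (t *ᶻ t) +ᶻ c *ᶻ (u *ᶻ u))) -ᶻ (α *ᶻ t' +ᶻ β *ᶻ u' +ᶻ q *ᶻ (b *ᶻ (t' *ᶻ t') +ᶻ c *ᶻ (u' *ᶻ u')))
                     ≡ (t -ᶻ t') *ᶻ (α +ᶻ q *ᶻ b *ᶻ (t +ᶻ t')) +ᶻ (u -ᶻ u') *ᶻ (β +ᶻ q *ᶻ c *ᶻ (u +ᶻ u'))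
                l = solveᶻ

        abs-lin : ∀ α β n N → n ≤ N → ∣ α +ᶻ + q *ᶻ β *ᶻ + n ∣ ≤ (∣ α ∣) + q * (∣ β ∣) * N
        abs-lin α β n N n≤N = ≤-trans (ℤP.∣i+j∣≤∣i∣+∣j∣ α (+ q *ᶻ β *ᶻ + n)) (+-monoʳ-≤ (∣ α ∣)
          (≤-trans (≤-reflexive (trans (ℤP.abs-* (+ q *ᶻ β) (+ n)) (cong (_* n) (ℤP.abs-* (+ q) β)))) (*-monoʳ-≤ (q * (∣ β ∣)) n≤N)))

        abs-prod : ∀ y z {Y Z} → ∣ y ∣ ≤ Y → ∣ z ∣ ≤ Z → ∣ y *ᶻ z ∣ ≤ Y * Z
        abs-prod y z hy hz = ≤-trans (≤-reflexive (ℤP.abs-* y z)) (*-mono-≤ hy hz)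

        g-close : ∀ D t u t° u° → ∣ + t -ᶻ + t° ∣ ≤ D → ∣ + u -ᶻ + u° ∣ ≤ D → t + t° ≤ 4 * T → u + u° ≤ 4 * T → ∣ g t u -ᶻ g t° u° ∣ ≤ D * (Cc * T)
        g-close D t u t° u° ht hu st su = ≤-trans (≤-reflexive (cong ∣_∣ (g-diff t u t° u°))) (≤-trans (ℤP.∣i+j∣≤∣i∣+∣j∣ ((+ t -ᶻ + t°) *ᶻ (α₁ +ᶻ + q *ᶻ b *ᶻ + (t + t°))) ((+ u -ᶻ + u°) *ᶻ (α₂ +ᶻ + q *ᶻ c *ᶻ + (u + u°))))
          (≤-trans (+-mono-≤ (abs-prod (+ t -ᶻ + t°) (α₁ +ᶻ + q *ᶻ b *ᶻ + (t + t°)) ht (abs-lin α₁ b (t + t°) (4 * T) st)) (abs-prod (+ u -ᶻ + u°) (α₂ +ᶻ + q *ᶻ c *ᶻ + (u + u°)) hu (abs-lin α₂ c (u + u°) (4 * T) su)))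
          (≤-trans (≤-reflexive (l₁ D (∣ α₁ ∣) (∣ α₂ ∣) q (∣ b ∣) (∣ c ∣) T)) (*-monoʳ-≤ D (≤-trans (+-monoˡ-≤ (4 * (q * ((∣ b ∣) + (∣ c ∣))) * T) (m≤m*n ((∣ α₁ ∣) + (∣ α₂ ∣)) T {{>-nonZero 1≤T}}))
             (≤-trans (m≤n+m _ T) (≤-reflexive (l₂ ((∣ α₁ ∣) + (∣ α₂ ∣)) (4 * (q * ((∣ b ∣) + (∣ c ∣)))) T))))))))
          where
          l₁ : ∀ D α β q b c T → D * (α + q * b * (4 * T)) + D * (β + q * c * (4 * T)) ≡ D * (α + β + 4 * (q * (b + c)) * T)
          l₁ = solve-∀
          l₂ : ∀ α y T → T + (α * T + y * T) ≡ suc (α + y) * T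
          l₂ = solve-∀

        diff-abs : ∀ t t° N → t ≤ N → t° ≤ N → ∣ + t -ᶻ + t° ∣ ≤ N
        diff-abs t t° N ht ht° = ≤-trans (≤-reflexive (cong ∣_∣ (ℤP.m-n≡m⊖n t t°))) (≤-trans (ℤP.∣m⊝n∣≤m⊔n t t°) (⊔-lub ht ht°))

        g-0 : g 0 0 ≡ + 0
        g-0 = l α₁ α₂ (+ q) b c where l : ∀ α β q b c → α *ᶻ + 0 +ᶻ β *ᶻ + 0 +ᶻ q *ᶻ (b *ᶻ (+ 0 *ᶻ + 0) +ᶻ c *ᶻ (+ 0 *ᶻ + 0)) ≡ + 0
                                      l = solveᶻ

        g-bound : ∀ t u → t < T → u < T → ∣ g t u ∣ ≤ T * (Cc * T)
        g-bound t u ht hu = ≤-trans (≤-reflexive (cong ∣_∣ (trans (l (g t u)) (cong (λ z → g t u -ᶻ z) (sym g-0))))) (g-close T t u 0 0 (diff-abs t 0 T (<⇒≤ ht) z≤n) (diff-abs u 0 T (<⇒≤ hu) z≤n) (4T t ht) (4T u hu))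
          where
          l : ∀ z → z ≡ z -ᶻ + 0
          l = solveᶻ
          4T : ∀ t → t < T → t + 0 ≤ 4 * T
          4T t ht = ≤-trans (≤-reflexive (+-identityʳ t)) (≤-trans (<⇒≤ ht) (m≤m+n T (3 * T)))

        weight-parts : ∀ i → ω i ≢ 0 → I₀ ≤ i × i < I₁
        weight-parts i ne = 𝟙-true (I₀ ≤? i) (*≢0⇒ˡ (*≢0⇒ˡ {𝟙 (I₀ ≤? i) * 𝟙 (i <? I₁)} ne)) , 𝟙-true (i <? I₁) (*≢0⇒ʳ (𝟙 (I₀ ≤? i)) (*≢0⇒ˡ {𝟙 (I₀ ≤? i) * 𝟙 (i <? I₁)} ne))

        ω≤ : ∀ i → ω i ≤ i
        ω≤ i = ≤-trans (*-monoˡ-≤ i (*-mono-≤ (𝟙≤1 (I₀ ≤? i)) (𝟙≤1 (i <? I₁)))) (≤-reflexive (+-identityʳ i))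

        module Fixed (δ : ℕ) where
          d = suc δ
          M = modulus d
          y = x * d
          1≤y : 1 ≤ y
          1≤y = *-mono-≤ (n≢0⇒n>0 x≢0) (s≤s z≤n)
          M≡ : M ≡ 2 * y
          M≡ = cong (2 *_) (x≡ d)
          d≤y : d ≤ y
          d≤y = ≤-trans (≤-reflexive (sym (+-identityʳ d))) (*-monoˡ-≤ d (n≢0⇒n>0 x≢0))

          term : ℕ → ℕ → ℕ → ℕ → ℕ → ℕ
          term t u t' u' j = ω (j + d) * ω j * same (j + d) j t u t' u'
          ψ : ℕ → ℕ → ℕ → ℕ → ℕ
          ψ t u t' u' = ∑ I₁ (term t u t' u')

          S≡ : S d ≡ ∑⁴ T ψ
          S≡ = trans (∑-cong I₁ (λ j _ → sym (∑⁴-*ˡ T (ω (j + d) * ω j) (same (j + d) j)))) (∑-∑⁴-swap I₁ T (λ j t u t' u' → term t u t' u' j))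

          term-eq : ∀ t u t' u' j → term t u t' u' j ≢ 0 → h (j + d) -ᶻ h j ≡ k t u t' u'
          term-eq t u t' u' j ne = 𝟙-true (h (j + d) -ᶻ h j ℤ.≟ k t u t' u') (*≢0⇒ʳ (ω (j + d) * ω j) ne)

          supp : ∀ t u t' u' → χ d t u t' u' ≡ 0 → ψ t u t' u' ≡ 0
          supp t u t' u' χ0 = ∑-zero I₁ (λ j _ → zero' j)
            where
            zero' : ∀ j → term t u t' u' j ≡ 0
            zero' j = decidable-stable (term t u t' u' j ≟ 0) (λ ne → 1+n≢0 (trans (sym (𝟙-yes (+ M ∣? k t u t' u' -ᶻ κ d) (divides (+ j) (trans (cong (_-ᶻ κ d) (trans (sym (term-eq t u t' u' j ne)) (h-diff-M j d))) (l (κ d) (+ j *ᶻ + M)))))) χ0))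
              where l : ∀ a b → a +ᶻ b -ᶻ a ≡ b
                    l = solveᶻ

          g-per : ∀ j r k s → + M ∣ g (j * M + r) (k * M + s) -ᶻ g r s
          g-per j r k s = divides (+ j *ᶻ (α₁ +ᶻ + q *ᶻ b *ᶻ + (j * M + r + r)) +ᶻ + k *ᶻ (α₂ +ᶻ + q *ᶻ c *ᶻ + (k * M + s + s)))
            (trans (g-diff (j * M + r) (k * M + s) r s) (trans (cong₂ (λ z w → (z +ᶻ + r -ᶻ + r) *ᶻ (α₁ +ᶻ + q *ᶻ b *ᶻ + (j * M + r + r)) +ᶻ (w +ᶻ + s -ᶻ + s) *ᶻ (α₂ +ᶻ + q *ᶻ c *ᶻ + (k * M + s + s))) (ℤP.pos-* j M) (ℤP.pos-* k M))
              (l (+ j) (+ M) (+ r) (+ k) (+ s) (α₁ +ᶻ + q *ᶻ b *ᶻ + (j * M + r + r)) (α₂ +ᶻ + q *ᶻ c *ᶻ + (k * M + s + s)))))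
            where l : ∀ j M r k s X Y → (j *ᶻ M +ᶻ r -ᶻ r) *ᶻ X +ᶻ (k *ᶻ M +ᶻ s -ᶻ s) *ᶻ Y ≡ (j *ᶻ X +ᶻ k *ᶻ Y) *ᶻ M
                  l = solveᶻ

          χ-per : ∀ j r k' s l t m' v → χ d (j * M + r) (k' * M + s) (l * M + t) (m' * M + v) ≡ χ d r s t v
          χ-per j r k' s l t m' v = 𝟙-cong (+ M ∣? k (j * M + r) (k' * M + s) (l * M + t) (m' * M + v) -ᶻ κ d) (+ M ∣? k r s t v -ᶻ κ d)
            (λ hh → ∣-eq (∣m∣n⇒∣m-n hh dd) (l₁ G₁ G₂ g₁ g₂ (κ d)))
            (λ hh → ∣-eq (∣m∣n⇒∣m+n hh dd) (l₂ G₁ G₂ g₁ g₂ (κ d)))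
            where
            G₁ = g (l * M + t) (m' * M + v)
            G₂ = g (j * M + r) (k' * M + s)
            g₁ = g t v
            g₂ = g r s
            dd : + M ∣ (G₁ -ᶻ g₁) -ᶻ (G₂ -ᶻ g₂)
            dd = ∣m∣n⇒∣m-n (g-per l t m' v) (g-per j r k' s)
            l₁ : ∀ A B a b κ → A -ᶻ B -ᶻ κ -ᶻ ((A -ᶻ a) -ᶻ (B -ᶻ b)) ≡ a -ᶻ b -ᶻ κ
            l₁ = solveᶻ
            l₂ : ∀ A B a b κ → a -ᶻ b -ᶻ κ +ᶻ ((A -ᶻ a) -ᶻ (B -ᶻ b)) ≡ A -ᶻ B -ᶻ κ
            l₂ = solveᶻ

          -- A collision has `k = y (2j + d) + d α₀`, so `k²` is approximately `y² (2j + d)²`, which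
          -- bounds `4 y²` times the weight; the factor `(m + 1)²` absorbs the error. The indicator
          -- records that `j + d < I₁`.
          Φ : ℕ → ℕ → ℕ → ℕ → ℕ
          Φ t u t' u' = let L = suc m * posPart (k t u t' u') in 𝟙 (L ≤? A * d) * (L * L)

          σ : ℕ
          σ = 4 * (Cc * T) + (∣ α₀ ∣)

          Λσ≤ : suc m * σ ≤ 2 * I₀
          Λσ≤ = ≤-trans (*-monoʳ-≤ (suc m) (≤-trans (+-monoʳ-≤ (4 * (Cc * T)) (≤-trans α₀≤T (≤-trans (≤-reflexive (sym (+-identityʳ T))) (*-monoˡ-≤ T {1} {Cc} (s≤s z≤n))))) (m≤m+n (4 * (Cc * T) + Cc * T) (11 * (Cc * T)))))
                 (≤-reflexive (l (suc m) Cc T))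
            where l : ∀ n C T → n * (4 * (C * T) + C * T + 11 * (C * T)) ≡ 2 * (8 * C * n * T)
                  l = solve-∀

          -- on a cell, k° differs from k = x d s + α₀ d by at most x d σ
          dominate : ∀ t u t' u' t° u° t'° u'° j → term t u t' u' j ≢ 0 → ∣ g t' u' -ᶻ g t'° u'° ∣ ≤ M * (Cc * T) → ∣ g t u -ᶻ g t° u° ∣ ≤ M * (Cc * T) →
            4 * (y * y) * (m * m) * term t u t' u' j ≤ Φ t° u° t'° u'°
          dominate t u t' u' t° u° t'° u'° j ne c₁ c₂ = ≤-trans (*-monoʳ-≤ (4 * (y * y) * (m * m)) term≤) (≤-trans (≤-reflexive (l₁ y m (j + d) j))
               (≤-trans (*-monoʳ-≤ (y * y * (m * m)) four) (≤-trans (≤-reflexive (l₂ y m s)) (≤-trans (*-mono-≤ lower lower) (≤-reflexive (sym (trans (cong (_* (L * L)) (𝟙-yes (L ≤? A * d) upper)) (+-identityʳ (L * L)))))))))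
            where
            s = 2 * j + d
            k° = k t° u° t'° u'°
            L = suc m * posPart k°
            ωω≢0 : ω (j + d) * ω j ≢ 0
            ωω≢0 = *≢0⇒ˡ {ω (j + d) * ω j} ne
            I₀≤j : I₀ ≤ j
            I₀≤j = proj₁ (weight-parts j (*≢0⇒ʳ (ω (j + d)) ωω≢0))
            jd<I₁ : j + d < I₁
            jd<I₁ = proj₂ (weight-parts (j + d) (*≢0⇒ˡ {ω (j + d)} ωω≢0))
            term≤ : term t u t' u' j ≤ (j + d) * j
            term≤ = ≤-trans (*-mono-≤ (*-mono-≤ (ω≤ (j + d)) (ω≤ j)) (𝟙≤1 (h (j + d) -ᶻ h j ℤ.≟ k t u t' u'))) (≤-reflexive (*-identityʳ _))
            four : 4 * ((j + d) * j) ≤ s * s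
            four = ≤-trans (m≤m+n _ (d * d)) (≤-reflexive (l j d))
              where l : ∀ j d → 4 * ((j + d) * j) + d * d ≡ (2 * j + d) * (2 * j + d)
                    l = solve-∀
            l₁ : ∀ y m i j → 4 * (y * y) * (m * m) * (i * j) ≡ y * y * (m * m) * (4 * (i * j))
            l₁ = solve-∀
            l₂ : ∀ y m s → y * y * (m * m) * (s * s) ≡ m * (y * s) * (m * (y * s))
            l₂ = solve-∀
            err : ℤ
            err = (g t' u' -ᶻ g t'° u'°) -ᶻ (g t u -ᶻ g t° u°) -ᶻ + d *ᶻ α₀
            eqn : + (y * s) ≡ k° +ᶻ err
            eqn = trans (l₄ (+ (y * s)) (+ d *ᶻ α₀)) (trans (cong (_-ᶻ + d *ᶻ α₀) (trans (sym (h-diff-s j d)) (term-eq t u t' u' j ne))) (l₃ (g t' u') (g t u) (g t'° u'°) (g t° u°) (+ d *ᶻ α₀)))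
              where l₄ : ∀ a b → a ≡ a +ᶻ b -ᶻ b
                    l₄ = solveᶻ
                    l₃ : ∀ A B a b e → A -ᶻ B -ᶻ e ≡ (a -ᶻ b) +ᶻ ((A -ᶻ a) -ᶻ (B -ᶻ b) -ᶻ e)
                    l₃ = solveᶻ
            err≤ : (∣ err ∣) ≤ y * σ
            err≤ = ≤-trans (ℤP.∣i-j∣≤∣i∣+∣j∣ ((g t' u' -ᶻ g t'° u'°) -ᶻ (g t u -ᶻ g t° u°)) (+ d *ᶻ α₀)) (≤-trans (+-mono-≤ (≤-trans (ℤP.∣i-j∣≤∣i∣+∣j∣ (g t' u' -ᶻ g t'° u'°) (g t u -ᶻ g t° u°)) (+-mono-≤ c₁ c₂)) (≤-trans (≤-reflexive (ℤP.abs-* (+ d) α₀)) (*-monoˡ-≤ (∣ α₀ ∣) d≤y)))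
                (≤-reflexive (trans (cong (λ z → z * (Cc * T) + z * (Cc * T) + y * (∣ α₀ ∣)) M≡) (l y (Cc * T) (∣ α₀ ∣)))))
              where l : ∀ y c e → 2 * y * c + 2 * y * c + y * e ≡ y * (4 * c + e)
                    l = solve-∀
            Λerr : suc m * (∣ err ∣) ≤ y * s
            Λerr = ≤-trans (*-monoʳ-≤ (suc m) err≤) (≤-trans (≤-reflexive (l (suc m) y σ)) (*-monoʳ-≤ y (≤-trans Λσ≤ (≤-trans (*-monoʳ-≤ 2 I₀≤j) (m≤m+n (2 * j) d)))))
              where l : ∀ n y s → n * (y * s) ≡ y * (n * s)
                    l = solve-∀
            lower : m * (y * s) ≤ L
            lower = +-cancelˡ-≤ (y * s) _ _ (≤-trans (*-monoʳ-≤ (suc m) (posPart-lower (y * s) k° err eqn)) (≤-trans (≤-reflexive (trans (*-distribˡ-+ (suc m) (posPart k°) (∣ err ∣)) (+-comm L _))) (+-monoˡ-≤ L Λerr)))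
            upper : L ≤ A * d
            upper = ≤-trans (*-monoʳ-≤ (suc m) (posPart-upper (y * s) k° err eqn)) (≤-trans (≤-reflexive (*-distribˡ-+ (suc m) (y * s) (∣ err ∣))) (≤-trans (+-monoʳ-≤ (suc m * (y * s)) Λerr)
               (≤-trans (≤-reflexive (l (suc m) (y * s))) (≤-trans (*-monoʳ-≤ (2 + m) (*-monoʳ-≤ y s≤)) (≤-reflexive (l' m x d I₁))))))
              where
              l : ∀ n z → n * z + z ≡ suc n * z
              l = solve-∀
              l' : ∀ m x d I → (2 + m) * (x * d * (2 * I)) ≡ 2 * (x * I) * (2 + m) * d
              l' = solve-∀
              s≤ : s ≤ 2 * I₁
              s≤ = ≤-trans (≤-trans (m≤m+n s d) (≤-reflexive (l'' j d))) (*-monoʳ-≤ 2 (<⇒≤ jd<I₁))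
                where l'' : ∀ j d → 2 * j + d + d ≡ 2 * (j + d)
                      l'' = solve-∀

          -- At most one `j` contributes to `ψ`, because `h(j + d) - h(j)` is affine in `j` with
          -- slope `M`.
          ψ-dominate : ∀ t u t' u' t° u° t'° u'° → ∣ g t' u' -ᶻ g t'° u'° ∣ ≤ M * (Cc * T) → ∣ g t u -ᶻ g t° u° ∣ ≤ M * (Cc * T) →
            4 * (y * y) * (m * m) * ψ t u t' u' ≤ Φ t° u° t'° u'°
          ψ-dominate t u t' u' t° u° t'° u'° c₁ c₂ = ≤-trans (≤-reflexive (sym (∑-*ˡ I₁ cf (term t u t' u'))))
              (∑-at-most-one I₁ (λ j → cf * term t u t' u' j) (Φ t° u° t'° u'°) bnd un)
            where
            cf = 4 * (y * y) * (m * m)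
            bnd : ∀ j → j < I₁ → cf * term t u t' u' j ≤ Φ t° u° t'° u'°
            bnd j _ = [ (λ e → ≤-trans (≤-reflexive (trans (cong (cf *_) e) (*-zeroʳ cf))) z≤n) , (λ ne → dominate t u t' u' t° u° t'° u'° j ne c₁ c₂) ]′ (toSum (term t u t' u' j ≟ 0))
            un : ∀ i j → i < I₁ → j < I₁ → cf * term t u t' u' i ≢ 0 → cf * term t u t' u' j ≢ 0 → i ≡ j
            un i j _ _ p p' = ℤP.+-injective (ℤP.*-cancelʳ-≡ (+ i) (+ j) (+ M) {{ℤ.≢-nonZero M≢0}} (cancel (κ d) (+ i *ᶻ + M) (+ j *ᶻ + M)
                (trans (sym (h-diff-M i d)) (trans (term-eq t u t' u' i (*≢0⇒ʳ cf p)) (trans (sym (term-eq t u t' u' j (*≢0⇒ʳ cf p'))) (h-diff-M j d))))))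
              where
              cancel : ∀ z v w → z +ᶻ v ≡ z +ᶻ w → v ≡ w
              cancel z v w e = trans (l z v) (trans (cong (_-ᶻ z) e) (sym (l z w)))
                where l : ∀ z v → v ≡ z +ᶻ v -ᶻ z
                      l = solveᶻ
              M≢0 : + M ≢ + 0
              M≢0 e = n≮0 (subst (1 ≤_) (trans (sym M≡) (ℤP.+-injective e)) (≤-trans 1≤y (m≤m+n y (y + 0))))

          -- a collision forces d to be small
          M≤T₁ : ∀ t u t' u' j → t < T → u < T → t' < T → u' < T → term t u t' u' j ≢ 0 → M ≤ T₁
          M≤T₁ t u t' u' j ht hu ht' hu' ne = ≤-trans (≤-reflexive M≡) (*-cancelˡ-≤ (2 * (Cc * (m * T))) {{>-nonZero (*-mono-≤ {1} {2} (s≤s z≤n) (*-mono-≤ {1} {Cc} (s≤s z≤n) (*-mono-≤ (n≢0⇒n>0 m≢0) 1≤T)))}}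
              (≤-trans (≤-reflexive (l₁ Cc m T y)) (≤-trans main (≤-reflexive (l₂ Cc m T₁)))))
            where
            s = 2 * j + d
            ωω≢0 : ω (j + d) * ω j ≢ 0
            ωω≢0 = *≢0⇒ˡ {ω (j + d) * ω j} ne
            I₀≤j : I₀ ≤ j
            I₀≤j = proj₁ (weight-parts j (*≢0⇒ʳ (ω (j + d)) ωω≢0))
            l₁ : ∀ C m T y → 2 * (C * (m * T)) * (2 * y) ≡ y * (4 * (C * m) * T)
            l₁ = solve-∀
            l₂ : ∀ C m T₁ → 2 * (C * (m * T₁) * (m * T₁)) ≡ 2 * (C * (m * (m * T₁))) * T₁
            l₂ = solve-∀
            eqn : + (y * s) ≡ (g t' u' -ᶻ g t u) -ᶻ + d *ᶻ α₀
            eqn = trans (l₄ (+ (y * s)) (+ d *ᶻ α₀)) (cong (_-ᶻ + d *ᶻ α₀) (trans (sym (h-diff-s j d)) (term-eq t u t' u' j ne)))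
              where l₄ : ∀ a b → a ≡ a +ᶻ b -ᶻ b
                    l₄ = solveᶻ
            ys≤ : y * s ≤ T * (Cc * T) + T * (Cc * T) + y * T
            ys≤ = ≤-trans (≤-reflexive (cong ∣_∣ eqn)) (≤-trans (ℤP.∣i-j∣≤∣i∣+∣j∣ (g t' u' -ᶻ g t u) (+ d *ᶻ α₀)) (+-mono-≤ (≤-trans (ℤP.∣i-j∣≤∣i∣+∣j∣ (g t' u') (g t u)) (+-mono-≤ (g-bound t' u' ht' hu') (g-bound t u ht hu)))
                (≤-trans (≤-reflexive (ℤP.abs-* (+ d) α₀)) (*-mono-≤ d≤y α₀≤T))))
            lowS : 4 * (Cc * m) * T + T ≤ s
            lowS = ≤-trans (≤-trans (+-monoʳ-≤ (4 * (Cc * m) * T) (≤-trans (≤-reflexive (sym (+-identityʳ T))) (*-monoˡ-≤ T (s≤s {0} {pred Cc} z≤n)))) (≤-trans (m≤m+n _ (12 * (Cc * m) * T + 15 * (Cc * T))) (≤-reflexive (l Cc m T)))) (≤-trans (*-monoʳ-≤ 2 I₀≤j) (m≤m+n (2 * j) d))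
              where l : ∀ C m T → 4 * (C * m) * T + C * T + (12 * (C * m) * T + 15 * (C * T)) ≡ 2 * (8 * C * suc m * T)
                    l = solve-∀
            main : y * (4 * (Cc * m) * T) ≤ 2 * (Cc * T * T)
            main = +-cancelʳ-≤ (y * T) _ _ (≤-trans (≤-reflexive (sym (*-distribˡ-+ y (4 * (Cc * m) * T) T))) (≤-trans (*-monoʳ-≤ y lowS) (≤-trans ys≤ (≤-reflexive (l T Cc (y * T))))))
              where l : ∀ T C z → T * (C * T) + T * (C * T) + z ≡ 2 * (C * T * T) + z
                    l = solve-∀

          divs : ℕ
          divs = ∑ (suc d) (λ e → ∑ (suc d) (λ d' → 𝟙 (e * d' ≟ d) * 𝟙 (coprime? e F) * d'))

          bound-large : ¬ M ≤ T₁ → 8 * (x * x * x) * (d * d * d * d) * (m * m) * S d ≤ H * divs * ∑⁴ T' Φ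
          bound-large M≰ = ≤-trans (≤-reflexive (trans (cong (8 * (x * x * x) * (d * d * d * d) * (m * m) *_) S0) (*-zeroʳ (8 * (x * x * x) * (d * d * d * d) * (m * m))))) z≤n
            where
            S0 : S d ≡ 0
            S0 = trans S≡ (∑-zero T λ t ht → ∑-zero T λ u hu → ∑-zero T λ t' ht' → ∑-zero T λ u' hu' → ∑-zero I₁ λ j _ → z t u t' u' j ht hu ht' hu')
              where
              z : ∀ t u t' u' j → t < T → u < T → t' < T → u' < T → term t u t' u' j ≡ 0
              z t u t' u' j ht hu ht' hu' = decidable-stable (term t u t' u' j ≟ 0) (λ ne → M≰ (M≤T₁ t u t' u' j ht hu ht' hu' ne))

          bound-small : M ≤ T₁ → 8 * (x * x * x) * (d * d * d * d) * (m * m) * S d ≤ H * divs * ∑⁴ T' Φ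
          bound-small M≤ = *-cancelˡ-≤ (M * M * (2 * x)) {{>-nonZero (*-mono-≤ (*-mono-≤ 1≤M 1≤M) (*-mono-≤ {1} {2} (s≤s z≤n) (n≢0⇒n>0 x≢0)))}}
              (≤-trans (≤-reflexive step₁) (≤-trans cells (≤-trans (*-mono-≤ (≤-trans (count-≤ d (λ ())) (≤-reflexive divs-eq)) (∑⁴-extend Φ BM≤T')) (≤-reflexive (l₃ (M * M) H x divs (∑⁴ T' Φ))))))
            where
            1≤M : 1 ≤ M
            1≤M = ≤-trans (≤-trans 1≤y (m≤m+n y (y + 0))) (≤-reflexive (sym M≡))
            instance
              M-nz : NonZero M
              M-nz = >-nonZero 1≤M
            -- `T` rounded up to whole residue systems stays within `T' = T + T₁`, as `M ≤ T₁`.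
            B = suc (T / M)
            T≤BM : T ≤ B * M
            T≤BM = ≤-trans (≤-reflexive (m≡m%n+[m/n]*n T M)) (+-monoˡ-≤ (T / M * M) (<⇒≤ (m%n<n T M)))
            BM≤T' : B * M ≤ T'
            BM≤T' = +-mono-≤ M≤ (m/n*n≤m T M)
            T'≤2T : T' ≤ 2 * T
            T'≤2T = ≤-trans (+-monoˡ-≤ T (≤-trans (≤-reflexive (sym (+-identityʳ T₁))) (*-monoˡ-≤ T₁ (n≢0⇒n>0 m≢0)))) (≤-reflexive (cong (_+_ T) (sym (+-identityʳ T))))
            close : ∀ j₁ j₂ → j₁ < B → j₂ < B → ∀ r₁ r₂ s₁ s₂ → r₁ < M → r₂ < M → s₁ < M → s₂ < M →
              ∣ g (j₁ * M + r₁) (j₂ * M + r₂) -ᶻ g (j₁ * M + s₁) (j₂ * M + s₂) ∣ ≤ M * (Cc * T)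
            close j₁ j₂ b₁ b₂ r₁ r₂ s₁ s₂ h₁ h₂ h₃ h₄ = g-close M (j₁ * M + r₁) (j₂ * M + r₂) (j₁ * M + s₁) (j₂ * M + s₂)
                (near j₁ r₁ s₁ h₁ h₃) (near j₂ r₂ s₂ h₂ h₄) (sums j₁ r₁ s₁ b₁ h₁ h₃) (sums j₂ r₂ s₂ b₂ h₂ h₄)
              where
              near : ∀ j r s → r < M → s < M → ∣ + (j * M + r) -ᶻ + (j * M + s) ∣ ≤ M
              near j r s hr hs = ≤-trans (≤-reflexive (cong ∣_∣ (l (+ (j * M)) (+ r) (+ s)))) (diff-abs r s M (<⇒≤ hr) (<⇒≤ hs))
                where l : ∀ j r s → (j +ᶻ r) -ᶻ (j +ᶻ s) ≡ r -ᶻ s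
                      l = solveᶻ
              one : ∀ j r → j < B → r < M → j * M + r ≤ 2 * T
              one j r hj hr = ≤-trans (≤-trans (+-monoʳ-≤ (j * M) (<⇒≤ hr)) (≤-trans (≤-reflexive (+-comm (j * M) M)) (*-monoˡ-≤ M hj))) (≤-trans BM≤T' T'≤2T)
              sums : ∀ j r s → j < B → r < M → s < M → j * M + r + (j * M + s) ≤ 4 * T
              sums j r s hj hr hs = ≤-trans (+-mono-≤ (one j r hj hr) (one j s hj hs)) (≤-reflexive (l T))
                where l : ∀ T → 2 * T + 2 * T ≡ 4 * T
                      l = solve-∀
            cells : M * (M * (M * (M * (4 * (y * y) * (m * m))))) * S d ≤ ∑⁴ M (χ d) * ∑⁴ (B * M) Φ
            cells = ≤-trans (*-monoʳ-≤ (M * (M * (M * (M * (4 * (y * y) * (m * m)))))) (≤-trans (≤-reflexive S≡) (∑⁴-extend ψ T≤BM)))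
              (∑⁴-cells B M (4 * (y * y) * (m * m)) ψ Φ (χ d) χ-per supp (λ t u t' u' → 𝟙≤1 (+ M ∣? k t u t' u' -ᶻ κ d))
                λ j₁ j₂ j₃ j₄ b₁ b₂ b₃ b₄ r₁ r₂ r₃ r₄ s₁ s₂ s₃ s₄ h₁ h₂ h₃ h₄ g₁ g₂ g₃ g₄ →
                  ψ-dominate (j₁ * M + r₁) (j₂ * M + r₂) (j₃ * M + r₃) (j₄ * M + r₄) (j₁ * M + s₁) (j₂ * M + s₂) (j₃ * M + s₃) (j₄ * M + s₄)
                    (close j₃ j₄ b₃ b₄ r₃ r₄ s₃ s₄ h₃ h₄ g₃ g₄) (close j₁ j₂ b₁ b₂ r₁ r₂ s₁ s₂ h₁ h₂ g₁ g₂))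
            step₁ : M * M * (2 * x) * (8 * (x * x * x) * (d * d * d * d) * (m * m) * S d) ≡ M * (M * (M * (M * (4 * (y * y) * (m * m))))) * S d
            step₁ = trans (l (M * M) x d (m * m) (S d)) (trans (cong (λ z → M * M * (z * z) * (4 * (y * y) * (m * m)) * S d) (sym M≡)) (l' M (4 * (y * y) * (m * m)) (S d)))
              where l : ∀ N x d e s → N * (2 * x) * (8 * (x * x * x) * (d * d * d * d) * e * s) ≡ N * (2 * (x * d) * (2 * (x * d))) * (4 * (x * d * (x * d)) * e) * s
                    l = solve-∀
                    l' : ∀ M z s → M * M * (M * M) * z * s ≡ M * (M * (M * (M * z))) * s
                    l' = solve-∀
            divs-eq : divisor-sum d (λ ()) (λ e d' → M * M * (H * (2 * (q * a * d')))) ≡ M * M * (H * (2 * x)) * divs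
            divs-eq = trans (∑-cong (suc d) (λ e _ → trans (∑-cong (suc d) (λ d' _ → l (𝟙 (e * d' ≟ d) * 𝟙 (coprime? e F)) (M * M) H x d')) (∑-*ˡ (suc d) (M * M * (H * (2 * x))) (λ d' → 𝟙 (e * d' ≟ d) * 𝟙 (coprime? e F) * d'))))
                (∑-*ˡ (suc d) (M * M * (H * (2 * x))) (λ e → ∑ (suc d) (λ d' → 𝟙 (e * d' ≟ d) * 𝟙 (coprime? e F) * d')))
              where l : ∀ i N H x d → i * (N * (H * (2 * (x * d)))) ≡ N * (H * (2 * x)) * (i * d)
                    l = solve-∀
            l₃ : ∀ N H x v s → N * (H * (2 * x)) * v * s ≡ N * (2 * x) * (H * v * s)
            l₃ = solve-∀

          bound : 8 * (x * x * x) * (d * d * d * d) * (m * m) * S d ≤ H * divs * ∑⁴ T' Φ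
          bound = [ bound-small , bound-large ]′ (toSum (M ≤? T₁))

      coordinate-bound : ∀ t u → t < T → u < T → ∣ g t u ∣ ≤ T * (Cc * T)
      coordinate-bound = g-bound

      -- The bound for `S d` carries `d⁴` on its left; multiplication by `Y d` turns this into the
      -- common `Z`. The sums over `d` and over quadruples are then exchanged, and for one quadruple
      -- the sum over `d` is the quantity of `DivisorTail` with `L = (m + 1) k`. Only quadruples
      -- with `k > 0` enter.
      off-bound : 4 * m * x * (m * m) * ∑ I₁ (λ δ → S (suc δ)) ≤ H * (I₁ * I₁) * ((2 + m) * (2 + m)) * ((m + 5) * positives + 4 * m * small)
      off-bound = go (I₁ ≟ 0)
        where
        go : Dec (I₁ ≡ 0) → 4 * m * x * (m * m) * ∑ I₁ (λ δ → S (suc δ)) ≤ H * (I₁ * I₁) * ((2 + m) * (2 + m)) * ((m + 5) * positives + 4 * m * small)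
        go (yes I₁≡0) = ≤-trans (≤-reflexive (trans (cong (4 * m * x * (m * m) *_) (trans (cong (λ n → ∑ n (λ δ → S (suc δ))) I₁≡0) refl)) (*-zeroʳ (4 * m * x * (m * m))))) z≤n
        go (no I₁≢0) = *-cancelˡ-≤ (4 * (x * x) * Z) {{m*n≢0 (4 * (x * x)) Z {{m*n≢0 4 (x * x) {{_}} {{m*n≢0 x x {{≢-nonZero x≢0}} {{≢-nonZero x≢0}}}}}} {{≢-nonZero Z≢0}}}}
            (≤-trans (≤-reflexive (l₁ x Z m (∑ I₁ (λ δ → S (suc δ))))) (≤-trans (*-monoʳ-≤ (2 * m) summed) (≤-trans (≤-reflexive l₂') (≤-trans (*-monoʳ-≤ H pointwise) (≤-reflexive l₃')))))
          where
          cm = commonMultiple I₁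
          Z = proj₁ cm
          Y = proj₁ (proj₂ cm)
          Z≢0 = proj₁ (proj₂ (proj₂ cm))
          Y≤ = proj₁ (proj₂ (proj₂ (proj₂ cm)))
          Y≡ = proj₂ (proj₂ (proj₂ (proj₂ cm)))
          A≢0 : A ≢ 0
          A≢0 = ≢-nonZero⁻¹ A {{m*n≢0 (2 * (x * I₁)) (2 + m) {{m*n≢0 2 (x * I₁) {{_}} {{m*n≢0 x I₁ {{≢-nonZero x≢0}} {{≢-nonZero I₁≢0}}}}}}}}
          G : ℕ → ℕ
          G κ' = ∑ I₁ (λ δ → Y (suc δ) * Fixed.divs δ * (𝟙 (suc m * κ' ≤? A * suc δ) * (suc m * κ' * (suc m * κ'))))
          l₁ : ∀ x Z m s → 4 * (x * x) * Z * (4 * m * x * (m * m) * s) ≡ 2 * m * (8 * (x * x * x) * (m * m) * (Z * s))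
          l₁ = solve-∀
          summed : 8 * (x * x * x) * (m * m) * (Z * ∑ I₁ (λ δ → S (suc δ))) ≤ H * ∑⁴ T' (λ t u t' u' → G (posPart (k t u t' u')))
          summed = ≤-trans (≤-reflexive (trans (sym (*-assoc (8 * (x * x * x) * (m * m)) Z (∑ I₁ (λ δ → S (suc δ))))) (sym (∑-*ˡ I₁ (8 * (x * x * x) * (m * m) * Z) (λ δ → S (suc δ))))))
            (≤-trans (∑-mono I₁ one) (≤-reflexive (trans (∑-*ˡ I₁ H (λ δ → Y (suc δ) * Fixed.divs δ * ∑⁴ T' (Fixed.Φ δ))) (cong (H *_)
               (trans (∑-cong I₁ (λ δ _ → sym (∑⁴-*ˡ T' (Y (suc δ) * Fixed.divs δ) (Fixed.Φ δ)))) (∑-∑⁴-swap I₁ T' (λ δ t u t' u' → Y (suc δ) * Fixed.divs δ * Fixed.Φ δ t u t' u')))))))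
            where
            one : ∀ δ → δ < I₁ → 8 * (x * x * x) * (m * m) * Z * S (suc δ) ≤ H * (Y (suc δ) * Fixed.divs δ * ∑⁴ T' (Fixed.Φ δ))
            one δ δ<I₁ = ≤-trans (≤-reflexive (trans (cong (λ z → 8 * (x * x * x) * (m * m) * z * S d) (sym (Y≡ d (s≤s z≤n) δ<I₁))) (l (x * x * x) (m * m) (Y d) (d * d * d * d) (S d))))
                (≤-trans (*-monoʳ-≤ (Y d) (Fixed.bound δ)) (≤-reflexive (l' (Y d) H (Fixed.divs δ) (∑⁴ T' (Fixed.Φ δ)))))
              where
              d = suc δ
              l : ∀ x e y d s → 8 * x * e * (y * d) * s ≡ y * (8 * x * d * e * s)
              l = solve-∀
              l' : ∀ y H v s → y * (H * v * s) ≡ H * (y * v * s)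
              l' = solve-∀
          G-positive : ∀ κ' → 2 * m * G κ' ≤ A * A * Z * (𝟙 (0 <? κ') * (m + 5) + 4 * m * (𝟙 (0 <? κ') * 𝟙 (suc m * κ' ≤? A * m)))
          G-positive zero = ≤-trans (≤-reflexive (trans (cong (2 * m *_) (∑-zero I₁ (λ δ _ → zz (Y (suc δ) * Fixed.divs δ) (𝟙 (suc m * 0 ≤? A * suc δ))))) (*-zeroʳ (2 * m)))) z≤n
            where zz : ∀ y i → y * (i * (suc m * 0 * (suc m * 0))) ≡ 0
                  zz y i = trans (cong (λ z → y * (i * (z * z))) (*-zeroʳ (suc m))) (trans (cong (y *_) (*-zeroʳ i)) (*-zeroʳ y))
          G-positive κ'@(suc _) = ≤-trans (≤-reflexive (cong (2 * m *_) G≡)) (≤-trans DT.G-bound (≤-reflexive (cong (A * A * Z *_) (l m (𝟙 (suc m * κ' ≤? A * m))))))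
            where
            module DT = DivisorTail I₁ m A (suc m * κ') Z F Y A≢0 (λ ()) m≢0 Y≤ rough
            l : ∀ m i → m + 5 + 4 * m * i ≡ 1 * (m + 5) + 4 * m * (1 * i)
            l = solve-∀
            G≡ : G κ' ≡ DT.G
            G≡ = ∑-cong I₁ (λ δ _ → trans (expandδ δ) (∑-cong (suc (suc δ)) (λ e _ → ∑-cong (suc (suc δ)) (λ d' _ → entry δ e d' (e * d' ≟ suc δ)))))
              where
              LL = suc m * κ'
              expandδ : ∀ δ → Y (suc δ) * Fixed.divs δ * (𝟙 (LL ≤? A * suc δ) * (LL * LL)) ≡
                ∑ (suc (suc δ)) (λ e → ∑ (suc (suc δ)) (λ d' → Y (suc δ) * (𝟙 (LL ≤? A * suc δ) * (LL * LL)) * (𝟙 (e * d' ≟ suc δ) * 𝟙 (coprime? e F) * d')))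
              expandδ δ = trans (l' (Y (suc δ)) (Fixed.divs δ) (𝟙 (LL ≤? A * suc δ) * (LL * LL))) (trans (sym (∑-*ˡ (suc (suc δ)) (Y (suc δ) * (𝟙 (LL ≤? A * suc δ) * (LL * LL))) (λ e → ∑ (suc (suc δ)) (λ d' → 𝟙 (e * d' ≟ suc δ) * 𝟙 (coprime? e F) * d'))))
                  (∑-cong (suc (suc δ)) (λ e _ → sym (∑-*ˡ (suc (suc δ)) (Y (suc δ) * (𝟙 (LL ≤? A * suc δ) * (LL * LL))) (λ d' → 𝟙 (e * d' ≟ suc δ) * 𝟙 (coprime? e F) * d')))))
                where l' : ∀ y v z → y * v * z ≡ y * z * v
                      l' = solve-∀
              entry : ∀ δ e d' (dec : Dec (e * d' ≡ suc δ)) → Y (suc δ) * (𝟙 (LL ≤? A * suc δ) * (LL * LL)) * (𝟙 dec * 𝟙 (coprime? e F) * d') ≡ 𝟙 dec * DT.w e d'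
              entry δ e d' (no _) = *-zeroʳ (Y (suc δ) * (𝟙 (LL ≤? A * suc δ) * (LL * LL)))
              entry δ e d' (yes eq) = trans (l' (Y (suc δ)) (𝟙 (LL ≤? A * suc δ) * (LL * LL)) (𝟙 (coprime? e F)) d') (cong (λ z → 1 * (𝟙 (coprime? e F) * (d' * Y z * (𝟙 (LL ≤? A * z) * (LL * LL))))) (sym eq))
                where l' : ∀ y z i d → y * z * (1 * i * d) ≡ 1 * (i * (d * y * z))
                      l' = solve-∀
          GT = ∑⁴ T' (λ t u t' u' → G (posPart (k t u t' u')))
          l₂' : 2 * m * (H * GT) ≡ H * (2 * m * GT)
          l₂' = l (2 * m) H GT where l : ∀ a b c → a * (b * c) ≡ b * (a * c)
                                     l = solve-∀
          pointwise : 2 * m * GT ≤ A * A * Z * ((m + 5) * positives + 4 * m * small)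
          pointwise = ≤-trans (≤-reflexive (sym (∑⁴-*ˡ T' (2 * m) (λ t u t' u' → G (posPart (k t u t' u'))))))
            (≤-trans (∑⁴-mono T' (λ t u t' u' _ _ _ _ → G-positive (posPart (k t u t' u'))))
            (≤-reflexive (trans (∑⁴-*ˡ T' (A * A * Z) _) (cong (A * A * Z *_) (trans (∑⁴-+ T' (λ t u t' u' → 𝟙 (0 <? posPart (k t u t' u')) * (m + 5)) (λ t u t' u' → 4 * m * (𝟙 (0 <? posPart (k t u t' u')) * 𝟙 (suc m * posPart (k t u t' u') ≤? A * m))))
              (cong₂ _+_ (trans (∑⁴-cong T' (λ t u t' u' _ _ _ _ → *-comm (𝟙 (0 <? posPart (k t u t' u'))) (m + 5))) (∑⁴-*ˡ T' (m + 5) (λ t u t' u' → 𝟙 (0 <? posPart (k t u t' u')))))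
                 (∑⁴-*ˡ T' (4 * m) (λ t u t' u' → 𝟙 (0 <? posPart (k t u t' u')) * 𝟙 (suc m * posPart (k t u t' u') ≤? A * m)))))))))
          l₃' : H * (A * A * Z * ((m + 5) * positives + 4 * m * small)) ≡ 4 * (x * x) * Z * (H * (I₁ * I₁) * ((2 + m) * (2 + m)) * ((m + 5) * positives + 4 * m * small))
          l₃' = l H x I₁ m Z ((m + 5) * positives + 4 * m * small)
            where l : ∀ H x I m Z v → H * (2 * (x * I) * (2 + m) * (2 * (x * I) * (2 + m)) * Z * v) ≡ 4 * (x * x) * Z * (H * (I * I) * ((2 + m) * (2 + m)) * v)
                  l = solve-∀

  -- The exceptional parts of the second moment

  ∑-two-triangles : ∀ n (f : ℕ → ℕ → ℕ) → ∑ n (λ i → ∑ n (f i)) ≤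
    ∑ n (λ i → f i i) + (∑ n (λ η → ∑ n (λ j → f (j + suc η) j)) + ∑ n (λ η → ∑ n (λ j → f j (j + suc η))))
  ∑-two-triangles n f = ≤-trans (≤-reflexive (split n)) (+-monoʳ-≤ (∑ n (λ i → f i i)) (+-mono-≤ (∑-diagonals n f) (∑-diagonals n (λ i j → f j i))))
    where
    split : ∀ n → ∑ n (λ i → ∑ n (f i)) ≡ ∑ n (λ i → f i i) + (∑ n (λ i → ∑ i (f i)) + ∑ n (λ i → ∑ i (λ j → f j i)))
    split zero = refl
    split (suc n) = trans (cong (λ z → z + (∑ n (f n) + f n n)) (trans (∑-+ n (λ i → ∑ n (f i)) (λ i → f i n)) (cong (λ z → z + ∑ n (λ i → f i n)) (split n))))
      (l (∑ n (λ i → f i i)) (∑ n (λ i → ∑ i (f i))) (∑ n (λ i → ∑ i (λ j → f j i))) (∑ n (λ i → f i n)) (∑ n (f n)) (f n n))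
      where l : ∀ a b c d e g → a + (b + c) + d + (e + g) ≡ a + g + (b + e + (c + d))
            l = solve-∀

  -- If `v` divides no `n (δ + 1)` with `δ < J`, points of the support are at least `J` apart.
  -- Otherwise the trivial bound is charged to the last term.
  spaced-or-divides : ∀ T₂ J n v (χ : ℕ → ℕ) → (∀ i → χ i ≤ 1) → (∀ i j → i < j → χ i ≢ 0 → χ j ≢ 0 → v ℕD.∣ n * (j ∸ i)) →
    ∑ (T₂ * J) χ ≤ T₂ + T₂ * J * ∑ J (λ δ → 𝟙 (v ℕD.∣? n * suc δ))
  spaced-or-divides T₂ J n v χ χ≤1 hyp = go (s ≟ 0)
    where
    s = ∑ J (λ δ → 𝟙 (v ℕD.∣? n * suc δ))
    go : Dec (s ≡ 0) → ∑ (T₂ * J) χ ≤ T₂ + T₂ * J * s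
    go (no s≢0) = ≤-trans (∑-mono (T₂ * J) (λ i _ → χ≤1 i)) (≤-trans (≤-reflexive (∑-const (T₂ * J) 1)) (≤-trans (*-monoʳ-≤ (T₂ * J) (n≢0⇒n>0 s≢0)) (m≤n+m _ T₂)))
    go (yes s≡0) = ≤-trans (∑-spaced T₂ J χ χ≤1 sp) (m≤m+n T₂ _)
      where
      sp : ∀ i j → i < j → j < T₂ * J → χ i ≢ 0 → χ j ≢ 0 → J ≤ j ∸ i
      sp i j i<j _ p q = ≮⇒≥ λ lt → 1+n≢0 (n≤0⇒n≡0 (subst (1 ≤_) s≡0 (≤-trans (≤-reflexive (sym (𝟙-yes (v ℕD.∣? n * suc (pred (j ∸ i))) (subst (λ z → v ℕD.∣ n * z) (sym e) (hyp i j i<j p q)))))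
          (∑-term J (λ δ → 𝟙 (v ℕD.∣? n * suc δ)) (pred (j ∸ i)) (≤-trans (≤-reflexive e) (<⇒≤ lt))))))
        where e : suc (pred (j ∸ i)) ≡ j ∸ i
              e = suc-pred (j ∸ i) {{>-nonZero (m<n⇒0<n∸m i<j)}}

  -- divisors of n exceeding V are determined by their cofactor, which is less than E
  few-large-divisors : ∀ N V E n → n ≢ 0 → n < E * suc V → ∑ N (λ δ → 𝟙 (suc (V + δ) ℕD.∣? n)) ≤ E
  few-large-divisors N V E n n≢0 lt = ≤-trans (∑-mono N (λ δ _ → one δ)) (≤-trans (≤-reflexive (∑-swap N E (λ δ e → 𝟙 (e * suc (V + δ) ≟ n))))
     (≤-trans (∑-mono E (λ e _ → ∑-at-most-one N (λ δ → 𝟙 (e * suc (V + δ) ≟ n)) 1 (λ δ _ → 𝟙≤1 (e * suc (V + δ) ≟ n)) (un e))) (≤-reflexive (trans (∑-const E 1) (*-identityʳ E)))))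
    where
    one : ∀ δ → 𝟙 (suc (V + δ) ℕD.∣? n) ≤ ∑ E (λ e → 𝟙 (e * suc (V + δ) ≟ n))
    one δ = go (suc (V + δ) ℕD.∣? n)
      where
      go : (dec : Dec (suc (V + δ) ℕD.∣ n)) → 𝟙 dec ≤ ∑ E (λ e → 𝟙 (e * suc (V + δ) ≟ n))
      go (no _) = z≤n
      go (yes (ℕD.divides e eq)) = ≤-trans (≤-reflexive (sym (𝟙-yes (e * suc (V + δ) ≟ n) (sym eq)))) (∑-term E (λ e → 𝟙 (e * suc (V + δ) ≟ n)) e
        (*-cancelʳ-< (suc V) e E (≤-trans (s≤s (≤-trans (*-monoʳ-≤ e (s≤s (m≤m+n V δ))) (≤-reflexive (sym eq)))) lt)))
    un : ∀ e δ δ' → δ < N → δ' < N → 𝟙 (e * suc (V + δ) ≟ n) ≢ 0 → 𝟙 (e * suc (V + δ') ≟ n) ≢ 0 → δ ≡ δ'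
    un zero δ δ' _ _ p _ = ⊥-elim (n≢0 (sym (𝟙-true (0 ≟ n) p)))
    un (suc e) δ δ' _ _ p p' = +-cancelˡ-≡ V _ _ (suc-injective (*-cancelˡ-≡ (suc (V + δ)) (suc (V + δ')) (suc e) (trans (𝟙-true (suc e * suc (V + δ) ≟ n) p) (sym (𝟙-true (suc e * suc (V + δ') ≟ n) p')))))

  module Errors (𝓕 : Family) (b≢0 : ∣ Family.b 𝓕 ∣ ≢ 0) (c≢0 : ∣ Family.c 𝓕 ∣ ≢ 0) (m K r : ℕ) (m≢0 : m ≢ 0) (K≢0 : K ≢ 0) where
    open Family 𝓕 hiding (χ)
    -- `J` is, up to a constant, the factor to be saved in the count of `zeros`. `R` is the length
    -- of an initial segment given away in the count of `small`, and `T₁ = 16 m R` makes that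
    -- segment negligible. All lengths are proportional to the scale `r`.
    J R' R T₁ : ℕ
    J = 64 * (q * a * K) * m
    R' = J * r
    R = 4 * (q * a * K) * R'
    T₁ = 16 * m * R
    open Moment 𝓕 m T₁ K public

    -- `T = T₂ J = T₃ J²`: one factor `J` for the spacing of solutions, one for separating small
    -- from large divisors. `Δ R = A m` is the width of the window for `small`. `R₀` does not
    -- involve `r`, so it is exceeded by `R'` for large scales.
    T₂ T₃ Δ E c₀ R₀ : ℕ
    T₃ = m * r
    T₂ = T₃ * J
    Δ = 2 * (x * K) * (2 + m) * m * (16 * m * m)
    c₀ = 2 * (q * ∣ b ∣)
    E = suc (c₀ * J * J * J)
    R₀ = suc (∣ α₂ ∣ + Δ + 8 * (x * K) * m * (5 + 4 * J * E))

    private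
      q≢0 : q ≢ 0
      q≢0 e = [ H≢0 , q'≢0 ]′ (m*n≡0⇒m≡0∨n≡0 H e)
      1≤q : 1 ≤ q
      1≤q = n≢0⇒n>0 q≢0
      1≤xK : 1 ≤ x * K
      1≤xK = *-mono-≤ (*-mono-≤ 1≤q (n≢0⇒n>0 a≢0)) (n≢0⇒n>0 K≢0)
      T≡ : T ≡ T₂ * J
      T≡ = l m (x * K) J r where l : ∀ m y J r → m * (16 * m * (4 * y * (J * r))) ≡ m * r * J * (64 * y * m)
                                 l = solve-∀
      A≡ : A * m ≡ Δ * R
      A≡ = l x K m R where l : ∀ x K m R → 2 * (x * (K * (m * (16 * m * R)))) * (2 + m) * m ≡ 2 * (x * K) * (2 + m) * m * (16 * m * m) * R
                           l = solve-∀
      R'≤R : R' ≤ R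
      R'≤R = ≤-trans (≤-reflexive (sym (+-identityʳ R'))) (*-monoˡ-≤ R' (*-mono-≤ {1} {4} (s≤s z≤n) 1≤xK))
      R≤T : R ≤ T
      R≤T = ≤-trans (≤-reflexive (sym (+-identityʳ R))) (≤-trans (*-monoˡ-≤ R (*-mono-≤ {1} {16} (s≤s z≤n) (n≢0⇒n>0 m≢0))) (≤-trans (≤-reflexive (sym (+-identityʳ T₁))) (*-monoˡ-≤ T₁ (n≢0⇒n>0 m≢0))))

    module _ (large : R₀ ≤ R') where
      private
        α₂≤R : ∣ α₂ ∣ ≤ R
        α₂≤R = ≤-trans (≤-trans (m≤n⇒m≤1+n (≤-trans (m≤m+n (∣ α₂ ∣) Δ) (m≤m+n (∣ α₂ ∣ + Δ) _))) large) R'≤R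
        Δ<R : suc Δ ≤ R
        Δ<R = ≤-trans (≤-trans (s≤s (≤-trans (m≤n+m Δ (∣ α₂ ∣)) (m≤m+n (∣ α₂ ∣ + Δ) _))) large) R'≤R
        1≤R : 1 ≤ R
        1≤R = ≤-trans (s≤s z≤n) Δ<R

      -- With `t`, `u`, `t'` fixed and `u' ≥ R`, each step of `u'` moves `k` by at least `R`, so a
      -- window of width `Δ R` catches at most `Δ + 1` of its values. The first `R` values of `u'`
      -- are counted trivially.
      small-bound : 8 * m * small ≤ T' * (T' * (T' * (T' * 1)))
      small-bound = ≤-trans (*-monoʳ-≤ (8 * m) (≤-trans (∑²-mono T' (λ t u _ _ → ∑-mono T' (λ t' _ → row t u t'))) (≤-reflexive (trans (∑²-cong T' (λ t u _ _ → ∑-const T' (R + suc Δ))) (∑²-const T' (T' * (R + suc Δ)))))))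
          (≤-trans (≤-reflexive (l₁ m T' (R + suc Δ))) (*-monoʳ-≤ T' (*-monoʳ-≤ T' (*-monoʳ-≤ T' (≤-trans (*-monoʳ-≤ (8 * m) (+-monoʳ-≤ R Δ<R)) (≤-trans (≤-reflexive (l₂ m R)) (≤-trans (m≤m+n T₁ (m * T₁)) (≤-reflexive (sym (*-identityʳ T'))))))))))
        where
        l₁ : ∀ m T r → 8 * m * (T * (T * (T * r))) ≡ T * (T * (T * (8 * m * r)))
        l₁ = solve-∀
        l₂ : ∀ m R → 8 * m * (R + R) ≡ 16 * m * R
        l₂ = solve-∀
        row : ∀ t u t' → ∑ T' (λ u' → 𝟙 (0 <? posPart (k t u t' u')) * 𝟙 (suc m * posPart (k t u t' u') ≤? A * m)) ≤ R + suc Δ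
        row t u t' = ≤-trans (∑-extend χ (m≤n+m T' R)) (≤-trans (≤-reflexive (∑-split R T' χ)) (+-mono-≤ (≤-trans (∑-mono R (λ i _ → χ≤1 i)) (≤-reflexive (trans (∑-const R 1) (*-identityʳ R)))) (∑-clustered T' Δ (λ i → χ (R + i)) (λ i → χ≤1 (R + i)) cl)))
          where
          χ : ℕ → ℕ
          χ u' = 𝟙 (0 <? posPart (k t u t' u')) * 𝟙 (suc m * posPart (k t u t' u') ≤? A * m)
          χ≤1 : ∀ i → χ i ≤ 1
          χ≤1 i = *-mono-≤ (𝟙≤1 (0 <? posPart (k t u t' i))) (𝟙≤1 (suc m * posPart (k t u t' i) ≤? A * m))
          pos⇒ : ∀ z → 0 < posPart z → z ≡ + posPart z
          pos⇒ (+ n) _ = refl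
          info : ∀ i → χ i ≢ 0 → (k t u t' i ≡ + posPart (k t u t' i)) × posPart (k t u t' i) ≤ A * m
          info i ne = pos⇒ _ (𝟙-true (0 <? posPart (k t u t' i)) (*≢0⇒ˡ ne)) , ≤-trans (m≤m+n _ (m * posPart (k t u t' i))) (𝟙-true (suc m * posPart (k t u t' i) ≤? A * m) (*≢0⇒ʳ (𝟙 (0 <? posPart (k t u t' i))) ne))
          cl : ∀ i j → i < j → j < T' → χ (R + i) ≢ 0 → χ (R + j) ≢ 0 → j ≤ i + Δ
          cl i j i<j _ p p' = ≤-trans (≤-reflexive (sym (m+[n∸m]≡n (<⇒≤ i<j)))) (+-monoʳ-≤ i (*-cancelʳ-≤ (j ∸ i) Δ R {{>-nonZero 1≤R}} (≤-trans (*-monoʳ-≤ (j ∸ i) R≤y) (≤-trans (≤-reflexive prod) (≤-trans diff (≤-reflexive A≡))))))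
            where
            y = α₂ +ᶻ + q *ᶻ c *ᶻ + (R + j + (R + i))
            k₁ = k t u t' (R + j)
            k₀ = k t u t' (R + i)
            kd : (+ j -ᶻ + i) *ᶻ y ≡ k₁ -ᶻ k₀
            kd = l (α₁ *ᶻ + t') α₂ (+ q) (b *ᶻ (+ t' *ᶻ + t')) c (+ R) (+ i) (+ j) (g t u)
              where l : ∀ X α q Y c R i j G → (j -ᶻ i) *ᶻ (α +ᶻ q *ᶻ c *ᶻ (R +ᶻ j +ᶻ (R +ᶻ i))) ≡
                          ((X +ᶻ α *ᶻ (R +ᶻ j) +ᶻ q *ᶻ (Y +ᶻ c *ᶻ ((R +ᶻ j) *ᶻ (R +ᶻ j)))) -ᶻ G) -ᶻ ((X +ᶻ α *ᶻ (R +ᶻ i) +ᶻ q *ᶻ (Y +ᶻ c *ᶻ ((R +ᶻ i) *ᶻ (R +ᶻ i)))) -ᶻ G)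
                    l = solveᶻ
            prod : (j ∸ i) * ∣ y ∣ ≡ ∣ k₁ -ᶻ k₀ ∣
            prod = trans (sym (ℤP.abs-* (+ (j ∸ i)) y)) (cong ∣_∣ (trans (cong (_*ᶻ y) (pos-∸ (<⇒≤ i<j))) kd))
            diff : ∣ k₁ -ᶻ k₀ ∣ ≤ A * m
            diff = ≤-trans (≤-reflexive (cong ∣_∣ (trans (cong₂ _-ᶻ_ (proj₁ (info (R + j) p')) (proj₁ (info (R + i) p))) (ℤP.m-n≡m⊖n (posPart k₁) (posPart k₀)))))
               (≤-trans (ℤP.∣m⊝n∣≤m⊔n (posPart k₁) (posPart k₀)) (⊔-lub (proj₂ (info (R + j) p')) (proj₂ (info (R + i) p))))
            R≤y : R ≤ ∣ y ∣
            R≤y = +-cancelʳ-≤ R _ _ (≤-trans big (≤-trans (ℤP.∣i-j∣≤∣i∣+∣j∣ y α₂) (+-monoʳ-≤ (∣ y ∣) α₂≤R)))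
              where
              N = R + j + (R + i)
              big : R + R ≤ ∣ y -ᶻ α₂ ∣
              big = ≤-trans (≤-trans (+-mono-≤ (m≤m+n R j) (m≤m+n R i)) (≤-trans (≤-reflexive (sym (+-identityʳ N))) (*-monoˡ-≤ N (*-mono-≤ 1≤q (n≢0⇒n>0 c≢0)))))
                 (≤-reflexive (sym (trans (cong ∣_∣ (l α₂ (+ q *ᶻ c *ᶻ + N))) (trans (ℤP.abs-* (+ q *ᶻ c) (+ N)) (cong (_* N) (ℤP.abs-* (+ q) c))))))
                where l : ∀ a b → a +ᶻ b -ᶻ a ≡ b
                      l = solveᶻ

      private
        Z⁰ : ℕ → ℕ → ℕ → ℕ → ℕ
        Z⁰ t u t' u' = 𝟙 (+ 0 ℤ.≟ k t u t' u')

        C : ℕ → ℕ → ℕ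
        C u u' = ∑ T (λ t → ∑ T (λ t' → Z⁰ t u t' u'))

        zeros≡ : zeros ≡ ∑ T (λ u → ∑ T (C u))
        zeros≡ = trans (∑-swap T T (λ t u → ∑² T (Z⁰ t u))) (∑-cong T (λ u _ → trans (∑-cong T (λ t _ → ∑-swap T T (Z⁰ t u))) (∑-swap T T (λ t u' → ∑ T (λ t' → Z⁰ t u t' u')))))

        C-sym : ∀ u u' → C u u' ≡ C u' u
        C-sym u u' = trans (∑-swap T T (λ t t' → Z⁰ t u t' u')) (∑²-cong T (λ t' t _ _ → 𝟙-cong (+ 0 ℤ.≟ k t u t' u') (+ 0 ℤ.≟ k t' u' t u) (λ e → trans (cong -ᶻ_ e) (l (g t' u') (g t u))) (λ e → trans (cong -ᶻ_ e) (l (g t u) (g t' u')))))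
          where l : ∀ x y → -ᶻ (x -ᶻ y) ≡ y -ᶻ x
                l = solveᶻ

        s₁ s₂ : ℕ → ℤ
        s₁ t = α₁ *ᶻ + t +ᶻ + q *ᶻ b *ᶻ (+ t *ᶻ + t)
        s₂ u = α₂ *ᶻ + u +ᶻ + q *ᶻ c *ᶻ (+ u *ᶻ + u)
        k≡ : ∀ t u t' u' → k t u t' u' ≡ (s₁ t' -ᶻ s₁ t) +ᶻ (s₂ u' -ᶻ s₂ u)
        k≡ t u t' u' = l α₁ α₂ (+ q) b c (+ t) (+ u) (+ t') (+ u')
          where l : ∀ α β q b c t u t' u' → (α *ᶻ t' +ᶻ β *ᶻ u' +ᶻ q *ᶻ (b *ᶻ (t' *ᶻ t') +ᶻ c *ᶻ (u' *ᶻ u'))) -ᶻ (α *ᶻ t +ᶻ β *ᶻ u +ᶻ q *ᶻ (b *ᶻ (t *ᶻ t) +ᶻ c *ᶻ (u *ᶻ u)))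
                  ≡ ((α *ᶻ t' +ᶻ q *ᶻ b *ᶻ (t' *ᶻ t')) -ᶻ (α *ᶻ t +ᶻ q *ᶻ b *ᶻ (t *ᶻ t))) +ᶻ ((β *ᶻ u' +ᶻ q *ᶻ c *ᶻ (u' *ᶻ u')) -ᶻ (β *ᶻ u +ᶻ q *ᶻ c *ᶻ (u *ᶻ u)))
                l = solveᶻ

        step-diff : ∀ α β v j j' → let s = λ n → α *ᶻ n +ᶻ + q *ᶻ β *ᶻ (n *ᶻ n) in
          (s (+ (j' + v)) -ᶻ s (+ j')) -ᶻ (s (+ (j + v)) -ᶻ s (+ j)) ≡ + 2 *ᶻ (+ q *ᶻ β) *ᶻ (+ v *ᶻ (+ j' -ᶻ + j))
        step-diff α β v j j' = l α (+ q *ᶻ β) (+ v) (+ j) (+ j')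
          where l : ∀ α β v j j' → ((α *ᶻ (j' +ᶻ v) +ᶻ β *ᶻ ((j' +ᶻ v) *ᶻ (j' +ᶻ v))) -ᶻ (α *ᶻ j' +ᶻ β *ᶻ (j' *ᶻ j'))) -ᶻ ((α *ᶻ (j +ᶻ v) +ᶻ β *ᶻ ((j +ᶻ v) *ᶻ (j +ᶻ v))) -ᶻ (α *ᶻ j +ᶻ β *ᶻ (j *ᶻ j)))
                     ≡ + 2 *ᶻ β *ᶻ (v *ᶻ (j' -ᶻ j))
                l = solveᶻ

        nonzero-coeff : ∀ β v → ∣ β ∣ ≢ 0 → ∀ z → + 2 *ᶻ (+ q *ᶻ β) *ᶻ (+ suc v *ᶻ z) ≡ + 0 → z ≡ + 0
        nonzero-coeff β v β≢0 z e = [ (λ e₁ → ⊥-elim ([ (λ ()) , (λ e₂ → [ (λ e₃ → q≢0 (ℤP.+-injective e₃)) , (λ e₃ → β≢0 (cong ∣_∣ e₃)) ]′ (ℤP.i*j≡0⇒i≡0∨j≡0 (+ q) e₂)) ]′ (ℤP.i*j≡0⇒i≡0∨j≡0 (+ 2) e₁)))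
            , (λ e₁ → [ (λ ()) , (λ e₂ → e₂) ]′ (ℤP.i*j≡0⇒i≡0∨j≡0 (+ suc v) e₁)) ]′ (ℤP.i*j≡0⇒i≡0∨j≡0 (+ 2 *ᶻ (+ q *ᶻ β)) e)

        minus-eq : ∀ i j → + j -ᶻ + i ≡ + 0 → i ≡ j
        minus-eq i j e = ℤP.+-injective (trans (l (+ i) (+ j)) (trans (cong (λ z → + j -ᶻ z) e) (l' (+ j))))
          where l : ∀ i j → i ≡ j -ᶻ (j -ᶻ i)
                l = solveᶻ
                l' : ∀ j → j -ᶻ + 0 ≡ j
                l' = solveᶻ

        sub0 : ∀ {x y} → + 0 ≡ x → + 0 ≡ y → y -ᶻ x ≡ + 0
        sub0 refl refl = refl

        L : ℕ → ℕ → ℕ → ℕ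
        L δ t t' = ∑ T (λ j → Z⁰ t (j + suc δ) t' j)

        -- For a fixed difference of `u` and `u'`, the equation is affine in `j` with slope a
        -- nonzero multiple of `q c`.
        L≤1 : ∀ δ t t' → L δ t t' ≤ 1
        L≤1 δ t t' = ∑-at-most-one T (λ j → Z⁰ t (j + suc δ) t' j) 1 (λ j _ → 𝟙≤1 (+ 0 ℤ.≟ k t (j + suc δ) t' j)) un
          where
          un : ∀ i j → i < T → j < T → Z⁰ t (i + suc δ) t' i ≢ 0 → Z⁰ t (j + suc δ) t' j ≢ 0 → i ≡ j
          un i j _ _ p p' = minus-eq i j (nonzero-coeff c δ c≢0 (+ j -ᶻ + i) (trans (sym (step-diff α₂ c (suc δ) i j)) (trans (l (s₁ t' -ᶻ s₁ t) (s₂ i) (s₂ (i + suc δ)) (s₂ j) (s₂ (j + suc δ)))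
              (sub0 (trans (𝟙-true (+ 0 ℤ.≟ k t (j + suc δ) t' j) p') (k≡ t (j + suc δ) t' j)) (trans (𝟙-true (+ 0 ℤ.≟ k t (i + suc δ) t' i) p) (k≡ t (i + suc δ) t' i))))))
            where l : ∀ X a b c d → (d -ᶻ c) -ᶻ (b -ᶻ a) ≡ (X +ᶻ (a -ᶻ b)) -ᶻ (X +ᶻ (c -ᶻ d))
                  l = solveᶻ

        -- With both differences fixed, `t` against `t'` by `η + 1` and `u` against `u'` by `δ + 1`,
        -- the equation is linear in the positions `i` and `j`. Subtracting two solutions shows that
        -- `δ + 1` divides `c₀ (η + 1) (i' - i)`. `σ` covers both orders of `t` and `t'`.
        spaced : ∀ δ η (σ : ℕ → ℕ × ℕ) →
          (∀ i i' → s₁ (proj₂ (σ i')) -ᶻ s₁ (proj₁ (σ i')) -ᶻ (s₁ (proj₂ (σ i)) -ᶻ s₁ (proj₁ (σ i))) ≡ + 2 *ᶻ (+ q *ᶻ b) *ᶻ (+ suc η *ᶻ (+ i' -ᶻ + i)) ⊎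
                    s₁ (proj₂ (σ i')) -ᶻ s₁ (proj₁ (σ i')) -ᶻ (s₁ (proj₂ (σ i)) -ᶻ s₁ (proj₁ (σ i))) ≡ -ᶻ (+ 2 *ᶻ (+ q *ᶻ b) *ᶻ (+ suc η *ᶻ (+ i' -ᶻ + i)))) →
          ∑ T (λ i → L δ (proj₁ (σ i)) (proj₂ (σ i))) ≤ T₂ + T * ∑ J (λ δ' → 𝟙 (suc δ ℕD.∣? c₀ * suc η * suc δ'))
        spaced δ η σ eqs = subst (λ z → ∑ z χ ≤ T₂ + z * ∑ J (λ δ' → 𝟙 (suc δ ℕD.∣? c₀ * suc η * suc δ'))) (sym T≡) (spaced-or-divides T₂ J (c₀ * suc η) (suc δ) χ (λ i → L≤1 δ _ _) div)
          where
          χ : ℕ → ℕ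
          χ i = L δ (proj₁ (σ i)) (proj₂ (σ i))
          div : ∀ i i' → i < i' → χ i ≢ 0 → χ i' ≢ 0 → suc δ ℕD.∣ c₀ * suc η * (i' ∸ i)
          div i i' i<i' p p' = subst (suc δ ℕD.∣_) size (∣⇒∣ᵤ dv)
            where
            w = ∑-positive T (λ j → Z⁰ (proj₁ (σ i)) (j + suc δ) (proj₂ (σ i)) j) p
            w' = ∑-positive T (λ j → Z⁰ (proj₁ (σ i')) (j + suc δ) (proj₂ (σ i')) j) p'
            j = proj₁ w
            j' = proj₁ w'
            X = s₁ (proj₂ (σ i)) -ᶻ s₁ (proj₁ (σ i))
            X' = s₁ (proj₂ (σ i')) -ᶻ s₁ (proj₁ (σ i'))
            z₁ : + 0 ≡ X +ᶻ (s₂ j -ᶻ s₂ (j + suc δ))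
            z₁ = trans (𝟙-true (+ 0 ℤ.≟ k (proj₁ (σ i)) (j + suc δ) (proj₂ (σ i)) j) (proj₂ (proj₂ w))) (k≡ (proj₁ (σ i)) (j + suc δ) (proj₂ (σ i)) j)
            z₂ : + 0 ≡ X' +ᶻ (s₂ j' -ᶻ s₂ (j' + suc δ))
            z₂ = trans (𝟙-true (+ 0 ℤ.≟ k (proj₁ (σ i')) (j' + suc δ) (proj₂ (σ i')) j') (proj₂ (proj₂ w'))) (k≡ (proj₁ (σ i')) (j' + suc δ) (proj₂ (σ i')) j')
            Q = + 2 *ᶻ (+ q *ᶻ b) *ᶻ (+ suc η *ᶻ (+ i' -ᶻ + i))
            rel : X' -ᶻ X ≡ + 2 *ᶻ (+ q *ᶻ c) *ᶻ (+ suc δ *ᶻ (+ j' -ᶻ + j))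
            rel = trans (l X X' (s₂ j) (s₂ (j + suc δ)) (s₂ j') (s₂ (j' + suc δ))) (trans (cong₂ (λ y z → z +ᶻ ((s₂ (j' + suc δ) -ᶻ s₂ j') -ᶻ (s₂ (j + suc δ) -ᶻ s₂ j)) -ᶻ y) (sym z₁) (sym z₂))
               (trans (l' ((s₂ (j' + suc δ) -ᶻ s₂ j') -ᶻ (s₂ (j + suc δ) -ᶻ s₂ j))) (step-diff α₂ c (suc δ) j j')))
              where l : ∀ X X' a b a' b' → X' -ᶻ X ≡ (X' +ᶻ (a' -ᶻ b')) +ᶻ ((b' -ᶻ a') -ᶻ (b -ᶻ a)) -ᶻ (X +ᶻ (a -ᶻ b))
                    l = solveᶻ
                    l' : ∀ z → + 0 +ᶻ z -ᶻ + 0 ≡ z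
                    l' = solveᶻ
            dX : + suc δ ∣ X' -ᶻ X
            dX = ∣-eq (divides (+ 2 *ᶻ (+ q *ᶻ c) *ᶻ (+ j' -ᶻ + j)) refl) (trans (l (+ 2 *ᶻ (+ q *ᶻ c)) (+ suc δ) (+ j' -ᶻ + j)) (sym rel))
              where l : ∀ a d z → a *ᶻ z *ᶻ d ≡ a *ᶻ (d *ᶻ z)
                    l = solveᶻ
            dv : + suc δ ∣ Q
            dv = [ (λ e → ∣-eq dX e) , (λ e → ∣-eq (ℤD.∣m⇒∣-m dX) (trans (cong -ᶻ_ e) (ℤP.neg-involutive Q))) ]′ (eqs i i')
            size : ∣ Q ∣ ≡ c₀ * suc η * (i' ∸ i)
            size = trans (cong (λ z → ∣ + 2 *ᶻ (+ q *ᶻ b) *ᶻ (+ suc η *ᶻ z) ∣) (sym (pos-∸ (<⇒≤ i<i')))) (trans (ℤP.abs-* (+ 2 *ᶻ (+ q *ᶻ b)) (+ suc η *ᶻ + (i' ∸ i)))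
               (trans (cong₂ _*_ (trans (ℤP.abs-* (+ 2) (+ q *ᶻ b)) (cong (2 *_) (ℤP.abs-* (+ q) b))) (ℤP.abs-* (+ suc η) (+ (i' ∸ i)))) (sym (*-assoc c₀ (suc η) (i' ∸ i)))))

        bad : ℕ → ℕ → ℕ
        bad δ η = ∑ J (λ δ' → 𝟙 (suc δ ℕD.∣? c₀ * suc η * suc δ'))

        lower-triangle : ∀ δ η → ∑ T (λ i → L δ (i + suc η) i) ≤ T₂ + T * bad δ η
        lower-triangle δ η = spaced δ η (λ i → i + suc η , i) (λ i i' → inj₂ (trans (l (s₁ i) (s₁ (i + suc η)) (s₁ i') (s₁ (i' + suc η))) (cong -ᶻ_ (step-diff α₁ b (suc η) i i'))))
          where l : ∀ a b a' b' → a' -ᶻ b' -ᶻ (a -ᶻ b) ≡ -ᶻ ((b' -ᶻ a') -ᶻ (b -ᶻ a))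
                l = solveᶻ

        upper-triangle : ∀ δ η → ∑ T (λ i → L δ i (i + suc η)) ≤ T₂ + T * bad δ η
        upper-triangle δ η = spaced δ η (λ i → i , i + suc η) (λ i i' → inj₁ (step-diff α₁ b (suc η) i i'))

        column : ∀ δ → ∑ T (λ j → C (j + suc δ) j) ≤ T + 2 * (T * T₂ + T * ∑ T (bad δ))
        column δ = ≤-trans (≤-reflexive (∑-∑²-swap T T (λ j t t' → Z⁰ t (j + suc δ) t' j))) (≤-trans (∑-two-triangles T (L δ))
          (≤-trans (+-mono-≤ (≤-trans (∑-mono T (λ t _ → L≤1 δ t t)) (≤-reflexive (trans (∑-const T 1) (*-identityʳ T))))
                     (+-mono-≤ (≤-trans (∑-mono T (λ η _ → lower-triangle δ η)) tot) (≤-trans (∑-mono T (λ η _ → upper-triangle δ η)) tot)))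
            (≤-reflexive (cong (λ z → T + (S' + z)) (sym (+-identityʳ S'))))))
          where
          S' = T * T₂ + T * ∑ T (bad δ)
          tot : ∑ T (λ η → T₂ + T * bad δ η) ≤ S'
          tot = ≤-reflexive (trans (∑-+ T (λ _ → T₂) (λ η → T * bad δ η)) (cong₂ _+_ (∑-const T T₂) (∑-*ˡ T T (bad δ))))

        same-u : ∀ u → C u u ≤ 3 * T
        same-u u = ≤-trans (∑-two-triangles T (λ t t' → Z⁰ t u t' u)) (≤-trans (+-mono-≤ (≤-trans (∑-mono T (λ t _ → 𝟙≤1 (+ 0 ℤ.≟ k t u t u))) (≤-reflexive (trans (∑-const T 1) (*-identityʳ T))))
            (+-mono-≤ (≤-trans (∑-mono T (λ η _ → lo η)) (≤-reflexive (trans (∑-const T 1) (*-identityʳ T)))) (≤-trans (∑-mono T (λ η _ → up η)) (≤-reflexive (trans (∑-const T 1) (*-identityʳ T))))))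
            (≤-reflexive (l T)))
          where
          l : ∀ T → T + (T + T) ≡ 3 * T
          l = solve-∀
          kk : ∀ t t' → Z⁰ t u t' u ≢ 0 → + 0 ≡ s₁ t' -ᶻ s₁ t
          kk t t' ne = trans (𝟙-true (+ 0 ℤ.≟ k t u t' u) ne) (trans (k≡ t u t' u) (l' (s₁ t' -ᶻ s₁ t) (s₂ u)))
            where l' : ∀ x y → x +ᶻ (y -ᶻ y) ≡ x
                  l' = solveᶻ
          lo : ∀ η → ∑ T (λ j → Z⁰ (j + suc η) u j u) ≤ 1
          lo η = ∑-at-most-one T (λ j → Z⁰ (j + suc η) u j u) 1 (λ j _ → 𝟙≤1 (+ 0 ℤ.≟ k (j + suc η) u j u)) λ i j _ _ p p' →
            minus-eq i j (nonzero-coeff b η b≢0 (+ j -ᶻ + i) (trans (sym (step-diff α₁ b (suc η) i j)) (trans (l' (s₁ i) (s₁ (i + suc η)) (s₁ j) (s₁ (j + suc η))) (sub0 (kk (j + suc η) j p') (kk (i + suc η) i p)))))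
            where l' : ∀ a b a' b' → (b' -ᶻ a') -ᶻ (b -ᶻ a) ≡ (a -ᶻ b) -ᶻ (a' -ᶻ b')
                  l' = solveᶻ
          up : ∀ η → ∑ T (λ j → Z⁰ j u (j + suc η) u) ≤ 1
          up η = ∑-at-most-one T (λ j → Z⁰ j u (j + suc η) u) 1 (λ j _ → 𝟙≤1 (+ 0 ℤ.≟ k j u (j + suc η) u)) λ i j _ _ p p' →
            minus-eq i j (nonzero-coeff b η b≢0 (+ j -ᶻ + i) (trans (sym (step-diff α₁ b (suc η) i j)) (sub0 (kk i (i + suc η) p) (kk j (j + suc η) p'))))

        -- The divisors `δ + 1` up to `T₃` are counted trivially. A larger one has a cofactor below
        -- `E`, because the number divided is at most `c₀ T J = c₀ J³ T₃`.
        badδ : ∀ η → η < T → ∑ T (λ δ → bad δ η) ≤ J * (T₃ + E)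
        badδ η η<T = ≤-trans (≤-reflexive (∑-swap T J (λ δ δ' → 𝟙 (suc δ ℕD.∣? c₀ * suc η * suc δ')))) (≤-trans (∑-mono J one) (≤-reflexive (∑-const J (T₃ + E))))
          where
          one : ∀ δ' → δ' < J → ∑ T (λ δ → 𝟙 (suc δ ℕD.∣? c₀ * suc η * suc δ')) ≤ T₃ + E
          one δ' δ'<J = ≤-trans (∑-extend χ (m≤n+m T T₃)) (≤-trans (≤-reflexive (∑-split T₃ T χ)) (+-mono-≤ (≤-trans (∑-mono T₃ (λ i _ → 𝟙≤1 (suc i ℕD.∣? n))) (≤-reflexive (trans (∑-const T₃ 1) (*-identityʳ T₃))))
              (few-large-divisors T T₃ E n n≢0 bound)))
            where
            n = c₀ * suc η * suc δ'
            χ : ℕ → ℕ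
            χ δ = 𝟙 (suc δ ℕD.∣? n)
            n≢0 : n ≢ 0
            n≢0 = ≢-nonZero⁻¹ n {{m*n≢0 (c₀ * suc η) (suc δ') {{m*n≢0 c₀ (suc η) {{m*n≢0 2 (q * ∣ b ∣) {{_}} {{m*n≢0 q (∣ b ∣) {{≢-nonZero q≢0}} {{≢-nonZero b≢0}}}}}}}}}}
            bound : n < E * suc T₃
            bound = ≤-trans (s≤s (≤-trans (*-mono-≤ (*-monoʳ-≤ c₀ (≤-trans η<T (≤-reflexive T≡))) δ'<J) (≤-reflexive (l c₀ T₃ J)))) (≤-trans (m≤m+n _ (T₃ + c₀ * J * J * J)) (≤-reflexive (l' (c₀ * J * J * J) T₃)))
              where l : ∀ c t J → c * (t * J * J) * J ≡ c * J * J * J * t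
                    l = solve-∀
                    l' : ∀ e t → suc (e * t) + (t + e) ≡ suc e * suc t
                    l' = solve-∀

        zeros-≤ : zeros ≤ 5 * (T * T) + 4 * (T * T * T₂) + 4 * (T * T * (J * (T₃ + E)))
        zeros-≤ = ≤-trans (≤-reflexive (trans zeros≡ (∑-triangle T C C-sym))) (≤-trans (+-mono-≤ diagonal (*-monoʳ-≤ 2 off)) (≤-reflexive (l T T₂ (J * (T₃ + E)))))
          where
          diagonal : ∑ T (λ u → C u u) ≤ T * (3 * T)
          diagonal = ≤-trans (∑-mono T (λ u _ → same-u u)) (≤-reflexive (∑-const T (3 * T)))
          bads : ∑ T (λ δ → ∑ T (bad δ)) ≤ T * (J * (T₃ + E))
          bads = ≤-trans (≤-reflexive (∑-swap T T bad)) (≤-trans (∑-mono T badδ) (≤-reflexive (∑-const T (J * (T₃ + E)))))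
          cols : ∑ T (λ δ → T + 2 * (T * T₂ + T * ∑ T (bad δ))) ≡ T * T + 2 * (T * (T * T₂) + T * ∑ T (λ δ → ∑ T (bad δ)))
          cols = trans (∑-+ T (λ _ → T) (λ δ → 2 * (T * T₂ + T * ∑ T (bad δ)))) (cong₂ _+_ (∑-const T T) (trans (∑-*ˡ T 2 (λ δ → T * T₂ + T * ∑ T (bad δ))) (cong (2 *_) (trans (∑-+ T (λ _ → T * T₂) (λ δ → T * ∑ T (bad δ))) (cong₂ _+_ (∑-const T (T * T₂)) (∑-*ˡ T T (λ δ → ∑ T (bad δ))))))))
          off : ∑ T (λ u → ∑ u (C u)) ≤ T * T + 2 * (T * (T * T₂) + T * (T * (J * (T₃ + E))))
          off = ≤-trans (∑-diagonals T C) (≤-trans (∑-mono T (λ δ _ → column δ)) (≤-trans (≤-reflexive cols) (+-monoʳ-≤ (T * T) (*-monoʳ-≤ 2 (+-monoʳ-≤ (T * (T * T₂)) (*-monoʳ-≤ T bads))))))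
          l : ∀ T t B → T * (3 * T) + 2 * (T * T + 2 * (T * (T * t) + T * (T * B))) ≡ 5 * (T * T) + 4 * (T * T * t) + 4 * (T * T * B)
          l = solve-∀

      -- In the diagonal part `∑ ω²` is of order `I₁³ = I₁² K T`, so compared with `I₁² T⁴` the
      -- count of `zeros` has to be below `T³` by a factor depending on `K`. The trivial count, of
      -- order `T³`, does not give this; hence the divisor argument.
      zeros-bound : 4 * (x * K) * m * zeros ≤ T * T * T
      zeros-bound = *-cancelˡ-≤ 2 (≤-trans (*-monoʳ-≤ 2 (*-monoʳ-≤ (4 * (x * K) * m) zeros-≤)) (≤-trans (≤-reflexive (l (x * K) m T T₃ E J))
          (≤-trans (+-mono-≤ (≤-reflexive (cong (T * T *_) (sym T≡))) (*-monoʳ-≤ (T * T) T≥)) (≤-reflexive (l' T)))))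
        where
        l : ∀ y m T t E J → 2 * (4 * y * m * (5 * (T * T) + 4 * (T * T * (t * J)) + 4 * (T * T * (J * (t + E))))) ≡ T * T * (t * J * (64 * y * m)) + T * T * (8 * y * m * (5 + 4 * J * E))
        l = solve-∀
        l' : ∀ T → T * T * T + T * T * T ≡ 2 * (T * T * T)
        l' = solve-∀
        T≥ : 8 * (x * K) * m * (5 + 4 * J * E) ≤ T
        T≥ = ≤-trans (≤-trans (m≤n⇒m≤1+n (m≤n+m _ (∣ α₂ ∣ + Δ))) large) (≤-trans R'≤R R≤T)

  -- Almost all of a residue class is represented

  ∑-*-∑ : ∀ m n (f g : ℕ → ℕ) → ∑ m f * ∑ n g ≡ ∑ m (λ i → ∑ n (λ j → f i * g j))
  ∑-*-∑ m n f g = trans (sym (∑-*ʳ m (∑ n g) f)) (∑-cong m (λ i _ → sym (∑-*ˡ n (f i) g)))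

  ∑²-*-∑² : ∀ n (f g : ℕ → ℕ → ℕ) → ∑² n f * ∑² n g ≡ ∑⁴ n (λ t u t' u' → f t u * g t' u')
  ∑²-*-∑² n f g = trans (sym (∑-*ʳ n (∑² n g) (λ t → ∑ n (f t)))) (∑-cong n (λ t _ → trans (sym (∑-*ʳ n (∑² n g) (f t))) (∑-cong n (λ u _ → sym (∑²-*ˡ n (f t u) g)))))

  ∑-identity : ∀ n → 2 * ∑ n (λ i → i) + n ≡ n * n
  ∑-identity zero = refl
  ∑-identity (suc n) = trans (l (∑ n (λ i → i)) n) (trans (cong (λ z → z + (2 * n + 1)) (∑-identity n)) (l' n))
    where l : ∀ s n → 2 * (s + n) + suc n ≡ 2 * s + n + (2 * n + 1)
          l = solve-∀
          l' : ∀ n → n * n + (2 * n + 1) ≡ suc n * suc n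
          l' = solve-∀

  square-bracket : ∀ B N → B ≢ 0 → ∃[ r ] B * (r * r) ≤ N × N < B * (suc r * suc r)
  square-bracket B zero B≢0 = 0 , ≤-reflexive (*-zeroʳ B) , ≤-trans (n≢0⇒n>0 B≢0) (≤-reflexive (sym (*-identityʳ B)))
  square-bracket B (suc N) B≢0 with square-bracket B N B≢0
  ... | r , lo , hi with suc N <? B * (suc r * suc r)
  ... | yes lt = r , m≤n⇒m≤1+n lo , lt
  ... | no ≮ = suc r , ≮⇒≥ ≮ , ≤-trans (s≤s hi) (*-monoʳ-< B {{≢-nonZero B≢0}} (*-mono-< {suc r} {suc (suc r)} {suc r} {suc (suc r)} ≤-refl ≤-refl))

  two-products : ∀ x y → 2 * (x * y) ≤ x * x + y * y
  two-products x y with ≤-total x y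
  ... | inj₁ x≤y = subst (λ y → 2 * (x * y) ≤ x * x + y * y) (m+[n∸m]≡n x≤y) (≤-trans (m≤m+n _ ((y ∸ x) * (y ∸ x))) (≤-reflexive (l x (y ∸ x))))
    where l : ∀ x d → 2 * (x * (x + d)) + d * d ≡ x * x + (x + d) * (x + d)
          l = solve-∀
  ... | inj₂ y≤x = subst (λ x → 2 * (x * y) ≤ x * x + y * y) (m+[n∸m]≡n y≤x) (≤-trans (m≤m+n _ ((x ∸ y) * (x ∸ y))) (≤-reflexive (l y (x ∸ y))))
    where l : ∀ y d → 2 * ((y + d) * y) + d * d ≡ (y + d) * (y + d) + y * y
          l = solve-∀

  ≤-of-abs : ∀ z n → ∣ z ∣ ≤ n → z ℤ.≤ + n
  ≤-of-abs (+ k) n h = ℤ.+≤+ h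
  ≤-of-abs -[1+ k ] n h = ℤ.-≤+

  ≥-of-abs : ∀ X e n → ∣ e ∣ ≤ n → suc n ≤ X → + 1 ℤ.≤ + X +ᶻ e
  ≥-of-abs X (+ k) n h le = ℤ.+≤+ (≤-trans (≤-trans (s≤s z≤n) le) (m≤m+n X k))
  ≥-of-abs X -[1+ k ] n h le = subst (+ 1 ℤ.≤_) (sym (ℤP.⊖-≥ (≤-trans (m≤n⇒m≤1+n h) le))) (ℤ.+≤+ (m<n⇒0<n∸m (≤-trans (s≤s h) le)))

  -- `(m + a) (m + b) ≤ m (m + a + b + 1)` as soon as `a b ≤ m`. Six such mergers raise the sum
  -- `2 + 2 + 6 + 1 + 1 + 1 + 1 = 14` to 20; the largest product met is `5 * 6`, whence the
  -- requirement on `m`.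
  moment-polynomial : ∀ m → 30 ≤ m → (2 + m) * (2 + m) * (m + 6) * (suc m * suc m * suc m * suc m) + m * m * m * m * m * m ≤ m * m * m * m * m * m * (m + 24)
  moment-polynomial m 30≤m = ≤-trans (+-monoˡ-≤ (m * m * m * m * m * m) seven) (≤-trans (≤-reflexive (l₁ m)) (*-monoʳ-≤ (m * m * m * m * m * m) (+-monoʳ-≤ m (m≤m+n 21 3))))
    where
    merge : ∀ a b → a * b ≤ 30 → (m + a) * (m + b) ≤ m * (m + suc (a + b))
    merge a b ab≤ = ≤-trans (≤-reflexive (l m a b)) (≤-trans (+-monoʳ-≤ (m * (m + (a + b))) (≤-trans ab≤ 30≤m)) (≤-reflexive (l' m (a + b))))
      where l : ∀ m a b → (m + a) * (m + b) ≡ m * (m + (a + b)) + a * b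
            l = solve-∀
            l' : ∀ m c → m * (m + c) + m ≡ m * (m + suc c)
            l' = solve-∀
    step : ∀ P a b X → X ≤ P * (m + a) → a * b ≤ 30 → X * (m + b) ≤ P * m * (m + suc (a + b))
    step P a b X h ab≤ = ≤-trans (*-monoˡ-≤ (m + b) h) (≤-trans (≤-reflexive (*-assoc P (m + a) (m + b))) (≤-trans (*-monoʳ-≤ P (merge a b ab≤)) (≤-reflexive (sym (*-assoc P m (m + suc (a + b)))))))
    seven : (2 + m) * (2 + m) * (m + 6) * (suc m * suc m * suc m * suc m) ≤ m * m * m * m * m * m * (m + 20)
    seven = ≤-trans (≤-reflexive (l₂ m)) (step (m * m * m * m * m) 18 1 ((m + 2) * (m + 2) * (m + 6) * (m + 1) * (m + 1) * (m + 1)) (step (m * m * m * m) 16 1 ((m + 2) * (m + 2) * (m + 6) * (m + 1) * (m + 1)) (step (m * m * m) 14 1 ((m + 2) * (m + 2) * (m + 6) * (m + 1))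
       (step (m * m) 12 1 ((m + 2) * (m + 2) * (m + 6)) (step m 5 6 ((m + 2) * (m + 2)) (merge 2 2 (m≤m+n 4 26)) ≤-refl) (m≤m+n 12 18)) (m≤m+n 14 16)) (m≤m+n 16 14)) (m≤m+n 18 12))
      where l₂ : ∀ m → (2 + m) * (2 + m) * (m + 6) * (suc m * suc m * suc m * suc m) ≡ (m + 2) * (m + 2) * (m + 6) * (m + 1) * (m + 1) * (m + 1) * (m + 1)
            l₂ = solve-∀
    l₁ : ∀ m → m * m * m * m * m * m * (m + 20) + m * m * m * m * m * m ≡ m * m * m * m * m * m * (m + 21)
    l₁ = solve-∀

  module Core (𝓕 : Family) (n₀ : ℤ) (b≢0 : ∣ Family.b 𝓕 ∣ ≢ 0) (c≢0 : ∣ Family.c 𝓕 ∣ ≢ 0)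
      (m : ℕ) (30≤m : 30 ≤ m) (rough : ∀ e → Coprime e (Family.F 𝓕) → e ≢ 1 → m < e) (K κ₀ : ℕ) (κ₀≢0 : κ₀ ≢ 0)
      (K-def : K ≡ m * (8 * suc (∣ Family.α₁ 𝓕 ∣ + ∣ Family.α₂ 𝓕 ∣ + 4 * (Family.q 𝓕 * (∣ Family.b 𝓕 ∣ + ∣ Family.c 𝓕 ∣))) * suc m) * κ₀) where
    open Family 𝓕 hiding (χ)

    val : ℕ → ℕ → ℕ → ℤ
    val i t u = n₀ +ᶻ + q *ᶻ ((α₀ *ᶻ + i +ᶻ + (q * a) *ᶻ (+ i *ᶻ + i)) +ᶻ g t u)

    inClass : ℤ → ℕ
    inClass n = 𝟙 (+ (q * H) ∣? n -ᶻ n₀)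

    private
      m≢0 : m ≢ 0
      m≢0 e = n≮0 (subst (30 ≤_) e 30≤m)
      instance
        m-nz : NonZero m
        m-nz = ≢-nonZero m≢0
        κ₀-nz : NonZero κ₀
        κ₀-nz = ≢-nonZero κ₀≢0
      K≢0 : K ≢ 0
      K≢0 e = ≢-nonZero⁻¹ _ {{m*n≢0 (m * (8 * suc (∣ α₁ ∣ + ∣ α₂ ∣ + 4 * (q * (∣ b ∣ + ∣ c ∣))) * suc m)) κ₀ {{m*n≢0 m (8 * suc (∣ α₁ ∣ + ∣ α₂ ∣ + 4 * (q * (∣ b ∣ + ∣ c ∣))) * suc m)}}}} (trans (sym K-def) e)
      q≢0 : q ≢ 0
      q≢0 e = [ H≢0 , q'≢0 ]′ (m*n≡0⇒m≡0∨n≡0 H e)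
      1≤q : 1 ≤ q
      1≤q = n≢0⇒n>0 q≢0

      val-class : ∀ i t u → + (q * H) ∣ val i t u -ᶻ n₀
      val-class i t u = divides (α₀' *ᶻ + i +ᶻ + q' *ᶻ + a *ᶻ (+ i *ᶻ + i) +ᶻ (α₁' *ᶻ + t +ᶻ α₂' *ᶻ + u +ᶻ + q' *ᶻ (b *ᶻ (+ t *ᶻ + t) +ᶻ c *ᶻ (+ u *ᶻ + u))))
        (trans (cong₂ (λ X Q → n₀ +ᶻ + q *ᶻ ((α₀ *ᶻ + i +ᶻ X *ᶻ (+ i *ᶻ + i)) +ᶻ (α₁ *ᶻ + t +ᶻ α₂ *ᶻ + u +ᶻ Q *ᶻ (b *ᶻ (+ t *ᶻ + t) +ᶻ c *ᶻ (+ u *ᶻ + u)))) -ᶻ n₀) (trans (ℤP.pos-* q a) (cong (_*ᶻ + a) (ℤP.pos-* H q'))) (ℤP.pos-* H q'))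
          (trans (l n₀ (+ q) (+ H) (+ q') (+ a) α₀' α₁' α₂' b c (+ i) (+ t) (+ u))
            (cong ((α₀' *ᶻ + i +ᶻ + q' *ᶻ + a *ᶻ (+ i *ᶻ + i) +ᶻ (α₁' *ᶻ + t +ᶻ α₂' *ᶻ + u +ᶻ + q' *ᶻ (b *ᶻ (+ t *ᶻ + t) +ᶻ c *ᶻ (+ u *ᶻ + u)))) *ᶻ_) (sym (ℤP.pos-* q H)))))
        where
        l : ∀ n q H p a α β γ b c i t u → n +ᶻ q *ᶻ ((H *ᶻ α *ᶻ i +ᶻ H *ᶻ p *ᶻ a *ᶻ (i *ᶻ i)) +ᶻ (H *ᶻ β *ᶻ t +ᶻ H *ᶻ γ *ᶻ u +ᶻ H *ᶻ p *ᶻ (b *ᶻ (t *ᶻ t) +ᶻ c *ᶻ (u *ᶻ u)))) -ᶻ n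
            ≡ (α *ᶻ i +ᶻ p *ᶻ a *ᶻ (i *ᶻ i) +ᶻ (β *ᶻ t +ᶻ γ *ᶻ u +ᶻ p *ᶻ (b *ᶻ (t *ᶻ t) +ᶻ c *ᶻ (u *ᶻ u)))) *ᶻ (q *ᶻ H)
        l = solveᶻ

    module Scale (r : ℕ) where
      open Errors 𝓕 b≢0 c≢0 m K r m≢0 K≢0 public

      first : ℕ
      first = ∑ I₁ ω

      T⁴ : ℕ
      T⁴ = T * (T * (T * T))

      module _ (large : R₀ ≤ R') (α₀≤T : ∣ α₀ ∣ ≤ T) (n₀<T : ∣ n₀ ∣ < T) where
        private
          1≤T : 1 ≤ T
          1≤T = ≤-trans (s≤s z≤n) n₀<T
          T₁≢0 : T₁ ≢ 0
          T₁≢0 e = n≮0 (subst (1 ≤_) (trans (cong (m *_) e) (*-zeroʳ m)) 1≤T)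
          1≤H : 1 ≤ H
          1≤H = n≢0⇒n>0 H≢0
          1≤x : 1 ≤ x
          1≤x = *-mono-≤ 1≤q (n≢0⇒n>0 a≢0)
          open Off m≢0 T₁≢0 α₀≤T rough

          I₁≡ : I₁ ≡ m * I₀ * κ₀
          I₁≡ = trans (cong (_* T) K-def) (l m K₀ T κ₀)
            where l : ∀ m k t c → m * k * c * t ≡ m * (k * t) * c
                  l = solve-∀

          mI₀≤I₁ : m * I₀ ≤ I₁
          mI₀≤I₁ = ≤-trans (m≤m*n (m * I₀) κ₀) (≤-reflexive (sym I₁≡))

          m≤I₁ : m ≤ I₁
          m≤I₁ = ≤-trans (≤-trans (m≤m*n m (K₀ * T) {{m*n≢0 K₀ T {{_}} {{>-nonZero 1≤T}}}}) ≤-refl) mI₀≤I₁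

          -- The sum of the weights is `I₁² / 2` up to `I₁` and `I₀²`. Both are at most `I₁² / m`
          -- because `K` contains the factor `m K₀`.
          first-≥ : m * (I₁ * I₁) ≤ m * (2 * first) + 2 * (I₁ * I₁)
          first-≥ = ≤-trans (*-monoʳ-≤ m sumω) (≤-trans (≤-reflexive (l m first I₁ (I₀ * I₀))) (+-monoʳ-≤ (m * (2 * first)) (≤-trans (+-mono-≤ (*-monoˡ-≤ I₁ m≤I₁) mI₀) (≤-reflexive (cong (_+_ (I₁ * I₁)) (sym (+-identityʳ (I₁ * I₁))))))))
            where
            l : ∀ m s i j → m * (2 * s + (i + j)) ≡ m * (2 * s) + (m * i + m * j)
            l = solve-∀
            mI₀ : m * (I₀ * I₀) ≤ I₁ * I₁
            mI₀ = ≤-trans (≤-reflexive (sym (*-assoc m I₀ I₀))) (*-mono-≤ mI₀≤I₁ (≤-trans (m≤n*m I₀ m) mI₀≤I₁))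
            point : ∀ i → i < I₁ → i ≤ ω i + 𝟙 (i <? I₀) * i
            point i i<I₁ = go (I₀ ≤? i) (i <? I₁) (i <? I₀)
              where
              go : (d₁ : Dec (I₀ ≤ i)) (d₂ : Dec (i < I₁)) (d₃ : Dec (i < I₀)) → i ≤ 𝟙 d₁ * 𝟙 d₂ * i + 𝟙 d₃ * i
              go (yes _) (yes _) _ = ≤-trans (≤-reflexive (sym (+-identityʳ i))) (m≤m+n (i + 0) _)
              go _ (no ≮) _ = ⊥-elim (≮ i<I₁)
              go (no ≰) (yes _) (yes lt) = ≤-reflexive (sym (+-identityʳ i))
              go (no ≰) (yes _) (no ≮) = ⊥-elim (≰ (≮⇒≥ ≮))
            below : ∑ I₁ (λ i → 𝟙 (i <? I₀) * i) ≤ ∑ I₀ (λ i → i)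
            below = ≤-trans (∑-extend _ (m≤n+m I₁ I₀)) (≤-trans (≤-reflexive (∑-split I₀ I₁ (λ i → 𝟙 (i <? I₀) * i)))
              (≤-trans (+-mono-≤ (∑-mono I₀ (λ i _ → ≤-trans (*-monoˡ-≤ i (𝟙≤1 (i <? I₀))) (≤-reflexive (+-identityʳ i)))) (≤-reflexive (∑-zero I₁ (λ i _ → cong (_* (I₀ + i)) (𝟙-no (I₀ + i <? I₀) (λ lt → <-irrefl refl (<-≤-trans lt (m≤m+n I₀ i)))))))) (≤-reflexive (+-identityʳ _))))
            half : ∑ I₁ (λ i → i) ≤ first + ∑ I₀ (λ i → i)
            half = ≤-trans (∑-mono I₁ point) (≤-trans (≤-reflexive (∑-+ I₁ ω (λ i → 𝟙 (i <? I₀) * i))) (+-monoʳ-≤ first below))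
            sumω : I₁ * I₁ ≤ 2 * first + (I₁ + I₀ * I₀)
            sumω = ≤-trans (≤-reflexive (sym (∑-identity I₁))) (≤-trans (+-monoˡ-≤ I₁ (*-monoʳ-≤ 2 half)) (≤-trans (≤-reflexive (l' first (∑ I₀ (λ i → i)) I₁)) (+-monoʳ-≤ (2 * first) (+-monoʳ-≤ I₁ (≤-trans (m≤m+n _ I₀) (≤-reflexive (∑-identity I₀)))))))
              where l' : ∀ f s i → 2 * (f + s) + i ≡ 2 * f + (i + 2 * s)
                    l' = solve-∀

          Σω²≤ : ∑ I₁ (λ i → ω i * ω i) ≤ I₁ * (I₁ * I₁)
          Σω²≤ = ≤-trans (∑-mono I₁ (λ i i<I₁ → *-mono-≤ (ω≤I₁ i i<I₁) (ω≤I₁ i i<I₁))) (≤-reflexive (∑-const I₁ (I₁ * I₁)))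
            where ω≤I₁ : ∀ i → i < I₁ → ω i ≤ I₁
                  ω≤I₁ i i<I₁ = ≤-trans (*-monoˡ-≤ i (*-mono-≤ (𝟙≤1 (I₀ ≤? i)) (𝟙≤1 (i <? I₁)))) (≤-trans (≤-reflexive (+-identityʳ i)) (<⇒≤ i<I₁))

          ΣS = ∑ I₁ (λ δ → S (suc δ))
          I² = I₁ * I₁

          diagonal-part : 4 * x * m * (∑ I₁ (λ i → ω i * ω i) * zeros) ≤ I² * T⁴
          diagonal-part = ≤-trans (*-monoʳ-≤ (4 * x * m) (*-monoˡ-≤ zeros Σω²≤)) (≤-trans (≤-reflexive (l x m K T I₁ I² zeros)) (≤-trans (*-monoʳ-≤ (I² * T) (zeros-bound large)) (≤-reflexive (l' I² T))))
            where l : ∀ x m K T i j z → 4 * x * m * (K * T * j * z) ≡ j * T * (4 * (x * K) * m * z)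
                  l = solve-∀
                  l' : ∀ j T → j * T * (T * T * T) ≡ j * (T * (T * (T * T)))
                  l' = solve-∀

          off-part : m * m * m * m * (4 * x * m * (m * m) * (2 * ΣS)) ≤ H * I² * ((2 + m) * (2 + m) * (m + 6) * (suc m * suc m * suc m * suc m)) * T⁴
          off-part = ≤-trans (≤-reflexive (l₁ m x ΣS)) (≤-trans (*-monoʳ-≤ (2 * (m * m * m * m)) off-bound) (≤-trans (≤-reflexive (l₂ (m * m * m * m) H I² (2 + m) m positives small))
              (≤-trans (*-monoʳ-≤ (m * m * m * m * (H * I² * ((2 + m) * (2 + m)))) (+-mono-≤ (*-monoʳ-≤ (m + 5) positives-half) (small-bound large))) (≤-reflexive (l₃ m H I² T₁)))))
            where
            l₁ : ∀ m x s → m * m * m * m * (4 * x * m * (m * m) * (2 * s)) ≡ 2 * (m * m * m * m) * (4 * m * x * (m * m) * s)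
            l₁ = solve-∀
            l₂ : ∀ q H i n m p s → 2 * q * (H * i * (n * n) * ((m + 5) * p + 4 * m * s)) ≡ q * (H * i * (n * n)) * ((m + 5) * (2 * p) + 8 * m * s)
            l₂ = solve-∀
            l₃ : ∀ m H i t → m * m * m * m * (H * i * ((2 + m) * (2 + m))) * ((m + 5) * (suc m * t * (suc m * t * (suc m * t * (suc m * t * 1)))) + suc m * t * (suc m * t * (suc m * t * (suc m * t * 1))))
               ≡ H * i * ((2 + m) * (2 + m) * (m + 6) * (suc m * suc m * suc m * suc m)) * (m * t * (m * t * (m * t * (m * t))))
            l₃ = solve-∀

          -- If the representations were equally distributed, each of about `x I₁² / H` members of
          -- the class would have weighted number `H T² / (2x)`, and the second moment would be
          -- `H I₁² T⁴ / (4x)`. The bound exceeds this only by the factor `1 + 24/m`.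
          moment-bound : 4 * x * m * secondMoment ≤ H * I² * T⁴ * (m + 24)
          moment-bound = *-cancelˡ-≤ (m * m * m * m * m * m) {{>-nonZero 1≤m⁶}} (≤-trans (*-monoʳ-≤ (m * m * m * m * m * m) (*-monoʳ-≤ (4 * x * m) moment-split))
            (≤-trans (≤-reflexive (l₁ m x (∑ I₁ (λ i → ω i * ω i) * zeros) (2 * ΣS))) (≤-trans (+-mono-≤ (*-monoʳ-≤ (m * m * m * m * m * m) (≤-trans diagonal-part (m≤n*m (I² * T⁴) H {{>-nonZero 1≤H}}))) off-part)
            (≤-trans (≤-reflexive (l₂ (m * m * m * m * m * m) H I² T⁴ ((2 + m) * (2 + m) * (m + 6) * (suc m * suc m * suc m * suc m)))) (≤-trans (*-monoʳ-≤ (H * I² * T⁴) (moment-polynomial m 30≤m)) (≤-reflexive (l₃ (H * I² * T⁴) (m * m * m * m * m * m) (m + 24))))))))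
            where
            1≤m : 1 ≤ m
            1≤m = n≢0⇒n>0 m≢0
            1≤m⁶ : 1 ≤ m * m * m * m * m * m
            1≤m⁶ = *-mono-≤ (*-mono-≤ (*-mono-≤ (*-mono-≤ (*-mono-≤ 1≤m 1≤m) 1≤m) 1≤m) 1≤m) 1≤m
            l₁ : ∀ m x z s → m * m * m * m * m * m * (4 * x * m * (z + s)) ≡ m * m * m * m * m * m * (4 * x * m * z) + m * m * m * m * (4 * x * m * (m * m) * s)
            l₁ = solve-∀
            l₂ : ∀ p H i t v → p * (H * (i * t)) + H * i * v * t ≡ H * i * t * (v + p)
            l₂ = solve-∀
            l₃ : ∀ h p v → h * (p * v) ≡ p * (h * v)
            l₃ = solve-∀

        B₁ : ℕ
        B₁ = q * x * (K * K) + (q * Cc + q * (∣ α₀ ∣ * K) + ∣ n₀ ∣)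

        private
          val-upper : ∀ i t u → i < I₁ → t < T → u < T → ∣ val i t u ∣ ≤ B₁ * (T * T)
          val-upper i t u i<I₁ ht hu = ≤-trans (ℤP.∣i+j∣≤∣i∣+∣j∣ n₀ (+ q *ᶻ (h i +ᶻ g t u))) (≤-trans (+-mono-≤ (m≤m*n (∣ n₀ ∣) (T * T) {{>-nonZero (*-mono-≤ 1≤T 1≤T)}})
              (≤-trans (≤-reflexive (ℤP.abs-* (+ q) (h i +ᶻ g t u))) (*-monoʳ-≤ q (≤-trans (ℤP.∣i+j∣≤∣i∣+∣j∣ (h i) (g t u)) (+-mono-≤ h≤ (coordinate-bound t u ht hu)))))) (≤-reflexive (l (∣ n₀ ∣) q x K T (∣ α₀ ∣) Cc)))
            where
            i≤ : i ≤ K * T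
            i≤ = <⇒≤ i<I₁
            h≤ : ∣ h i ∣ ≤ ∣ α₀ ∣ * (K * T * T) + x * (K * T * (K * T))
            h≤ = ≤-trans (ℤP.∣i+j∣≤∣i∣+∣j∣ (α₀ *ᶻ + i) (+ x *ᶻ (+ i *ᶻ + i))) (+-mono-≤ (≤-trans (≤-reflexive (ℤP.abs-* α₀ (+ i))) (*-monoʳ-≤ (∣ α₀ ∣) (≤-trans i≤ (m≤m*n (K * T) T {{>-nonZero 1≤T}}))))
               (≤-trans (≤-reflexive (trans (ℤP.abs-* (+ x) (+ i *ᶻ + i)) (cong (x *_) (ℤP.abs-* (+ i) (+ i))))) (*-monoʳ-≤ x (*-mono-≤ i≤ i≤))))
            l : ∀ n q x K T α C → n * (T * T) + q * (α * (K * T * T) + x * (K * T * (K * T)) + T * (C * T)) ≡ (q * x * (K * K) + (q * C + q * (α * K) + n)) * (T * T)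
            l = solve-∀

          -- From `I₀` on, `q x i²` outweighs all other terms, whatever the signs of `b` and `c`.
          val-positive : ∀ i t u → I₀ ≤ i → t < T → u < T → + 1 ℤ.≤ val i t u
          val-positive i t u I₀≤i ht hu = subst (+ 1 ℤ.≤_) (sym eq) (≥-of-abs (q * x * (i * i)) err (∣ n₀ ∣ + q * (∣ α₀ ∣ * i + T * (Cc * T))) err≤ big)
            where
            err = n₀ +ᶻ + q *ᶻ (α₀ *ᶻ + i +ᶻ g t u)
            eq : val i t u ≡ + (q * x * (i * i)) +ᶻ err
            eq = trans (l n₀ (+ q) (+ x) (+ i) α₀ (g t u)) (cong (_+ᶻ err) (trans (cong₂ _*ᶻ_ (sym (ℤP.pos-* q x)) (sym (ℤP.pos-* i i))) (sym (ℤP.pos-* (q * x) (i * i)))))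
              where l : ∀ n q x i α g → n +ᶻ q *ᶻ ((α *ᶻ i +ᶻ x *ᶻ (i *ᶻ i)) +ᶻ g) ≡ q *ᶻ x *ᶻ (i *ᶻ i) +ᶻ (n +ᶻ q *ᶻ (α *ᶻ i +ᶻ g))
                    l = solveᶻ
            err≤ : ∣ err ∣ ≤ ∣ n₀ ∣ + q * (∣ α₀ ∣ * i + T * (Cc * T))
            err≤ = ≤-trans (ℤP.∣i+j∣≤∣i∣+∣j∣ n₀ (+ q *ᶻ (α₀ *ᶻ + i +ᶻ g t u))) (+-monoʳ-≤ (∣ n₀ ∣) (≤-trans (≤-reflexive (ℤP.abs-* (+ q) (α₀ *ᶻ + i +ᶻ g t u))) (*-monoʳ-≤ q (≤-trans (ℤP.∣i+j∣≤∣i∣+∣j∣ (α₀ *ᶻ + i) (g t u)) (+-mono-≤ (≤-reflexive (ℤP.abs-* α₀ (+ i))) (coordinate-bound t u ht hu))))))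
            T≤i : T ≤ i
            T≤i = ≤-trans (m≤n*m T K₀) I₀≤i
            8CT≤i : 3 * (Cc * T) ≤ i
            8CT≤i = ≤-trans (≤-trans (m≤m+n _ (5 * (Cc * T) + 8 * Cc * m * T)) (≤-reflexive (l Cc T m))) I₀≤i
              where l : ∀ C T m → 3 * (C * T) + (5 * (C * T) + 8 * C * m * T) ≡ 8 * C * suc m * T
                    l = solve-∀
            big : suc (∣ n₀ ∣ + q * (∣ α₀ ∣ * i + T * (Cc * T))) ≤ q * x * (i * i)
            big = ≤-trans (+-mono-≤ (≤-trans n₀<T (≤-trans (m≤m*n T i {{>-nonZero (≤-trans 1≤T T≤i)}}) (m≤n*m (T * i) q {{>-nonZero 1≤q}}))) ≤-refl)
               (≤-trans (≤-reflexive (sym (*-distribˡ-+ q (T * i) (∣ α₀ ∣ * i + T * (Cc * T))))) (≤-trans (*-monoʳ-≤ q inner) (≤-trans (≤-reflexive (sym (+-identityʳ _))) (≤-trans (*-monoˡ-≤ (q * (i * i)) 1≤x) (≤-reflexive (l x q (i * i)))))))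
              where
              l : ∀ x q i → x * (q * i) ≡ q * x * i
              l = solve-∀
              inner : T * i + (∣ α₀ ∣ * i + T * (Cc * T)) ≤ i * i
              inner = ≤-trans (+-mono-≤ (≤-trans (m≤n*m (T * i) Cc) (≤-reflexive (sym (*-assoc Cc T i)))) (+-mono-≤ (≤-trans (*-monoˡ-≤ i α₀≤T) (≤-trans (m≤n*m (T * i) Cc) (≤-reflexive (sym (*-assoc Cc T i))))) (≤-trans (≤-reflexive (*-comm T (Cc * T))) (*-monoʳ-≤ (Cc * T) T≤i))))
                 (≤-trans (≤-reflexive (l' (Cc * T) i)) (*-monoˡ-≤ i 8CT≤i))
                where l' : ∀ c i → c * i + (c * i + c * i) ≡ 3 * c * i
                      l' = solve-∀

        module _ (N : ℕ) (fits : B₁ * (T * T) ≤ N) (ys : List ℤ) (unique : Unique ys)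
            (complete : ∀ i t u → + 1 ℤ.≤ val i t u → val i t u ℤ.≤ + N → val i t u ∈ ys) where
          private
            count : ℕ
            count = ∑ᴸ ys inClass

            hit : ℤ → ℕ → ℕ → ℕ → ℕ
            hit n i t u = 𝟙 (val i t u ℤ.≟ n)

            reps : ℤ → ℕ → ℕ
            reps n i = ∑² T (hit n i)

            R[_] : ℤ → ℕ
            R[ n ] = ∑ I₁ (λ i → ω i * reps n i)

            R-class : ∀ n → inClass n ≡ 0 → R[ n ] ≡ 0
            R-class n e = ∑-zero I₁ (λ i _ → trans (cong (ω i *_) (∑-zero T (λ t _ → ∑-zero T (λ u _ → 𝟙-no (val i t u ℤ.≟ n) (no-hit i t u))))) (*-zeroʳ (ω i)))
              where
              no-hit : ∀ i t u → val i t u ≢ n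
              no-hit i t u refl = 1+n≢0 (trans (sym (𝟙-yes (+ (q * H) ∣? val i t u -ᶻ n₀) (val-class i t u))) e)

            -- Cauchy-Schwarz in linear form: `2 X Y ≤ X² + Y²` taken at the expected value
            -- `H T² / (2x)` of `R[ n ]`. Outside the class `R[ n ]` vanishes, so summation over
            -- `ys` brings in the number of members of the class.
            cauchy : ∀ n → 2 * (T * T * H * (2 * x * R[ n ])) ≤ T * T * H * (T * T * H) * inClass n + 2 * x * (2 * x) * (R[ n ] * R[ n ])
            cauchy n = go (inClass n) refl
              where
              go : ∀ c → inClass n ≡ c → 2 * (T * T * H * (2 * x * R[ n ])) ≤ T * T * H * (T * T * H) * c + 2 * x * (2 * x) * (R[ n ] * R[ n ])
              go zero e = ≤-trans (≤-reflexive (trans (cong (λ z → 2 * (T * T * H * (2 * x * z))) (R-class n e)) (l (T * T * H) (2 * x)))) z≤n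
                where l : ∀ a b → 2 * (a * (b * 0)) ≡ 0
                      l = solve-∀
              go (suc c) e = ≤-trans (two-products (T * T * H) (2 * x * R[ n ])) (+-mono-≤ (m≤m*n _ (suc c)) (≤-reflexive (l (2 * x) R[ n ])))
                where l : ∀ a r → a * r * (a * r) ≡ a * a * (r * r)
                      l = solve-∀

            total-≤ : T * T * first ≤ ∑ᴸ ys R[_]
            total-≤ = ≤-trans (≤-reflexive (trans (sym (∑-*ˡ I₁ (T * T) ω)) (∑-cong I₁ (λ i _ → *-comm (T * T) (ω i))))) (≤-trans (∑-mono I₁ (λ i i<I₁ → one i i<I₁)) (≤-reflexive (sym (trans (∑ᴸ-∑-swap ys I₁ (λ n i → ω i * reps n i)) (∑-cong I₁ (λ i _ → ∑ᴸ-*ˡ ys (ω i) (λ n → reps n i)))))))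
              where
              one : ∀ i → i < I₁ → ω i * (T * T) ≤ ω i * ∑ᴸ ys (λ n → reps n i)
              one i i<I₁ = go (ω i ≟ 0)
                where
                go : Dec (ω i ≡ 0) → ω i * (T * T) ≤ ω i * ∑ᴸ ys (λ n → reps n i)
                go (yes e) = ≤-trans (≤-reflexive (cong (_* (T * T)) e)) z≤n
                go (no ne) = *-monoʳ-≤ (ω i) (≤-trans (≤-reflexive (sym (trans (∑²-const T 1) (cong (T *_) (*-identityʳ T)))))
                    (≤-trans (∑²-mono T (λ t u ht hu → found t u ht hu)) (≤-reflexive (sym (trans (∑ᴸ-∑-swap ys T (λ n t → ∑ T (hit n i t))) (∑-cong T (λ t _ → ∑ᴸ-∑-swap ys T (λ n u → hit n i t u))))))))
                  where
                  I₀≤i : I₀ ≤ i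
                  I₀≤i = 𝟙-true (I₀ ≤? i) (*≢0⇒ˡ (*≢0⇒ˡ {𝟙 (I₀ ≤? i) * 𝟙 (i <? I₁)} ne))
                  found : ∀ t u → t < T → u < T → 1 ≤ ∑ᴸ ys (λ n → hit n i t u)
                  found t u ht hu = ≤-trans (≤-reflexive (sym (𝟙-yes (val i t u ℤ.≟ val i t u) refl))) (∑ᴸ-member ys (λ n → hit n i t u)
                    (complete i t u (val-positive i t u I₀≤i ht hu) (≤-of-abs (val i t u) N (≤-trans (val-upper i t u i<I₁ ht hu) fits))))

            square-≤ : ∑ᴸ ys (λ n → R[ n ] * R[ n ]) ≤ secondMoment
            square-≤ = ≤-trans (≤-reflexive (trans (∑ᴸ-cong ys (λ n _ → ∑-*-∑ I₁ I₁ (λ i → ω i * reps n i) (λ i → ω i * reps n i)))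
                (trans (∑ᴸ-∑-swap ys I₁ (λ n i → ∑ I₁ (λ i' → ω i * reps n i * (ω i' * reps n i')))) (∑-cong I₁ (λ i _ → ∑ᴸ-∑-swap ys I₁ (λ n i' → ω i * reps n i * (ω i' * reps n i')))))))
                (∑-mono I₁ (λ i _ → ∑-mono I₁ (λ i' _ → ≤-trans (≤-reflexive (trans (∑ᴸ-cong ys (λ n _ → l (ω i) (reps n i) (ω i') (reps n i'))) (∑ᴸ-*ˡ ys (ω i * ω i') (λ n → reps n i * reps n i')))) (*-monoʳ-≤ (ω i * ω i') (pair i i')))))
              where
              l : ∀ a b c d → a * b * (c * d) ≡ a * c * (b * d)
              l = solve-∀
              both : ∀ i i' t u t' u' → ∑ᴸ ys (λ n → hit n i t u * hit n i' t' u') ≤ same i i' t u t' u'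
              both i i' t u t' u' = go (h i -ᶻ h i' ℤ.≟ k t u t' u')
                where
                go : (dec : Dec (h i -ᶻ h i' ≡ k t u t' u')) → ∑ᴸ ys (λ n → hit n i t u * hit n i' t' u') ≤ 𝟙 dec
                go (yes _) = ∑ᴸ-at-most-one (λ n → hit n i t u * hit n i' t' u') 1 unique (λ n → *-mono-≤ (𝟙≤1 (val i t u ℤ.≟ n)) (𝟙≤1 (val i' t' u' ℤ.≟ n)))
                   (λ n n' p p' → trans (sym (𝟙-true (val i t u ℤ.≟ n) (*≢0⇒ˡ p))) (𝟙-true (val i t u ℤ.≟ n') (*≢0⇒ˡ p')))
                go (no ne) = ≤-reflexive (∑ᴸ-zero ys (λ n _ → zero' n))
                  where
                  zero' : ∀ n → hit n i t u * hit n i' t' u' ≡ 0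
                  zero' n = go' (val i t u ℤ.≟ n) (val i' t' u' ℤ.≟ n)
                    where
                    go' : (d₁ : Dec (val i t u ≡ n)) (d₂ : Dec (val i' t' u' ≡ n)) → 𝟙 d₁ * 𝟙 d₂ ≡ 0
                    go' (no _) _ = refl
                    go' (yes _) (no _) = refl
                    go' (yes e₁) (yes e₂) = ⊥-elim (ne (cancel (ℤP.*-cancelˡ-≡ (+ q) (h i +ᶻ g t u) (h i' +ᶻ g t' u') {{ℤ.≢-nonZero (λ e → q≢0 (ℤP.+-injective e))}} (cancel₀ (trans e₁ (sym e₂))))))
                      where
                      cancel₀ : n₀ +ᶻ + q *ᶻ (h i +ᶻ g t u) ≡ n₀ +ᶻ + q *ᶻ (h i' +ᶻ g t' u') → + q *ᶻ (h i +ᶻ g t u) ≡ + q *ᶻ (h i' +ᶻ g t' u')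
                      cancel₀ e = trans (l₀ n₀ (+ q *ᶻ (h i +ᶻ g t u))) (trans (cong (_-ᶻ n₀) e) (sym (l₀ n₀ (+ q *ᶻ (h i' +ᶻ g t' u')))))
                        where l₀ : ∀ n v → v ≡ n +ᶻ v -ᶻ n
                              l₀ = solveᶻ
                      cancel : h i +ᶻ g t u ≡ h i' +ᶻ g t' u' → h i -ᶻ h i' ≡ k t u t' u'
                      cancel e = trans (l₁ (h i) (g t u) (h i')) (trans (cong (λ z → z -ᶻ g t u -ᶻ h i') e) (l₂ (h i') (g t' u') (g t u)))
                        where l₁ : ∀ a b c → a -ᶻ c ≡ a +ᶻ b -ᶻ b -ᶻ c
                              l₁ = solveᶻ
                              l₂ : ∀ a b c → a +ᶻ b -ᶻ c -ᶻ a ≡ b -ᶻ c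
                              l₂ = solveᶻ
              pair : ∀ i i' → ∑ᴸ ys (λ n → reps n i * reps n i') ≤ collisions i i'
              pair i i' = ≤-trans (≤-reflexive (trans (∑ᴸ-cong ys (λ n _ → ∑²-*-∑² T (hit n i) (hit n i'))) move)) (∑⁴-mono T (λ t u t' u' _ _ _ _ → both i i' t u t' u'))
                where
                move : ∑ᴸ ys (λ n → ∑⁴ T (λ t u t' u' → hit n i t u * hit n i' t' u')) ≡ ∑⁴ T (λ t u t' u' → ∑ᴸ ys (λ n → hit n i t u * hit n i' t' u'))
                move = trans (∑ᴸ-∑-swap ys T _) (∑-cong T (λ t _ → trans (∑ᴸ-∑-swap ys T _) (∑-cong T (λ u _ → trans (∑ᴸ-∑-swap ys T _) (∑-cong T (λ t' _ → ∑ᴸ-∑-swap ys T _))))))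

            summed : 4 * x * H * (T * T) * (T * T * first) ≤ T⁴ * (H * H) * count + 4 * x * x * secondMoment
            summed = ≤-trans (*-monoʳ-≤ (4 * x * H * (T * T)) total-≤) (≤-trans (≤-reflexive (trans (l₁ x H (T * T) (∑ᴸ ys R[_])) (sym (trans (∑ᴸ-*ˡ ys 2 (λ n → T * T * H * (2 * x * R[ n ]))) (cong (2 *_) (trans (∑ᴸ-*ˡ ys (T * T * H) (λ n → 2 * x * R[ n ])) (cong (T * T * H *_) (∑ᴸ-*ˡ ys (2 * x) R[_]))))))))
               (≤-trans (∑ᴸ-mono ys (λ n _ → cauchy n)) (≤-trans (≤-reflexive (trans (∑ᴸ-+ ys (λ n → T * T * H * (T * T * H) * inClass n) (λ n → 2 * x * (2 * x) * (R[ n ] * R[ n ]))) (cong₂ _+_ (∑ᴸ-*ˡ ys (T * T * H * (T * T * H)) inClass) (∑ᴸ-*ˡ ys (2 * x * (2 * x)) (λ n → R[ n ] * R[ n ])))))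
               (+-mono-≤ (≤-reflexive (l₂ T H count)) (≤-trans (*-monoʳ-≤ (2 * x * (2 * x)) square-≤) (≤-reflexive (cong (_* secondMoment) (l₃ x))))))))
              where
              l₁ : ∀ x H t s → 4 * x * H * t * s ≡ 2 * (t * H * (2 * x * s))
              l₁ = solve-∀
              l₂ : ∀ T H c → T * T * H * (T * T * H) * c ≡ T * (T * (T * T)) * (H * H) * c
              l₂ = solve-∀
              l₃ : ∀ x → 2 * x * (2 * x) ≡ 4 * x * x
              l₃ = solve-∀

          -- The loss 28 consists of 24 from the second moment and 4 from the first.
          count-bound : x * m * (I₁ * I₁) ≤ m * H * count + x * (I₁ * I₁) * 28
          count-bound = *-cancelˡ-≤ (T⁴ * H) {{>-nonZero (*-mono-≤ (*-mono-≤ 1≤T (*-mono-≤ 1≤T (*-mono-≤ 1≤T 1≤T))) 1≤H)}}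
              (+-cancelʳ-≤ (T⁴ * H * (x * m * I²)) _ _ (≤-trans (≤-reflexive (l₁ (T⁴ * H) x m I²)) (≤-trans (*-monoʳ-≤ (T⁴ * H * (2 * x)) first-≥) (≤-trans (≤-reflexive (l₂ T H x m first I²))
               (≤-trans (+-monoˡ-≤ (T⁴ * H * (4 * x * I²)) (≤-trans (*-monoʳ-≤ m summed) (≤-trans (≤-reflexive (l₃ m (T⁴ * (H * H)) count x secondMoment)) (+-monoʳ-≤ (m * (T⁴ * (H * H) * count)) (*-monoʳ-≤ x moment-bound))))) (≤-reflexive (l₄ m T⁴ H count x I²)))))))
            where
            l₁ : ∀ t x m i → t * (x * m * i) + t * (x * m * i) ≡ t * (2 * x) * (m * i)
            l₁ = solve-∀
            l₂ : ∀ T H x m f i → T * (T * (T * T)) * H * (2 * x) * (m * (2 * f) + 2 * i) ≡ m * (4 * x * H * (T * T) * (T * T * f)) + T * (T * (T * T)) * H * (4 * x * i)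
            l₂ = solve-∀
            l₃ : ∀ m t c x s → m * (t * c + 4 * x * x * s) ≡ m * (t * c) + x * (4 * x * m * s)
            l₃ = solve-∀
            l₄ : ∀ m t H c x i → m * (t * (H * H) * c) + x * (H * i * t * (m + 24)) + t * H * (4 * x * i) ≡ t * H * (m * H * c + x * i * 28) + t * H * (x * m * i)
            l₄ = solve-∀

  module ClassDensity (𝓕 : Family) (n₀ : ℤ) (b≢0 : ∣ Family.b 𝓕 ∣ ≢ 0) (c≢0 : ∣ Family.c 𝓕 ∣ ≢ 0)
      (m : ℕ) (30≤m : 30 ≤ m) (rough : ∀ e → Coprime e (Family.F 𝓕) → e ≢ 1 → m < e) where
    open Family 𝓕 hiding (χ)

    private
      Cc = suc (∣ α₁ ∣ + ∣ α₂ ∣ + 4 * (q * (∣ b ∣ + ∣ c ∣)))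
      κ₀ = suc (∣ α₀ ∣ + ∣ n₀ ∣)

      module WithK (K : ℕ) (K-def : K ≡ m * (8 * Cc * suc m) * κ₀) where
        module C = Core 𝓕 n₀ b≢0 c≢0 m 30≤m rough K κ₀ (λ ()) K-def
        x J τ ρ B₁ B₀ r₀ : ℕ
        x = q * a
        J = 64 * (x * K) * m
        τ = m * (16 * m * (4 * (x * K) * J))
        ρ = q * Cc + q * (∣ α₀ ∣ * K) + ∣ n₀ ∣
        B₁ = q * x * (K * K) + ρ
        B₀ = B₁ * (τ * τ)
        r₀ = C.Scale.R₀ 0 + (suc (∣ α₀ ∣ + ∣ n₀ ∣) + 3 * m)

        1≤m : 1 ≤ m
        1≤m = ≤-trans (s≤s z≤n) 30≤m
        1≤q : 1 ≤ q
        1≤q = n≢0⇒n>0 (λ e → [ H≢0 , q'≢0 ]′ (m*n≡0⇒m≡0∨n≡0 H e))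
        1≤x : 1 ≤ x
        1≤x = *-mono-≤ 1≤q (n≢0⇒n>0 a≢0)
        K-mκ : m * (Cc * κ₀) ≤ K
        K-mκ = ≤-trans (≤-trans (m≤m*n (m * (Cc * κ₀)) (8 * suc m)) (≤-reflexive (l m Cc κ₀))) (≤-reflexive (sym K-def))
          where l : ∀ m c k → m * (c * k) * (8 * suc m) ≡ m * (8 * c * suc m) * k
                l = solve-∀
        1≤K : 1 ≤ K
        1≤K = ≤-trans (*-mono-≤ 1≤m (*-mono-≤ {1} {Cc} {1} {κ₀} (s≤s z≤n) (s≤s z≤n))) K-mκ
        1≤J : 1 ≤ J
        1≤J = *-mono-≤ (*-mono-≤ {1} {64} (s≤s z≤n) (*-mono-≤ 1≤x 1≤K)) 1≤m
        1≤τ : 1 ≤ τ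
        1≤τ = *-mono-≤ 1≤m (*-mono-≤ (*-mono-≤ {1} {16} (s≤s z≤n) 1≤m) (*-mono-≤ (*-mono-≤ {1} {4} (s≤s z≤n) (*-mono-≤ 1≤x 1≤K)) 1≤J))
        1≤B₀ : 1 ≤ B₀
        1≤B₀ = *-mono-≤ (≤-trans (*-mono-≤ (*-mono-≤ 1≤q 1≤x) (*-mono-≤ 1≤K 1≤K)) (m≤m+n _ ρ)) (*-mono-≤ 1≤τ 1≤τ)

        -- `K` contains the factor `m Cc κ₀`, so each of the three lower-order terms in `B₁` is at
        -- most `1/m` of the leading one.
        mρ≤ : m * ρ ≤ 3 * (q * x * (K * K))
        mρ≤ = ≤-trans (≤-reflexive (l₁ m q Cc (∣ α₀ ∣) K (∣ n₀ ∣))) (≤-trans (+-mono-≤ (+-mono-≤ (*-monoʳ-≤ q (≤-trans mCc (m≤m*n K K {{>-nonZero 1≤K}}))) (*-monoʳ-≤ q (*-monoˡ-≤ K mα₀))) (≤-trans mn₀ (≤-trans (m≤m*n K K {{>-nonZero 1≤K}}) (m≤n*m (K * K) q {{>-nonZero 1≤q}}))))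
            (≤-trans (≤-reflexive (l₂ (q * (K * K)))) (*-monoʳ-≤ 3 (≤-trans (m≤m*n (q * (K * K)) x {{>-nonZero 1≤x}}) (≤-reflexive (l₃ q (K * K) x))))))
          where
          l₁ : ∀ m q c α K n → m * (q * c + q * (α * K) + n) ≡ q * (m * c) + q * (m * α * K) + m * n
          l₁ = solve-∀
          l₂ : ∀ z → z + z + z ≡ 3 * z
          l₂ = solve-∀
          l₃ : ∀ q k x → q * k * x ≡ q * x * k
          l₃ = solve-∀
          mCc : m * Cc ≤ K
          mCc = ≤-trans (*-monoʳ-≤ m (m≤m*n Cc κ₀)) K-mκ
          α₀≤κ : ∣ α₀ ∣ ≤ κ₀
          α₀≤κ = m≤n⇒m≤1+n (m≤m+n (∣ α₀ ∣) (∣ n₀ ∣))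
          n₀≤κ : ∣ n₀ ∣ ≤ κ₀
          n₀≤κ = m≤n⇒m≤1+n (m≤n+m (∣ n₀ ∣) (∣ α₀ ∣))
          mα₀ : m * ∣ α₀ ∣ ≤ K
          mα₀ = ≤-trans (*-monoʳ-≤ m (≤-trans α₀≤κ (m≤n*m κ₀ Cc))) K-mκ
          mn₀ : m * ∣ n₀ ∣ ≤ K
          mn₀ = ≤-trans (*-monoʳ-≤ m (≤-trans n₀≤κ (m≤n*m κ₀ Cc))) K-mκ

        -- The scale is the largest `r` with `B₀ r² ≤ N`. To the loss 28 of `count-bound` are added
        -- 3 for the lower-order terms of `B₁` and 1 for replacing `N` by `B₀ r²`.
        density : ∀ N → B₀ * (r₀ * r₀) ≤ N → ∀ ys → Unique ys →
          (∀ i t u → + 1 ℤ.≤ C.val i t u → C.val i t u ℤ.≤ + N → C.val i t u ∈ ys) →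
          m * N ≤ m * (q * H * ∑ᴸ ys C.inClass) + 32 * N
        density N M≤N ys uniq complete = ≤-trans mN≤ (≤-trans (+-monoˡ-≤ (4 * N) (≤-trans (≤-reflexive (l₁ m q x (S.I₁ * S.I₁))) (≤-trans (*-monoʳ-≤ q cb) (≤-trans (≤-reflexive (l₂ q m H (∑ᴸ ys C.inClass) x (S.I₁ * S.I₁))) (+-monoʳ-≤ (m * (q * H * ∑ᴸ ys C.inClass)) (*-monoˡ-≤ 28 qxI²≤N)))))) (≤-reflexive (l₃ (m * (q * H * ∑ᴸ ys C.inClass)) N)))
          where
          br = square-bracket B₀ N (λ e → n≮0 (subst (1 ≤_) e 1≤B₀))
          r = proj₁ br
          lo = proj₁ (proj₂ br)
          hi = proj₂ (proj₂ br)
          module S = C.Scale r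
          r₀≤r : r₀ ≤ r
          r₀≤r = ≮⇒≥ (λ lt → <-irrefl refl (<-≤-trans hi (≤-trans (*-monoʳ-≤ B₀ (*-mono-≤ lt lt)) M≤N)))
          r≤R' : r ≤ S.R'
          r≤R' = m≤n*m r J {{>-nonZero 1≤J}}
          T≡ : S.T ≡ τ * r
          T≡ = l m (x * K) J r where l : ∀ m y J r → m * (16 * m * (4 * y * (J * r))) ≡ m * (16 * m * (4 * y * J)) * r
                                     l = solve-∀
          r≤T : r ≤ S.T
          r≤T = ≤-trans (m≤n*m r τ {{>-nonZero 1≤τ}}) (≤-reflexive (sym T≡))
          r₁≤ : suc (∣ α₀ ∣ + ∣ n₀ ∣) ≤ r
          r₁≤ = ≤-trans (≤-trans (m≤m+n _ (3 * m)) (m≤n+m _ (C.Scale.R₀ 0))) r₀≤r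
          3m≤r : 3 * m ≤ r
          3m≤r = ≤-trans (≤-trans (m≤n+m (3 * m) (suc (∣ α₀ ∣ + ∣ n₀ ∣))) (m≤n+m _ (C.Scale.R₀ 0))) r₀≤r
          large : S.R₀ ≤ S.R'
          large = ≤-trans (≤-trans (m≤m+n (C.Scale.R₀ 0) _) r₀≤r) r≤R'
          α₀≤T : ∣ α₀ ∣ ≤ S.T
          α₀≤T = ≤-trans (≤-trans (m≤n⇒m≤1+n (m≤m+n (∣ α₀ ∣) (∣ n₀ ∣))) r₁≤) r≤T
          n₀<T : ∣ n₀ ∣ < S.T
          n₀<T = ≤-trans (≤-trans (s≤s (m≤n+m (∣ n₀ ∣) (∣ α₀ ∣))) r₁≤) r≤T
          T²≡ : S.T * S.T ≡ τ * τ * (r * r)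
          T²≡ = trans (cong₂ _*_ T≡ T≡) (l τ r) where l : ∀ t r → t * r * (t * r) ≡ t * t * (r * r)
                                                      l = solve-∀
          B₁T² : B₁ * (S.T * S.T) ≡ B₀ * (r * r)
          B₁T² = trans (cong (B₁ *_) T²≡) (sym (*-assoc B₁ (τ * τ) (r * r)))
          fits : B₁ * (S.T * S.T) ≤ N
          fits = ≤-trans (≤-reflexive B₁T²) lo
          cb : x * m * (S.I₁ * S.I₁) ≤ m * H * ∑ᴸ ys C.inClass + x * (S.I₁ * S.I₁) * 28
          cb = S.count-bound large α₀≤T n₀<T N fits ys uniq complete
          I²≡ : q * x * (S.I₁ * S.I₁) ≡ q * x * (K * K) * (S.T * S.T)
          I²≡ = l (q * x) K S.T where l : ∀ y K T → y * (K * T * (K * T)) ≡ y * (K * K) * (T * T)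
                                      l = solve-∀
          qxI²≤N : q * x * (S.I₁ * S.I₁) ≤ N
          qxI²≤N = ≤-trans (≤-reflexive I²≡) (≤-trans (*-monoˡ-≤ (S.T * S.T) (m≤m+n (q * x * (K * K)) ρ)) fits)
          mN≤ : m * N ≤ m * (q * x * (S.I₁ * S.I₁)) + 4 * N
          mN≤ = ≤-trans (*-monoʳ-≤ m (<⇒≤ hi)) (≤-trans (≤-reflexive (l₄ m B₀ r)) (≤-trans (+-monoʳ-≤ (m * (B₀ * (r * r))) (≤-trans (*-monoʳ-≤ B₀ step) (≤-trans lo ≤-refl)))
              (≤-trans (+-monoˡ-≤ N main) (≤-reflexive (l₆ (m * (q * x * (S.I₁ * S.I₁))) N)))))
            where
            l₄ : ∀ m B r → m * (B * (suc r * suc r)) ≡ m * (B * (r * r)) + B * (m * (2 * r + 1))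
            l₄ = solve-∀
            step : m * (2 * r + 1) ≤ r * r
            step = ≤-trans (*-monoʳ-≤ m (+-monoʳ-≤ (2 * r) (≤-trans (s≤s z≤n) r₁≤))) (≤-trans (≤-reflexive (l m r)) (*-monoˡ-≤ r 3m≤r))
              where l : ∀ m r → m * (2 * r + r) ≡ 3 * m * r
                    l = solve-∀
            l₆ : ∀ z N → z + 3 * N + N ≡ z + 4 * N
            l₆ = solve-∀
            main : m * (B₀ * (r * r)) ≤ m * (q * x * (S.I₁ * S.I₁)) + 3 * N
            main = ≤-trans (≤-reflexive (trans (cong (m *_) (sym B₁T²)) (trans (l₅ m (q * x * (K * K)) ρ (S.T * S.T)) (cong (λ z → m * z + m * ρ * (S.T * S.T)) (sym I²≡)))))
               (+-monoʳ-≤ (m * (q * x * (S.I₁ * S.I₁))) (≤-trans (*-monoˡ-≤ (S.T * S.T) mρ≤) (≤-trans (≤-reflexive (*-assoc 3 (q * x * (K * K)) (S.T * S.T))) (*-monoʳ-≤ 3 (≤-trans (*-monoˡ-≤ (S.T * S.T) (m≤m+n (q * x * (K * K)) ρ)) fits)))))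
              where l₅ : ∀ m y ρ t → m * ((y + ρ) * t) ≡ m * (y * t) + m * ρ * t
                    l₅ = solve-∀
          l₁ : ∀ m q x i → m * (q * x * i) ≡ q * (x * m * i)
          l₁ = solve-∀
          l₂ : ∀ q m H c x i → q * (m * H * c + x * i * 28) ≡ m * (q * H * c) + q * x * i * 28
          l₂ = solve-∀
          l₃ : ∀ z N → z + N * 28 + 4 * N ≡ z + 32 * N
          l₃ = solve-∀

    private
      K = m * (8 * Cc * suc m) * κ₀
      module W = WithK K refl

    open Core 𝓕 n₀ b≢0 c≢0 m 30≤m rough K κ₀ (λ ()) refl public using (val; inClass)

    class-density : ∃[ M ] ∀ N → M ≤ N → ∀ ys → Unique ys →
          (∀ i t u → + 1 ℤ.≤ val i t u → val i t u ℤ.≤ + N → val i t u ∈ ys) →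
          m * N ≤ m * (q * H * ∑ᴸ ys inClass) + 32 * N
    class-density = W.B₀ * (W.r₀ * W.r₀) , W.density

  -- Base points in general position

  -- Partial sums of the geometric series for the inverse of `1 + w`, which converges `F`-adically.
  neumann : ∀ F w → + F ∣ w → ∀ k → ∃[ S ] + (F ^ k) ∣ (+ 1 +ᶻ w) *ᶻ S -ᶻ + 1
  neumann F w F∣w zero = + 0 , divides ((+ 1 +ᶻ w) *ᶻ + 0 -ᶻ + 1) (sym (ℤP.*-identityʳ _))
  neumann F w F∣w (suc k) = let (S , d) = neumann F w F∣w k in + 1 -ᶻ w *ᶻ S ,
    ∣-eq (subst (_∣ (-ᶻ w) *ᶻ ((+ 1 +ᶻ w) *ᶻ S -ᶻ + 1)) (sym (ℤP.pos-* F (F ^ k))) (∣-*-∣ (ℤD.∣m⇒∣-m F∣w) d)) (l w S)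
    where
    ∣-*-∣ : ∀ {a b c d} → a ∣ c → b ∣ d → a *ᶻ b ∣ c *ᶻ d
    ∣-*-∣ {a} {b} (divides p refl) (divides q refl) = divides (p *ᶻ q) (l' p a q b)
      where l' : ∀ p a q b → p *ᶻ a *ᶻ (q *ᶻ b) ≡ p *ᶻ q *ᶻ (a *ᶻ b)
            l' = solveᶻ
    l : ∀ w S → (-ᶻ w) *ᶻ ((+ 1 +ᶻ w) *ᶻ S -ᶻ + 1) ≡ (+ 1 +ᶻ w) *ᶻ (+ 1 -ᶻ w *ᶻ S) -ᶻ + 1
    l = solveᶻ

  ∑-zero-term : ∀ n (f : ℕ → ℕ) → ∑ n f < n → ∃[ i ] i < n × f i ≡ 0
  ∑-zero-term (suc n) f lt with f n ≟ 0
  ... | yes e = n , ≤-refl , e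
  ... | no ne = let (i , i<n , e) = ∑-zero-term n f (+-cancelʳ-< (f n) (∑ n f) n (≤-trans lt (≤-trans (≤-reflexive (+-comm 1 n)) (+-monoʳ-≤ n (n≢0⇒n>0 ne))))) in i , m<n⇒m<1+n i<n , e

  module Rotation {f : TernaryForm} (Fr : Frame f) (x₀ : V) where
    open Frame Fr
    β₀ β₁ β₂ : ℤ
    β₀ = bil f x₀ e₁
    β₁ = bil f x₀ e₂
    β₂ = bil f x₀ e₃

    N : ℤ → ℤ
    N v = + 1 +ᶻ A *ᶻ B *ᶻ (v *ᶻ v)

    -- N v times the image of x₀ under the rotation by v √(-AB) in the plane of e₁, e₂
    rotate : ℤ → V
    rotate v = N v ⊛ x₀ ⊕ ((-ᶻ (B *ᶻ (v *ᶻ v) *ᶻ β₀) -ᶻ v *ᶻ β₁) ⊛ e₁ ⊕ (v *ᶻ β₀ -ᶻ A *ᶻ (v *ᶻ v) *ᶻ β₁) ⊛ e₂)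

    private
      s t : ℤ → ℤ
      s v = -ᶻ (B *ᶻ (v *ᶻ v) *ᶻ β₀) -ᶻ v *ᶻ β₁
      t v = v *ᶻ β₀ -ᶻ A *ᶻ (v *ᶻ v) *ᶻ β₁
      w : ℤ → V
      w v = s v ⊛ e₁ ⊕ t v ⊛ e₂
      bil-w : ∀ u v → bil f u (w v) ≡ s v *ᶻ bil f u e₁ +ᶻ t v *ᶻ bil f u e₂
      bil-w u v = trans (bil-⊕ʳ f u (s v ⊛ e₁) (t v ⊛ e₂)) (cong₂ _+ᶻ_ (bil-⊛ʳ f u (s v) e₁) (bil-⊛ʳ f u (t v) e₂))
      ev-w : ∀ v → ev f (w v) ≡ s v *ᶻ s v *ᶻ A +ᶻ t v *ᶻ t v *ᶻ B
      ev-w v = trans (ev-⊕ f (s v ⊛ e₁) (t v ⊛ e₂)) (trans (cong₂ _+ᶻ_ (cong₂ _+ᶻ_ (trans (ev-⊛ f (s v) e₁) (cong (s v *ᶻ s v *ᶻ_) ev₁))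
          (trans (bil-⊛ʳ f (s v ⊛ e₁) (t v) e₂) (cong (t v *ᶻ_) (trans (bil-⊛ˡ f (s v) e₁ e₂) (cong (s v *ᶻ_) e₁⊥e₂))))) (trans (ev-⊛ f (t v) e₂) (cong (t v *ᶻ t v *ᶻ_) ev₂)))
          (l (s v *ᶻ s v *ᶻ A) (s v) (t v) (t v *ᶻ t v *ᶻ B)))
        where l : ∀ x s t y → x +ᶻ t *ᶻ (s *ᶻ + 0) +ᶻ y ≡ x +ᶻ y
              l = solveᶻ

    ev-rotate : ∀ v → ev f (rotate v) ≡ N v *ᶻ N v *ᶻ ev f x₀
    ev-rotate v = trans (ev-⊕ f (N v ⊛ x₀) (w v)) (trans (cong₂ _+ᶻ_ (cong₂ _+ᶻ_ (ev-⊛ f (N v) x₀) (trans (bil-⊛ˡ f (N v) x₀ (w v)) (cong (N v *ᶻ_) (bil-w x₀ v)))) (ev-w v)) (l (ev f x₀) A B v β₀ β₁))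
      where
      l : ∀ E A B v x y →
        (+ 1 +ᶻ A *ᶻ B *ᶻ (v *ᶻ v)) *ᶻ (+ 1 +ᶻ A *ᶻ B *ᶻ (v *ᶻ v)) *ᶻ E
        +ᶻ (+ 1 +ᶻ A *ᶻ B *ᶻ (v *ᶻ v)) *ᶻ ((-ᶻ (B *ᶻ (v *ᶻ v) *ᶻ x) -ᶻ v *ᶻ y) *ᶻ x +ᶻ (v *ᶻ x -ᶻ A *ᶻ (v *ᶻ v) *ᶻ y) *ᶻ y)
        +ᶻ ((-ᶻ (B *ᶻ (v *ᶻ v) *ᶻ x) -ᶻ v *ᶻ y) *ᶻ (-ᶻ (B *ᶻ (v *ᶻ v) *ᶻ x) -ᶻ v *ᶻ y) *ᶻ A +ᶻ (v *ᶻ x -ᶻ A *ᶻ (v *ᶻ v) *ᶻ y) *ᶻ (v *ᶻ x -ᶻ A *ᶻ (v *ᶻ v) *ᶻ y) *ᶻ B)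
        ≡ (+ 1 +ᶻ A *ᶻ B *ᶻ (v *ᶻ v)) *ᶻ (+ 1 +ᶻ A *ᶻ B *ᶻ (v *ᶻ v)) *ᶻ E
      l = solveᶻ

    bil₂-rotate : ∀ v → bil f (rotate v) e₂ ≡ (+ 1 -ᶻ A *ᶻ B *ᶻ (v *ᶻ v)) *ᶻ β₁ +ᶻ + 2 *ᶻ B *ᶻ v *ᶻ β₀
    bil₂-rotate v = trans (bil-⊕ˡ f (N v ⊛ x₀) (w v) e₂) (trans (cong₂ _+ᶻ_ (bil-⊛ˡ f (N v) x₀ e₂) (trans (bil-sym f (w v) e₂) (trans (bil-w e₂ v) (cong₂ (λ p r → s v *ᶻ p +ᶻ t v *ᶻ r) e₂⊥e₁ bil₂₂)))) (l A B v β₀ β₁))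
      where l : ∀ A B v x y → (+ 1 +ᶻ A *ᶻ B *ᶻ (v *ᶻ v)) *ᶻ y +ᶻ ((-ᶻ (B *ᶻ (v *ᶻ v) *ᶻ x) -ᶻ v *ᶻ y) *ᶻ + 0 +ᶻ (v *ᶻ x -ᶻ A *ᶻ (v *ᶻ v) *ᶻ y) *ᶻ (+ 2 *ᶻ B))
                  ≡ (+ 1 -ᶻ A *ᶻ B *ᶻ (v *ᶻ v)) *ᶻ y +ᶻ + 2 *ᶻ B *ᶻ v *ᶻ x
            l = solveᶻ

    bil₃-rotate : ∀ v → bil f (rotate v) e₃ ≡ N v *ᶻ β₂
    bil₃-rotate v = trans (bil-⊕ˡ f (N v ⊛ x₀) (w v) e₃) (trans (cong₂ _+ᶻ_ (bil-⊛ˡ f (N v) x₀ e₃) (trans (bil-sym f (w v) e₃) (trans (bil-w e₃ v) (cong₂ (λ p r → s v *ᶻ p +ᶻ t v *ᶻ r) e₃⊥e₁ e₃⊥e₂)))) (l (N v *ᶻ β₂) (s v) (t v)))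
      where l : ∀ n s t → n +ᶻ (s *ᶻ + 0 +ᶻ t *ᶻ + 0) ≡ n
            l = solveᶻ

  module GeneralPosition {f : TernaryForm} (Fr : Frame f) (F : ℕ) (F≢0 : F ≢ 0) where
    open Frame Fr

    -- The factor lost when divisibility of `f(x₀)` is deduced from two bad rotations: `2 B` and a
    -- power of `F` from eliminating `β₀`, and `4 A B C` from `expand`. Its absolute value, added in
    -- `J₂`, bounds its valuations.
    C₀ : ℤ
    C₀ = + 2 *ᶻ B *ᶻ + (F ^ (2 + F)) *ᶻ (+ 4 *ᶻ A *ᶻ B *ᶻ C)

    C₀≢0 : C₀ ≢ + 0
    C₀≢0 = *≢0 (*≢0 (*≢0 {+ 2} (λ ()) B≢0) (λ e → ≢-nonZero⁻¹ (F ^ (2 + F)) {{m^n≢0 F (2 + F) {{≢-nonZero F≢0}}}} (ℤP.+-injective e))) (*≢0 (*≢0 (*≢0 {+ 4} (λ ()) A≢0) B≢0) C≢0)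

    module _ (Jg : ℕ) where
      J₂ Q : ℕ
      J₂ = Jg + ∣ C₀ ∣
      Q = F ^ (2 * J₂ + 1)

      module _ (x₀ : V) (good : ∀ p → Prime p → p ℕD.∣ F → ¬ (+ (p ^ Jg) ∣ ev f x₀)) where
        open Rotation Fr x₀

        private
          -- Divisible by `F`, so that `N (v i)` and `u i` are units at every prime of `F`;
          -- successive powers, so that any two rotations stay independent there up to a bounded
          -- power of `F`.
          v : ℕ → ℤ
          v i = + (F ^ suc i)
          u : ℕ → ℤ
          u i = + 1 -ᶻ A *ᶻ B *ᶻ (v i *ᶻ v i)
          γ₁ γ₂ : ℕ → ℤ
          γ₁ i = u i *ᶻ β₁ +ᶻ + 2 *ᶻ B *ᶻ v i *ᶻ β₀
          γ₂ i = N (v i) *ᶻ β₂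
          Bad : ℕ → ℕ → Set
          Bad p i = (Prime p × p ℕD.∣ F) × (+ (p ^ J₂) ∣ γ₁ i) × (+ (p ^ J₂) ∣ γ₂ i)
          bad? : ∀ p i → Dec (Bad p i)
          bad? p i = (prime? p ×-dec (p ℕD.∣? F)) ×-dec ((+ (p ^ J₂) ∣? γ₁ i) ×-dec (+ (p ^ J₂) ∣? γ₂ i))

          p∣v : ∀ {p} → p ℕD.∣ F → ∀ i → + p ∣ v i
          p∣v p∣F i = ∣ᵤ⇒∣ (ℕD.∣-trans p∣F (ℕD.m∣m*n (F ^ i)))

          not-unit : ∀ {p} → Prime p → ∀ z w → + p ∣ w → z ≡ + 1 +ᶻ w → ¬ (+ p ∣ z)
          not-unit {p} pp z w p∣w e p∣z = <-irrefl refl (≤-trans (prime⇒≥2 pp) (ℕD.∣⇒≤ (∣⇒∣ᵤ (ℤD.∣m+n∣n⇒∣m {+ p} {+ 1} {w} (∣-eq p∣z e) p∣w))))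

          p∤N : ∀ {p} → Prime p → p ℕD.∣ F → ∀ i → ¬ (+ p ∣ N (v i))
          p∤N pp p∣F i = not-unit pp (N (v i)) (A *ᶻ B *ᶻ (v i *ᶻ v i)) (∣*ˡ (A *ᶻ B) (∣*ˡ (v i) (p∣v p∣F i))) refl
          p∤u : ∀ {p} → Prime p → p ℕD.∣ F → ∀ i → ¬ (+ p ∣ u i)
          p∤u pp p∣F i = not-unit pp (u i) (-ᶻ (A *ᶻ B *ᶻ (v i *ᶻ v i))) (ℤD.∣m⇒∣-m (∣*ˡ (A *ᶻ B) (∣*ˡ (v i) (p∣v p∣F i)))) refl

          -- two bad rotations for the same p would make all of β₀, β₁, β₂, hence f(x₀), highly divisible by p
          two-bad : ∀ p i δ → i + suc δ < 2 + F → Bad p i → Bad p (i + suc δ) → ⊥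
          two-bad p i δ lt ((pp , p∣F) , d₁ , d₂) (_ , d₁' , _) = good p pp p∣F (prime-pow-divide-outℤ pp C₀ C₀≢0 Jg (∣-eq dall (sym all-eq)))
            where
            i' = i + suc δ
            ω = + (F ^ suc δ)
            vi' : v i' ≡ v i *ᶻ ω
            vi' = trans (cong +_ (^-distribˡ-+-* F (suc i) (suc δ))) (ℤP.pos-* (F ^ suc i) (F ^ suc δ))
            dβ₂ : + (p ^ J₂) ∣ β₂
            dβ₂ = prime-pow-cancel pp (p∤N pp p∣F i) J₂ d₂
            bracket' = u i' -ᶻ ω *ᶻ u i
            elim : u i' *ᶻ γ₁ i -ᶻ u i *ᶻ γ₁ i' ≡ bracket' *ᶻ (+ 2 *ᶻ B *ᶻ v i *ᶻ β₀)
            elim = trans (cong (λ z → u i' *ᶻ γ₁ i -ᶻ u i *ᶻ (u i' *ᶻ β₁ +ᶻ + 2 *ᶻ B *ᶻ z *ᶻ β₀)) vi') (l (u i') (u i) β₁ B (v i) β₀ ω)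
              where l : ∀ U u b B v a w → U *ᶻ (u *ᶻ b +ᶻ + 2 *ᶻ B *ᶻ v *ᶻ a) -ᶻ u *ᶻ (U *ᶻ b +ᶻ + 2 *ᶻ B *ᶻ (v *ᶻ w) *ᶻ a) ≡ (U -ᶻ w *ᶻ u) *ᶻ (+ 2 *ᶻ B *ᶻ v *ᶻ a)
                    l = solveᶻ
            p∤bracket : ¬ (+ p ∣ bracket')
            p∤bracket = not-unit pp bracket' (-ᶻ (A *ᶻ B *ᶻ (v i' *ᶻ v i')) -ᶻ ω *ᶻ u i) (∣m∣n⇒∣m-n (ℤD.∣m⇒∣-m (∣*ˡ (A *ᶻ B) (∣*ˡ (v i') (p∣v p∣F i')))) (ℤD.∣m⇒∣m*n {+ p} {ω} (u i) (p∣v p∣F δ))) (l (A *ᶻ B *ᶻ (v i' *ᶻ v i')) (ω *ᶻ u i))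
              where l : ∀ a b → + 1 -ᶻ a -ᶻ b ≡ + 1 +ᶻ (-ᶻ a -ᶻ b)
                    l = solveᶻ
            dβ₀ : + (p ^ J₂) ∣ + 2 *ᶻ B *ᶻ v i *ᶻ β₀
            dβ₀ = prime-pow-cancel pp p∤bracket J₂ (∣-eq (∣m∣n⇒∣m-n (∣*ˡ (u i') d₁) (∣*ˡ (u i) d₁')) elim)
            dβ₁ : + (p ^ J₂) ∣ β₁
            dβ₁ = prime-pow-cancel pp (p∤u pp p∣F i) J₂ (ℤD.∣m+n∣n⇒∣m {+ (p ^ J₂)} {u i *ᶻ β₁} {+ 2 *ᶻ B *ᶻ v i *ᶻ β₀} d₁ dβ₀)
            W = + (F ^ (2 + F))
            rest = 2 + F ∸ suc i
            si≤ : suc i ≤ 2 + F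
            si≤ = ≤-trans (≤-trans (s≤s (m≤m+n i δ)) (≤-reflexive (sym (+-suc i δ)))) (<⇒≤ lt)
            W-eq : W ≡ v i *ᶻ + (F ^ rest)
            W-eq = trans (cong (λ z → + (F ^ z)) (sym (m+[n∸m]≡n si≤))) (trans (cong +_ (^-distribˡ-+-* F (suc i) rest)) (ℤP.pos-* (F ^ suc i) (F ^ rest)))
            c = + 2 *ᶻ B *ᶻ W
            dcβ₀ : + (p ^ J₂) ∣ c *ᶻ β₀
            dcβ₀ = ∣-eq (∣*ˡ (+ (F ^ rest)) dβ₀) (trans (l B (v i) β₀ (+ (F ^ rest))) (cong (λ z → + 2 *ᶻ B *ᶻ z *ᶻ β₀) (sym W-eq)))
              where l : ∀ B v b r → r *ᶻ (+ 2 *ᶻ B *ᶻ v *ᶻ b) ≡ + 2 *ᶻ B *ᶻ (v *ᶻ r) *ᶻ b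
                    l = solveᶻ
            all-eq : C₀ *ᶻ ev f x₀ ≡ B *ᶻ C *ᶻ β₀ *ᶻ (c *ᶻ β₀) +ᶻ c *ᶻ A *ᶻ C *ᶻ β₁ *ᶻ β₁ +ᶻ c *ᶻ A *ᶻ B *ᶻ β₂ *ᶻ β₂
            all-eq = trans (ℤP.*-assoc c (+ 4 *ᶻ A *ᶻ B *ᶻ C) (ev f x₀)) (trans (cong (c *ᶻ_) (expand x₀)) (l c A B C β₀ β₁ β₂))
              where l : ∀ c A B C x y z → c *ᶻ (B *ᶻ C *ᶻ (x *ᶻ x) +ᶻ A *ᶻ C *ᶻ (y *ᶻ y) +ᶻ A *ᶻ B *ᶻ (z *ᶻ z)) ≡ B *ᶻ C *ᶻ x *ᶻ (c *ᶻ x) +ᶻ c *ᶻ A *ᶻ C *ᶻ y *ᶻ y +ᶻ c *ᶻ A *ᶻ B *ᶻ z *ᶻ z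
                    l = solveᶻ
            dall : + (p ^ J₂) ∣ B *ᶻ C *ᶻ β₀ *ᶻ (c *ᶻ β₀) +ᶻ c *ᶻ A *ᶻ C *ᶻ β₁ *ᶻ β₁ +ᶻ c *ᶻ A *ᶻ B *ᶻ β₂ *ᶻ β₂
            dall = ∣m∣n⇒∣m+n (∣m∣n⇒∣m+n (∣*ˡ (B *ᶻ C *ᶻ β₀) dcβ₀) (∣*ˡ (c *ᶻ A *ᶻ C *ᶻ β₁) dβ₁)) (∣*ˡ (c *ᶻ A *ᶻ B *ᶻ β₂) dβ₂)

          column : ∀ p → ∑ (2 + F) (λ i → 𝟙 (bad? p i)) ≤ 1
          column p = ∑-at-most-one (2 + F) (λ i → 𝟙 (bad? p i)) 1 (λ i _ → 𝟙≤1 (bad? p i)) λ i j i< j< hi hj → case i j i< j< (𝟙-true (bad? p i) hi) (𝟙-true (bad? p j) hj)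
            where
            gap : ∀ i j → i < j → i + suc (j ∸ suc i) ≡ j
            gap i j i<j = trans (+-suc i (j ∸ suc i)) (m+[n∸m]≡n i<j)
            case : ∀ i j → i < 2 + F → j < 2 + F → Bad p i → Bad p j → i ≡ j
            case i j i< j< bi bj = [ (λ i<j → ⊥-elim (two-bad p i (j ∸ suc i) (subst (_< 2 + F) (sym (gap i j i<j)) j<) bi (subst (Bad p) (sym (gap i j i<j)) bj)))
              , (λ j≤i → [ (λ j<i → ⊥-elim (two-bad p j (i ∸ suc j) (subst (_< 2 + F) (sym (gap j i j<i)) i<) bj (subst (Bad p) (sym (gap j i j<i)) bi))) , sym ]′ (m≤n⇒m<n∨m≡n j≤i)) ]′ (<-≤-connex i j)

          -- Pigeonhole: there are `2 + F` rotations and at most `F + 1` candidates for a prime of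
          -- `F`, each spoiling at most one rotation.
          choice : ∃[ i ] i < 2 + F × ∑ (suc F) (λ p → 𝟙 (bad? p i)) ≡ 0
          choice = ∑-zero-term (2 + F) (λ i → ∑ (suc F) (λ p → 𝟙 (bad? p i))) (s≤s (≤-trans (≤-reflexive (∑-swap (2 + F) (suc F) (λ i p → 𝟙 (bad? p i)))) (≤-trans (∑-mono (suc F) (λ p _ → column p)) (≤-reflexive (trans (∑-const (suc F) 1) (*-identityʳ (suc F)))))))
          i₀ = proj₁ choice

          none : ∀ p → Prime p → p ℕD.∣ F → ¬ ((+ (p ^ J₂) ∣ γ₁ i₀) × (+ (p ^ J₂) ∣ γ₂ i₀))
          none p pp p∣F h = 1+n≢0 (n≤0⇒n≡0 (subst (1 ≤_) (proj₂ (proj₂ choice)) (≤-trans (≤-reflexive (sym (𝟙-yes (bad? p i₀) ((pp , p∣F) , h)))) (∑-term (suc F) (λ p → 𝟙 (bad? p i₀)) p (s≤s (ℕD.∣⇒≤ {{≢-nonZero F≢0}} p∣F))))))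

          inv = neumann F (A *ᶻ B *ᶻ (v i₀ *ᶻ v i₀)) (∣*ˡ (A *ᶻ B) (∣*ˡ (v i₀) (p∣v ℕD.∣-refl i₀))) (2 * J₂ + 1)
          S = proj₁ inv
          NS : + Q ∣ N (v i₀) *ᶻ S -ᶻ + 1
          NS = proj₂ inv

        -- A base point on or near the line of `e₁` has both other pairings divisible by high
        -- powers, leaving no bound for their common factor. A rotation cures this and multiplies
        -- `f` by `N²`; scaling by the inverse `S` of `N` modulo `Q` restores the residue class.
        general-position : ∃[ x₁ ] (+ Q ∣ ev f x₁ -ᶻ ev f x₀) × (∀ p → Prime p → p ℕD.∣ F → ¬ ((+ (p ^ J₂) ∣ bil f x₁ e₂) × (+ (p ^ J₂) ∣ bil f x₁ e₃)))
        general-position = S ⊛ rotate (v i₀) , congruent , generic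
          where
          n = N (v i₀)
          congruent : + Q ∣ ev f (S ⊛ rotate (v i₀)) -ᶻ ev f x₀
          congruent = ∣-eq (ℤD.∣m⇒∣m*n {+ Q} {n *ᶻ S -ᶻ + 1} ((n *ᶻ S +ᶻ + 1) *ᶻ ev f x₀) NS) (trans (l n S (ev f x₀)) (cong (_-ᶻ ev f x₀) (sym (trans (ev-⊛ f S (rotate (v i₀))) (cong (S *ᶻ S *ᶻ_) (ev-rotate (v i₀)))))))
            where l : ∀ n S E → (n *ᶻ S -ᶻ + 1) *ᶻ ((n *ᶻ S +ᶻ + 1) *ᶻ E) ≡ S *ᶻ S *ᶻ (n *ᶻ n *ᶻ E) -ᶻ E
                  l = solveᶻ
          generic : ∀ p → Prime p → p ℕD.∣ F → ¬ ((+ (p ^ J₂) ∣ bil f (S ⊛ rotate (v i₀)) e₂) × (+ (p ^ J₂) ∣ bil f (S ⊛ rotate (v i₀)) e₃))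
          generic p pp p∣F (d₂ , d₃) = none p pp p∣F (prime-pow-cancel pp p∤S J₂ (∣-eq d₂ (trans (bil-⊛ˡ f S (rotate (v i₀)) e₂) (cong (S *ᶻ_) (bil₂-rotate (v i₀))))) , prime-pow-cancel pp p∤S J₂ (∣-eq d₃ (trans (bil-⊛ˡ f S (rotate (v i₀)) e₃) (cong (S *ᶻ_) (bil₃-rotate (v i₀))))))
            where
            p∣Q : + p ∣ + Q
            p∣Q = ∣ᵤ⇒∣ (ℕD.∣-trans p∣F (subst (λ z → F ℕD.∣ F ^ z) (+-comm 1 (2 * J₂)) (ℕD.m∣m*n (F ^ (2 * J₂)))))
            p∤S : ¬ (+ p ∣ S)
            p∤S p∣S = not-unit pp (n *ᶻ S) (n *ᶻ S -ᶻ + 1) (ℤD.∣-trans p∣Q NS) (l (n *ᶻ S)) (∣*ˡ n p∣S)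
              where l : ∀ z → z ≡ + 1 +ᶻ (z -ᶻ + 1)
                    l = solveᶻ

  -- One-sided counting of represented integers

  -- Only positive values are listed; the negative ones appear as the positive values of `-f`.
  record Values (f : TernaryForm) (N : ℕ) (ys : List ℤ) : Set where
    field
      unique : Unique ys
      sound : ∀ n → n ∈ ys → (+ 1 ℤ.≤ n × n ℤ.≤ + N) × ∃[ v ] ev f v ≡ n
      complete : ∀ v → + 1 ℤ.≤ ev f v → ev f v ℤ.≤ + N → ev f v ∈ ys

  length-∑ᴸ : ∀ (ys : List ℤ) → length ys ≡ ∑ᴸ ys (λ _ → 1)
  length-∑ᴸ [] = refl
  length-∑ᴸ (_ ∷ ys) = cong suc (length-∑ᴸ ys)

  residue-∣ : ∀ Q n r → .{{_ : NonZero Q}} → r < Q → + Q ∣ n -ᶻ + r → n %ℕ Q ≡ r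
  residue-∣ Q n r r<Q d = go (<-≤-connex (n %ℕ Q) r) (<-≤-connex r (n %ℕ Q))
    where
    s = n %ℕ Q
    dd : + Q ∣ + r -ᶻ + s
    dd = ∣-eq (∣m∣n⇒∣m-n (%ℕ-∣ n Q) d) (l n (+ r) (+ s))
      where l : ∀ n r s → n -ᶻ s -ᶻ (n -ᶻ r) ≡ r -ᶻ s
            l = solveᶻ
    dd' : + Q ∣ + s -ᶻ + r
    dd' = ∣-eq (∣m∣n⇒∣m-n d (%ℕ-∣ n Q)) (l n (+ r) (+ s))
      where l : ∀ n r s → n -ᶻ r -ᶻ (n -ᶻ s) ≡ s -ᶻ r
            l = solveᶻ
    far : ∀ i j → i < j → j < Q → + Q ∣ + j -ᶻ + i → ⊥
    far i j i<j j<Q h = <-irrefl refl (<-≤-trans j<Q (≤-trans (spaced-of-∣ i<j h) (m∸n≤m j i)))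
    go : s < r ⊎ r ≤ s → r < s ⊎ s ≤ r → s ≡ r
    go (inj₁ lt) _ = ⊥-elim (far s r lt r<Q dd)
    go _ (inj₁ lt) = ⊥-elim (far r s lt (n%ℕd<d n Q) dd')
    go (inj₂ a) (inj₂ b) = ≤-antisym b a

  module Residues (f : TernaryForm) (Q : ℕ) (Q≢0 : Q ≢ 0) where
    private
      instance
        Q-nz : NonZero Q
        Q-nz = ≢-nonZero Q≢0

    Represented : ℕ → Set
    Represented r = ∃[ v ] + Q ∣ ev f v -ᶻ + r

    represented? : ∀ r → Dec (Represented r)
    represented? r = map′ (λ (x , _ , y , _ , z , _ , d) → (+ x , + y , + z) , d) (λ (v , d) → reduce v d)
      (anyUpTo? (λ x → anyUpTo? (λ y → anyUpTo? (λ z → + Q ∣? ev f (+ x , + y , + z) -ᶻ + r) Q) Q) Q)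
      where
      reduce : ∀ v → + Q ∣ ev f v -ᶻ + r → ∃[ x ] x < Q × ∃[ y ] y < Q × ∃[ z ] z < Q × (+ Q ∣ ev f (+ x , + y , + z) -ᶻ + r)
      reduce (x , y , z) d = x %ℕ Q , n%ℕd<d x Q , y %ℕ Q , n%ℕd<d y Q , z %ℕ Q , n%ℕd<d z Q ,
          ∣-eq (∣m∣n⇒∣m-n d (ℤD.∣m⇒∣m*n {+ Q} {+ Q} (bil f v₀ w +ᶻ + Q *ᶻ ev f w) (ℤD.∣-refl {+ Q}))) eq
        where
        v₀ w : V
        v₀ = + (x %ℕ Q) , + (y %ℕ Q) , + (z %ℕ Q)
        w = x /ℕ Q , y /ℕ Q , z /ℕ Q
        split : ∀ x → x ≡ + (x %ℕ Q) +ᶻ + Q *ᶻ (x /ℕ Q)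
        split x = trans (a≡a%ℕn+[a/ℕn]*n x Q) (cong (+ (x %ℕ Q) +ᶻ_) (ℤP.*-comm (x /ℕ Q) (+ Q)))
        veq : (x , y , z) ≡ v₀ ⊕ + Q ⊛ w
        veq = cong₂ _,_ (split x) (cong₂ _,_ (split y) (split z))
        eq : ev f (x , y , z) -ᶻ + r -ᶻ + Q *ᶻ (bil f v₀ w +ᶻ + Q *ᶻ ev f w) ≡ ev f v₀ -ᶻ + r
        eq = trans (cong (λ u → u -ᶻ + r -ᶻ + Q *ᶻ (bil f v₀ w +ᶻ + Q *ᶻ ev f w)) (trans (cong (ev f) veq) (trans (ev-⊕ f v₀ (+ Q ⊛ w)) (cong₂ (λ p s → ev f v₀ +ᶻ p +ᶻ s) (bil-⊛ʳ f v₀ (+ Q) w) (ev-⊛ f (+ Q) w)))))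
          (l (ev f v₀) (+ Q) (bil f v₀ w) (ev f w) (+ r))
          where l : ∀ e Q b w r → e +ᶻ Q *ᶻ b +ᶻ Q *ᶻ Q *ᶻ w -ᶻ r -ᶻ Q *ᶻ (b +ᶻ Q *ᶻ w) ≡ e -ᶻ r
                l = solveᶻ

    imageSize : ℕ
    imageSize = ∑ Q (λ r → 𝟙 (represented? r))

    imageSize-≤ : imageSize ≤ Q
    imageSize-≤ = ≤-trans (∑-mono Q (λ r _ → 𝟙≤1 (represented? r))) (≤-reflexive (trans (∑-const Q 1) (*-identityʳ Q)))

    imageSize-< : ∀ r → r < Q → ¬ Represented r → imageSize < Q
    imageSize-< r r<Q ¬rep = ≤-trans (+-monoˡ-≤ imageSize {1} (≤-trans (≤-reflexive (sym (𝟙-yes (r ≟ r) refl))) (∑-term Q (λ s → 𝟙 (s ≟ r)) r r<Q)))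
        (≤-trans (≤-reflexive (sym (∑-+ Q (λ s → 𝟙 (s ≟ r)) (λ s → 𝟙 (represented? s))))) (≤-trans (∑-mono Q (λ s _ → both s (s ≟ r) (represented? s))) (≤-reflexive (trans (∑-const Q 1) (*-identityʳ Q)))))
      where
      both : ∀ s (d : Dec (s ≡ r)) (d' : Dec (Represented s)) → 𝟙 d + 𝟙 d' ≤ 1
      both s (no _) d' = 𝟙≤1 d'
      both s (yes refl) d' = ≤-reflexive (cong suc (𝟙-no d' ¬rep))

    count : List ℤ → ℕ → ℕ
    count ys r = ∑ᴸ ys (λ n → 𝟙 (+ Q ∣? n -ᶻ + r))

    module _ {N : ℕ} {ys : List ℤ} (vals : Values f N ys) where
      open Values vals

      counts-≤ : ∑ Q (count ys) ≤ length ys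
      counts-≤ = ≤-trans (≤-reflexive (sym (∑ᴸ-∑-swap ys Q (λ n r → 𝟙 (+ Q ∣? n -ᶻ + r))))) (≤-trans (∑ᴸ-mono ys (λ n _ → ∑-at-most-one Q (λ r → 𝟙 (+ Q ∣? n -ᶻ + r)) 1 (λ r _ → 𝟙≤1 (+ Q ∣? n -ᶻ + r))
          (λ r s r<Q s<Q p p' → trans (sym (residue-∣ Q n r r<Q (𝟙-true (+ Q ∣? n -ᶻ + r) p))) (residue-∣ Q n s s<Q (𝟙-true (+ Q ∣? n -ᶻ + s) p'))))) (≤-reflexive (sym (length-∑ᴸ ys))))

      counts-≥ : length ys ≤ ∑ Q (count ys)
      counts-≥ = ≤-trans (≤-reflexive (length-∑ᴸ ys)) (≤-trans (∑ᴸ-mono ys (λ n _ → ≤-trans (≤-reflexive (sym (𝟙-yes (+ Q ∣? n -ᶻ + (n %ℕ Q)) (%ℕ-∣ n Q)))) (∑-term Q (λ r → 𝟙 (+ Q ∣? n -ᶻ + r)) (n %ℕ Q) (n%ℕd<d n Q)))) (≤-reflexive (∑ᴸ-∑-swap ys Q (λ n r → 𝟙 (+ Q ∣? n -ᶻ + r)))))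

      private
        to-range : ∀ (φ : ℤ → ℕ) → ∑ᴸ ys φ ≤ ∑ N (λ k → φ (+ suc k))
        to-range φ = ≤-trans (∑ᴸ-mono ys one) (≤-trans (≤-reflexive (∑ᴸ-∑-swap ys N (λ n k → φ (+ suc k) * 𝟙 (n ℤ.≟ + suc k))))
            (∑-mono N (λ k _ → ≤-trans (≤-reflexive (∑ᴸ-*ˡ ys (φ (+ suc k)) (λ n → 𝟙 (n ℤ.≟ + suc k)))) (≤-trans (*-monoʳ-≤ (φ (+ suc k)) (∑ᴸ-at-most-one (λ n → 𝟙 (n ℤ.≟ + suc k)) 1 unique (λ n → 𝟙≤1 (n ℤ.≟ + suc k)) (λ n n' p p' → trans (𝟙-true (n ℤ.≟ + suc k) p) (sym (𝟙-true (n' ℤ.≟ + suc k) p'))))) (≤-reflexive (*-identityʳ _))))))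
          where
          one : ∀ n → n ∈ ys → φ n ≤ ∑ N (λ k → φ (+ suc k) * 𝟙 (n ℤ.≟ + suc k))
          one n n∈ = go n (proj₁ (sound n n∈))
            where
            go : ∀ n → (+ 1 ℤ.≤ n × n ℤ.≤ + N) → φ n ≤ ∑ N (λ k → φ (+ suc k) * 𝟙 (n ℤ.≟ + suc k))
            go (+ zero) (ℤ.+≤+ () , _)
            go (+ suc k) (_ , ℤ.+≤+ k<N) = ≤-trans (≤-reflexive (sym (trans (cong (φ (+ suc k) *_) (𝟙-yes (+ suc k ℤ.≟ + suc k) refl)) (*-identityʳ _)))) (∑-term N (λ j → φ (+ suc j) * 𝟙 (+ suc k ℤ.≟ + suc j)) k k<N)

      class-upper : ∀ r → Q * count ys r ≤ 𝟙 (represented? r) * (N + Q)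
      class-upper r = go (represented? r)
        where
        go : (d : Dec (Represented r)) → Q * count ys r ≤ 𝟙 d * (N + Q)
        go (no ¬rep) = ≤-trans (≤-reflexive (trans (cong (Q *_) (∑ᴸ-zero ys (λ n n∈ → 𝟙-no (+ Q ∣? n -ᶻ + r) (λ d → ¬rep (let (v , e) = proj₂ (sound n n∈) in v , subst (λ z → + Q ∣ z -ᶻ + r) (sym e) d))))) (*-zeroʳ Q))) z≤n
        go (yes _) = ≤-trans (*-monoʳ-≤ Q (≤-trans (to-range (λ n → 𝟙 (+ Q ∣? n -ᶻ + r))) (≤-trans (∑-extend (λ k → 𝟙 (+ Q ∣? + suc k -ᶻ + r)) N≤) (count-residue (suc (N / Q)) Q (λ k → 𝟙 (+ Q ∣? + suc k -ᶻ + r)) (λ k → 𝟙≤1 (+ Q ∣? + suc k -ᶻ + r))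
            (λ i j p p' → ∣-eq (∣m∣n⇒∣m-n (𝟙-true (+ Q ∣? + suc j -ᶻ + r) p') (𝟙-true (+ Q ∣? + suc i -ᶻ + r) p)) (l (+ i) (+ j) (+ r)))))))
            (≤-trans (≤-reflexive (l' Q (N / Q))) (≤-trans (+-monoˡ-≤ Q (m/n*n≤m N Q)) (≤-reflexive (sym (+-identityʳ (N + Q))))))
          where
          l : ∀ i j r → (+ 1 +ᶻ j) -ᶻ r -ᶻ ((+ 1 +ᶻ i) -ᶻ r) ≡ j -ᶻ i
          l = solveᶻ
          l' : ∀ q d → q * suc d ≡ d * q + q
          l' = solve-∀
          N≤ : N ≤ suc (N / Q) * Q
          N≤ = ≤-trans (≤-reflexive (m≡m%n+[m/n]*n N Q)) (+-monoˡ-≤ (N / Q * Q) (<⇒≤ (m%n<n N Q)))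

      upper : Q * length ys ≤ imageSize * (N + Q)
      upper = ≤-trans (*-monoʳ-≤ Q counts-≥) (≤-trans (≤-reflexive (sym (∑-*ˡ Q Q (count ys)))) (≤-trans (∑-mono Q (λ r _ → class-upper r)) (≤-reflexive (∑-*ʳ Q (N + Q) (λ r → 𝟙 (represented? r))))))

  coprime-* : ∀ {e x y} → Coprime e x → Coprime e y → Coprime e (x * y)
  coprime-* {e} {x} {y} cx cy {d} (d∣e , d∣xy) = cy (d∣e , Cop.coprime-divisor (λ (k∣d , k∣x) → cx (ℕD.∣-trans k∣d d∣e , k∣x)) d∣xy)

  coprime-^ : ∀ {e x} → Coprime e x → ∀ j → Coprime e (x ^ j)
  coprime-^ c zero (_ , d∣1) = ℕD.∣1⇒≡1 d∣1
  coprime-^ c (suc j) = coprime-* c (coprime-^ c j)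

  coprime-∣ : ∀ {e n k} → Coprime e n → k ℕD.∣ n → Coprime e k
  coprime-∣ c k∣n (d∣e , d∣k) = c (d∣e , ℕD.∣-trans d∣k k∣n)

  -- The family through a base point and the lower bound in one residue class

  module _ {f : TernaryForm} (Fr : Frame f) (x₁ : V) (a₁ q H : ℕ) (α₁' α₂' : ℤ) where
    open Frame Fr

    -- The extra `H` along `e₁` makes the linear coefficient of `i` divisible by `H`, as those of
    -- `t` and `u` are already.
    familyPoint : ℕ → ℕ → ℕ → V
    familyPoint i t u = x₁ ⊕ ((+ q *ᶻ + i *ᶻ + H) ⊛ e₁ ⊕ ((+ q *ᶻ + t) ⊛ e₂ ⊕ (+ q *ᶻ + u) ⊛ e₃))

    ev-familyPoint : A ≡ + a₁ → bil f x₁ e₂ ≡ + H *ᶻ α₁' → bil f x₁ e₃ ≡ + H *ᶻ α₂' → ∀ i t u → ev f (familyPoint i t u) ≡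
      ev f x₁ +ᶻ + q *ᶻ ((+ H *ᶻ bil f x₁ e₁ *ᶻ + i +ᶻ + (q * (a₁ * (H * H))) *ᶻ (+ i *ᶻ + i)) +ᶻ (+ H *ᶻ α₁' *ᶻ + t +ᶻ + H *ᶻ α₂' *ᶻ + u +ᶻ + q *ᶻ (B *ᶻ (+ t *ᶻ + t) +ᶻ C *ᶻ (+ u *ᶻ + u))))
    ev-familyPoint A≡ β₁≡ β₂≡ i t u = trans (ev-⊕ f x₁ w) (trans (cong₂ (λ p s → ev f x₁ +ᶻ p +ᶻ s) bil-w ev-w) (trans (cong₂ (λ y z → ev f x₁ +ᶻ (X *ᶻ β₀ +ᶻ (Y *ᶻ y +ᶻ Z *ᶻ z)) +ᶻ (X *ᶻ X *ᶻ A +ᶻ (Y *ᶻ Y *ᶻ B +ᶻ Z *ᶻ Z *ᶻ C))) β₁≡ β₂≡)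
        (trans (l (ev f x₁) (+ q) (+ H) (+ i) (+ t) (+ u) A B C β₀ α₁' α₂') (cong (λ z → ev f x₁ +ᶻ + q *ᶻ ((+ H *ᶻ β₀ *ᶻ + i +ᶻ z *ᶻ (+ i *ᶻ + i)) +ᶻ (+ H *ᶻ α₁' *ᶻ + t +ᶻ + H *ᶻ α₂' *ᶻ + u +ᶻ + q *ᶻ (B *ᶻ (+ t *ᶻ + t) +ᶻ C *ᶻ (+ u *ᶻ + u))))) (sym a-eq)))))
      where
      β₀ = bil f x₁ e₁
      β₁ = bil f x₁ e₂
      β₂ = bil f x₁ e₃
      X = + q *ᶻ + i *ᶻ + H
      Y = + q *ᶻ + t
      Z = + q *ᶻ + u
      w = X ⊛ e₁ ⊕ (Y ⊛ e₂ ⊕ Z ⊛ e₃)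
      w' = Y ⊛ e₂ ⊕ Z ⊛ e₃
      bil-w : bil f x₁ w ≡ X *ᶻ β₀ +ᶻ (Y *ᶻ β₁ +ᶻ Z *ᶻ β₂)
      bil-w = trans (bil-⊕ʳ f x₁ (X ⊛ e₁) w') (cong₂ _+ᶻ_ (bil-⊛ʳ f x₁ X e₁) (trans (bil-⊕ʳ f x₁ (Y ⊛ e₂) (Z ⊛ e₃)) (cong₂ _+ᶻ_ (bil-⊛ʳ f x₁ Y e₂) (bil-⊛ʳ f x₁ Z e₃))))
      zero₁ : bil f (X ⊛ e₁) w' ≡ + 0
      zero₁ = trans (bil-⊛ˡ f X e₁ w') (trans (cong (X *ᶻ_) (trans (bil-⊕ʳ f e₁ (Y ⊛ e₂) (Z ⊛ e₃)) (cong₂ _+ᶻ_ (trans (bil-⊛ʳ f e₁ Y e₂) (cong (Y *ᶻ_) e₁⊥e₂)) (trans (bil-⊛ʳ f e₁ Z e₃) (cong (Z *ᶻ_) e₁⊥e₃))))) (l' X Y Z))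
        where l' : ∀ X Y Z → X *ᶻ (Y *ᶻ + 0 +ᶻ Z *ᶻ + 0) ≡ + 0
              l' = solveᶻ
      zero₂ : bil f (Y ⊛ e₂) (Z ⊛ e₃) ≡ + 0
      zero₂ = trans (bil-⊛ˡ f Y e₂ (Z ⊛ e₃)) (trans (cong (Y *ᶻ_) (trans (bil-⊛ʳ f e₂ Z e₃) (cong (Z *ᶻ_) e₂⊥e₃))) (l' Y Z))
        where l' : ∀ Y Z → Y *ᶻ (Z *ᶻ + 0) ≡ + 0
              l' = solveᶻ
      ev-w : ev f w ≡ X *ᶻ X *ᶻ A +ᶻ (Y *ᶻ Y *ᶻ B +ᶻ Z *ᶻ Z *ᶻ C)
      ev-w = trans (ev-⊕ f (X ⊛ e₁) w') (trans (cong₂ _+ᶻ_ (cong₂ _+ᶻ_ (trans (ev-⊛ f X e₁) (cong (X *ᶻ X *ᶻ_) ev₁)) zero₁) (trans (ev-⊕ f (Y ⊛ e₂) (Z ⊛ e₃)) (cong₂ _+ᶻ_ (cong₂ _+ᶻ_ (trans (ev-⊛ f Y e₂) (cong (Y *ᶻ Y *ᶻ_) ev₂)) zero₂) (trans (ev-⊛ f Z e₃) (cong (Z *ᶻ Z *ᶻ_) ev₃)))))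
         (l' (X *ᶻ X *ᶻ A) (Y *ᶻ Y *ᶻ B) (Z *ᶻ Z *ᶻ C)))
        where l' : ∀ x y z → x +ᶻ + 0 +ᶻ (y +ᶻ + 0 +ᶻ z) ≡ x +ᶻ (y +ᶻ z)
              l' = solveᶻ
      a-eq : + (q * (a₁ * (H * H))) ≡ + q *ᶻ (A *ᶻ (+ H *ᶻ + H))
      a-eq = trans (ℤP.pos-* q (a₁ * (H * H))) (cong (+ q *ᶻ_) (trans (ℤP.pos-* a₁ (H * H)) (cong₂ _*ᶻ_ (sym A≡) (ℤP.pos-* H H))))
      l : ∀ e q H i t u A B C x y z →
        e +ᶻ (q *ᶻ i *ᶻ H *ᶻ x +ᶻ (q *ᶻ t *ᶻ (H *ᶻ y) +ᶻ q *ᶻ u *ᶻ (H *ᶻ z))) +ᶻ (q *ᶻ i *ᶻ H *ᶻ (q *ᶻ i *ᶻ H) *ᶻ A +ᶻ (q *ᶻ t *ᶻ (q *ᶻ t) *ᶻ B +ᶻ q *ᶻ u *ᶻ (q *ᶻ u) *ᶻ C))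
        ≡ e +ᶻ q *ᶻ ((H *ᶻ x *ᶻ i +ᶻ q *ᶻ (A *ᶻ (H *ᶻ H)) *ᶻ (i *ᶻ i)) +ᶻ (H *ᶻ y *ᶻ t +ᶻ H *ᶻ z *ᶻ u +ᶻ q *ᶻ (B *ᶻ (t *ᶻ t) +ᶻ C *ᶻ (u *ᶻ u))))
      l = solveᶻ

  module Lower {f : TernaryForm} (Fr : Frame f) (a₁ : ℕ) (A≡ : Frame.A Fr ≡ + a₁) (m : ℕ) (30≤m : 30 ≤ m)
      (F : ℕ) (F≢0 : F ≢ 0) (2∣F : 2 ℕD.∣ F) (rough : ∀ e → Coprime e F → e ≢ 1 → m < e)
      (A∣F : a₁ ℕD.∣ F) (B∣F : ∣ Frame.B Fr ∣ ℕD.∣ F) (C∣F : ∣ Frame.C Fr ∣ ℕD.∣ F) (Jg : ℕ) where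
    open Frame Fr
    open GeneralPosition Fr F F≢0

    private
      J = J₂ Jg
      Qₘ = Q Jg

      module Point (x₁ : V) (generic : ∀ p → Prime p → p ℕD.∣ F → ¬ ((+ (p ^ J) ∣ bil f x₁ e₂) × (+ (p ^ J) ∣ bil f x₁ e₃))) where
        β₀ = bil f x₁ e₁
        β₁ = bil f x₁ e₂
        β₂ = bil f x₁ e₃
        G = gcd (∣ β₁ ∣) (∣ β₂ ∣)
        H = gcd G (F ^ J)
        H∣β₁ : + H ∣ β₁
        H∣β₁ = ∣ᵤ⇒∣ (ℕD.∣-trans (gcd[m,n]∣m G (F ^ J)) (gcd[m,n]∣m (∣ β₁ ∣) (∣ β₂ ∣)))
        H∣β₂ : + H ∣ β₂
        H∣β₂ = ∣ᵤ⇒∣ (ℕD.∣-trans (gcd[m,n]∣m G (F ^ J)) (gcd[m,n]∣n (∣ β₁ ∣) (∣ β₂ ∣)))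
        H∣F^J : H ℕD.∣ F ^ J
        H∣F^J = gcd[m,n]∣n G (F ^ J)
        H' = ℕD.quotient H∣F^J
        F^J≡ : F ^ J ≡ H' * H
        F^J≡ = ℕD.m∣n⇒n≡quotient*m H∣F^J
        F^J≢0 : F ^ J ≢ 0
        F^J≢0 = ≢-nonZero⁻¹ (F ^ J) {{m^n≢0 F J {{≢-nonZero F≢0}}}}
        H≢0 : H ≢ 0
        H≢0 e = F^J≢0 (trans F^J≡ (trans (cong (H' *_) e) (*-zeroʳ H')))
        H'≢0 : H' ≢ 0
        H'≢0 e = F^J≢0 (trans F^J≡ (cong (_* H) e))
        H'∣F^J : H' ℕD.∣ F ^ J
        H'∣F^J = ℕD.divides H (trans F^J≡ (*-comm H' H))
        α₁' = ℤD.quotient H∣β₁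
        α₂' = ℤD.quotient H∣β₂
        β₁≡ : β₁ ≡ + H *ᶻ α₁'
        β₁≡ = trans (ℤD._∣_.equality H∣β₁) (ℤP.*-comm α₁' (+ H))
        β₂≡ : β₂ ≡ + H *ᶻ α₂'
        β₂≡ = trans (ℤD._∣_.equality H∣β₂) (ℤP.*-comm α₂' (+ H))
        a₁≢0 : a₁ ≢ 0
        a₁≢0 e = A≢0 (trans A≡ (cong +_ e))
        -- With `H H' = F^J` this gives `q H = F^(2J + 1)` whatever `H` is, so all residue classes
        -- are treated with the same modulus.
        q' = F * (H' * H')

        -- If `p` divided both, then `p H` would divide `β₁` and `β₂`. As `H` is their common
        -- divisor with `F^J`, each power of `p` in `H` up to `J` would produce the next, and `p^J`
        -- would divide both, against `generic`.
        jointly : ∀ p → Prime p → p ℕD.∣ F → ¬ ((+ p ∣ α₁') × (+ p ∣ α₂'))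
        jointly p pp p∣F (d₁ , d₂) = generic p pp p∣F (ℤD.∣-trans (∣ᵤ⇒∣ (power J ≤-refl)) H∣β₁ , ℤD.∣-trans (∣ᵤ⇒∣ (power J ≤-refl)) H∣β₂)
          where
          pH : ∀ {α β} → + p ∣ α → β ≡ + H *ᶻ α → p * H ℕD.∣ ∣ β ∣
          pH {α} {β} d e = subst (p * H ℕD.∣_) (sym (trans (cong ∣_∣ e) (ℤP.abs-* (+ H) α))) (subst (ℕD._∣ H * ∣ α ∣) (*-comm H p) (ℕD.*-monoʳ-∣ H (∣⇒∣ᵤ d)))
          power : ∀ j → j ≤ J → p ^ j ℕD.∣ H
          power zero _ = ℕD.1∣ H
          power (suc j) j<J = gcd-greatest (ℕD.∣-trans up (gcd-greatest (pH d₁ β₁≡) (pH d₂ β₂≡))) (ℕD.∣-trans (pow-mono p∣F (suc j)) (^-mono F j<J))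
            where
            up : p ^ suc j ℕD.∣ p * H
            up = ℕD.*-monoʳ-∣ p (power j (<⇒≤ j<J))
            pow-mono : ∀ {x y} → x ℕD.∣ y → ∀ j → x ^ j ℕD.∣ y ^ j
            pow-mono d zero = ℕD.∣-refl
            pow-mono d (suc j) = ℕD.*-pres-∣ d (pow-mono d j)
            ^-mono : ∀ F {j k} → j ≤ k → F ^ j ℕD.∣ F ^ k
            ^-mono F {j} {k} le = ℕD.divides (F ^ (k ∸ j)) (trans (cong (F ^_) (sym (m∸n+n≡m le))) (^-distribˡ-+-* F (k ∸ j) j))

        cop : ∀ e → Coprime e F → Coprime e (q' * (a₁ * (H * H))) × Coprime e (q' * ∣ B ∣) × Coprime e (q' * ∣ C ∣)
        cop e c = coprime-* cq (coprime-* (coprime-∣ c A∣F) (coprime-* cH cH)) , coprime-* cq (coprime-∣ c B∣F) , coprime-* cq (coprime-∣ c C∣F)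
          where
          cH : Coprime e H
          cH = coprime-∣ (coprime-^ c J) H∣F^J
          cH' : Coprime e H'
          cH' = coprime-∣ (coprime-^ c J) H'∣F^J
          cq : Coprime e q'
          cq = coprime-* c (coprime-* cH' cH')

        𝓕 : Family
        𝓕 = record
          { a = a₁ * (H * H) ; q' = q' ; H = H ; F = F ; b = B ; c = C ; α₀' = β₀ ; α₁' = α₁' ; α₂' = α₂'
          ; a≢0 = ≢-nonZero⁻¹ (a₁ * (H * H)) {{m*n≢0 a₁ (H * H) {{≢-nonZero a₁≢0}} {{m*n≢0 H H {{≢-nonZero H≢0}} {{≢-nonZero H≢0}}}}}}
          ; q'≢0 = ≢-nonZero⁻¹ q' {{m*n≢0 F (H' * H') {{≢-nonZero F≢0}} {{m*n≢0 H' H' {{≢-nonZero H'≢0}} {{≢-nonZero H'≢0}}}}}}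
          ; H≢0 = H≢0 ; F≢0 = F≢0 ; 2∣F = 2∣F ; F∣q' = ℕD.m∣m*n (H' * H') ; jointly-prime = jointly ; coprime-F = cop }

        q = Family.q 𝓕
        qH≡ : q * H ≡ Qₘ
        qH≡ = trans (l H F H') (trans (cong (λ z → F * (z * z)) (sym F^J≡)) (trans (cong (F *_) (sym (^-distribˡ-+-* F J J))) (cong (F ^_) (l' J))))
          where l : ∀ H F H' → H * (F * (H' * H')) * H ≡ F * (H' * H * (H' * H))
                l = solve-∀
                l' : ∀ J → suc (J + J) ≡ 2 * J + 1
                l' = solve-∀

        module CD = ClassDensity 𝓕 (ev f x₁) (λ e → B≢0 (ℤP.∣i∣≡0⇒i≡0 e)) (λ e → C≢0 (ℤP.∣i∣≡0⇒i≡0 e)) m 30≤m rough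

        point : ℕ → ℕ → ℕ → V
        point = familyPoint Fr x₁ a₁ q H α₁' α₂'

        val≡ : ∀ i t u → CD.val i t u ≡ ev f (point i t u)
        val≡ i t u = sym (ev-familyPoint Fr x₁ a₁ q H α₁' α₂' A≡ β₁≡ β₂≡ i t u)

    class-lower : ∀ r x₀ → + Qₘ ∣ ev f x₀ -ᶻ + r → (∀ p → Prime p → p ℕD.∣ F → ¬ (+ (p ^ Jg) ∣ ev f x₀)) →
      ∃[ M ] ∀ N → M ≤ N → ∀ ys → Values f N ys → m * N ≤ m * (Qₘ * ∑ᴸ ys (λ n → 𝟙 (+ Qₘ ∣? n -ᶻ + r))) + 32 * N
    class-lower r x₀ dr good = proj₁ P.CD.class-density , λ N M≤N ys vals →
        ≤-trans (proj₂ P.CD.class-density N M≤N ys (Values.unique vals) (λ i t u lo hi → subst (_∈ ys) (sym (P.val≡ i t u)) (Values.complete vals (P.point i t u) (subst (+ 1 ℤ.≤_) (P.val≡ i t u) lo) (subst (ℤ._≤ + N) (P.val≡ i t u) hi))))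
          (+-monoˡ-≤ (32 * N) (*-monoʳ-≤ m (≤-trans (≤-reflexive (cong (_* ∑ᴸ ys P.CD.inClass) P.qH≡)) (*-monoʳ-≤ Qₘ (∑ᴸ-mono ys (λ n _ → 𝟙-mono (+ (P.q * P.H) ∣? n -ᶻ ev f x₁) (+ Qₘ ∣? n -ᶻ + r) (move n)))))))
      where
      gp = general-position Jg x₀ good
      x₁ = proj₁ gp
      module P = Point x₁ (proj₂ (proj₂ gp))
      move : ∀ n → + (P.q * P.H) ∣ n -ᶻ ev f x₁ → + Qₘ ∣ n -ᶻ + r
      move n d = ∣-eq (∣m∣n⇒∣m+n (∣m∣n⇒∣m+n (subst (λ z → + z ∣ n -ᶻ ev f x₁) P.qH≡ d) (proj₁ (proj₂ gp))) dr) (l n (ev f x₁) (ev f x₀) (+ r))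
        where l : ∀ n a b r → n -ᶻ a +ᶻ (a -ᶻ b) +ᶻ (b -ᶻ r) ≡ n -ᶻ r
              l = solveᶻ

  -- Summation over the residue classes

  uniform : ∀ n (P : ℕ → ℕ → Set) → (∀ r → ∃[ M ] ∀ N → M ≤ N → P r N) → ∃[ M ] ∀ r → r < n → ∀ N → M ≤ N → P r N
  uniform zero P h = 0 , λ r ()
  uniform (suc n) P h = let (M , f) = uniform n P h ; (M' , f') = h n in
    M ⊔ M' , λ r r<1+n N le → [ (λ r<n → f r r<n N (≤-trans (m≤m⊔n M M') le)) , (λ e → subst (λ z → P z N) (sym e) (f' N (≤-trans (m≤n⊔m M M') le))) ]′ (m≤n⇒m<n∨m≡n (s≤s⁻¹ r<1+n))

  n≤2^n : ∀ n → n ≤ 2 ^ n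
  n≤2^n zero = z≤n
  n≤2^n (suc n) = ≤-trans (+-mono-≤ (m^n>0 2 n) (n≤2^n n)) (≤-reflexive (cong (_+_ (2 ^ n)) (sym (+-identityʳ (2 ^ n)))))

  -- The difference of `k / N` and `A / Q` is at most `34 / m`, with denominators cleared.
  Near : ℕ → ℕ → ℕ → ℕ → ℕ → Set
  Near m A Q N k = (m * (A * N) ≤ m * (Q * k) + 34 * (Q * N)) × (m * (Q * k) ≤ m * (A * N) + 34 * (Q * N))

  module Assemble {f : TernaryForm} (Fr : Frame f) (a₁ : ℕ) (A≡ : Frame.A Fr ≡ + a₁) (m : ℕ) (30≤m : 30 ≤ m)
      (F : ℕ) (F≢0 : F ≢ 0) (2∣F : 2 ℕD.∣ F) (rough : ∀ e → Coprime e F → e ≢ 1 → m < e)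
      (A∣F : a₁ ℕD.∣ F) (B∣F : ∣ Frame.B Fr ∣ ℕD.∣ F) (C∣F : ∣ Frame.C Fr ∣ ℕD.∣ F) (Jg : ℕ) (mF≤ : m * F ≤ 2 ^ Jg) where
    open GeneralPosition Fr F F≢0
    open Lower Fr a₁ A≡ m 30≤m F F≢0 2∣F rough A∣F B∣F C∣F Jg

    private
      J = J₂ Jg
      Qₘ = Q Jg
      Qₘ≢0 : Qₘ ≢ 0
      Qₘ≢0 = ≢-nonZero⁻¹ Qₘ {{m^n≢0 F (2 * J + 1) {{≢-nonZero F≢0}}}}
      2≤F : 2 ≤ F
      2≤F = ℕD.∣⇒≤ {{≢-nonZero F≢0}} 2∣F
      Jg≤ : Jg ≤ 2 * J + 1
      Jg≤ = ≤-trans (m≤m+n Jg (∣ C₀ ∣)) (≤-trans (m≤m+n J (J + 0)) (m≤m+n (2 * J) 1))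

    open Residues f Qₘ Qₘ≢0

    private
      -- All bases from 2 to `F + 1` are tested instead of the primes of `F`. Where nothing is
      -- counted, no value in the class is divisible by the power `Jg` of such a prime, as general
      -- position requires.
      badness : ℕ → ℕ
      badness r = ∑ F (λ s → 𝟙 ((2 + s) ^ Jg ℕD.∣? r))

      multiples : ∀ s → 2 ^ Jg * ∑ Qₘ (λ r → 𝟙 ((2 + s) ^ Jg ℕD.∣? r)) ≤ 2 * Qₘ
      multiples s = ≤-trans (*-monoʳ-≤ (2 ^ Jg) (≤-trans (∑-extend χ Q≤) (count-residue (suc (Qₘ / d)) d χ (λ r → 𝟙≤1 (d ℕD.∣? r)) λ i j p p' → ∣m∣n⇒∣m-n (∣ᵤ⇒∣ {+ d} {+ j} (𝟙-true (d ℕD.∣? j) p')) (∣ᵤ⇒∣ {+ d} {+ i} (𝟙-true (d ℕD.∣? i) p)))))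
          (≤-trans (≤-reflexive (l (2 ^ Jg) (Qₘ / d))) (≤-trans (+-mono-≤ (≤-trans (*-monoʳ-≤ (Qₘ / d) (^-monoˡ-≤ Jg (s≤s (s≤s z≤n)))) (m/n*n≤m Qₘ d)) D≤Q) (≤-reflexive (cong (_+_ Qₘ) (sym (+-identityʳ Qₘ))))))
        where
        d = (2 + s) ^ Jg
        instance
          d-nz : NonZero d
          d-nz = m^n≢0 (2 + s) Jg
        χ : ℕ → ℕ
        χ r = 𝟙 (d ℕD.∣? r)
        l : ∀ D x → D * suc x ≡ x * D + D
        l = solve-∀
        Q≤ : Qₘ ≤ suc (Qₘ / d) * d
        Q≤ = ≤-trans (≤-reflexive (m≡m%n+[m/n]*n Qₘ d)) (+-monoˡ-≤ (Qₘ / d * d) (<⇒≤ (m%n<n Qₘ d)))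
        D≤Q : 2 ^ Jg ≤ Qₘ
        D≤Q = ≤-trans (^-monoʳ-≤ 2 Jg≤) (^-monoˡ-≤ (2 * J + 1) 2≤F)

      -- Each of `F` bases contributes at most the fraction `2 / 2^Jg` of the residues, and `2^Jg`
      -- is at least `m F`.
      badness-total : m * ∑ Qₘ badness ≤ 2 * Qₘ
      badness-total = *-cancelʳ-≤ (m * ∑ Qₘ badness) (2 * Qₘ) F {{≢-nonZero F≢0}} (≤-trans (≤-reflexive (l m (∑ Qₘ badness) F)) (≤-trans (*-monoˡ-≤ (∑ Qₘ badness) mF≤)
          (≤-trans (≤-reflexive (trans (cong (2 ^ Jg *_) (∑-swap Qₘ F (λ r s → 𝟙 ((2 + s) ^ Jg ℕD.∣? r)))) (sym (∑-*ˡ F (2 ^ Jg) (λ s → ∑ Qₘ (λ r → 𝟙 ((2 + s) ^ Jg ℕD.∣? r))))))) (≤-trans (∑-mono F (λ s _ → multiples s)) (≤-reflexive (trans (∑-const F (2 * Qₘ)) (*-comm F (2 * Qₘ))))))))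
        where l : ∀ m b F → m * b * F ≡ m * F * b
              l = solve-∀

      Bound : ℕ → ℕ → Set
      Bound r N = ∀ ys → Values f N ys → 𝟙 (represented? r) * (m * N) ≤ m * (Qₘ * count ys r) + 32 * N + badness r * (m * N)

      bound : ∀ r → ∃[ M ] ∀ N → M ≤ N → Bound r N
      bound r = go (represented? r) (badness r ≟ 0)
        where
        go : (d : Dec (Represented r)) → Dec (badness r ≡ 0) → ∃[ M ] ∀ N → M ≤ N → ∀ ys → Values f N ys → 𝟙 d * (m * N) ≤ m * (Qₘ * count ys r) + 32 * N + badness r * (m * N)
        go (no _) _ = 0 , λ _ _ _ _ → z≤n
        -- A bad class is given up: its whole expected count is charged to `badness`.
        go (yes _) (no bad) = 0 , λ N _ ys _ → ≤-trans (*-monoˡ-≤ (m * N) (n≢0⇒n>0 bad)) (m≤n+m _ (m * (Qₘ * count ys r) + 32 * N))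
        go (yes (x₀ , d)) (yes fine) = let (M , h) = class-lower r x₀ d good in M , λ N M≤N ys vals → ≤-trans (≤-reflexive (+-identityʳ (m * N))) (≤-trans (h N M≤N ys vals) (m≤m+n _ (badness r * (m * N))))
          where
          good : ∀ p → Prime p → p ℕD.∣ F → ¬ (+ (p ^ Jg) ∣ ev f x₀)
          good p pp p∣F h = 1+n≢0 (n≤0⇒n≡0 (subst (1 ≤_) fine (≤-trans (≤-reflexive (sym (𝟙-yes ((2 + s) ^ Jg ℕD.∣? r) (subst (λ z → z ^ Jg ℕD.∣ r) (sym p≡) p^∣r)))) (∑-term F (λ s → 𝟙 ((2 + s) ^ Jg ℕD.∣? r)) s s<F))))
            where
            2≤p = prime⇒≥2 pp
            s = p ∸ 2
            p≡ : 2 + s ≡ p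
            p≡ = m+[n∸m]≡n 2≤p
            s<F : s < F
            s<F = ≤-trans (≤-trans (s≤s (n≤1+n s)) (≤-reflexive p≡)) (ℕD.∣⇒≤ {{≢-nonZero F≢0}} p∣F)
            pow-mono : ∀ {x y} → x ℕD.∣ y → ∀ j → x ^ j ℕD.∣ y ^ j
            pow-mono d zero = ℕD.∣-refl
            pow-mono d (suc j) = ℕD.*-pres-∣ d (pow-mono d j)
            p^∣Q : + (p ^ Jg) ∣ + Qₘ
            p^∣Q = ℤD.∣-trans (∣ᵤ⇒∣ {+ (p ^ Jg)} {+ (F ^ Jg)} (pow-mono p∣F Jg)) (^-∣ F Jg≤)
            p^∣r : p ^ Jg ℕD.∣ r
            p^∣r = ∣⇒∣ᵤ (∣-eq (∣m∣n⇒∣m-n h (ℤD.∣-trans p^∣Q d)) (l (ev f x₀) (+ r)))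
              where l : ∀ e r → e -ᶻ (e -ᶻ r) ≡ r
                    l = solveᶻ

    -- Below, 34 is the 32 of each class plus 2 for the classes given up. Above, only residues in
    -- the image occur, and `N ≥ m Q` makes the rounding negligible.
    near : ∃[ M ] ∀ N → M ≤ N → ∀ ys → Values f N ys → Near m imageSize Qₘ N (length ys)
    near = let (M , h) = uniform Qₘ Bound bound in M + m * Qₘ , λ N le ys vals →
        lower N ys vals (λ r r<Q → h r r<Q N (≤-trans (m≤m+n M (m * Qₘ)) le) ys vals) , above N ys vals (≤-trans (m≤n+m (m * Qₘ) M) le)
      where
      lower : ∀ N ys → Values f N ys → (∀ r → r < Qₘ → 𝟙 (represented? r) * (m * N) ≤ m * (Qₘ * count ys r) + 32 * N + badness r * (m * N)) →
        m * (imageSize * N) ≤ m * (Qₘ * length ys) + 34 * (Qₘ * N)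
      lower N ys vals h = ≤-trans (≤-reflexive (trans (l₁ m imageSize N) (sym (∑-*ʳ Qₘ (m * N) (λ r → 𝟙 (represented? r)))))) (≤-trans (∑-mono Qₘ h)
         (≤-trans (≤-reflexive (trans (∑-+ Qₘ (λ r → m * (Qₘ * count ys r) + 32 * N) (λ r → badness r * (m * N))) (cong₂ _+_ (trans (∑-+ Qₘ (λ r → m * (Qₘ * count ys r)) (λ _ → 32 * N)) (cong₂ _+_ (trans (∑-*ˡ Qₘ m (λ r → Qₘ * count ys r)) (cong (m *_) (∑-*ˡ Qₘ Qₘ (count ys)))) (∑-const Qₘ (32 * N)))) (∑-*ʳ Qₘ (m * N) badness))))
         (≤-trans (+-mono-≤ (+-monoˡ-≤ (Qₘ * (32 * N)) (*-monoʳ-≤ m (*-monoʳ-≤ Qₘ (counts-≤ vals)))) (≤-trans (≤-reflexive (l₂ (∑ Qₘ badness) m N)) (*-monoˡ-≤ N badness-total))) (≤-reflexive (l₃ (m * (Qₘ * length ys)) Qₘ N)))))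
        where
        l₁ : ∀ m A N → m * (A * N) ≡ A * (m * N)
        l₁ = solve-∀
        l₂ : ∀ b m N → b * (m * N) ≡ m * b * N
        l₂ = solve-∀
        l₃ : ∀ z Q N → z + Q * (32 * N) + 2 * Q * N ≡ z + 34 * (Q * N)
        l₃ = solve-∀
      above : ∀ N ys → Values f N ys → m * Qₘ ≤ N → m * (Qₘ * length ys) ≤ m * (imageSize * N) + 34 * (Qₘ * N)
      above N ys vals mQ≤N = ≤-trans (*-monoʳ-≤ m (upper vals)) (≤-trans (≤-reflexive (l₁ m imageSize N Qₘ)) (+-monoʳ-≤ (m * (imageSize * N)) (≤-trans (*-mono-≤ imageSize-≤ mQ≤N) (m≤n*m (Qₘ * N) 34))))
        where l₁ : ∀ m A N Q → m * (A * (N + Q)) ≡ m * (A * N) + A * (m * Q)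
              l₁ = solve-∀

    near-image : ∃[ A ] ∃[ Q ] Q ≢ 0 × ∃[ M ] ∀ N → M ≤ N → ∀ ys → Values f N ys → Near m A Q N (length ys)
    near-image = imageSize , Qₘ , Qₘ≢0 , near

  -- The frame starts at a vector of positive value, so the values grow to plus infinity along `e₁`.
  -- `F` contains `m !`, so that an `e ≠ 1` prime to it exceeds `m`, and the three frame values, so
  -- that such an `e` is prime to them. The exponent `m F` is large enough since `n ≤ 2^n`.
  one-sided : ∀ f → AnisotropicZ f → ∀ v → + 1 ℤ.≤ ev f v → ∀ m → 30 ≤ m →
    ∃[ A ] ∃[ Q ] Q ≢ 0 × ∃[ M ] ∀ N → M ≤ N → ∀ ys → Values f N ys → Near m A Q N (length ys)
  one-sided f an v pos m 30≤m = go F refl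
    where
    ev≢0 : ev f v ≢ + 0
    ev≢0 e with subst (+ 1 ℤ.≤_) e pos
    ... | ℤ.+≤+ ()
    Fr = frame-from f an v ev≢0
    open Frame Fr
    a₁ = ∣ ev f v ∣
    A≡ : A ≡ + a₁
    A≡ = sym (ℤP.0≤i⇒+∣i∣≡i (ℤP.≤-trans (ℤ.+≤+ z≤n) pos))
    abc = a₁ * (∣ B ∣ * ∣ C ∣)
    F = 2 * (m ! * abc)
    abs≢0 : ∀ {z} → z ≢ + 0 → ∣ z ∣ ≢ 0
    abs≢0 h e = h (ℤP.∣i∣≡0⇒i≡0 e)
    F≢0 : F ≢ 0
    F≢0 = ≢-nonZero⁻¹ F {{m*n≢0 2 (m ! * abc) {{_}} {{m*n≢0 (m !) abc {{m !≢0}} {{m*n≢0 a₁ (∣ B ∣ * ∣ C ∣) {{≢-nonZero (abs≢0 ev≢0)}} {{m*n≢0 (∣ B ∣) (∣ C ∣) {{≢-nonZero (abs≢0 B≢0)}} {{≢-nonZero (abs≢0 C≢0)}}}}}}}}}}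
    2∣F : 2 ℕD.∣ F
    2∣F = ℕD.m∣m*n (m ! * abc)
    abc∣F : abc ℕD.∣ F
    abc∣F = ℕD.∣n⇒∣m*n 2 (ℕD.n∣m*n (m !))
    bc∣F : ∣ B ∣ * ∣ C ∣ ℕD.∣ F
    bc∣F = ℕD.∣-trans (ℕD.n∣m*n a₁) abc∣F
    rough : ∀ e → Coprime e F → e ≢ 1 → m < e
    rough zero cop _ = ⊥-elim (<-irrefl refl (subst (1 <_) (cop (F ℕD.∣0 , ℕD.∣-refl)) (ℕD.∣⇒≤ {{≢-nonZero F≢0}} 2∣F)))
    rough (suc e) cop e≢1 = ≰⇒> λ le → e≢1 (cop (ℕD.∣-refl , ℕD.∣n⇒∣m*n 2 (ℕD.∣m⇒∣m*n abc (ℕD.∣-trans (ℕD.m∣m*n (e !)) (ℕD.m≤n⇒m!∣n! le)))))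
    go : ∀ F' → F' ≡ F → ∃[ A ] ∃[ Q ] Q ≢ 0 × ∃[ M ] ∀ N → M ≤ N → ∀ ys → Values f N ys → Near m A Q N (length ys)
    go F' e = Assemble.near-image Fr a₁ A≡ m 30≤m F' F'≢0 (into 2∣F) (λ k c → rough k (subst (Coprime k) e c)) (into (ℕD.∣-trans (ℕD.m∣m*n (∣ B ∣ * ∣ C ∣)) abc∣F)) (into (ℕD.∣-trans (ℕD.m∣m*n (∣ C ∣)) bc∣F)) (into (ℕD.∣-trans (ℕD.n∣m*n (∣ B ∣)) bc∣F)) (m * F') (n≤2^n (m * F'))
      where
      F'≢0 : F' ≢ 0
      F'≢0 h = F≢0 (trans (sym e) h)
      into : ∀ {k} → k ℕD.∣ F → k ℕD.∣ F'
      into {k} = subst (k ℕD.∣_) (sym e)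

  -- The comparison value `A / Q` depends on `m`, so it is eliminated between the two lengths. What
  -- remains is the Cauchy estimate with error `68 / m`.
  near-close : ∀ {m A Q N N' k k'} → Q ≢ 0 → Near m A Q N k → Near m A Q N' k' → m * (k * N') ≤ m * (k' * N) + 68 * (N * N')
  near-close {m} {A} {Q} {N} {N'} {k} {k'} Q≢0 (_ , up) (lo , _) = *-cancelˡ-≤ Q {{≢-nonZero Q≢0}} (≤-trans (≤-reflexive (l₁ Q m k N')) (≤-trans (*-monoˡ-≤ N' up) (≤-trans (≤-reflexive (l₂ m A N N' Q))
     (≤-trans (+-monoˡ-≤ (34 * (Q * N) * N') (*-monoˡ-≤ N lo)) (≤-reflexive (l₃ m Q k' N N'))))))
    where
    l₁ : ∀ Q m k N → Q * (m * (k * N)) ≡ m * (Q * k) * N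
    l₁ = solve-∀
    l₂ : ∀ m A N N' Q → (m * (A * N) + 34 * (Q * N)) * N' ≡ m * (A * N') * N + 34 * (Q * N) * N'
    l₂ = solve-∀
    l₃ : ∀ m Q k N N' → (m * (Q * k) + 34 * (Q * N')) * N + 34 * (Q * N) * N' ≡ Q * (m * (k * N) + 68 * (N * N'))
    l₃ = solve-∀

open import Defs
open import Data.Product using (_×_)
open Arithmetic
open Counting using (Values; module Residues; one-sided; near-close)
open import Data.Nat as ℕ using (ℕ; zero; suc; z≤n; s≤s)
import Data.Nat.Properties as ℕP
open import Data.Nat.Tactic.RingSolver using () renaming (solve-∀ to solveℕ)
open import Data.Integer as ℤ using (ℤ; +_; -[1+_]; _+_; _*_; _-_; -_)
import Data.Integer.Properties as ℤP
open import Data.Integer.DivMod using (_%ℕ_; n%ℕd<d)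
open import Data.Integer.Divisibility.Signed using (_∣_; ∣m∣n⇒∣m-n)
open import Data.Integer.Tactic.RingSolver using (solve-∀)
open import Data.Rational as ℚ using (ℚ; 0ℚ; 1ℚ; mkℚ)
import Data.Rational.Properties as ℚP
import Data.Rational.Unnormalised as ℚᵘ
import Data.Rational.Unnormalised.Properties as ℚᵘP
open import Algebra.Properties.Group ℚP.+-0-group using (⁻¹-involutive)
open import Data.List using ([]; _∷_; length; map; filter)
open import Data.List.Properties using (length-map)
open import Data.List.Membership.Propositional using (_∈_)
open import Data.List.Membership.Propositional.Properties using (∈-filter⁺; ∈-filter⁻; ∈-map⁺; ∈-map⁻)
open import Data.List.Relation.Unary.Any using (here; there)
import Data.List.Relation.Unary.Unique.Propositional.Properties as Uniq
open import Data.Product using (∃-syntax; _,_; proj₁; proj₂)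
open import Data.Sum using (_⊎_; inj₁; inj₂; [_,_]′)
open import Data.Empty using (⊥-elim)
open import Relation.Nullary using (¬_; Dec; yes; no)
open import Relation.Binary.PropositionalEquality

-- The density

negate : TernaryForm → TernaryForm
negate f = form (- a f) (- b f) (- c f) (- d f) (- e f) (- g f)

ev-negate : ∀ f v → ev (negate f) v ≡ - ev f v
ev-negate f (x , y , z) = l (a f) (b f) (c f) (d f) (e f) (g f) x y z
  where l : ∀ a b c d e g x y z → - a * x * x + - b * y * y + - c * z * z + - d * x * y + - e * x * z + - g * y * z ≡ - (a * x * x + b * y * y + c * z * z + d * x * y + e * x * z + g * y * z)
        l = solve-∀

negate-anisotropic : ∀ f → AnisotropicZ f → AnisotropicZ (negate f)
negate-anisotropic f an v h = an v (trans (sym (ℤP.neg-involutive (ev f v))) (cong -_ (trans (sym (ev-negate f v)) h)))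

module _ (f : TernaryForm) where
  values₊ : ∀ {N k} → CountIs (D f) (+ 1) (+ N) k → ∃[ ys ] Values f N ys × length ys ≡ k
  values₊ (xs , uniq , len , sound , complete) = xs , record
    { unique = uniq
    ; sound = λ n n∈ → let (range , _ , x , y , z , eq) = sound n n∈ in range , (x , y , z) , eq
    ; complete = λ v lo hi → complete (ev f v) lo hi ((λ h → 1≰0 (subst (+ 1 ℤ.≤_) h lo)) , proj₁ v , proj₁ (proj₂ v) , proj₂ (proj₂ v) , refl) } , len
    where 1≰0 : ¬ (+ 1 ℤ.≤ + 0)
          1≰0 (ℤ.+≤+ ())

  values₋ : ∀ {N k} → CountIs (D f) (- (+ N)) (- (+ 1)) k → ∃[ ys ] Values (negate f) N ys × length ys ≡ k
  values₋ {N} (xs , uniq , len , sound , complete) = map -_ xs , record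
    { unique = Uniq.map⁺ ℤP.neg-injective uniq
    ; sound = λ n n∈ → let (x , x∈ , eq) = ∈-map⁻ -_ n∈ ; ((lo , hi) , _ , p , q , r , v) = sound x x∈ in
        (subst (+ 1 ℤ.≤_) (sym eq) (ℤP.neg-mono-≤ hi) , subst (ℤ._≤ + N) (sym eq) (subst (- x ℤ.≤_) (ℤP.neg-involutive (+ N)) (ℤP.neg-mono-≤ lo))) ,
        (p , q , r) , trans (ev-negate f (p , q , r)) (trans (cong -_ v) (sym eq))
    ; complete = λ v lo hi → subst (_∈ map -_ xs) (sym (ev-negate f v)) (∈-map⁺ -_ (complete (ev f v)
        (subst (- (+ N) ℤ.≤_) (back v) (ℤP.neg-mono-≤ hi)) (subst (ℤ._≤ - (+ 1)) (back v) (ℤP.neg-mono-≤ lo))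
        ((λ h → 1≰0 (subst (+ 1 ℤ.≤_) (trans (ev-negate f v) (cong -_ h)) lo)) , proj₁ v , proj₁ (proj₂ v) , proj₂ (proj₂ v) , refl))) } ,
    trans (length-map -_ xs) len
    where
    1≰0 : ¬ (+ 1 ℤ.≤ + 0)
    1≰0 (ℤ.+≤+ ())
    back : ∀ v → - ev (negate f) v ≡ ev f v
    back v = trans (cong -_ (ev-negate f v)) (ℤP.neg-involutive (ev f v))

  private
    pos? : (n : ℤ) → Dec (+ 1 ℤ.≤ n)
    pos? n = + 1 ℤP.≤? n
    neg? : (n : ℤ) → Dec (n ℤ.≤ - (+ 1))
    neg? n = n ℤP.≤? - (+ 1)

    split-length : ∀ xs → (∀ x → x ∈ xs → x ≢ + 0) → length (filter pos? xs) ℕ.+ length (filter neg? xs) ≡ length xs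
    split-length [] h = refl
    split-length (+ zero ∷ xs) h = ⊥-elim (h (+ 0) (here refl) refl)
    split-length (+ suc n ∷ xs) h with pos? (+ suc n) | neg? (+ suc n)
    ... | yes _ | no _ = cong suc (split-length xs (λ x x∈ → h x (there x∈)))
    ... | no np | _ = ⊥-elim (np (ℤ.+≤+ (s≤s z≤n)))
    ... | yes _ | yes ()
    split-length (-[1+ n ] ∷ xs) h with pos? -[1+ n ] | neg? -[1+ n ]
    ... | no _ | yes _ = trans (ℕP.+-suc _ _) (cong suc (split-length xs (λ x x∈ → h x (there x∈))))
    ... | no _ | no nn = ⊥-elim (nn (ℤ.-≤- z≤n))
    ... | yes () | _

  -- Zero is excluded from `D f`, so the positive and negative parts of the list exhaust it.
  values± : ∀ {N k} → CountIs (D f) (- (+ N)) (+ N) k → ∃[ ys ] ∃[ zs ] Values f N ys × Values (negate f) N zs × length ys ℕ.+ length zs ≡ k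
  values± {N} (xs , uniq , len , sound , complete) = proj₁ P , proj₁ M , proj₁ (proj₂ P) , proj₁ (proj₂ M) ,
      trans (cong₂ ℕ._+_ (proj₂ (proj₂ P)) (proj₂ (proj₂ M))) (trans (split-length xs (λ x x∈ → proj₁ (proj₂ (sound x x∈)))) len)
    where
    P = values₊ {N} (filter pos? xs , Uniq.filter⁺ pos? uniq , refl ,
      (λ x x∈ → let (x∈xs , pos) = ∈-filter⁻ pos? x∈ in (pos , proj₂ (proj₁ (sound x x∈xs))) , proj₂ (sound x x∈xs)) ,
      (λ x lo hi s → ∈-filter⁺ pos? (complete x (ℤP.≤-trans (ℤP.≤-trans ℤP.neg-≤-pos (ℤ.+≤+ z≤n)) lo) hi s) lo))
    M = values₋ {N} (filter neg? xs , Uniq.filter⁺ neg? uniq , refl ,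
      (λ x x∈ → let (x∈xs , neg) = ∈-filter⁻ neg? x∈ in (proj₁ (proj₁ (sound x x∈xs)) , neg) , proj₂ (sound x x∈xs)) ,
      (λ x lo hi s → ∈-filter⁺ neg? (complete x lo (ℤP.≤-trans hi ℤ.-≤+) s) hi))

-- Ratios

private
  to-/ : ∀ k D₁ → ℚ.toℚᵘ ((+ k) ℚ./ suc D₁) ℚᵘ.≃ ℚᵘ.mkℚᵘ (+ k) D₁
  to-/ k D₁ = ℚP.toℚᵘ-fromℚᵘ (ℚᵘ.mkℚᵘ (+ k) D₁)

positive-form : ∀ ε → 0ℚ ℚ.< ε → ∃[ p ] ∃[ d ] ℚ.toℚᵘ ε ≡ ℚᵘ.mkℚᵘ (+ suc p) d
positive-form (mkℚ (+ suc p) d _) _ = p , d , refl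
positive-form (mkℚ (+ zero) d _) (ℚ.*<* (ℤ.+<+ ()))
positive-form (mkℚ -[1+ n ] d _) (ℚ.*<* ())

-- With `m = 69 (d + 1)` the error is `68 / (69 (d + 1))`, strictly less than `1 / (d + 1) ≤ ε`;
-- hence 69.
ratio-< : ∀ ε p d → ℚ.toℚᵘ ε ≡ ℚᵘ.mkℚᵘ (+ suc p) d → ∀ k k' D₁ D₁' →
  69 ℕ.* suc d ℕ.* (k ℕ.* suc D₁') ℕ.≤ 69 ℕ.* suc d ℕ.* (k' ℕ.* suc D₁) ℕ.+ 68 ℕ.* (suc D₁ ℕ.* suc D₁') →
  (+ k) ℚ./ suc D₁ ℚ.< (+ k') ℚ./ suc D₁' ℚ.+ ε
ratio-< ε p d eε k k' D₁ D₁' h = ℚP.toℚᵘ-cancel-< (ℚᵘP.<-respˡ-≃ (ℚᵘP.≃-sym (to-/ k D₁)) (ℚᵘP.<-respʳ-≃ (ℚᵘP.≃-sym rhs) (ℚᵘ.*<* lt)))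
  where
  rhs : ℚ.toℚᵘ ((+ k') ℚ./ suc D₁' ℚ.+ ε) ℚᵘ.≃ ℚᵘ.mkℚᵘ (+ k') D₁' ℚᵘ.+ ℚᵘ.mkℚᵘ (+ suc p) d
  rhs = ℚᵘP.≃-trans (ℚP.toℚᵘ-homo-+ ((+ k') ℚ./ suc D₁') ε) (ℚᵘP.+-cong (to-/ k' D₁') (ℚᵘP.≃-reflexive eε))
  strict : k ℕ.* (suc D₁' ℕ.* suc d) ℕ.< (k' ℕ.* suc d ℕ.+ suc p ℕ.* suc D₁') ℕ.* suc D₁
  strict = ℕP.*-cancelˡ-< 69 _ _ (ℕP.≤-<-trans (ℕP.≤-reflexive (l₁ (suc d) k (suc D₁'))) (ℕP.≤-<-trans h (ℕP.<-≤-trans (ℕP.+-monoʳ-< (69 ℕ.* suc d ℕ.* (k' ℕ.* suc D₁)) small)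
      (ℕP.≤-reflexive (l₂ (suc d) k' (suc D₁) (suc p) (suc D₁'))))))
    where
    l₁ : ∀ d k D → 69 ℕ.* (k ℕ.* (D ℕ.* d)) ≡ 69 ℕ.* d ℕ.* (k ℕ.* D)
    l₁ = solveℕ
    l₂ : ∀ d k D p D' → 69 ℕ.* d ℕ.* (k ℕ.* D) ℕ.+ 69 ℕ.* (p ℕ.* (D ℕ.* D')) ≡ 69 ℕ.* ((k ℕ.* d ℕ.+ p ℕ.* D') ℕ.* D)
    l₂ = solveℕ
    X = suc D₁ ℕ.* suc D₁'
    small : 68 ℕ.* X ℕ.< 69 ℕ.* (suc p ℕ.* X)
    small = ℕP.<-≤-trans (ℕP.+-monoˡ-< (68 ℕ.* X) {0} {X} (s≤s z≤n)) (ℕP.*-monoʳ-≤ 69 (ℕP.m≤n*m X (suc p)))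
  lt : + k * + (suc D₁' ℕ.* suc d) ℤ.< (+ k' * + suc d + + suc p * + suc D₁') * + suc D₁
  lt = subst₂ ℤ._<_ (ℤP.pos-* k (suc D₁' ℕ.* suc d)) (trans (ℤP.pos-* (k' ℕ.* suc d ℕ.+ suc p ℕ.* suc D₁') (suc D₁)) (cong (_* + suc D₁) (cong₂ _+_ (ℤP.pos-* k' (suc d)) (ℤP.pos-* (suc p) (suc D₁'))))) (ℤ.+<+ strict)

abs-diff-< : ∀ x y ε → x ℚ.< y ℚ.+ ε → y ℚ.< x ℚ.+ ε → ℚ.∣ x ℚ.- y ∣ ℚ.< ε
abs-diff-< x y ε h h' = [ (λ e → subst (ℚ._< ε) (sym e) (sub x y h)) , (λ e → subst (ℚ._< ε) (sym (trans e (neg-sub x y))) (sub y x h')) ]′ (ℚP.∣p∣≡p∨∣p∣≡-p (x ℚ.- y))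
  where
  sub : ∀ x y → x ℚ.< y ℚ.+ ε → x ℚ.- y ℚ.< ε
  sub x y lt = subst (x ℚ.- y ℚ.<_) (trans (cong (ℚ._- y) (ℚP.+-comm y ε)) (trans (ℚP.+-assoc ε y (ℚ.- y)) (trans (cong (ε ℚ.+_) (ℚP.+-inverseʳ y)) (ℚP.+-identityʳ ε)))) (ℚP.+-monoˡ-< (ℚ.- y) lt)
  neg-sub : ∀ x y → ℚ.- (x ℚ.- y) ≡ y ℚ.- x
  neg-sub x y = trans (ℚP.neg-distrib-+ x (ℚ.- y)) (trans (cong (ℚ.- x ℚ.+_) (⁻¹-involutive y)) (ℚP.+-comm (ℚ.- x) y))

below : ℕ → ℚ
below W = (+ suc W) ℚ./ suc (suc W)

below<1 : ∀ W → below W ℚ.< 1ℚ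
below<1 W = ℚP.toℚᵘ-cancel-< (ℚᵘP.<-respˡ-≃ (ℚᵘP.≃-sym (to-/ (suc W) (suc W))) (ℚᵘ.*<* (subst₂ ℤ._<_ (sym (ℤP.*-identityʳ (+ suc W))) (sym (ℤP.*-identityˡ (+ suc (suc W)))) (ℤ.+<+ ℕP.≤-refl))))

ratio-≤ : ∀ W k D₁ → suc (suc W) ℕ.* k ℕ.≤ suc W ℕ.* suc D₁ → (+ k) ℚ./ suc D₁ ℚ.≤ below W
ratio-≤ W k D₁ h = ℚP.toℚᵘ-cancel-≤ (ℚᵘP.≤-respˡ-≃ (ℚᵘP.≃-sym (to-/ k D₁)) (ℚᵘP.≤-respʳ-≃ (ℚᵘP.≃-sym (to-/ (suc W) (suc W))) (ℚᵘ.*≤* (subst₂ ℤ._≤_ (ℤP.pos-* k (suc (suc W))) (ℤP.pos-* (suc W) (suc D₁)) (ℤ.+≤+ (ℕP.≤-trans (ℕP.≤-reflexive (ℕP.*-comm k (suc (suc W)))) h))))))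

-- Signs

HasPositive : TernaryForm → Set
HasPositive f = ∃[ v ] + 1 ℤ.≤ ev f v

data Signature (f : TernaryForm) : Set where
  definite₊ : HasPositive f → (∀ v → + 0 ℤ.≤ ev f v) → Signature f
  definite₋ : HasPositive (negate f) → (∀ v → ev f v ℤ.≤ + 0) → Signature f
  indefinite : HasPositive f → HasPositive (negate f) → Signature f

private
  sign-split : ∀ z → z ≢ + 0 → (+ 1 ℤ.≤ z) ⊎ (+ 1 ℤ.≤ - z)
  sign-split (+ zero) h = ⊥-elim (h refl)
  sign-split (+ suc n) _ = inj₁ (ℤ.+≤+ (s≤s z≤n))
  sign-split -[1+ n ] _ = inj₂ (ℤ.+≤+ (s≤s z≤n))

  prod-pos : ∀ {x y} → + 1 ℤ.≤ x → + 1 ℤ.≤ y → + 1 ℤ.≤ x * y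
  prod-pos {+ suc x} {+ suc y} _ _ = ℤ.+≤+ (s≤s z≤n)
  prod-pos {+ zero} (ℤ.+≤+ ())
  prod-pos {+ suc x} {+ zero} _ (ℤ.+≤+ ())

  prod-square : ∀ {x} y → + 1 ℤ.≤ x → + 0 ℤ.≤ x * (y * y)
  prod-square {+ suc x} (+ zero) _ = subst (+ 0 ℤ.≤_) (sym (ℤP.*-zeroʳ (+ suc x))) (ℤ.+≤+ z≤n)
  prod-square {+ suc x} (+ suc y) _ = ℤ.+≤+ z≤n
  prod-square {+ suc x} -[1+ y ] _ = ℤ.+≤+ z≤n
  prod-square {+ zero} y (ℤ.+≤+ ())

  cancel-pos : ∀ {x z} → + 1 ℤ.≤ x → + 0 ℤ.≤ x * z → + 0 ℤ.≤ z
  cancel-pos {+ suc x} {+ z} _ _ = ℤ.+≤+ z≤n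
  cancel-pos {+ suc x} { -[1+ z ]} _ ()
  cancel-pos {+ zero} (ℤ.+≤+ ()) _

-- If `A`, `B`, `C` share a sign, `expand` writes `4 A B C f(v)` as a sum of squares with positive
-- coefficients. Otherwise two frame vectors already take values of opposite sign.
signature : ∀ f → AnisotropicZ f → Signature f
signature f an = go (sign-split A A≢0) (sign-split B B≢0) (sign-split C C≢0)
  where
  e₀ : V
  e₀ = + 1 , + 0 , + 0
  Fr = frame-from f an e₀ (λ h → case (an e₀ h))
    where case : ¬ (e₀ ≡ 0V)
          case ()
  open Frame Fr
  p : ∀ {v z} → ev f v ≡ z → + 1 ℤ.≤ z → HasPositive f
  p {v} e h = v , subst (+ 1 ℤ.≤_) (sym e) h
  n : ∀ {v z} → ev f v ≡ z → + 1 ℤ.≤ - z → HasPositive (negate f)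
  n {v} e h = v , subst (+ 1 ℤ.≤_) (sym (trans (ev-negate f v) (cong -_ e))) h
  square-sum : + 1 ℤ.≤ B * C → + 1 ℤ.≤ A * C → + 1 ℤ.≤ A * B → ∀ v → + 0 ℤ.≤ + 4 * A * B * C * ev f v
  square-sum bc ac ab v = subst (+ 0 ℤ.≤_) (sym (expand v)) (ℤP.+-mono-≤ (ℤP.+-mono-≤ (prod-square (bil f v e₁) bc) (prod-square (bil f v e₂) ac)) (prod-square (bil f v e₃) ab))
  go : (+ 1 ℤ.≤ A) ⊎ (+ 1 ℤ.≤ - A) → (+ 1 ℤ.≤ B) ⊎ (+ 1 ℤ.≤ - B) → (+ 1 ℤ.≤ C) ⊎ (+ 1 ℤ.≤ - C) → Signature f
  go (inj₁ x) (inj₁ y) (inj₁ z) = definite₊ (p ev₁ x) λ v → cancel-pos (prod-pos (prod-pos (prod-pos {+ 4} (ℤ.+≤+ (s≤s z≤n)) x) y) z) (square-sum (prod-pos y z) (prod-pos x z) (prod-pos x y) v)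
  go (inj₂ x) (inj₂ y) (inj₂ z) = definite₋ (n ev₁ x) λ v → subst (ℤ._≤ + 0) (ℤP.neg-involutive (ev f v)) (ℤP.neg-mono-≤ (cancel-pos (prod-pos (prod-pos (prod-pos {+ 4} (ℤ.+≤+ (s≤s z≤n)) x) y) z)
      (subst (+ 0 ℤ.≤_) (l₄ A B C (ev f v)) (square-sum (subst (+ 1 ℤ.≤_) (l B C) (prod-pos y z)) (subst (+ 1 ℤ.≤_) (l A C) (prod-pos x z)) (subst (+ 1 ℤ.≤_) (l A B) (prod-pos x y)) v))))
    where l : ∀ x y → - x * - y ≡ x * y
          l = solve-∀
          l₄ : ∀ A B C E → + 4 * A * B * C * E ≡ + 4 * - A * - B * - C * - E
          l₄ = solve-∀
  go (inj₁ x) (inj₂ y) _ = indefinite (p ev₁ x) (n ev₂ y)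
  go (inj₂ x) (inj₁ y) _ = indefinite (p ev₂ y) (n ev₁ x)
  go (inj₁ x) (inj₁ y) (inj₂ z) = indefinite (p ev₁ x) (n ev₃ z)
  go (inj₂ x) (inj₂ y) (inj₁ z) = indefinite (p ev₃ z) (n ev₁ x)

module _ (f : TernaryForm) where
  private
    1≰0 : ¬ (+ 1 ℤ.≤ + 0)
    1≰0 (ℤ.+≤+ ())
    in-D : ∀ v → ev f v ≢ + 0 → D f (ev f v)
    in-D v h = h , proj₁ v , proj₁ (proj₂ v) , proj₂ (proj₂ v) , refl

  not-negative : HasPositive f → ¬ Negative (D f)
  not-negative (v , h) neg = 1≰0 (ℤP.≤-trans h (neg (ev f v) (in-D v (λ e → 1≰0 (subst (+ 1 ℤ.≤_) e h)))))

  not-positive : HasPositive (negate f) → ¬ Positive (D f)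
  not-positive (v , h) pos = 1≰0 (ℤP.≤-trans h (subst (ℤ._≤ + 0) (sym (ev-negate f v)) (ℤP.neg-mono-≤ (pos (ev f v) (in-D v (λ e → 1≰0 (subst (+ 1 ℤ.≤_) (trans (ev-negate f v) (cong -_ e)) h)))))))

  is-positive : (∀ v → + 0 ℤ.≤ ev f v) → Positive (D f)
  is-positive h n (_ , x , y , z , eq) = subst (+ 0 ℤ.≤_) eq (h (x , y , z))

  is-negative : (∀ v → ev f v ℤ.≤ + 0) → Negative (D f)
  is-negative h n (_ , x , y , z , eq) = subst (ℤ._≤ + 0) eq (h (x , y , z))


-- Convergence of the ratios and the bound below one

Counts : TernaryForm → ℕ → ℕ → Set
Counts f N k = ∃[ ys ] Values f N ys × length ys ≡ k

counts-close : ∀ f → AnisotropicZ f → HasPositive f → ∀ m → 30 ℕ.≤ m →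
  ∃[ M ] ∀ N N' k k' → M ℕ.≤ N → M ℕ.≤ N' → Counts f N k → Counts f N' k' → m ℕ.* (k ℕ.* N') ℕ.≤ m ℕ.* (k' ℕ.* N) ℕ.+ 68 ℕ.* (N ℕ.* N')
counts-close f an (v , h) m 30≤m = let (A , Q , Q≢0 , M , near) = one-sided f an v h m 30≤m in
  M , λ { N N' k k' M≤N M≤N' (ys , vals , refl) (ys' , vals' , refl) → near-close {m} {A} {Q} {N} {N'} Q≢0 (near N M≤N ys vals) (near N' M≤N' ys' vals') }

Misses : TernaryForm → ℕ → Set
Misses f W = ∃[ r ] r ℕ.< suc W × ¬ Residues.Represented f (suc W) (λ ()) r

-- At most `W` of `W + 1` classes occur, so the ratio is essentially at most `W / (W + 1)`. The
-- larger `(2W + 1) / (2W + 2)` absorbs the rounding once `N ≥ 2 W (W + 1)`.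
counts-below : ∀ f W → Misses f W → ∀ N k → 2 ℕ.* W ℕ.* suc W ℕ.≤ N → Counts f N k → suc (suc (2 ℕ.* W)) ℕ.* k ℕ.≤ suc (2 ℕ.* W) ℕ.* N
counts-below f W (r , r< , ¬rep) N _ le (ys , vals , refl) = ℕP.≤-trans (ℕP.≤-reflexive (l₁ W (length ys))) (ℕP.≤-trans (ℕP.*-monoʳ-≤ 2 (upper vals))
    (ℕP.≤-trans (ℕP.*-monoʳ-≤ 2 (ℕP.*-monoˡ-≤ (N ℕ.+ suc W) (ℕP.≤-pred (imageSize-< r r< ¬rep)))) (ℕP.≤-trans (ℕP.≤-reflexive (l₂ W N)) (ℕP.≤-trans (ℕP.+-monoʳ-≤ (2 ℕ.* W ℕ.* N) le) (ℕP.≤-reflexive (ℕP.+-comm (2 ℕ.* W ℕ.* N) N))))))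
  where
  open Residues f (suc W) (λ ())
  l₁ : ∀ W k → suc (suc (2 ℕ.* W)) ℕ.* k ≡ 2 ℕ.* (suc W ℕ.* k)
  l₁ = solveℕ
  l₂ : ∀ W N → 2 ℕ.* (W ℕ.* (N ℕ.+ suc W)) ≡ 2 ℕ.* W ℕ.* N ℕ.+ 2 ℕ.* W ℕ.* suc W
  l₂ = solveℕ

-- One modulus serves both signs: `f` misses the class of `-w`, hence `-f` that of `w`.
misses : ∀ f → AnisotropicZ f → ∃[ W ] Misses f W × Misses (negate f) W
misses f an = go (missed-class an Fr)
  where
  e₀ : V
  e₀ = + 1 , + 0 , + 0
  e₀≢0 : ¬ (e₀ ≡ 0V)
  e₀≢0 ()
  Fr = frame-from f an e₀ (λ h → e₀≢0 (an e₀ h))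
  open Frame Fr
  w = + 4 * A * B * C
  go : (∃[ q ] q ≢ 0 × ∀ v → ¬ (+ q ∣ ev f v + w)) → ∃[ W ] Misses f W × Misses (negate f) W
  go (zero , q≢0 , _) = ⊥-elim (q≢0 refl)
  go (suc W , _ , miss) = W ,
      ((- w) %ℕ suc W , n%ℕd<d (- w) (suc W) , λ (v , h) → miss v (∣-eq (∣m∣n⇒∣m-n h (%ℕ-∣ (- w) (suc W))) (l (ev f v) w (+ ((- w) %ℕ suc W))))) ,
      (w %ℕ suc W , n%ℕd<d w (suc W) , λ (v , h) → miss v (∣-eq (∣m∣n⇒∣m-n (%ℕ-∣ w (suc W)) (subst (λ z → + suc W ∣ z - + (w %ℕ suc W)) (ev-negate f v) h)) (l' (ev f v) w (+ (w %ℕ suc W)))))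
    where
    l : ∀ e w r → e - r - (- w - r) ≡ e + w
    l = solve-∀
    l' : ∀ e w r → w - r - (- e - r) ≡ e + w
    l' = solve-∀

-- The passage to rational numbers, common to the three signatures. `Count` is a relation because
-- counts are never computed; only those supplied with the ratios are compared.
module Ratios (Ratio : ℕ → ℚ → Set) (D₁ : ℕ → ℕ) (Count : ℕ → ℕ → Set)
    (ratio : ∀ n r → Ratio n r → ∃[ k ] Count n k × r ≡ (+ k) ℚ./ suc (D₁ n))
    (close : ∀ m → 30 ℕ.≤ m → ∃[ M ] ∀ n n' k k' → M ℕ.≤ n → M ℕ.≤ n' → Count n k → Count n' k' → m ℕ.* (k ℕ.* suc (D₁ n')) ℕ.≤ m ℕ.* (k' ℕ.* suc (D₁ n)) ℕ.+ 68 ℕ.* (suc (D₁ n) ℕ.* suc (D₁ n')))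
    (W M₀ : ℕ) (below₁ : ∀ n k → M₀ ℕ.≤ n → Count n k → suc (suc W) ℕ.* k ℕ.≤ suc W ℕ.* suc (D₁ n)) where

  exists : ∀ ε → 0ℚ ℚ.< ε → ∃[ M ] ∀ n n' → M ℕ.≤ n → M ℕ.≤ n' → ∀ r r' → Ratio n r → Ratio n' r' → ℚ.∣ r ℚ.- r' ∣ ℚ.< ε
  exists ε 0<ε = let (p , d , eε) = positive-form ε 0<ε ; (M , h) = close (69 ℕ.* suc d) (ℕP.≤-trans (ℕP.m≤m+n 30 39) (ℕP.m≤m*n 69 (suc d))) in
    M , λ n n' M≤n M≤n' r r' R R' →
      let (k , c , e) = ratio n r R ; (k' , c' , e') = ratio n' r' R' in
      subst₂ (λ x y → ℚ.∣ x ℚ.- y ∣ ℚ.< ε) (sym e) (sym e') (abs-diff-< ((+ k) ℚ./ suc (D₁ n)) ((+ k') ℚ./ suc (D₁ n')) ε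
        (ratio-< ε p d eε k k' (D₁ n) (D₁ n') (h n n' k k' M≤n M≤n' c c')) (ratio-< ε p d eε k' k (D₁ n') (D₁ n) (h n' n k' k M≤n' M≤n c' c)))

  bounded : ∃[ q ] (q ℚ.< 1ℚ × ∃[ M ] ∀ n → M ℕ.≤ n → ∀ r → Ratio n r → r ℚ.≤ q)
  bounded = below W , below<1 W , M₀ , λ n M≤n r R → let (k , c , e) = ratio n r R in subst (ℚ._≤ below W) (sym e) (ratio-≤ W k (D₁ n) (below₁ n k M≤n c))

module _ (f : TernaryForm) (an : AnisotropicZ f) where
  private
    an' = negate-anisotropic f an
    W = proj₁ (misses f an)
    miss₊ = proj₁ (proj₂ (misses f an))
    miss₋ = proj₂ (proj₂ (misses f an))
    M₀ = 2 ℕ.* W ℕ.* suc W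
    up : ∀ {M n} → M ℕ.≤ n → M ℕ.≤ suc n
    up = ℕP.m≤n⇒m≤1+n

    one-sided-close : ∀ h → AnisotropicZ h → HasPositive h → ∀ m → 30 ℕ.≤ m →
      ∃[ M ] ∀ n n' k k' → M ℕ.≤ n → M ℕ.≤ n' → Counts h (suc n) k → Counts h (suc n') k' → m ℕ.* (k ℕ.* suc n') ℕ.≤ m ℕ.* (k' ℕ.* suc n) ℕ.+ 68 ℕ.* (suc n ℕ.* suc n')
    one-sided-close h anh pos m 30≤m = let (M , cl) = counts-close h anh pos m 30≤m in M , λ n n' k k' M≤n M≤n' → cl (suc n) (suc n') k k' (up M≤n) (up M≤n')

    Both : ℕ → ℕ → Set
    Both n k = ∃[ k₁ ] ∃[ k₂ ] Counts f (suc n) k₁ × Counts (negate f) (suc n) k₂ × k₁ ℕ.+ k₂ ≡ k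

    -- Shaped so that `suc (double n)` is by computation the denominator `2 * suc n` of the
    -- indefinite case.
    double : ℕ → ℕ
    double n = n ℕ.+ (suc n ℕ.+ 0)

    both-close : HasPositive f → HasPositive (negate f) → ∀ m → 30 ℕ.≤ m →
      ∃[ M ] ∀ n n' k k' → M ℕ.≤ n → M ℕ.≤ n' → Both n k → Both n' k' → m ℕ.* (k ℕ.* suc (double n')) ℕ.≤ m ℕ.* (k' ℕ.* suc (double n)) ℕ.+ 68 ℕ.* (suc (double n) ℕ.* suc (double n'))
    both-close pos neg m 30≤m = let (M₁ , cl₁) = one-sided-close f an pos m 30≤m ; (M₂ , cl₂) = one-sided-close (negate f) an' neg m 30≤m in
      M₁ ℕ.⊔ M₂ , λ { n n' _ _ le le' (k₁ , k₂ , c₁ , c₂ , refl) (k₁' , k₂' , c₁' , c₂' , refl) →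
        combine m (suc n) (suc n') k₁ k₂ k₁' k₂' (cl₁ n n' k₁ k₁' (ℕP.≤-trans (ℕP.m≤m⊔n M₁ M₂) le) (ℕP.≤-trans (ℕP.m≤m⊔n M₁ M₂) le') c₁ c₁')
          (cl₂ n n' k₂ k₂' (ℕP.≤-trans (ℕP.m≤n⊔m M₁ M₂) le) (ℕP.≤-trans (ℕP.m≤n⊔m M₁ M₂) le') c₂ c₂') }
      where
      combine : ∀ m N N' k₁ k₂ k₁' k₂' → m ℕ.* (k₁ ℕ.* N') ℕ.≤ m ℕ.* (k₁' ℕ.* N) ℕ.+ 68 ℕ.* (N ℕ.* N') → m ℕ.* (k₂ ℕ.* N') ℕ.≤ m ℕ.* (k₂' ℕ.* N) ℕ.+ 68 ℕ.* (N ℕ.* N') →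
        m ℕ.* ((k₁ ℕ.+ k₂) ℕ.* (N' ℕ.+ (N' ℕ.+ 0))) ℕ.≤ m ℕ.* ((k₁' ℕ.+ k₂') ℕ.* (N ℕ.+ (N ℕ.+ 0))) ℕ.+ 68 ℕ.* ((N ℕ.+ (N ℕ.+ 0)) ℕ.* (N' ℕ.+ (N' ℕ.+ 0)))
      combine m N N' k₁ k₂ k₁' k₂' h₁ h₂ = ℕP.≤-trans (ℕP.≤-reflexive (l₁ m N' k₁ k₂)) (ℕP.≤-trans (ℕP.*-monoʳ-≤ 2 (ℕP.+-mono-≤ h₁ h₂)) (ℕP.≤-reflexive (l₂ m N N' k₁' k₂')))
        where
        l₁ : ∀ m N k l → m ℕ.* ((k ℕ.+ l) ℕ.* (N ℕ.+ (N ℕ.+ 0))) ≡ 2 ℕ.* (m ℕ.* (k ℕ.* N) ℕ.+ m ℕ.* (l ℕ.* N))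
        l₁ = solveℕ
        l₂ : ∀ m N N' k l → 2 ℕ.* (m ℕ.* (k ℕ.* N) ℕ.+ 68 ℕ.* (N ℕ.* N') ℕ.+ (m ℕ.* (l ℕ.* N) ℕ.+ 68 ℕ.* (N ℕ.* N'))) ≡ m ℕ.* ((k ℕ.+ l) ℕ.* (N ℕ.+ (N ℕ.+ 0))) ℕ.+ 68 ℕ.* ((N ℕ.+ (N ℕ.+ 0)) ℕ.* (N' ℕ.+ (N' ℕ.+ 0)))
        l₂ = solveℕ

    both-below : ∀ n k → M₀ ℕ.≤ n → Both n k → suc (suc (2 ℕ.* W)) ℕ.* k ℕ.≤ suc (2 ℕ.* W) ℕ.* suc (double n)
    both-below n _ le (k₁ , k₂ , c₁ , c₂ , refl) = ℕP.≤-trans (ℕP.≤-reflexive (ℕP.*-distribˡ-+ (suc (suc (2 ℕ.* W))) k₁ k₂)) (ℕP.≤-trans (ℕP.+-mono-≤ (counts-below f W miss₊ (suc n) k₁ (up le) c₁) (counts-below (negate f) W miss₋ (suc n) k₂ (up le) c₂)) (ℕP.≤-reflexive (l (suc (2 ℕ.* W)) (suc n))))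
      where l : ∀ w N → w ℕ.* N ℕ.+ w ℕ.* N ≡ w ℕ.* (N ℕ.+ (N ℕ.+ 0))
            l = solveℕ

  density : Signature f → DensityExists (D f) × DensityBelowOne (D f)
  density (definite₊ pos nonneg) = R.exists , R.bounded
    where
    ratio : ∀ n r → DensityRatio (D f) n r → ∃[ k ] Counts f (suc n) k × r ≡ (+ k) ℚ./ suc n
    ratio n r (inj₁ (_ , k , cnt , eq)) = k , values₊ f cnt , eq
    ratio n r (inj₂ (inj₁ (neg , _))) = ⊥-elim (not-negative f pos neg)
    ratio n r (inj₂ (inj₂ ((¬pos , _) , _))) = ⊥-elim (¬pos (is-positive f nonneg))
    module R = Ratios (DensityRatio (D f)) (λ n → n) (λ n → Counts f (suc n)) ratio (one-sided-close f an pos) (2 ℕ.* W) M₀ (λ n k le → counts-below f W miss₊ (suc n) k (up le))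
  density (definite₋ neg nonpos) = R.exists , R.bounded
    where
    ratio : ∀ n r → DensityRatio (D f) n r → ∃[ k ] Counts (negate f) (suc n) k × r ≡ (+ k) ℚ./ suc n
    ratio n r (inj₁ (pos , _)) = ⊥-elim (not-positive f neg pos)
    ratio n r (inj₂ (inj₁ (_ , k , cnt , eq))) = k , values₋ f cnt , eq
    ratio n r (inj₂ (inj₂ ((_ , ¬neg) , _))) = ⊥-elim (¬neg (is-negative f nonpos))
    module R = Ratios (DensityRatio (D f)) (λ n → n) (λ n → Counts (negate f) (suc n)) ratio (one-sided-close (negate f) an' neg) (2 ℕ.* W) M₀ (λ n k le → counts-below (negate f) W miss₋ (suc n) k (up le))
  density (indefinite pos neg) = R.exists , R.bounded
    where
    ratio : ∀ n r → DensityRatio (D f) n r → ∃[ k ] Both n k × r ≡ (+ k) ℚ./ suc (double n)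
    ratio n r (inj₁ (p , _)) = ⊥-elim (not-positive f neg p)
    ratio n r (inj₂ (inj₁ (p , _))) = ⊥-elim (not-negative f pos p)
    ratio n r (inj₂ (inj₂ (_ , k , cnt , eq))) = let (ys , zs , vy , vz , len) = values± f cnt in k , (length ys , length zs , (ys , vy , refl) , (zs , vz , refl) , len) , eq
    module R = Ratios (DensityRatio (D f)) double Both ratio (both-close pos neg) (2 ℕ.* W) M₀ both-below

theorem1p8 : ∀ (f : TernaryForm) → Nondegenerate f → Anisotropic f →
    DensityExists (D f) × DensityBelowOne (D f)
theorem1p8 f _ an = density f anZ (signature f anZ)
  where anZ = anisotropic⇒anisotropicZ f an
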